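{- There is an algorithm that solves the APSP problem correctly on every input consisting of a finite simple digraph $D=(V,A)$ with $n=|V|$ vertices and a weight function $c:A\to\mathbb{R}$, and that runs in time $O(2^{k_2}\cdot n^4)$ whenever every weak block of any strongly connected component of $D$ contains at most $k_2$ negative trees. The constant in the $O$ is absolute (independent of $D$, $c$, $k_2$, $n$).
   Context: A digraph is simple if it has no loops and at most one arc from $u$ to $v$ for each ordered pair $(u,v)$. A negative cycle is a directed cycle (all vertices distinct) whose total weight is negative. The weight function $c$ is nearly conservative on $D$ if every negative cycle of $D$ consists of (at most) two arcs. The APSP problem for $(D,c)$: first decide whether $c$ is nearly conservative on $D$; if it is, then for every ordered pair $s\neq t$ of vertices determine the distance $d_D(s,t)$, the minimum total weight of a directed simple path from $s$ to $t$ (a path has no repeated vertices), with $d_D(s,t)=+\infty$ if there is no such path. Negative trees: let $F=(V,E)$ be the undirected graph whose edges are the unordered pairs $\{u,v\}$, $u\ne v$, such that both $uv$ and $vu$ are arcs of $D$ and $c(uv)+c(vu)<0$. It is supposed that $F$ is a forest (if $F$ contains a cycle, then $c$ is not nearly conservative on $D$ and the algorithm stops with this answer). The negative trees of a digraph are the connected components, having at least one edge, of its associated graph $F$. The weak blocks (weakly 2-connected blocks) of a digraph $K$ are the subdigraphs corresponding to the 2-connected blocks of the underlying undirected graph of $K$ (arcs replaced by undirected edges). The number of negative trees contained in a weak block $B$ means the number of negative trees of $B$ regarded as a digraph with the restricted weights. Running time counts elementary steps, an arithmetic operation or comparison on real weights counting as one step. -}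

module Defs where

open import Algebra.Structures using (IsCommutativeRing)
open import Data.Bool using (Bool; true; false; T; T?; not; _∧_; if_then_else_)
open import Data.Fin using (Fin; toℕ; fromℕ<)
open import Data.Fin.Subset using (Subset; _∈_; _⊆_; Nonempty) renaming (_-_ to _∖_)
open import Data.List using (List; []; _∷_; length)
open import Data.List.Relation.Unary.All using (All)
open import Data.List.Relation.Unary.Unique.Propositional using (Unique)
open import Data.Maybe using (Maybe; just; nothing)
open import Data.Nat using (ℕ; zero; suc; _∸_; _≡ᵇ_; _<ᵇ_; _<?_)
import Data.Nat as ℕ
open import Data.Product using (Σ; _×_; _,_; ∃; ∃-syntax)
open import Data.Sum using (_⊎_)
open import Function.Bundles using (_⇔_)
open import Level using (0ℓ)
open import Relation.Binary.Core using (Rel)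
open import Relation.Binary.Construct.Closure.ReflexiveTransitive using (Star; ε; _◅_)
open import Relation.Binary.PropositionalEquality using (_≡_; _≢_)
open import Relation.Binary.Structures using (IsDecTotalOrder)
open import Relation.Nullary using (¬_; Dec; yes; no)
open import Relation.Nullary.Decidable using (⌊_⌋)

-- A Dedekind complete ordered field, which classically is ℝ up to
-- isomorphism.  Decidability of the order is what makes a comparison of two
-- weights an admissible step of an algorithm.

record RealNumbers : Set₁ where
  infix  4 _≈_ _≤_ _<_
  infixl 6 _+_
  infixl 7 _*_
  infix  8 -_ _⁻¹
  field
    Carrier           : Set
    _≈_ _≤_           : Rel Carrier 0ℓ
    _+_ _*_           : Carrier → Carrier → Carrier
    -_ _⁻¹            : Carrier → Carrier
    0# 1#             : Carrier
    isCommutativeRing : IsCommutativeRing _≈_ _+_ _*_ -_ 0# 1#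
    isDecTotalOrder   : IsDecTotalOrder _≈_ _≤_
    1≉0               : ¬ 1# ≈ 0#
    ⁻¹-cong           : ∀ {x y} → x ≈ y → x ⁻¹ ≈ y ⁻¹
    ⁻¹-inverseʳ       : ∀ x → ¬ x ≈ 0# → x * x ⁻¹ ≈ 1#
    +-monoˡ-≤         : ∀ z {x y} → x ≤ y → x + z ≤ y + z
    *-nonNegative     : ∀ {x y} → 0# ≤ x → 0# ≤ y → 0# ≤ x * y
    supremum          : (P : Carrier → Set) → ∃ P →
                        (∃[ b ] ∀ x → P x → x ≤ b) →
                        ∃[ s ] (∀ x → P x → x ≤ s) ×
                               (∀ b → (∀ x → P x → x ≤ b) → s ≤ b)

  _<_ : Rel Carrier 0ℓ
  x < y = ¬ y ≤ x

  _≤?_ : ∀ x y → Dec (x ≤ y)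
  _≤?_ = IsDecTotalOrder._≤?_ isDecTotalOrder

------------------------------------------------------------------------
-- Graphs on vertex sets X ⊆ Fin n

infixl 5 _∣_

_∣_ : ∀ {n} → Rel (Fin n) 0ℓ → Subset n → Rel (Fin n) 0ℓ
(G ∣ X) u v = u ∈ X × v ∈ X × G u v

-- Connectedness of the induced subgraph G[X] of an undirected graph G.

Connected : ∀ {n} → Rel (Fin n) 0ℓ → Subset n → Set
Connected G X = ∀ {u v} → u ∈ X → v ∈ X → Star (G ∣ X) u v

Nonseparable : ∀ {n} → Rel (Fin n) 0ℓ → Subset n → Set
Nonseparable G X =
  Nonempty X × Connected G X × (∀ {v} → v ∈ X → Connected G (X ∖ v))

-- The vertex sets of the 2-connected blocks of G[X].  Blocks are induced
-- subgraphs, so they are determined by their vertex sets; bridges and isolated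
-- vertices are blocks.

IsBlock : ∀ {n} → Rel (Fin n) 0ℓ → Subset n → Subset n → Set
IsBlock G X B =
  B ⊆ X × Nonseparable G B ×
  (∀ {B′} → B ⊆ B′ → B′ ⊆ X → Nonseparable G B′ → B′ ⊆ B)

-- The vertex sets of the connected components of G[X].

IsComponent : ∀ {n} → Rel (Fin n) 0ℓ → Subset n → Subset n → Set
IsComponent G X Y =
  Nonempty Y × Y ⊆ X ×
  (∀ {u} → u ∈ Y → ∀ v → v ∈ Y ⇔ Star (G ∣ X) u v)

AtMost : {A : Set} → ℕ → (A → Set) → Set
AtMost k P = ∀ xs → Unique xs → All P xs → length xs ℕ.≤ k

------------------------------------------------------------------------
-- Digraphs

record Digraph (n : ℕ) : Set where
  field
    arc      : Fin n → Fin n → Bool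
    loopless : ∀ v → arc v v ≡ false

  Arc : Rel (Fin n) 0ℓ
  Arc u v = T (arc u v)

  Adjacent : Rel (Fin n) 0ℓ
  Adjacent u v = Arc u v ⊎ Arc v u

  IsStrongComponent : Subset n → Set
  IsStrongComponent S =
    Nonempty S ×
    (∀ {u} → u ∈ S → ∀ v → v ∈ S ⇔ (Star Arc u v × Star Arc v u))

  vertices : ∀ {s t} → Star Arc s t → List (Fin n)
  vertices {s} ε       = s ∷ []
  vertices {s} (_ ◅ p) = s ∷ vertices p

  #arcs : ∀ {s t} → Star Arc s t → ℕ
  #arcs ε       = 0
  #arcs (_ ◅ p) = suc (#arcs p)

  Simple : ∀ {s t} → Star Arc s t → Set
  Simple p = Unique (vertices p)

module _ (ℝ : RealNumbers) where
  open RealNumbers ℝ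

  Weight : ∀ {n} → Digraph n → Set
  Weight D = ∀ u v → .(Digraph.Arc D u v) → Carrier

  module Weighted {n : ℕ} (D : Digraph n) (c : Weight D) where
    open Digraph D

    weight : ∀ {s t} → Star Arc s t → Carrier
    weight ε                   = 0#
    weight (_◅_ {u} {v} uv p) = c u v uv + weight p

    -- A directed cycle is an arc uv together with a simple path from v to u.

    NearlyConservative : Set
    NearlyConservative =
      ∀ {u v} (uv : Arc u v) (p : Star Arc v u) → Simple p →
      c u v uv + weight p < 0# → suc (#arcs p) ℕ.≤ 2

    -- nothing stands for +∞.

    IsDistance : Fin n → Fin n → Maybe Carrier → Set
    IsDistance s t nothing  = ¬ (Σ (Star Arc s t) Simple)
    IsDistance s t (just d) =
      (Σ (Star Arc s t) λ p → Simple p × weight p ≈ d) ×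
      (∀ (p : Star Arc s t) → Simple p → d ≤ weight p)

    NegativeEdge : Rel (Fin n) 0ℓ
    NegativeEdge u v =
      u ≢ v × Σ (Arc u v) λ uv → Σ (Arc v u) λ vu → c u v uv + c v u vu < 0#

    -- The vertex sets of the negative trees of the induced subdigraph D[X].

    IsNegativeTree : Subset n → Subset n → Set
    IsNegativeTree X Y =
      IsComponent NegativeEdge X Y × ∃[ u ] ∃[ v ] (NegativeEdge ∣ Y) u v

    BlocksHaveAtMost_NegativeTrees : ℕ → Set
    BlocksHaveAtMost k NegativeTrees =
      ∀ S → IsStrongComponent S → ∀ B → IsBlock Adjacent S B →
      AtMost k (IsNegativeTree B)

------------------------------------------------------------------------
-- Programs of a real random access machine: finitely many zero-initialised
-- arrays with two indices, holding natural numbers or weights.  Multiplication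
-- of natural numbers is deliberately not an elementary step.

infixl 6 _+ᴺ_ _∸ᴺ_ _+ᵂ_ _-ᵂ_
infixl 7 _*ᵂ_ _/ᵂ_
infix  5 _<ᴺ_ _≡ᴺ_ _<ᵂ_
infixr 4 _and_
infix  3 _[_,_]≔ᴺ_ _[_,_]≔ᵂ_
infixr 2 _⨾_

data NExp : Set where
  litᴺ      : ℕ → NExp
  _[_,_]ᴺ   : ℕ → NExp → NExp → NExp
  _+ᴺ_ _∸ᴺ_ : NExp → NExp → NExp

data WExp : Set where
  0ᵂ 1ᵂ                    : WExp
  _[_,_]ᵂ                  : ℕ → NExp → NExp → WExp
  _+ᵂ_ _-ᵂ_ _*ᵂ_ _/ᵂ_      : WExp → WExp → WExp

data BExp : Set where
  _<ᴺ_ _≡ᴺ_ : NExp → NExp → BExp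
  _<ᵂ_      : WExp → WExp → BExp
  neg       : BExp → BExp
  _and_     : BExp → BExp → BExp

data Program : Set where
  skip           : Program
  _[_,_]≔ᴺ_      : ℕ → NExp → NExp → NExp → Program
  _[_,_]≔ᵂ_      : ℕ → NExp → NExp → WExp → Program
  _⨾_            : Program → Program → Program
  ifᴾ_then_else_ : BExp → Program → Program → Program
  while_loop_    : BExp → Program → Program

-- The number of elementary steps taken to evaluate an expression.

costᴺ : NExp → ℕ
costᴺ (litᴺ _)      = 1
costᴺ (_ [ i , j ]ᴺ) = suc (costᴺ i ℕ.+ costᴺ j)
costᴺ (e +ᴺ f)      = suc (costᴺ e ℕ.+ costᴺ f)
costᴺ (e ∸ᴺ f)      = suc (costᴺ e ℕ.+ costᴺ f)

costᵂ : WExp → ℕ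
costᵂ 0ᵂ            = 1
costᵂ 1ᵂ            = 1
costᵂ (_ [ i , j ]ᵂ) = suc (costᴺ i ℕ.+ costᴺ j)
costᵂ (e +ᵂ f)      = suc (costᵂ e ℕ.+ costᵂ f)
costᵂ (e -ᵂ f)      = suc (costᵂ e ℕ.+ costᵂ f)
costᵂ (e *ᵂ f)      = suc (costᵂ e ℕ.+ costᵂ f)
costᵂ (e /ᵂ f)      = suc (costᵂ e ℕ.+ costᵂ f)

costᴮ : BExp → ℕ
costᴮ (e <ᴺ f)  = suc (costᴺ e ℕ.+ costᴺ f)
costᴮ (e ≡ᴺ f)  = suc (costᴺ e ℕ.+ costᴺ f)
costᴮ (e <ᵂ f)  = suc (costᵂ e ℕ.+ costᵂ f)
costᴮ (neg b)   = suc (costᴮ b)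
costᴮ (a and b) = suc (costᴮ a ℕ.+ costᴮ b)

Memory : Set → Set
Memory X = ℕ → ℕ → ℕ → X

write : {X : Set} → Memory X → ℕ → ℕ → ℕ → X → Memory X
write m a i j x a′ i′ j′ =
  if (a ≡ᵇ a′) ∧ (i ≡ᵇ i′) ∧ (j ≡ᵇ j′) then x else m a′ i′ j′

module _ (ℝ : RealNumbers) where
  open RealNumbers ℝ

  record State : Set where
    constructor ⟨_,_⟩
    field
      nat : Memory ℕ
      wt  : Memory Carrier
  open State

  evalᴺ : State → NExp → ℕ
  evalᴺ σ (litᴺ k)       = k
  evalᴺ σ (a [ i , j ]ᴺ) = nat σ a (evalᴺ σ i) (evalᴺ σ j)
  evalᴺ σ (e +ᴺ f)       = evalᴺ σ e ℕ.+ evalᴺ σ f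
  evalᴺ σ (e ∸ᴺ f)       = evalᴺ σ e ∸ evalᴺ σ f

  -- The result of a division by zero is unspecified.

  evalᵂ : State → WExp → Carrier
  evalᵂ σ 0ᵂ             = 0#
  evalᵂ σ 1ᵂ             = 1#
  evalᵂ σ (a [ i , j ]ᵂ) = wt σ a (evalᴺ σ i) (evalᴺ σ j)
  evalᵂ σ (e +ᵂ f)       = evalᵂ σ e + evalᵂ σ f
  evalᵂ σ (e -ᵂ f)       = evalᵂ σ e + - evalᵂ σ f
  evalᵂ σ (e *ᵂ f)       = evalᵂ σ e * evalᵂ σ f
  evalᵂ σ (e /ᵂ f)       = evalᵂ σ e * evalᵂ σ f ⁻¹

  evalᴮ : State → BExp → Bool
  evalᴮ σ (e <ᴺ f)  = evalᴺ σ e <ᵇ evalᴺ σ f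
  evalᴮ σ (e ≡ᴺ f)  = evalᴺ σ e ≡ᵇ evalᴺ σ f
  evalᴮ σ (e <ᵂ f)  = not ⌊ evalᵂ σ f ≤? evalᵂ σ e ⌋
  evalᴮ σ (neg b)   = not (evalᴮ σ b)
  evalᴮ σ (a and b) = evalᴮ σ a ∧ evalᴮ σ b

  -- Run p σ σ′ t: started in σ, p halts in σ′ after t elementary steps.

  data Run : Program → State → State → ℕ → Set where
    run-skip : ∀ {σ} → Run skip σ σ 1
    run-nat : ∀ {σ a i j e} →
      Run (a [ i , j ]≔ᴺ e) σ
          ⟨ write (nat σ) a (evalᴺ σ i) (evalᴺ σ j) (evalᴺ σ e) , wt σ ⟩
          (suc (costᴺ i ℕ.+ costᴺ j ℕ.+ costᴺ e))
    run-wt : ∀ {σ a i j e} →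
      Run (a [ i , j ]≔ᵂ e) σ
          ⟨ nat σ , write (wt σ) a (evalᴺ σ i) (evalᴺ σ j) (evalᵂ σ e) ⟩
          (suc (costᴺ i ℕ.+ costᴺ j ℕ.+ costᵂ e))
    run-seq : ∀ {p q σ σ′ σ″ t t′} →
      Run p σ σ′ t → Run q σ′ σ″ t′ → Run (p ⨾ q) σ σ″ (t ℕ.+ t′)
    run-then : ∀ {b p q σ σ′ t} → evalᴮ σ b ≡ true →
      Run p σ σ′ t → Run (ifᴾ b then p else q) σ σ′ (suc (costᴮ b ℕ.+ t))
    run-else : ∀ {b p q σ σ′ t} → evalᴮ σ b ≡ false →
      Run q σ σ′ t → Run (ifᴾ b then p else q) σ σ′ (suc (costᴮ b ℕ.+ t))
    run-exit : ∀ {b p σ} → evalᴮ σ b ≡ false →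
      Run (while b loop p) σ σ (suc (costᴮ b))
    run-loop : ∀ {b p σ σ′ σ″ t t′} → evalᴮ σ b ≡ true →
      Run p σ σ′ t → Run (while b loop p) σ′ σ″ t′ →
      Run (while b loop p) σ σ″ (suc (costᴮ b ℕ.+ t ℕ.+ t′))

  table : {X : Set} → X → ∀ {n} → (Fin n → Fin n → X) → ℕ → ℕ → X
  table d {n} f i j with i <? n | j <? n
  ... | yes i<n | yes j<n = f (fromℕ< i<n) (fromℕ< j<n)
  ... | _       | _       = d

  -- Input convention: n is in entry (0,0) of natural number array 0, the
  -- adjacency matrix is natural number array 1, and the matrix of arc weights
  -- (0 at pairs that are not arcs) is weight array 0.

  module _ {n : ℕ} (D : Digraph n) (c : Weight ℝ D) where
    open Digraph D
    open Weighted ℝ D c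

    weightEntry : Fin n → Fin n → Carrier
    weightEntry u v with T? (arc u v)
    ... | yes uv = c u v uv
    ... | no  _  = 0#

    input : State
    nat input 0 0 0 = n
    nat input 1 i j = table 0 (λ u v → if arc u v then 1 else 0) i j
    nat input _ _ _ = 0
    wt  input 0 i j = table 0# weightEntry i j
    wt  input _ _ _ = 0#

    -- Output convention: entry (0,0) of natural number array 2 is the answer to
    -- whether c is nearly conservative; d(s,t) is finite iff entry (s,t) of
    -- natural number array 3 is nonzero, and is then in weight array 1.

    distance : State → Fin n → Fin n → Maybe Carrier
    distance σ s t with nat σ 3 (toℕ s) (toℕ t)
    ... | zero  = nothing
    ... | suc _ = just (wt σ 1 (toℕ s) (toℕ t))

    APSPSolution : State → Set
    APSPSolution σ =
      (nat σ 2 0 0 ≡ 1 × NearlyConservative ×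
        (∀ s t → s ≢ t → IsDistance s t (distance σ s t)))
      ⊎ (nat σ 2 0 0 ≡ 0 × ¬ NearlyConservative)

-- If c is nearly conservative, the tree path between two vertices of a negative
-- tree is a shortest path, so a shortest path may be assumed to traverse every
-- negative tree at most once, along a tree path.  Conversely, a walk that uses
-- no negative edge in both directions contains a path of at most its weight.
-- Distances can therefore be computed by dynamic programming over the set of
-- trees visited.  A path between two vertices of a common block of a strong
-- component stays in that block, so only sets of at most k₂ trees occur; other
-- distances are composed at separating vertices and at arcs between strong
-- components.  Call an arc a chord if it is not a negative edge.  If the
-- negative edges form a forest, c is nearly conservative iff no chord closes a
-- computed distance to a negative cycle: that the computed distances bound all
-- paths from below, and that no cycle is negative, are proved together by
-- induction on the number of chords.

module Submission where

open import Defs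
open import Algebra.Bundles using (CommutativeMonoid)
open import Algebra.Structures using (IsCommutativeRing)
open import Data.Bool using (Bool; T; false; if_then_else_; true)
open import Data.Empty using (⊥; ⊥-elim)
open import Data.Fin using (Fin; fromℕ<; toℕ)
open import Data.Fin.Properties using (fromℕ<-toℕ; injective⇒≤; toℕ-fromℕ<; toℕ-injective; toℕ<n) renaming (_≟_ to _≟ꟳ_; any? to anyꟳ?)
open import Data.Fin.Subset using (Subset; _⊆_) renaming (_-_ to _∖_; _∈_ to _∈ˢ_)
open import Data.Fin.Subset.Properties using (p─q⊆p; x∈p∧x≢y⇒x∈p-y) renaming (_∈?_ to _∈ˢ?_)
open import Data.List as List using (List; []; _++_; _∷_; length; lookup)
open import Data.List.Membership.Propositional using (_∈_; _∉_; find; lose)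
open import Data.List.Membership.Propositional.Properties using (∈-++⁺ʳ; ∈-++⁺ˡ; ∈-++⁻; ∈-lookup)
open import Data.List.Properties using (length-map)
open import Data.List.Relation.Unary.All as All using (All; []; _∷_)
open import Data.List.Relation.Unary.All.Properties as Allₚ using (All¬⇒¬Any; ¬Any⇒All¬)
open import Data.List.Relation.Unary.AllPairs using ([]; _∷_)
open import Data.List.Relation.Unary.Any using (Any; any?; here; there)
open import Data.List.Relation.Unary.Unique.Propositional using (Unique)
open import Data.Nat as ℕ using (suc; s≤s; zero; z≤n; ℕ)
import Data.Nat.Properties as ℕₚ
open import Data.Product using (_,_; _×_; proj₁; proj₂; Σ; ∃; ∃-syntax)
open import Data.Sum using (_⊎_; inj₁; inj₂; swap)
open import Data.Unit using (tt)
open import Data.Vec using (_∷_; tabulate; there)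
open import Data.Vec.Properties using ([]=⇒lookup; lookup⇒[]=; lookup∘tabulate)
open import Function using (_∘_)
open import Function.Bundles using (mk⇔)
open import Level using (0ℓ)
open import Relation.Binary.Construct.Closure.ReflexiveTransitive using (Star; _◅_; _◅◅_; map; reverse; ε)
open import Relation.Binary.Core using (Rel)
open import Relation.Binary.Definitions using (DecidableEquality; tri<; tri>; tri≈) renaming (Decidable to Decidable₂)
open import Relation.Binary.PropositionalEquality using (_≡_; _≢_; cong; cong₂; refl; subst; subst₂; sym; trans)
open import Relation.Binary.Structures using (IsDecTotalOrder)
open import Relation.Nullary using (Dec; does; no; yes; ¬_)
open import Relation.Nullary.Decidable using (_×-dec_; dec-false; dec-true; ¬?)
open import Relation.Unary using (Decidable)

-- Walks

-- The program does not know `k₂`. For each source it finds out how many digits its sets of trees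
-- need, and the time bound is proved for every `k` that satisfies the hypothesis, so that one run
-- meets all of them. For a source `s` the trees are numbered separately in each block through `s`.
-- Numbers may recur in different blocks, but a path inside a block sees distinct ones, so `k₂`
-- digits suffice however many blocks meet in `s`. Distances are computed before it is known whether
-- `c` is nearly conservative. The table therefore carries two claims of different status: that an
-- entry is attained by a path is proved under the assumption of near conservativeness, and that no
-- path lies below it is proved only once the final check has passed. The factor `n ^ 4` comes from
-- `n` sources, `n` rounds and, for every set of trees, `n ^ 2` pairs of vertices: a move into
-- another tree is divided at its entry vertex, so that a round does not range over triples. Arcs
-- between strong components are condensed into a table for the same reason.

∉-head : ∀ {A : Set} {y : A} {xs} → Unique (y ∷ xs) → y ∉ xs
∉-head (y∉ ∷ _) = All¬⇒¬Any y∉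

Unique-∷ : ∀ {A : Set} {y : A} {xs} → y ∉ xs → Unique xs → Unique (y ∷ xs)
Unique-∷ y∉ u = ¬Any⇒All¬ _ y∉ ∷ u

Unique-tail : ∀ {A : Set} {y : A} {xs} → Unique (y ∷ xs) → Unique xs
Unique-tail (_ ∷ u) = u

module _ {V : Set} where

  private variable
    R R′ : Rel V 0ℓ
    s t u v x z : V

  -- Leaving out the end makes a concatenation list the joint once; disjointness of two consecutive
  -- walks is therefore stated between the `sources` of one and the `verts` of the other.
  sources : Star R s t → List V
  sources ε           = []
  sources {s = s} (_ ◅ p) = s ∷ sources p

  verts : Star R s t → List V
  verts {s = s} ε       = s ∷ []
  verts {s = s} (_ ◅ p) = s ∷ verts p

  edges : Star R s t → List (V × V)
  edges ε = []
  edges (_◅_ {i} {j} _ p) = (i , j) ∷ edges p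

  len : Star R s t → ℕ
  len ε       = 0
  len (_ ◅ p) = suc (len p)

  Simple : Star R s t → Set
  Simple p = Unique (verts p)

  start∈ : (p : Star R s t) → s ∈ verts p
  start∈ ε       = here refl
  start∈ (_ ◅ _) = here refl

  end∈ : (p : Star R s t) → t ∈ verts p
  end∈ ε       = here refl
  end∈ (_ ◅ p) = there (end∈ p)

  sources⊆verts : (p : Star R s t) → z ∈ sources p → z ∈ verts p
  sources⊆verts (_ ◅ p) (here e)  = here e
  sources⊆verts (_ ◅ p) (there m) = there (sources⊆verts p m)

  ∈-verts⁻ : (p : Star R s t) → z ∈ verts p → z ∈ sources p ⊎ z ≡ t
  ∈-verts⁻ ε (here e) = inj₂ e
  ∈-verts⁻ (_ ◅ p) (here e) = inj₁ (here e)
  ∈-verts⁻ (_ ◅ p) (there m) with ∈-verts⁻ p m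
  ... | inj₁ k = inj₁ (there k)
  ... | inj₂ e = inj₂ e

  verts-◅◅ : (p : Star R s t) (q : Star R t u) → verts (p ◅◅ q) ≡ sources p ++ verts q
  verts-◅◅ ε       q = refl
  verts-◅◅ (_ ◅ p) q = cong (_ ∷_) (verts-◅◅ p q)

  edges-◅◅ : (p : Star R s t) (q : Star R t u) → edges (p ◅◅ q) ≡ edges p ++ edges q
  edges-◅◅ ε       q = refl
  edges-◅◅ (_ ◅ p) q = cong (_ ∷_) (edges-◅◅ p q)

  len-◅◅ : (p : Star R s t) (q : Star R t u) → len (p ◅◅ q) ≡ len p ℕ.+ len q
  len-◅◅ ε       q = refl
  len-◅◅ (_ ◅ p) q = cong suc (len-◅◅ p q)

  module _ (p : Star R s t) (q : Star R t u) where

    ∈-◅◅⁻ : z ∈ verts (p ◅◅ q) → z ∈ sources p ⊎ z ∈ verts q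
    ∈-◅◅⁻ m = ∈-++⁻ (sources p) (subst (_ ∈_) (verts-◅◅ p q) m)

    ∈-◅◅⁺ʳ : z ∈ verts q → z ∈ verts (p ◅◅ q)
    ∈-◅◅⁺ʳ m = subst (_ ∈_) (sym (verts-◅◅ p q)) (∈-++⁺ʳ (sources p) m)

    ∈-◅◅⁺ˡ : z ∈ verts p → z ∈ verts (p ◅◅ q)
    ∈-◅◅⁺ˡ m with ∈-verts⁻ p m
    ... | inj₁ k    = subst (_ ∈_) (sym (verts-◅◅ p q)) (∈-++⁺ˡ k)
    ... | inj₂ refl = ∈-◅◅⁺ʳ (start∈ q)

    ∈-edges⁻ : ∀ {e} → e ∈ edges (p ◅◅ q) → e ∈ edges p ⊎ e ∈ edges q
    ∈-edges⁻ m = ∈-++⁻ (edges p) (subst (_ ∈_) (edges-◅◅ p q) m)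

    ∈-edges⁺ˡ : ∀ {e} → e ∈ edges p → e ∈ edges (p ◅◅ q)
    ∈-edges⁺ˡ m = subst (_ ∈_) (sym (edges-◅◅ p q)) (∈-++⁺ˡ m)

    ∈-edges⁺ʳ : ∀ {e} → e ∈ edges q → e ∈ edges (p ◅◅ q)
    ∈-edges⁺ʳ m = subst (_ ∈_) (sym (edges-◅◅ p q)) (∈-++⁺ʳ (edges p) m)

  ∈-sources-◅◅⁻ : (p : Star R s t) (q : Star R t u) → z ∈ sources (p ◅◅ q) → z ∈ sources p ⊎ z ∈ sources q
  ∈-sources-◅◅⁻ ε q m = inj₂ m
  ∈-sources-◅◅⁻ (_ ◅ p) q (here e) = inj₁ (here e)
  ∈-sources-◅◅⁻ (_ ◅ p) q (there m) with ∈-sources-◅◅⁻ p q m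
  ... | inj₁ k = inj₁ (there k)
  ... | inj₂ k = inj₂ k

  ◅◅-simple : (p : Star R s t) (q : Star R t u) → Simple p → Simple q →
              (∀ {z} → z ∈ sources p → z ∉ verts q) → Simple (p ◅◅ q)
  ◅◅-simple ε       q sp sq dis = sq
  ◅◅-simple (a ◅ p) q sp sq dis = Unique-∷ new (◅◅-simple p q (Unique-tail sp) sq (λ m → dis (there m)))
    where
    new : _ ∉ verts (p ◅◅ q)
    new m with ∈-◅◅⁻ p q m
    ... | inj₁ k = ∉-head sp (sources⊆verts p k)
    ... | inj₂ k = dis (here refl) k

  ◅◅-simple⁻ : (p : Star R s t) (q : Star R t u) → Simple (p ◅◅ q) →
               Simple p × Simple q × (∀ {z} → z ∈ sources p → z ∉ verts q)
  ◅◅-simple⁻ ε       q s = ([] ∷ []) , s , λ ()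
  ◅◅-simple⁻ (a ◅ p) q s with ◅◅-simple⁻ p q (Unique-tail s)
  ... | sp , sq , dis = Unique-∷ (λ m → ∉-head s (∈-◅◅⁺ˡ p q m)) sp , sq , dis′
    where
    dis′ : ∀ {z} → z ∈ sources (a ◅ p) → z ∉ verts q
    dis′ (here refl) m = ∉-head s (∈-◅◅⁺ʳ p q m)
    dis′ (there k)   m = dis k m

  end∉sources : (p : Star R s t) → Simple p → t ∉ sources p
  end∉sources (_ ◅ p) sp (here refl) = ∉-head sp (end∈ p)
  end∉sources (_ ◅ p) sp (there m)   = end∉sources p (Unique-tail sp) m

  split : (p : Star R s t) → z ∈ verts p →
          Σ (Star R s z) λ p₁ → Σ (Star R z t) λ p₂ → p ≡ p₁ ◅◅ p₂
  split ε (here refl) = ε , ε , refl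
  split (a ◅ p) (here refl) = ε , a ◅ p , refl
  split (a ◅ p) (there m) with split p m
  ... | p₁ , p₂ , refl = a ◅ p₁ , p₂ , refl

  edge-source : (p : Star R s t) → (u , v) ∈ edges p → u ∈ sources p
  edge-source (_ ◅ p) (here refl) = here refl
  edge-source (_ ◅ p) (there m)   = there (edge-source p m)

  edge-target : (p : Star R s t) → (u , v) ∈ edges p → v ∈ verts p
  edge-target (_ ◅ p) (here refl) = there (start∈ p)
  edge-target (_ ◅ p) (there m)   = there (edge-target p m)

  edge-rel : (p : Star R s t) → (u , v) ∈ edges p → R u v
  edge-rel (a ◅ p) (here refl) = a
  edge-rel (a ◅ p) (there m)   = edge-rel p m

  -- This is what makes a tree path harmless in a walk that must not use a negative edge in both
  -- directions.
  simple-no-antiparallel : (p : Star R s t) → Simple p → (u , v) ∈ edges p → (v , u) ∉ edges p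
  simple-no-antiparallel (_ ◅ p) sp (here refl) (here refl) = ∉-head sp (start∈ p)
  simple-no-antiparallel (_ ◅ p) sp (here refl) (there m)   = ∉-head sp (edge-target p m)
  simple-no-antiparallel (_ ◅ p) sp (there m)   (here refl) = ∉-head sp (edge-target p m)
  simple-no-antiparallel (_ ◅ p) sp (there m)   (there k)   = simple-no-antiparallel p (Unique-tail sp) m k

  -- The vertex list survives the change of relation, so simplicity and the avoidance of a vertex
  -- can be moved between arcs, links of the underlying graph and negative edges.
  relabel : (p : Star R s t) → (∀ {u v} → (u , v) ∈ edges p → R′ u v) →
            Σ (Star R′ s t) λ q → verts q ≡ verts p × edges q ≡ edges p
  relabel ε       f = ε , refl , refl
  relabel (a ◅ p) f with relabel p (λ m → f (there m))
  ... | q , e , e′ = f (here refl) ◅ q , cong (_ ∷_) e , cong (_ ∷_) e′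

  module _ (_≟_ : DecidableEquality V) where

    open import Data.List.Membership.DecPropositional _≟_ using (_∈?_)

    erase : {R : Rel V 0ℓ} {s t : V} (p : Star R s t) →
            Σ (Star R s t) λ q → Simple q × (∀ {z} → z ∈ verts q → z ∈ verts p)
    erase ε = ε , ([] ∷ []) , λ m → m
    erase {s = s} (a ◅ p) with erase p
    ... | q , sq , q⊆p with s ∈? verts q
    ...   | no s∉ = a ◅ q , Unique-∷ s∉ sq , λ { (here e) → here e ; (there m) → there (q⊆p m) }
    ...   | yes s∈ with split q s∈
    ...     | q₁ , q₂ , refl = q₂ , proj₁ (proj₂ (◅◅-simple⁻ q₁ q₂ sq)) , λ m → there (q⊆p (∈-◅◅⁺ʳ q₁ q₂ m))

  -- The cut is made at the last vertex with `P`, so the remainder never returns to the tree or the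
  -- strong component that `P` describes.
  data Last {R : Rel V 0ℓ} (P : V → Set) {s t : V} : Star R s t → Set where
    never : ∀ {p} → (∀ {z} → z ∈ verts p → ¬ P z) → Last P p
    at-end : ∀ {p} → P t → Last P p
    leave : ∀ {y a} (p₁ : Star R s y) (e : R y a) (p₂ : Star R a t) → P y →
            (∀ {z} → z ∈ verts p₂ → ¬ P z) → Last P (p₁ ◅◅ (e ◅ p₂))

  last : {P : V → Set} → Decidable P → (p : Star R s t) → Last P p
  last {s = s} P? ε with P? s
  ... | yes Ps = at-end Ps
  ... | no ¬Ps = never λ { (here refl) → ¬Ps }
  last {s = s} P? (a ◅ p) with last P? p
  ... | at-end Pt = at-end Pt
  ... | leave p₁ e p₂ Py none = leave (a ◅ p₁) e p₂ Py none
  ... | never none with P? s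
  ...   | yes Ps = leave ε a p Ps none
  ...   | no ¬Ps = never λ { (here refl) → ¬Ps ; (there m) → none m }

  length-verts : (p : Star R s t) → length (verts p) ≡ suc (len p)
  length-verts ε       = refl
  length-verts (_ ◅ p) = cong suc (length-verts p)

Unique⇒lookup-injective : {A : Set} {xs : List A} → Unique xs → ∀ {i j} → lookup xs i ≡ lookup xs j → i ≡ j
Unique⇒lookup-injective {xs = x ∷ xs} u {Fin.zero}  {Fin.zero}  e = refl
Unique⇒lookup-injective {xs = x ∷ xs} u {Fin.zero}  {Fin.suc j} e =
  ⊥-elim (∉-head u (subst (_∈ xs) (sym e) (∈-lookup j)))
Unique⇒lookup-injective {xs = x ∷ xs} u {Fin.suc i} {Fin.zero}  e =
  ⊥-elim (∉-head u (subst (_∈ xs) e (∈-lookup i)))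
Unique⇒lookup-injective {xs = x ∷ xs} u {Fin.suc i} {Fin.suc j} e =
  cong Fin.suc (Unique⇒lookup-injective (Unique-tail u) e)

simple-short : ∀ {n} {R : Rel (Fin n) 0ℓ} {s t} (p : Star R s t) → Simple p → suc (len p) ℕ.≤ n
simple-short p sp = subst (ℕ._≤ _) (length-verts p) (injective⇒≤ (Unique⇒lookup-injective sp))

-- Order and addition of weights

module OrderedField (ℝ : RealNumbers) where
  open RealNumbers ℝ public using (Carrier; _≈_; _≤_; _+_; _<_; _≤?_; 0#; -_)
  open RealNumbers ℝ using (isCommutativeRing; isDecTotalOrder; +-monoˡ-≤)
  open IsCommutativeRing isCommutativeRing public
    using (+-assoc; +-comm; +-cong; +-identityˡ; +-identityʳ; +-isCommutativeMonoid)
  open IsDecTotalOrder isDecTotalOrder public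
    using (antisym; total; module Eq)
    renaming (refl to ≤-refl; trans to ≤-trans; reflexive to ≤-reflexive)

  +-commutativeMonoid : CommutativeMonoid 0ℓ 0ℓ
  +-commutativeMonoid = record { isCommutativeMonoid = +-isCommutativeMonoid }

  module Solver where
    open import Algebra.Solver.CommutativeMonoid +-commutativeMonoid public

  ≈-refl : ∀ {x} → x ≈ x
  ≈-refl = Eq.refl

  ≈-sym : ∀ {x y} → x ≈ y → y ≈ x
  ≈-sym = Eq.sym

  ≈-trans : ∀ {x y z} → x ≈ y → y ≈ z → x ≈ z
  ≈-trans = Eq.trans

  ≡⇒≈ : ∀ {x y} → x ≡ y → x ≈ y
  ≡⇒≈ refl = ≈-refl

  ≡⇒≤ : ∀ {x y} → x ≡ y → x ≤ y
  ≡⇒≤ refl = ≤-refl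

  ≈⇒≤ : ∀ {x y} → x ≈ y → x ≤ y
  ≈⇒≤ = ≤-reflexive

  ≈⇒≥ : ∀ {x y} → x ≈ y → y ≤ x
  ≈⇒≥ e = ≤-reflexive (≈-sym e)

  ≮⇒≥ : ∀ {x y} → ¬ x < y → y ≤ x
  ≮⇒≥ {x} {y} x≮y with y ≤? x
  ... | yes y≤x = y≤x
  ... | no y≰x  = ⊥-elim (x≮y y≰x)

  <⇒≤ : ∀ {x y} → x < y → x ≤ y
  <⇒≤ {x} {y} x<y with total x y
  ... | inj₁ x≤y = x≤y
  ... | inj₂ y≤x = ⊥-elim (x<y y≤x)

  +-monoʳ : ∀ z {x y} → x ≤ y → z + x ≤ z + y
  +-monoʳ z {x} {y} x≤y = ≤-trans (≈⇒≤ (+-comm z x)) (≤-trans (+-monoˡ-≤ z x≤y) (≈⇒≤ (+-comm y z)))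

  +-mono : ∀ {x y u v} → x ≤ y → u ≤ v → x + u ≤ y + v
  +-mono {x} {y} {u} {v} x≤y u≤v = ≤-trans (+-monoˡ-≤ u x≤y) (+-monoʳ y u≤v)

  x≤y+x : ∀ {x y} → 0# ≤ y → x ≤ y + x
  x≤y+x {x} 0≤y = ≤-trans (≈⇒≥ (+-identityˡ x)) (+-mono 0≤y ≤-refl)

  x≤x+y : ∀ {x y} → 0# ≤ y → x ≤ x + y
  x≤x+y {x} 0≤y = ≤-trans (≈⇒≥ (+-identityʳ x)) (+-mono ≤-refl 0≤y)

  y+x≤x : ∀ {x y} → y ≤ 0# → y + x ≤ x
  y+x≤x {x} y≤0 = ≤-trans (+-mono y≤0 ≤-refl) (≈⇒≤ (+-identityˡ x))

  +-cancel-≤ : ∀ {x y z} → x + y ≤ z + y → x ≤ z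
  +-cancel-≤ {x} {y} {z} le =
    ≤-trans (≈⇒≥ (step x)) (≤-trans (+-monoˡ-≤ (- y) le) (≈⇒≤ (step z)))
    where
    open IsCommutativeRing isCommutativeRing using (-‿inverseʳ)
    step : ∀ w → (w + y) + - y ≈ w
    step w = ≈-trans (+-assoc w y (- y)) (≈-trans (+-cong ≈-refl (-‿inverseʳ y)) (+-identityʳ w))

-- Forests of negative edges

module Theory (ℝ : RealNumbers) {n : ℕ} (D : Digraph n) (c : Weight ℝ D) where

  open OrderedField ℝ
  open Digraph D using (Arc; loopless; arc; vertices; #arcs)
  open Weighted ℝ D c
  open Solver using (solve; _⊕_; _⊜_)
  open import Data.List.Membership.DecPropositional (_≟ꟳ_ {n}) using (_∈?_)

  private variable
    s t u v x y z : Fin n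

  arrow : Arc u v → Star Arc u v
  arrow a = a ◅ ε

  weight-◅◅ : (p : Star Arc s t) (q : Star Arc t u) → weight (p ◅◅ q) ≈ weight p + weight q
  weight-◅◅ ε       q = ≈-sym (+-identityˡ _)
  weight-◅◅ (a ◅ p) q = ≈-trans (+-cong ≈-refl (weight-◅◅ p q)) (≈-sym (+-assoc _ _ _))

  vertices≡verts : (p : Star Arc s t) → vertices p ≡ verts p
  vertices≡verts ε       = refl
  vertices≡verts (a ◅ p) = cong (_ ∷_) (vertices≡verts p)

  #arcs≡len : (p : Star Arc s t) → #arcs p ≡ len p
  #arcs≡len ε       = refl
  #arcs≡len (a ◅ p) = cong suc (#arcs≡len p)

  toSimple : (p : Star Arc s t) → Simple p → Digraph.Simple D p
  toSimple p = subst (λ vs → Unique vs) (sym (vertices≡verts p))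
    where open import Data.List.Relation.Unary.Unique.Propositional using (Unique)

  fromSimple : (p : Star Arc s t) → Digraph.Simple D p → Simple p
  fromSimple p = subst (λ vs → Unique vs) (vertices≡verts p)
    where open import Data.List.Relation.Unary.Unique.Propositional using (Unique)

  no-loop : ¬ Arc u u
  no-loop {u} a with arc u u | loopless u
  no-loop () | _ | refl

  negative-sym : NegativeEdge u v → NegativeEdge v u
  negative-sym (u≢v , uv , vu , neg<) =
    u≢v ∘ sym , vu , uv , λ le → neg< (≤-trans le (≈⇒≤ (+-comm _ _)))

  -- With two arcs in `p` the cycle has at least three, which excludes exactly the cycles that are
  -- allowed to be negative.
  cycle-nonnegative : NearlyConservative → (uv : Arc u v) (p : Star Arc v u) → Simple p → 2 ℕ.≤ len p →
                      0# ≤ c u v uv + weight p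
  cycle-nonnegative nc uv p sp 2≤ = ≮⇒≥ λ neg< → ℕₚ.<⇒≱ (s≤s 2≤)
    (subst (λ k → suc k ℕ.≤ 2) (#arcs≡len p) (nc uv p (toSimple p sp) neg<))

  AllEdges : Rel (Fin n) 0ℓ → Star Arc s t → Set
  AllEdges E p = ∀ {u v} → (u , v) ∈ edges p → E u v

  AllEdges-◅◅ : ∀ {E} (p : Star Arc s t) (q : Star Arc t u) → AllEdges E p → AllEdges E q → AllEdges E (p ◅◅ q)
  AllEdges-◅◅ p q ap aq m with ∈-edges⁻ p q m
  ... | inj₁ k = ap k
  ... | inj₂ k = aq k

  Label : Set
  Label = Fin n → ℕ

  constant-along : ∀ {E} {tr : Label} → (∀ {u v} → E u v → tr u ≡ tr v) →
                   (p : Star Arc x y) → AllEdges E p → z ∈ verts p → tr z ≡ tr x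
  constant-along f ε       ap (here refl) = refl
  constant-along f (a ◅ p) ap (here refl) = refl
  constant-along f (a ◅ p) ap (there m)   =
    trans (constant-along f p (λ k → ap (there k)) m) (sym (f (ap (here refl))))

  -- Both directions of a negative edge together weigh less than 0, and summing along the path
  -- bounds the path together with its reversal. A cycle through a tree path can thus be estimated
  -- from the other side.
  reverse-path : ∀ {E : Rel (Fin n) 0ℓ} → (∀ {u v} → E u v → NegativeEdge u v) → (∀ {u v} → E u v → E v u) →
                 (p : Star Arc x y) → Simple p → AllEdges E p →
                 Σ (Star Arc y x) λ q → Simple q × AllEdges E q × (∀ {z} → z ∈ verts q → z ∈ verts p) ×
                   weight p + weight q ≤ 0#
  reverse-path neg< sm ε sp ap = ε , [] ∷ [] , (λ ()) , (λ m → m) , ≈⇒≤ (+-identityˡ _)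
  reverse-path {E = E} neg< sm (_◅_ {i} {j} a p) sp ap
    with reverse-path {E = E} neg< sm p (Unique-tail sp) (λ m → ap (there m)) | neg< (ap (here refl))
  ... | q , sq , aq , q⊆p , wq | _ , _ , b , ab<0 =
    q ◅◅ (arrow b) , ◅◅-simple q (arrow b) sq (Unique-∷ (λ { (here refl) → no-loop a }) ([] ∷ [])) dis ,
    AllEdges-◅◅ {E = E} q (arrow b) aq (λ { (here refl) → sm (ap (here refl)) }) , sub , wt≤
    where
    dis : ∀ {z} → z ∈ sources q → z ∉ verts (arrow b)
    dis m (here refl)         = end∉sources q sq m
    dis m (there (here refl)) = ∉-head sp (q⊆p (sources⊆verts q m))
    sub : ∀ {z} → z ∈ verts (q ◅◅ (arrow b)) → z ∈ i ∷ verts p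
    sub m with ∈-◅◅⁻ q (arrow b) m
    ... | inj₁ k                   = there (q⊆p (sources⊆verts q k))
    ... | inj₂ (here refl)         = there (start∈ p)
    ... | inj₂ (there (here refl)) = here refl
    wt≤ : (c i j a + weight p) + weight (q ◅◅ (arrow b)) ≤ 0#
    wt≤ = ≤-trans (≈⇒≤ (+-cong ≈-refl (weight-◅◅ q (arrow b))))
      (≤-trans (≈⇒≤ (solve 4 (λ a p q b → (a ⊕ p) ⊕ (q ⊕ (b ⊕ Solver.id)) ⊜ (a ⊕ b) ⊕ (p ⊕ q)) ≈-refl _ _ _ _))
      (≤-trans (+-mono (<⇒≤ ab<0) wq) (≈⇒≤ (+-identityˡ _))))

  -- Acyclicity is expressed by weights: `unique` asks that all simple `E`-paths between two
  -- vertices weigh the same, which the two ways around a cycle of negative edges cannot do. The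
  -- matrix `P` is constrained only at pairs in a common tree; elsewhere its entries are arbitrary.
  record Forest (E : Rel (Fin n) 0ℓ) (tr : Label) (P : Fin n → Fin n → Carrier) : Set where
    field
      E-negative : ∀ {u v} → E u v → NegativeEdge u v
      E-sym      : ∀ {u v} → E u v → E v u
      E-label    : ∀ {u v} → E u v → tr u ≡ tr v
      path       : ∀ {x y} → tr x ≡ tr y →
                   Σ (Star Arc x y) λ p → Simple p × AllEdges E p × weight p ≈ P x y
      unique     : ∀ {x y} (p : Star Arc x y) → Simple p → AllEdges E p → weight p ≈ P x y

    label-along : (p : Star Arc x y) → AllEdges E p → z ∈ verts p → tr z ≡ tr x
    label-along = constant-along {E = E} E-label

  empty-forest : ∀ {E tr P} → (∀ {u v} → ¬ E u v) → (∀ {x y} → tr x ≡ tr y → x ≡ y) →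
                 (∀ x → P x x ≈ 0#) → Forest E tr P
  empty-forest none inj P≈0 = record
    { E-negative = λ e → ⊥-elim (none e)
    ; E-sym = λ e → ⊥-elim (none e)
    ; E-label = λ e → ⊥-elim (none e)
    ; path = λ e → path′ (inj e)
    ; unique = λ { ε sp ap → ≈-sym (P≈0 _) ; (a ◅ p) sp ap → ⊥-elim (none (ap (here refl))) }
    }
    where
    path′ : ∀ {x y} → x ≡ y → Σ (Star Arc x y) λ p → Simple p × AllEdges _ p × weight p ≈ _
    path′ refl = ε , [] ∷ [] , (λ ()) , ≈-sym (P≈0 _)

  -- The successors `E′`, `tr′` and `P′` are arbitrary apart from the properties that the memory has
  -- after a merge, which keeps array updates out of the graph theory.
  module Merge {E : Rel (Fin n) 0ℓ} {tr : Label} {P} (forest : Forest E tr P)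
               (uv : NegativeEdge u v) (new : tr u ≢ tr v)
               {E′ : Rel (Fin n) 0ℓ} {tr′ : Label} {P′ : Fin n → Fin n → Carrier}
               (E⇒E′ : ∀ {x y} → E x y → E′ x y) (E′uv : E′ u v) (E′vu : E′ v u)
               (E′⇒ : ∀ {x y} → E′ x y → E x y ⊎ ((x ≡ u × y ≡ v) ⊎ (x ≡ v × y ≡ u)))
               (relabelled : ∀ {x} → tr x ≡ tr v → tr′ x ≡ tr u)
               (kept : ∀ {x} → tr x ≢ tr v → tr′ x ≡ tr x)
               (P-old : ∀ {x y} → tr x ≡ tr y → P′ x y ≈ P x y)
               (P-uv : ∀ {x y} → tr x ≡ tr u → tr y ≡ tr v →
                       P′ x y ≈ (P x u + c u v (proj₁ (proj₂ uv))) + P v y)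
               (P-vu : ∀ {x y} → tr x ≡ tr v → tr y ≡ tr u →
                       P′ x y ≈ (P x v + c v u (proj₁ (proj₂ (proj₂ uv)))) + P u y)
               where
    open Forest forest

    private
      Joined : Fin n → Fin n → Fin n → Fin n → Set
      Joined a b x y = Σ (Arc a b) λ ab → Σ (Star Arc x a) λ q₁ → Σ (Star Arc b y) λ q₂ →
        (Simple q₁ × AllEdges E q₁) × (Simple q₂ × AllEdges E q₂)

      -- Passing the new edge a second time, in either direction, would repeat `u` or `v`. So a
      -- simple path contains it at most once, between two paths of the old forest.
      classify : (p : Star Arc x y) → Simple p → AllEdges E′ p →
                 AllEdges E p ⊎
                 ((Σ (Joined u v x y) λ { (a , q₁ , q₂ , _) → p ≡ q₁ ◅◅ (a ◅ q₂) }) ⊎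
                  (Σ (Joined v u x y) λ { (a , q₁ , q₂ , _) → p ≡ q₁ ◅◅ (a ◅ q₂) }))
      classify ε sp ap = inj₁ λ ()
      classify (a ◅ p) sp ap with classify p (Unique-tail sp) (λ m → ap (there m)) | E′⇒ (ap (here refl))
      ... | inj₁ al | inj₁ e = inj₁ λ { (here refl) → e ; (there m) → al m }
      ... | inj₁ al | inj₂ (inj₁ (refl , refl)) =
        inj₂ (inj₁ ((a , ε , p , ([] ∷ [] , λ ()) , (Unique-tail sp , al)) , refl))
      ... | inj₁ al | inj₂ (inj₂ (refl , refl)) =
        inj₂ (inj₂ ((a , ε , p , ([] ∷ [] , λ ()) , (Unique-tail sp , al)) , refl))
      ... | inj₂ (inj₁ ((a′ , q₁ , q₂ , (s₁ , al₁) , r) , refl)) | inj₁ e =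
        inj₂ (inj₁ ((a′ , a ◅ q₁ , q₂ ,
          (Unique-∷ (λ m → ∉-head sp (∈-◅◅⁺ˡ q₁ _ m)) s₁ ,
            λ { (here refl) → e ; (there m) → al₁ m }) , r) , refl))
      ... | inj₂ (inj₂ ((a′ , q₁ , q₂ , (s₁ , al₁) , r) , refl)) | inj₁ e =
        inj₂ (inj₂ ((a′ , a ◅ q₁ , q₂ ,
          (Unique-∷ (λ m → ∉-head sp (∈-◅◅⁺ˡ q₁ _ m)) s₁ ,
            λ { (here refl) → e ; (there m) → al₁ m }) , r) , refl))
      ... | inj₂ (inj₁ ((a′ , q₁ , q₂ , _) , refl)) | inj₂ (inj₁ (refl , refl)) =
        ⊥-elim (∉-head sp (∈-◅◅⁺ˡ q₁ _ (end∈ q₁)))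
      ... | inj₂ (inj₁ ((a′ , q₁ , q₂ , _) , refl)) | inj₂ (inj₂ (refl , refl)) =
        ⊥-elim (∉-head sp (∈-◅◅⁺ʳ q₁ (a′ ◅ q₂) (there (start∈ q₂))))
      ... | inj₂ (inj₂ ((a′ , q₁ , q₂ , _) , refl)) | inj₂ (inj₁ (refl , refl)) =
        ⊥-elim (∉-head sp (∈-◅◅⁺ʳ q₁ (a′ ◅ q₂) (there (start∈ q₂))))
      ... | inj₂ (inj₂ ((a′ , q₁ , q₂ , _) , refl)) | inj₂ (inj₂ (refl , refl)) =
        ⊥-elim (∉-head sp (∈-◅◅⁺ˡ q₁ _ (end∈ q₁)))

      label-end : (p : Star Arc x y) → AllEdges E p → tr x ≡ tr y
      label-end p ap = sym (label-along p ap (end∈ p))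

      joined-weight : ∀ {a b} (ab : Arc a b) (q₁ : Star Arc x a) (q₂ : Star Arc b y) →
                      weight q₁ ≈ P x a → weight q₂ ≈ P b y →
                      weight (q₁ ◅◅ (ab ◅ q₂)) ≈ (P x a + c a b ab) + P b y
      joined-weight ab q₁ q₂ w₁ w₂ = ≈-trans (weight-◅◅ q₁ (ab ◅ q₂))
        (≈-trans (+-cong w₁ (+-cong ≈-refl w₂)) (≈-sym (+-assoc _ _ _)))

      -- The two halves lie in trees with different labels and hence cannot meet.
      join : ∀ {a b} → Arc a b → E′ a b → tr a ≢ tr b → tr x ≡ tr a → tr b ≡ tr y →
             (∀ ab → P′ x y ≈ (P x a + c a b ab) + P b y) →
             Σ (Star Arc x y) λ p → Simple p × AllEdges E′ p × weight p ≈ P′ x y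
      join {a = a} {b} ab e′ a≁b xa by Pxy with path xa | path by
      ... | q₁ , s₁ , al₁ , w₁ | q₂ , s₂ , al₂ , w₂ =
        q₁ ◅◅ (ab ◅ q₂) ,
        ◅◅-simple q₁ (ab ◅ q₂) s₁ (Unique-∷ (λ m → a≁b (label-along q₂ al₂ m)) s₂) dis ,
        AllEdges-◅◅ {E = E′} q₁ (ab ◅ q₂) (λ m → E⇒E′ (al₁ m))
          (λ { (here refl) → e′ ; (there m) → E⇒E′ (al₂ m) }) ,
        ≈-trans (joined-weight ab q₁ q₂ w₁ w₂) (≈-sym (Pxy ab))
        where
        dis : ∀ {z} → z ∈ sources q₁ → z ∉ a ∷ verts q₂
        dis m (here refl) = end∉sources q₁ s₁ m
        dis m (there k)   = a≁b (trans (trans (sym xa) (sym (label-along q₁ al₁ (sources⊆verts q₁ m))))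
                                       (label-along q₂ al₂ k))

      path′ : ∀ {x y} → tr′ x ≡ tr′ y →
              Σ (Star Arc x y) λ p → Simple p × AllEdges E′ p × weight p ≈ P′ x y
      path′ {x} {y} eq with tr x ℕ.≟ tr v | tr y ℕ.≟ tr v
      ... | yes xv | yes yv with path (trans xv (sym yv))
      ...   | p , sp , ap , w = p , sp , (λ m → E⇒E′ (ap m)) , ≈-trans w (≈-sym (P-old (trans xv (sym yv))))
      path′ {x} {y} eq | no xv | no yv with path (trans (sym (kept xv)) (trans eq (kept yv)))
      ... | p , sp , ap , w =
        p , sp , (λ m → E⇒E′ (ap m)) , ≈-trans w (≈-sym (P-old (trans (sym (kept xv)) (trans eq (kept yv)))))
      path′ {x} {y} eq | yes xv | no yv =
        join (proj₁ (proj₂ (proj₂ uv))) E′vu (new ∘ sym) xv uy (λ _ → P-vu xv (sym uy))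
        where
        uy : tr u ≡ tr y
        uy = trans (sym (relabelled xv)) (trans eq (kept yv))
      path′ {x} {y} eq | no xv | yes yv =
        join (proj₁ (proj₂ uv)) E′uv new xu (sym yv) (λ _ → P-uv xu yv)
        where
        xu : tr x ≡ tr u
        xu = trans (sym (kept xv)) (trans eq (relabelled yv))

      unique′ : ∀ {x y} (p : Star Arc x y) → Simple p → AllEdges E′ p → weight p ≈ P′ x y
      unique′ p sp ap with classify p sp ap
      ... | inj₁ al = ≈-trans (unique p sp al) (≈-sym (P-old (label-end p al)))
      ... | inj₂ (inj₁ ((a , q₁ , q₂ , (s₁ , al₁) , (s₂ , al₂)) , refl)) =
        ≈-trans (joined-weight a q₁ q₂ (unique q₁ s₁ al₁) (unique q₂ s₂ al₂))
                (≈-sym (P-uv (label-end q₁ al₁) (sym (label-end q₂ al₂))))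
      ... | inj₂ (inj₂ ((a , q₁ , q₂ , (s₁ , al₁) , (s₂ , al₂)) , refl)) =
        ≈-trans (joined-weight a q₁ q₂ (unique q₁ s₁ al₁) (unique q₂ s₂ al₂))
                (≈-sym (P-vu (label-end q₁ al₁) (sym (label-end q₂ al₂))))

    merged : Forest E′ tr′ P′
    merged = record
      { E-negative = neg′
      ; E-sym = sm
      ; E-label = lab
      ; path = path′
      ; unique = unique′
      }
      where
      neg′ : ∀ {x y} → E′ x y → NegativeEdge x y
      neg′ e with E′⇒ e
      ... | inj₁ o = E-negative o
      ... | inj₂ (inj₁ (refl , refl)) = uv
      ... | inj₂ (inj₂ (refl , refl)) = negative-sym uv
      sm : ∀ {x y} → E′ x y → E′ y x
      sm e with E′⇒ e
      ... | inj₁ o = E⇒E′ (E-sym o)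
      ... | inj₂ (inj₁ (refl , refl)) = E′vu
      ... | inj₂ (inj₂ (refl , refl)) = E′uv
      lab : ∀ {x y} → E′ x y → tr′ x ≡ tr′ y
      lab {x} {y} e with E′⇒ e
      ... | inj₂ (inj₁ (refl , refl)) = trans (kept new) (sym (relabelled refl))
      ... | inj₂ (inj₂ (refl , refl)) = trans (relabelled refl) (sym (kept new))
      ... | inj₁ o with tr x ℕ.≟ tr v
      ...   | yes xv = trans (relabelled xv) (sym (relabelled (trans (sym (E-label o)) xv)))
      ...   | no xv  = trans (kept xv) (trans (E-label o) (sym (kept λ yv → xv (trans (E-label o) yv))))

  -- Of the two orientations of a cycle of negative edges one is negative.

  negative-edge-cycle : ∀ {E tr P} → Forest E tr P → NegativeEdge u v → tr u ≡ tr v → ¬ E u v →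
                        ¬ NearlyConservative
  negative-edge-cycle {u = u} {v} {E = E} forest (u≢v , uv , vu , neg<) same ¬E nc
    with Forest.path forest same
  ... | p , sp , ap , _ with reverse-path {E = E} (Forest.E-negative forest) (Forest.E-sym forest) p sp ap
  ... | q , sq , aq , _ , pq≤0 =
    neg< (≤-trans (≤-trans (≈⇒≥ (+-identityˡ _)) (+-mono 0≤q 0≤p)) (≤-trans
      (≈⇒≤ (solve 4 (λ a q b p → (a ⊕ q) ⊕ (b ⊕ p) ⊜ (p ⊕ q) ⊕ (a ⊕ b)) ≈-refl _ _ _ _))
      (y+x≤x pq≤0)))
    where
    long : ∀ {u v} (p : Star Arc u v) → AllEdges E p → u ≢ v → ¬ E u v → 2 ℕ.≤ len p
    long ε           ap u≢v ¬E = ⊥-elim (u≢v refl)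
    long (a ◅ ε)     ap u≢v ¬E = ⊥-elim (¬E (ap (here refl)))
    long (a ◅ b ◅ p) ap u≢v ¬E = s≤s (s≤s z≤n)
    0≤p : 0# ≤ c v u vu + weight p
    0≤p = cycle-nonnegative nc vu p sp (long p ap u≢v ¬E)
    0≤q : 0# ≤ c u v uv + weight q
    0≤q = cycle-nonnegative nc uv q sq (long q aq (u≢v ∘ sym) (¬E ∘ Forest.E-sym forest))

-- Sets of trees as binary numbers

module Bits where
  open import Data.Bool using (Bool; true; false)
  open import Data.Empty using (⊥-elim)
  open import Data.Nat using (ℕ; zero; suc; _+_; _^_; _≤_; _<_; z≤n; s≤s; ⌊_/2⌋)
  open import Data.Nat.Properties
  open import Relation.Binary.PropositionalEquality using (_≡_; _≢_; refl; sym; trans; cong; subst)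

  odd : ℕ → Bool
  odd zero          = false
  odd (suc zero)    = true
  odd (suc (suc m)) = odd m

  testbit : ℕ → ℕ → Bool
  testbit m zero    = odd m
  testbit m (suc j) = testbit ⌊ m /2⌋ j

  2^suc : ∀ j → 2 ^ suc j ≡ 2 ^ j + 2 ^ j
  2^suc j = cong (2 ^ j +_) (+-identityʳ (2 ^ j))

  half-+ : ∀ m k → ⌊ m + (k + k) /2⌋ ≡ ⌊ m /2⌋ + k
  half-+ m zero    = trans (cong ⌊_/2⌋ (+-identityʳ m)) (sym (+-identityʳ _))
  half-+ m (suc k) = trans (cong ⌊_/2⌋ (trans (cong (m +_) (cong suc (+-suc k k)))
    (trans (+-suc m _) (cong suc (+-suc m _)))))
                           (trans (cong suc (half-+ m k)) (sym (+-suc _ k)))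

  odd-+ : ∀ m k → odd (m + (k + k)) ≡ odd m
  odd-+ m zero    = cong odd (+-identityʳ m)
  odd-+ m (suc k) = trans (cong odd (trans (cong (m +_) (cong suc (+-suc k k)))
    (trans (+-suc m _) (cong suc (+-suc m _)))))
                          (odd-+ m k)

  even-suc : ∀ m → odd m ≡ false → odd (m + 1) ≡ true
  even-suc zero          e = refl
  even-suc (suc (suc m)) e = even-suc m e

  half-suc : ∀ m → odd m ≡ false → ⌊ m + 1 /2⌋ ≡ ⌊ m /2⌋
  half-suc zero          e = refl
  half-suc (suc (suc m)) e = cong suc (half-suc m e)

  testbit-zero : ∀ j → testbit 0 j ≡ false
  testbit-zero zero    = refl
  testbit-zero (suc j) = testbit-zero j

  -- No carry arises when `2 ^ j` is added at a vanishing digit, so the addition of the machine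
  -- serves as insertion of an element into a set.
  testbit-set : ∀ j {m} → testbit m j ≡ false → testbit (m + 2 ^ j) j ≡ true
  testbit-set zero    {m} e = even-suc m e
  testbit-set (suc j) {m} e = trans
    (cong (λ k → testbit k j) (trans (cong (λ k → ⌊ m + k /2⌋) (2^suc j)) (half-+ m (2 ^ j))))
    (testbit-set j e)

  testbit-other : ∀ j i {m} → testbit m j ≡ false → i ≢ j → testbit (m + 2 ^ j) i ≡ testbit m i
  testbit-other zero    zero        e i≢j = ⊥-elim (i≢j refl)
  testbit-other zero    (suc i) {m} e i≢j = cong (λ k → testbit k i) (half-suc m e)
  testbit-other (suc j) zero    {m} e i≢j = trans (cong (λ k → odd (m + k)) (2^suc j)) (odd-+ m (2 ^ j))
  testbit-other (suc j) (suc i) {m} e i≢j = trans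
    (cong (λ k → testbit k i) (trans (cong (λ k → ⌊ m + k /2⌋) (2^suc j)) (half-+ m (2 ^ j))))
    (testbit-other j i e (λ i≡j → i≢j (cong suc i≡j)))

  half-bound : ∀ m k → ⌊ m /2⌋ < k → m < k + k
  half-bound zero          (suc k) h       = s≤s z≤n
  half-bound (suc zero)    (suc k) h       = s≤s (subst (1 ≤_) (sym (+-suc k k)) (s≤s z≤n))
  half-bound (suc (suc m)) (suc k) (s≤s h) =
    s≤s (subst (suc (suc m) ≤_) (sym (+-suc k k)) (s≤s (half-bound m k h)))

  bound-half : ∀ m k → m < k + k → ⌊ m /2⌋ < k
  bound-half zero          (suc k) h       = s≤s z≤n
  bound-half (suc zero)    (suc k) h       = s≤s z≤n
  bound-half (suc (suc m)) (suc k) (s≤s h) with subst (suc (suc m) ≤_) (+-suc k k) h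
  ... | s≤s h′ = s≤s (bound-half m k h′)

  -- Again there is no carry, so the sum still has at most `K` digits. The induction halves both
  -- numbers until the added digit is the lowest one.
  testbit-bound : ∀ K j {m} → j < K → m < 2 ^ K → testbit m j ≡ false → m + 2 ^ j < 2 ^ K
  testbit-bound (suc K) zero    {m} j<K m< e =
    subst (m + 1 <_) (sym (2^suc K)) (half-bound (m + 1) (2 ^ K)
      (subst (_< 2 ^ K) (sym (half-suc m e)) (bound-half m (2 ^ K) (subst (m <_) (2^suc K) m<))))
  testbit-bound (suc K) (suc j) {m} (s≤s j<K) m< e =
    subst (m + 2 ^ suc j <_) (sym (2^suc K)) (half-bound (m + 2 ^ suc j) (2 ^ K)
      (subst (_< 2 ^ K) (sym (trans (cong (λ k → ⌊ m + k /2⌋) (2^suc j)) (half-+ m (2 ^ j))))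
        (testbit-bound K j j<K (bound-half m (2 ^ K) (subst (m <_) (2^suc K) m<)) e)))

  testbit-high : ∀ j {m} → m < 2 ^ j → testbit m j ≡ false
  testbit-high zero    {zero} h = refl
  testbit-high zero    {suc m} (s≤s ())
  testbit-high (suc j) {m} h = testbit-high j (bound-half m (2 ^ j) (subst (m <_) (2^suc j) h))

  -- Index 0 is reserved for vertices whose tree needs no bit.

  bit : ℕ → ℕ → Bool
  bit m zero    = false
  bit m (suc i) = testbit m i

  pw : ℕ → ℕ
  pw zero    = 0
  pw (suc i) = 2 ^ i

  bit-zero : ∀ i → bit 0 i ≡ false
  bit-zero zero    = refl
  bit-zero (suc i) = testbit-zero i

  bit-set : ∀ i {m} → i ≢ 0 → bit m i ≡ false → bit (m + pw i) i ≡ true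
  bit-set zero    i≢0 e = ⊥-elim (i≢0 refl)
  bit-set (suc i) i≢0 e = testbit-set i e

  bit-other : ∀ i j {m} → bit m i ≡ false → j ≢ i → bit (m + pw i) j ≡ bit m j
  bit-other i       zero        e j≢i = refl
  bit-other zero    (suc j) {m} e j≢i = cong (λ k → testbit k j) (+-identityʳ m)
  bit-other (suc i) (suc j)     e j≢i = testbit-other i j e (λ j≡i → j≢i (cong suc j≡i))

  bit-bound : ∀ K i {m} → i ≤ K → m < 2 ^ K → bit m i ≡ false → m + pw i < 2 ^ K
  bit-bound K zero {m} i≤K m< e = subst (_< 2 ^ K) (sym (+-identityʳ m)) m<
  bit-bound K (suc i) i<K m< e = testbit-bound K i i<K m< e

open Bits

-- Shortest paths and tree traversals

module Spanning (ℝ : RealNumbers) {n : ℕ} (D : Digraph n) (c : Weight ℝ D)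
                {E : Rel (Fin n) 0ℓ} {tr : Fin n → ℕ} {P : Fin n → Fin n → RealNumbers.Carrier ℝ}
                (forest : Theory.Forest ℝ D c E tr P) (E? : Decidable₂ E)
                (E-full : ∀ {u v} → Weighted.NegativeEdge ℝ D c u v → E u v) where

  open OrderedField ℝ
  open Digraph D using (Arc)
  open Weighted ℝ D c
  open Theory ℝ D c
  open Forest forest
  open Solver using (solve; _⊕_; _⊜_)
  open import Data.List.Membership.DecPropositional (_≟ꟳ_ {n}) using (_∈?_)

  private variable
    r s t u v x y z a b : Fin n

  NoReturn : Star Arc s t → Set
  NoReturn p = ∀ {u v} → (u , v) ∈ edges p → (v , u) ∈ edges p → ¬ E u v

  -- Loop erasure never gains weight because every removed cycle is nonnegative: with three or more
  -- arcs by near conservativeness, with two arcs because otherwise its arcs would be a negative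
  -- edge used in both directions. The inclusion of edges is carried along so that this last case
  -- concerns arcs of the given walk.
  erase-walk : NearlyConservative → (p : Star Arc s t) → NoReturn p →
               Σ (Star Arc s t) λ q → Simple q × weight q ≤ weight p × (∀ {e} → e ∈ edges q → e ∈ edges p)
  erase-walk nc ε nr = ε , [] ∷ [] , ≤-refl , λ m → m
  erase-walk nc (_◅_ {i} {j} a p) nr with erase-walk nc p (λ m k → nr (there m) (there k))
  ... | q , sq , q≤p , q⊆p with i ∈? verts q
  ...   | no i∉ = a ◅ q , Unique-∷ i∉ sq , +-monoʳ _ q≤p , λ { (here e) → here e ; (there m) → there (q⊆p m) }
  ...   | yes i∈ with split q i∈
  ...     | q₁ , q₂ , refl = q₂ , proj₁ (proj₂ (◅◅-simple⁻ q₁ q₂ sq)) , q₂≤ ,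
                             λ m → there (q⊆p (∈-edges⁺ʳ q₁ q₂ m))
    where
    cycle : (q₁ : Star Arc j i) → Simple q₁ → (∀ {e} → e ∈ edges q₁ → e ∈ edges p) → 0# ≤ c i j a + weight q₁
    cycle ε sq q⊆ = ⊥-elim (no-loop a)
    cycle (b ◅ ε) sq q⊆ = ≮⇒≥ λ lt → nr (here refl) (there (q⊆ (here refl)))
      (E-full ((λ { refl → no-loop a }) , a , b , λ le → lt (≤-trans le (+-monoʳ _ (≈⇒≥ (+-identityʳ _))))))
    cycle (b ◅ b′ ◅ q₁) sq q⊆ = cycle-nonnegative nc a (b ◅ b′ ◅ q₁) sq (s≤s (s≤s z≤n))
    q₂≤ : weight q₂ ≤ c i j a + weight p
    q₂≤ = ≤-trans (x≤y+x (cycle q₁ (proj₁ (◅◅-simple⁻ q₁ q₂ sq)) (λ m → q⊆p (∈-edges⁺ˡ q₁ q₂ m))))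
            (≤-trans (≈⇒≤ (≈-trans (+-assoc _ _ _) (+-cong ≈-refl (≈-sym (weight-◅◅ q₁ q₂))))) (+-monoʳ _ q≤p))

  chords : Star Arc s t → ℕ
  chords ε = 0
  chords (_◅_ {i} {j} a p) with E? i j
  ... | yes _ = chords p
  ... | no _  = suc (chords p)

  chords-◅◅ : (p : Star Arc s t) (q : Star Arc t u) → chords (p ◅◅ q) ≡ chords p ℕ.+ chords q
  chords-◅◅ ε q = refl
  chords-◅◅ (_◅_ {i} {j} a p) q with E? i j
  ... | yes _ = chords-◅◅ p q
  ... | no _  = cong suc (chords-◅◅ p q)

  chords-none : (p : Star Arc s t) → AllEdges E p → chords p ≡ 0
  chords-none ε al = refl
  chords-none (_◅_ {i} {j} a p) al with E? i j
  ... | yes _ = chords-none p (λ m → al (there m))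
  ... | no ¬e = ⊥-elim (¬e (al (here refl)))

  chords-chord : (ab : Arc a b) → ¬ E a b → (p : Star Arc b t) → chords (ab ◅ p) ≡ suc (chords p)
  chords-chord {a = a} {b} ab ¬e p with E? a b
  ... | yes e = ⊥-elim (¬e e)
  ... | no _  = refl

  Chord : Star Arc s t → Set
  Chord {s} {t} p = ∃[ a ] ∃[ b ] Σ (Arc a b) λ ab → Σ (Star Arc s a) λ p₁ → Σ (Star Arc b t) λ p₂ →
    p ≡ p₁ ◅◅ (ab ◅ p₂) × ¬ E a b

  first-chord : (p : Star Arc s t) → AllEdges E p ⊎ Chord p
  first-chord ε = inj₁ λ ()
  first-chord (_◅_ {i} {j} a p) with E? i j
  ... | no ¬e = inj₂ (i , j , a , ε , p , refl , ¬e)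
  ... | yes e with first-chord p
  ...   | inj₁ al = inj₁ λ { (here refl) → e ; (there m) → al m }
  ...   | inj₂ (_ , _ , ab , p₁ , p₂ , refl , ¬e) = inj₂ (_ , _ , ab , a ◅ p₁ , p₂ , refl , ¬e)

  -- The strict inequality drives the induction: a cycle made of a path with at most `m` chords and
  -- a tree path loses one chord when it is opened there, and what remains has fewer than `m`.
  ClosedBelow : ℕ → Set
  ClosedBelow m = ∀ {a b} (ab : Arc a b) → ¬ E a b → (q : Star Arc b a) → Simple q → chords q ℕ.< m →
                  0# ≤ c a b ab + weight q

  nonempty : (p : Star Arc s t) → s ≢ t → 1 ℕ.≤ len p
  nonempty ε       s≢t = ⊥-elim (s≢t refl)
  nonempty (_ ◅ _) s≢t = s≤s z≤n

  module _ {m : ℕ} (closed : ClosedBelow m) where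

    -- If p meets the tree path from x to y only at its ends, then p and the
    -- reversed tree path form a cycle, and removing a chord of p from it leaves
    -- a path with fewer chords.

    private
      disjoint-case : (p : Star Arc x y) → Simple p → chords p ℕ.≤ m →
                      (q : Star Arc x y) → Simple q → AllEdges E q → weight q ≈ P x y →
                      (∀ {z} → z ∈ verts p → z ∈ verts q → z ≡ x ⊎ z ≡ y) → P x y ≤ weight p
      disjoint-case {x = x} {y} p sp p≤m q sq aq wq meet with first-chord p
      ... | inj₁ ap = ≈⇒≥ (unique p sp ap)
      ... | inj₂ (a , b , ab , p₁ , p₂ , refl , ¬e)
        with reverse-path {E = E} E-negative E-sym q sq aq | ◅◅-simple⁻ p₁ (ab ◅ p₂) sp
      ... | r , sr , ar , r⊆q , qr≤0 | s₁ , s₂ , dis =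
        -- The nonnegative cycle of `ab` and `rest` is added to `q`. Since `rest` contains the
        -- reversal `r` of `q`, the pair `q`, `r` is at most 0 and drops out, leaving the arcs of
        -- `p`.
        ≤-trans (≈⇒≥ wq) (≤-trans (x≤x+y (closed ab ¬e rest rest-simple rest-chords)) (≤-trans
          (≈⇒≤ (≈-trans (+-cong ≈-refl (+-cong ≈-refl rest-weight))
            (solve 5 (λ q ab p₂ r p₁ → q ⊕ (ab ⊕ (p₂ ⊕ (r ⊕ p₁))) ⊜ (q ⊕ r) ⊕ (p₁ ⊕ (ab ⊕ p₂)))
              ≈-refl _ _ _ _ _)))
          (≤-trans (y+x≤x qr≤0) (≈⇒≥ (weight-◅◅ p₁ (ab ◅ p₂))))))
        where
        tail : Star Arc y a
        tail = r ◅◅ p₁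
        rest : Star Arc b a
        rest = p₂ ◅◅ tail
        rest-weight : weight rest ≈ weight p₂ + (weight r + weight p₁)
        rest-weight = ≈-trans (weight-◅◅ p₂ tail) (+-cong ≈-refl (weight-◅◅ r p₁))
        apart : ∀ {z} → z ∈ verts p₁ → z ∉ verts p₂
        apart k k′ with ∈-verts⁻ p₁ k
        ... | inj₁ k₁   = dis k₁ (there k′)
        ... | inj₂ refl = ∉-head s₂ k′
        in-r : ∀ {z} → z ∈ sources r → z ∈ verts (p₁ ◅◅ (ab ◅ p₂)) → z ≡ y
        in-r k k′ with meet k′ (r⊆q (sources⊆verts r k))
        ... | inj₁ refl = ⊥-elim (end∉sources r sr k)
        ... | inj₂ e    = e
        tail-simple : Simple tail
        tail-simple = ◅◅-simple r p₁ sr s₁ λ k k′ → apart k′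
          (subst (_∈ verts p₂) (sym (in-r k (∈-◅◅⁺ˡ p₁ (ab ◅ p₂) k′))) (end∈ p₂))
        rest-simple : Simple rest
        rest-simple = ◅◅-simple p₂ tail (Unique-tail s₂) tail-simple dis′
          where
          dis′ : ∀ {z} → z ∈ sources p₂ → z ∉ verts tail
          dis′ k k′ with ∈-◅◅⁻ r p₁ k′
          ... | inj₂ k″ = apart k″ (sources⊆verts p₂ k)
          ... | inj₁ k″ with in-r k″ (∈-◅◅⁺ʳ p₁ (ab ◅ p₂) (there (sources⊆verts p₂ k)))
          ...   | refl = end∉sources p₂ (Unique-tail s₂) k
        rest-chords : chords rest ℕ.< m
        rest-chords = ℕₚ.≤-trans (ℕₚ.≤-reflexive (sym eq)) p≤m
          where
          open Relation.Binary.PropositionalEquality.≡-Reasoning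
          eq : chords (p₁ ◅◅ (ab ◅ p₂)) ≡ suc (chords rest)
          eq = begin
            chords (p₁ ◅◅ (ab ◅ p₂))               ≡⟨ chords-◅◅ p₁ (ab ◅ p₂) ⟩
            chords p₁ ℕ.+ chords (ab ◅ p₂)          ≡⟨ cong (chords p₁ ℕ.+_) (chords-chord ab ¬e p₂) ⟩
            chords p₁ ℕ.+ suc (chords p₂)           ≡⟨ ℕₚ.+-suc _ _ ⟩
            suc (chords p₁ ℕ.+ chords p₂)           ≡⟨ cong suc (ℕₚ.+-comm (chords p₁) _) ⟩
            suc (chords p₂ ℕ.+ chords p₁)           ≡⟨ cong (λ k → suc (chords p₂ ℕ.+ (k ℕ.+ chords p₁)))
              (chords-none r ar) ⟨
            suc (chords p₂ ℕ.+ (chords r ℕ.+ chords p₁)) ≡⟨ cong (λ k → suc (chords p₂ ℕ.+ k)) (chords-◅◅ r p₁) ⟨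
            suc (chords p₂ ℕ.+ chords tail)         ≡⟨ cong suc (chords-◅◅ p₂ tail) ⟨
            suc (chords rest)                       ∎

      -- An interior vertex of the tree path that lies on `p` splits both into shorter pieces with
      -- the same ends; repeated splitting ends with paths that are internally disjoint. The number
      -- `k` bounds the length for the recursion.
      minimal : ∀ k (p : Star Arc x y) → len p ℕ.≤ k → Simple p → chords p ℕ.≤ m → tr x ≡ tr y → P x y ≤ weight p
      minimal {x = x} {y} k p p≤k sp p≤m xy with path xy
      ... | q , sq , aq , wq
        with any? (λ z → (z ∈? verts q) ×-dec (¬? (z ≟ꟳ x) ×-dec ¬? (z ≟ꟳ y))) (verts p)
      ...   | no ¬common = disjoint-case p sp p≤m q sq aq wq meet
        where
        meet : ∀ {z} → z ∈ verts p → z ∈ verts q → z ≡ x ⊎ z ≡ y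
        meet {z} zp zq with z ≟ꟳ x | z ≟ꟳ y
        ... | yes e | _     = inj₁ e
        ... | no _  | yes e = inj₂ e
        ... | no z≢x | no z≢y = ⊥-elim (¬common (lose zp (zq , z≢x , z≢y)))
      ...   | yes common with find common
      ...     | z , zp , zq , z≢x , z≢y with split p zp | split q zq
      ...       | p₁ , p₂ , refl | q₁ , q₂ , refl = halves k p≤k
        where
        sps = ◅◅-simple⁻ p₁ p₂ sp
        sqs = ◅◅-simple⁻ q₁ q₂ sq
        xz : tr x ≡ tr z
        xz = sym (label-along (q₁ ◅◅ q₂) aq zq)
        c₁ : chords p₁ ℕ.≤ m
        c₁ = ℕₚ.≤-trans (ℕₚ.m≤m+n _ _) (ℕₚ.≤-trans (ℕₚ.≤-reflexive (sym (chords-◅◅ p₁ p₂))) p≤m)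
        c₂ : chords p₂ ℕ.≤ m
        c₂ = ℕₚ.≤-trans (ℕₚ.m≤n+m _ _) (ℕₚ.≤-trans (ℕₚ.≤-reflexive (sym (chords-◅◅ p₁ p₂))) p≤m)
        halves : ∀ k → len (p₁ ◅◅ p₂) ℕ.≤ k → P x y ≤ weight (p₁ ◅◅ p₂)
        halves zero le = ⊥-elim (ℕₚ.<⇒≱ (nonempty p₁ (z≢x ∘ sym))
          (ℕₚ.≤-trans (ℕₚ.m≤m+n _ (len p₂)) (subst (ℕ._≤ 0) (len-◅◅ p₁ p₂) le)))
        halves (suc k) le = ≤-trans (≈⇒≥ wq) (≤-trans (≈⇒≤ (weight-◅◅ q₁ q₂)) (≤-trans
          (+-mono (≤-trans (≈⇒≤ (unique q₁ (proj₁ sqs) (λ e → aq (∈-edges⁺ˡ q₁ q₂ e))))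
                           (minimal k p₁ l₁ (proj₁ sps) c₁ xz))
                  (≤-trans (≈⇒≤ (unique q₂ (proj₁ (proj₂ sqs)) (λ e → aq (∈-edges⁺ʳ q₁ q₂ e))))
                           (minimal k p₂ l₂ (proj₁ (proj₂ sps)) c₂ (trans (sym xz) xy))))
          (≈⇒≥ (weight-◅◅ p₁ p₂))))
          where
          le′ : len p₁ ℕ.+ len p₂ ℕ.≤ suc k
          le′ = subst (ℕ._≤ suc k) (len-◅◅ p₁ p₂) le
          l₁ : len p₁ ℕ.≤ k
          l₁ = ℕₚ.≤-pred (ℕₚ.≤-trans (ℕₚ.≤-reflexive (ℕₚ.+-comm 1 _))
                 (ℕₚ.≤-trans (ℕₚ.+-monoʳ-≤ (len p₁) (nonempty p₂ z≢y)) le′))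
          l₂ : len p₂ ℕ.≤ k
          l₂ = ℕₚ.≤-pred (ℕₚ.≤-trans (ℕₚ.+-monoˡ-≤ (len p₂) (nonempty p₁ (z≢x ∘ sym))) le′)

    tree-path-minimal : (p : Star Arc x y) → Simple p → chords p ℕ.≤ m → tr x ≡ tr y → P x y ≤ weight p
    tree-path-minimal p sp p≤m = minimal (len p) p ℕₚ.≤-refl sp p≤m

  -- A negative cycle of three or more arcs contains a chord, since the negative edges form a
  -- forest. Rotated so that a chord comes first, the cycle contradicts `closed`.
  closed⇒nearlyConservative : (∀ m → ClosedBelow m) → NearlyConservative
  closed⇒nearlyConservative closed {u} {v} uv p sp′ lt with len p ℕ.≤? 1
  ... | yes short = s≤s (subst (ℕ._≤ 1) (sym (#arcs≡len p)) short)
  ... | no long = ⊥-elim (impossible p (fromSimple p sp′) (ℕₚ.≰⇒> long) (E? u v) (first-chord p) lt)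
    where
    -- Two negative-edge paths from a to u would have different weights.
    all-negative : (p : Star Arc v u) → Simple p → 2 ℕ.≤ len p → E u v → AllEdges E p → ⊥
    all-negative (va ◅ ε) sp (s≤s ()) e al
    all-negative (_◅_ {j = a} va p@(_ ◅ _)) sp 2≤ e al with E-negative e | E-negative (al (here refl))
    ... | u≢v , _ , vu , _ | v≢a , _ , av , va<0 =
      va<0 (+-cancel-≤ {y = c v u vu} (≤-trans (≈⇒≤ (≈-trans (+-identityˡ _)
      (≈-trans (≈-sym (+-identityʳ _)) (≈-trans (unique (arrow vu) s₁ a₁) (≈-trans (≈-sym (unique (va ◅ p) sp al))
        (+-cong ≈-refl (≈-trans (unique p (Unique-tail sp) (λ m → al (there m)))
          (≈-sym (unique (av ◅ arrow vu) s₂ a₂)))))))))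
      (≈⇒≤ (solve 3 (λ x y z → x ⊕ (y ⊕ (z ⊕ Solver.id)) ⊜ (x ⊕ y) ⊕ z) ≈-refl _ _ _))))
      where
      a≢u : a ≢ u
      a≢u refl = absurd p (Unique-tail sp) (s≤s z≤n)
        where
        absurd : (q : Star Arc a a) → Simple q → 1 ℕ.≤ len q → ⊥
        absurd (_ ◅ q) sq _ = ∉-head sq (end∈ q)
      s₁ : Simple (arrow vu)
      s₁ = Unique-∷ (λ { (here refl) → u≢v refl }) ([] ∷ [])
      a₁ : AllEdges E (arrow vu)
      a₁ (here refl) = E-sym e
      s₂ : Simple (av ◅ arrow vu)
      s₂ = Unique-∷ (λ { (here refl) → v≢a refl ; (there (here refl)) → a≢u refl }) s₁
      a₂ : AllEdges E (av ◅ arrow vu)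
      a₂ (here refl)         = E-sym (al (here refl))
      a₂ (there (here refl)) = E-sym e
    impossible : (p : Star Arc v u) → Simple p → 2 ℕ.≤ len p → Dec (E u v) → AllEdges E p ⊎ Chord p →
      c u v uv + weight p < 0# → ⊥
    impossible p sp 2≤ (no ¬e) _ lt = lt (closed (suc (chords p)) uv ¬e p sp ℕₚ.≤-refl)
    impossible p sp 2≤ (yes e) (inj₁ al) lt = all-negative p sp 2≤ e al
    impossible _ sp 2≤ (yes e) (inj₂ (a , b , ab , p₁ , p₂ , refl , ¬e)) lt with ◅◅-simple⁻ p₁ (ab ◅ p₂) sp
    ... | s₁ , s₂ , dis = lt (≤-trans (closed _ ab ¬e rest rest-simple ℕₚ.≤-refl) (≤-trans
        (≈⇒≤ (≈-trans (+-cong ≈-refl (weight-◅◅ p₂ (uv ◅ p₁)))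
          (solve 4 (λ ab p₂ uv p₁ → ab ⊕ (p₂ ⊕ (uv ⊕ p₁)) ⊜ uv ⊕ (p₁ ⊕ (ab ⊕ p₂))) ≈-refl _ _ _ _)))
        (+-monoʳ _ (≈⇒≥ (weight-◅◅ p₁ (ab ◅ p₂))))))
      where
      rest : Star Arc b a
      rest = p₂ ◅◅ (uv ◅ p₁)
      apart : ∀ {z} → z ∈ verts p₁ → z ∉ verts p₂
      apart k k′ with ∈-verts⁻ p₁ k
      ... | inj₁ k₁   = dis k₁ (there k′)
      ... | inj₂ refl = ∉-head s₂ k′
      rest-simple : Simple rest
      rest-simple = ◅◅-simple p₂ (uv ◅ p₁) (Unique-tail s₂) (Unique-∷ (λ m → apart m (end∈ p₂)) s₁) dis′
        where
        dis′ : ∀ {z} → z ∈ sources p₂ → z ∉ u ∷ verts p₁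
        dis′ k (here refl) = end∉sources p₂ (Unique-tail s₂) k
        dis′ k (there k′)  = apart k′ (sources⊆verts p₂ k)

  -- The first two fields make recorded walks sound: a tree has one number, and a tree without a
  -- number contributes no edge. The third makes the search complete; it compares only vertices of a
  -- common block, because trees in different blocks at `s` may share a number.
  record Numbering (_∼_ : Rel (Fin n) 0ℓ) (s : Fin n) (ix : Fin n → ℕ) : Set where
    field
      same-tree : s ∼ u → s ∼ v → tr u ≢ tr s → tr u ≡ tr v → ix u ≡ ix v
      single    : s ∼ u → s ∼ v → tr u ≢ tr s → tr u ≡ tr v → ix u ≡ 0 → u ≡ v
      distinct  : s ∼ u → s ∼ v → u ∼ v → tr u ≢ tr s → tr v ≢ tr s → ix u ≡ ix v → ix u ≢ 0 → tr u ≡ tr v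

  -- Hops r S y x: a walk of weight x from s to y which, after the tree of s,
  -- traverses r further trees, each at most once and along a tree path; S is the
  -- set of those of them that carry a number.

  data Hops (_∼_ : Rel (Fin n) 0ℓ) (s : Fin n) (ix : Fin n → ℕ) : ℕ → ℕ → Fin n → Carrier → Set where
    start : ∀ {y} → tr y ≡ tr s → s ∼ y → Hops _∼_ s ix 0 0 y (P s y)
    hop   : ∀ {r S x y a b} → Hops _∼_ s ix r S y x → (ya : Arc y a) → s ∼ a → tr a ≢ tr s → tr a ≢ tr y →
            bit S (ix a) ≡ false → tr a ≡ tr b → s ∼ b →
            Hops _∼_ s ix (suc r) (S ℕ.+ pw (ix a)) b ((x + c y a ya) + P a b)

  module _ {_∼_ : Rel (Fin n) 0ℓ} {s : Fin n} {ix : Fin n → ℕ} (numbering : Numbering _∼_ s ix) where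
    open Numbering numbering

    Visited : ℕ → Fin n → Set
    Visited S u = tr u ≡ tr s ⊎ ∃[ a ] s ∼ a × tr a ≢ tr s × tr a ≡ tr u × bit S (ix a) ≡ true

    -- The last component is the invariant behind `NoReturn`: every negative edge used so far starts
    -- in a visited tree, while the digit of the tree entered next is still free. The connecting arc
    -- joins different trees and so is no negative edge itself.
    hops⇒walk : ∀ {r S y x} → Hops _∼_ s ix r S y x →
                Σ (Star Arc s y) λ p → NoReturn p × weight p ≈ x ×
                  (∀ {u v} → (u , v) ∈ edges p → E u v → Visited S u)
    hops⇒walk (start ys _) with path (sym ys)
    ... | q , sq , aq , wq = q , (λ m k _ → simple-no-antiparallel q sq m k) , wq ,
      λ m e → inj₁ (label-along q aq (sources⊆verts q (edge-source q m)))
    hops⇒walk (hop {S = S} {x} {y} {a} {b} h ya sa a≁s a≁y free ab sb) with hops⇒walk h | path ab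
    ... | p , nr , wp , vis | q , sq , aq , wq = p ◅◅ (ya ◅ q) , nr′ ,
      ≈-trans (weight-◅◅ p (ya ◅ q)) (≈-trans (+-cong wp (+-cong ≈-refl wq)) (≈-sym (+-assoc _ _ _))) , vis′
      where
      unvisited : ∀ {u v} → E u v → Visited S u → tr u ≡ tr a → ⊥
      unvisited e (inj₁ us) ua = a≁s (trans (sym ua) us)
      unvisited e (inj₂ (a′ , sa′ , a′≁s , a′u , on)) ua
        with trans (sym on) (trans (cong (bit S) (same-tree sa′ sa a′≁s (trans a′u ua))) free)
      ... | ()
      new : ∀ {u v} → (u , v) ∈ edges (ya ◅ q) → E u v → (u , v) ∈ edges q
      new (here refl) e = ⊥-elim (a≁y (sym (E-label e)))
      new (there m)   e = m
      source-label : ∀ {u v} → (u , v) ∈ edges q → tr u ≡ tr a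
      source-label m = label-along q aq (sources⊆verts q (edge-source q m))
      nr′ : NoReturn (p ◅◅ (ya ◅ q))
      nr′ {u} {v} m k e with ∈-edges⁻ p (ya ◅ q) m | ∈-edges⁻ p (ya ◅ q) k
      ... | inj₁ m′ | inj₁ k′ = nr m′ k′ e
      ... | inj₁ m′ | inj₂ k′ = unvisited e (vis m′ e) (trans (E-label e) (source-label (new k′ (E-sym e))))
      ... | inj₂ m′ | inj₁ k′ = unvisited (E-sym e) (vis k′ (E-sym e))
        (trans (sym (E-label e)) (source-label (new m′ e)))
      ... | inj₂ m′ | inj₂ k′ = simple-no-antiparallel q sq (new m′ e) (new k′ (E-sym e))
      vis′ : ∀ {u v} → (u , v) ∈ edges (p ◅◅ (ya ◅ q)) → E u v → Visited (S ℕ.+ pw (ix a)) u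
      vis′ m e with ∈-edges⁻ p (ya ◅ q) m
      ... | inj₁ m′ with vis m′ e
      ...   | inj₁ us = inj₁ us
      ...   | inj₂ (a′ , sa′ , a′≁s , a′u , on) =
        inj₂ (a′ , sa′ , a′≁s , a′u , trans (bit-other (ix a) (ix a′) free differ) on)
        where
        differ : ix a′ ≢ ix a
        differ eq with trans (sym on) (trans (cong (bit S) eq) free)
        ... | ()
      vis′ {u} {v} m e | inj₂ m′ = inj₂ (a , sa , a≁s , sym (source-label (new m′ e)) , bit-set (ix a) ix≢0 free)
        where
        -- A tree without a number has a single vertex near `s`, and the tree path inside it would
        -- be empty.
        ix≢0 : ix a ≢ 0
        ix≢0 i0 with single sa sb a≁s ab i0
        ... | refl = no-edges q sq (new m′ e)
          where
          no-edges : ∀ {w} (q : Star Arc w w) → Simple q → (u , v) ∉ edges q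
          no-edges (_ ◅ q) sq _ = ∉-head sq (end∈ q)

    hops⇒path : NearlyConservative → ∀ {r S y x} → Hops _∼_ s ix r S y x →
                Σ (Star Arc s y) λ p → Simple p × weight p ≤ x
    hops⇒path nc h with hops⇒walk h
    ... | p , nr , wp , _ with erase-walk nc p nr
    ...   | q , sq , q≤p , _ = q , sq , ≤-trans q≤p (≈⇒≤ wp)

    module _ {m : ℕ} (closed : ClosedBelow m) where

      Follows : ℕ → ℕ → Fin n → Carrier → Set
      Follows r S t x = ∃[ r′ ] ∃[ S′ ] ∃[ x′ ] r′ ℕ.≤ r × x′ ≤ x × Hops _∼_ s ix r′ S′ t x′

      private
        chords-left : (p : Star Arc x y) (q : Star Arc y z) → chords (p ◅◅ q) ℕ.≤ m → chords p ℕ.≤ m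
        chords-left p q le = ℕₚ.≤-trans (ℕₚ.m≤m+n _ _) (subst (ℕ._≤ m) (chords-◅◅ p q) le)

        chords-right : (p : Star Arc x y) (q : Star Arc y z) → chords (p ◅◅ q) ℕ.≤ m → chords q ℕ.≤ m
        chords-right p q le = ℕₚ.≤-trans (ℕₚ.m≤n+m _ (chords p)) (subst (ℕ._≤ m) (chords-◅◅ p q) le)

        chords-tail : (e : Arc x y) (p : Star Arc y z) → chords (e ◅ p) ℕ.≤ m → chords p ℕ.≤ m
        chords-tail e p le = chords-right (arrow e) p le

      -- The stretch from `a` to the last vertex in the tree of `a` is exchanged for the tree path,
      -- which weighs no more. Later vertices avoid this tree, so its digit may be spent. Each hop
      -- consumes at least one arc, which gives the bound on their number.
      continue : ∀ k {r S y x a t} → Hops _∼_ s ix r S y x → (ya : Arc y a) → tr a ≢ tr y →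
                 (p : Star Arc a t) → len p ℕ.≤ k → Simple p → chords p ℕ.≤ m →
                 (∀ {z} → z ∈ verts p → s ∼ z × tr z ≢ tr s × bit S (ix z) ≡ false) →
                 (∀ {z z′} → z ∈ verts p → z′ ∈ verts p → z ∼ z′) →
                 Follows (r ℕ.+ suc (len p)) S t ((x + c y a ya) + weight p)
      continue k {a = a} h ya a≁y p p≤k sp cp ok clique with last (λ z → tr z ℕ.≟ tr a) p | ok (start∈ p)
      ... | never none | _ = ⊥-elim (none (start∈ p) refl)
      ... | at-end ta | sa , a≁s , free =
        _ , _ , _ , ℕₚ.≤-trans (ℕₚ.≤-reflexive (ℕₚ.+-comm 1 _)) (ℕₚ.+-monoʳ-≤ _ (s≤s z≤n)) ,
        +-monoʳ _ (tree-path-minimal closed p sp cp (sym ta)) ,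
        hop h ya sa a≁s a≁y free (sym ta) (proj₁ (ok (end∈ p)))
      continue zero h ya a≁y _ p≤k sp cp ok clique | leave p₁ e p₂ ta none | _ =
        ⊥-elim (ℕₚ.<⇒≱ (s≤s z≤n) (ℕₚ.≤-trans (ℕₚ.m≤n+m _ (len p₁)) (subst (ℕ._≤ 0) (len-◅◅ p₁ (e ◅ p₂)) p≤k)))
      continue (suc k) {r} {S} {y} {x} {a} h ya a≁y _ p≤k sp cp ok clique | leave {y = y′} p₁ e p₂ ta
        none | sa , a≁s , free
        with continue k (hop h ya sa a≁s a≁y free (sym ta) (proj₁ (ok (∈-◅◅⁺ˡ p₁ (e ◅ p₂) (end∈ p₁))))) e
               (λ eq → none (start∈ p₂) (trans eq ta)) p₂ shorter
               (Unique-tail (proj₁ (proj₂ (◅◅-simple⁻ p₁ (e ◅ p₂) sp))))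
               (chords-tail e p₂ (chords-right p₁ (e ◅ p₂) cp)) ok′
               (λ m m′ → clique (∈-◅◅⁺ʳ p₁ (e ◅ p₂) (there m)) (∈-◅◅⁺ʳ p₁ (e ◅ p₂) (there m′)))
        where
        total-len : len p₁ ℕ.+ suc (len p₂) ℕ.≤ suc k
        total-len = subst (ℕ._≤ suc k) (len-◅◅ p₁ (e ◅ p₂)) p≤k
        shorter : len p₂ ℕ.≤ k
        shorter = ℕₚ.≤-pred (ℕₚ.≤-trans (ℕₚ.m≤n+m _ (len p₁)) total-len)
        ok′ : ∀ {z} → z ∈ verts p₂ → s ∼ z × tr z ≢ tr s × bit (S ℕ.+ pw (ix a)) (ix z) ≡ false
        ok′ {z} m with ok (∈-◅◅⁺ʳ p₁ (e ◅ p₂) (there m)) | ix z ℕ.≟ ix a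
        ... | sz , z≁s , fz | no iz≢ia = sz , z≁s , trans (bit-other (ix a) (ix z) free iz≢ia) fz
        -- An equal nonzero number would put `z` into the tree of `a`, which `p₂` has left; the
        -- number 0 occupies no digit.
        ... | sz , z≁s , fz | yes iz≡ia with ix z ℕ.≟ 0
        ...   | yes i0 = sz , z≁s , subst (λ i → bit (S ℕ.+ pw (ix a)) i ≡ false) (sym i0) refl
        ...   | no i≢0 = ⊥-elim (none m (distinct sz sa
          (clique (∈-◅◅⁺ʳ p₁ (e ◅ p₂) (there m)) (start∈ (p₁ ◅◅ (e ◅ p₂))))
                                         z≁s a≁s iz≡ia i≢0))
      ... | r′ , S′ , x′ , r′≤ , x′≤ , h′ = r′ , S′ , x′ , ℕₚ.≤-trans r′≤ count , ≤-trans x′≤ bound , h′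
        where
        count : suc r ℕ.+ suc (len p₂) ℕ.≤ r ℕ.+ suc (len (p₁ ◅◅ (e ◅ p₂)))
        count = ℕₚ.≤-trans (ℕₚ.≤-reflexive (sym (ℕₚ.+-suc r _)))
          (ℕₚ.+-monoʳ-≤ r (s≤s (subst (suc (len p₂) ℕ.≤_) (sym (len-◅◅ p₁ (e ◅ p₂))) (ℕₚ.m≤n+m _ (len p₁)))))
        bound : (((x + c y a ya) + P a y′) + c y′ _ e) + weight p₂ ≤ (x + c y a ya) + weight (p₁ ◅◅ (e ◅ p₂))
        bound = ≤-trans (≈⇒≤ (solve 4 (λ X p e q → ((X ⊕ p) ⊕ e) ⊕ q ⊜ X ⊕ (p ⊕ (e ⊕ q))) ≈-refl _ _ _ _))
          (+-monoʳ _ (≤-trans (+-mono (tree-path-minimal closed p₁ (proj₁ (◅◅-simple⁻ p₁ (e ◅ p₂) sp))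
                                        (chords-left p₁ (e ◅ p₂) cp) (sym ta)) ≤-refl)
                     (≈⇒≥ (weight-◅◅ p₁ (e ◅ p₂)))))

      -- The tree of `s` is treated apart: it carries no digit, since the walk starts in it and
      -- never comes back after the last visit of `p`.
      path⇒hops : ∀ {t} (p : Star Arc s t) → Simple p → chords p ℕ.≤ m →
                  (∀ {z z′} → z ∈ verts p → z′ ∈ verts p → z ∼ z′) → Follows (len p) 0 t (weight p)
      path⇒hops p sp cp clique with last (λ z → tr z ℕ.≟ tr s) p
      ... | never none = ⊥-elim (none (start∈ p) refl)
      ... | at-end ts = _ , _ , _ , z≤n , tree-path-minimal closed p sp cp (sym ts) ,
        start ts (clique (start∈ p) (end∈ p))
      ... | leave {y = y} p₁ e p₂ ys none
        with continue (len p₂) (start ys (clique (start∈ p) (∈-◅◅⁺ˡ p₁ (e ◅ p₂) (end∈ p₁)))) e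
               (λ eq → none (start∈ p₂) (trans eq ys)) p₂ ℕₚ.≤-refl
               (Unique-tail (proj₁ (proj₂ (◅◅-simple⁻ p₁ (e ◅ p₂) sp))))
               (chords-tail e p₂ (chords-right p₁ (e ◅ p₂) cp))
               (λ {z} m → clique (start∈ p) (∈-◅◅⁺ʳ p₁ (e ◅ p₂) (there m)) , none m , bit-zero (ix z))
               (λ m m′ → clique (∈-◅◅⁺ʳ p₁ (e ◅ p₂) (there m)) (∈-◅◅⁺ʳ p₁ (e ◅ p₂) (there m′)))
      ... | r′ , S′ , x′ , r′≤ , x′≤ , h′ = r′ , S′ , x′ ,
        ℕₚ.≤-trans r′≤ (subst (suc (len p₂) ℕ.≤_) (sym (len-◅◅ p₁ (e ◅ p₂))) (ℕₚ.m≤n+m _ (len p₁))) ,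
        ≤-trans x′≤ (≤-trans (≈⇒≤ (+-assoc _ _ _)) (≤-trans
          (+-mono (tree-path-minimal closed p₁ (proj₁ (◅◅-simple⁻ p₁ (e ◅ p₂) sp))
            (chords-left p₁ (e ◅ p₂) cp) (sym ys)) ≤-refl)
          (≈⇒≥ (weight-◅◅ p₁ (e ◅ p₂))))) , h′

-- Blocks and separating vertices

module Separation {n : ℕ} (D : Digraph n) where
  open Digraph D using (Arc; Adjacent)

  private variable
    s t u v x y z : Fin n
    w : ℕ

  Mutual : Rel (Fin n) 0ℓ
  Mutual u v = Star Arc u v × Star Arc v u

  mutual-sym : Mutual u v → Mutual v u
  mutual-sym (p , q) = q , p

  mutual-trans : Mutual u v → Mutual v x → Mutual u x
  mutual-trans (p , q) (p′ , q′) = p ◅◅ p′ , q′ ◅◅ q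

  -- Adjacency within strong components; the blocks of this one graph are the weak blocks of all
  -- strong components together.
  Link : Rel (Fin n) 0ℓ
  Link u v = Adjacent u v × Mutual u v

  -- Link with the vertex of index w removed; nothing is removed when w ≥ n.

  Avoid : ℕ → Rel (Fin n) 0ℓ
  Avoid w u v = toℕ u ≢ w × toℕ v ≢ w × Link u v

  avoid-sym : Avoid w u v → Avoid w v u
  avoid-sym (a , b , adj , m) = b , a , swap adj , mutual-sym m

  Conn : ℕ → Rel (Fin n) 0ℓ
  Conn w = Star (Avoid w)

  conn-sym : Conn w u v → Conn w v u
  conn-sym = reverse avoid-sym

  conn⇒mutual : Conn w u v → Mutual u v
  conn⇒mutual ε = ε , ε
  conn⇒mutual ((_ , _ , _ , m) ◅ p) = mutual-trans m (conn⇒mutual p)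

  infix 4 _∼_
  -- Membership in a common block, put as the absence of a separating vertex because that is what an
  -- algorithm can test. A number `w` that is no vertex yields plain connectedness. The relation is
  -- not transitive.
  _∼_ : Rel (Fin n) 0ℓ
  u ∼ v = ∀ w → toℕ u ≢ w → toℕ v ≢ w → Conn w u v

  ∼-refl : u ∼ u
  ∼-refl _ _ _ = ε

  ∼-sym : u ∼ v → v ∼ u
  ∼-sym f w a b = conn-sym (f w b a)

  ∼⇒mutual : u ∼ v → Mutual u v
  ∼⇒mutual f = conn⇒mutual (f n (ℕₚ.<⇒≢ (toℕ<n _)) (ℕₚ.<⇒≢ (toℕ<n _)))

  -- Replaces transitivity: at a separating vertex the two blocks meet in this vertex alone, so two
  -- connections through different vertices `v` and `s` always suffice, one of them surviving any
  -- removal.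
  ∼-detour : u ∼ v → v ∼ x → u ∼ s → s ∼ x → s ≢ v → u ∼ x
  ∼-detour {v = v} {s = s} uv vx us sx s≢v w a b with toℕ v ℕ.≟ w
  ... | no v≢w   = uv w a v≢w ◅◅ vx w v≢w b
  ... | yes refl = us w a s≢w ◅◅ sx w s≢w b
    where
    s≢w : toℕ s ≢ toℕ v
    s≢w e = s≢v (toℕ-injective e)

  link⇒∼ : Link u v → u ∼ v
  link⇒∼ l w a b = (a , b , l) ◅ ε

  avoiding : (p : Star Link s t) → (∀ {z} → z ∈ verts p → toℕ z ≢ w) → Conn w s t
  avoiding p f = proj₁ (relabel p λ m →
    f (sources⊆verts p (edge-source p m)) , f (edge-target p m) , edge-rel p m)

  module _ where
    open import Data.List.Relation.Unary.Any using (any?)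

    meets? : ∀ {R : Rel (Fin n) 0ℓ} w (p : Star R s t) →
             (Σ (Fin n) λ x → x ∈ verts p × toℕ x ≡ w) ⊎ (∀ {z} → z ∈ verts p → toℕ z ≢ w)
    meets? w p with any? (λ z → toℕ z ℕ.≟ w) (verts p)
    ... | yes a = inj₁ (find a)
    ... | no ¬a = inj₂ λ m e → ¬a (lose m e)

  -- If the removed vertex lies on the path between `z` and `x`, the way back from `z` to `s`, a
  -- connection from `s` to `t` around it and the way back from `t` to `x` are all still available.
  ordered-∼ : (p₁ : Star Link s z) (p₂ : Star Link z x) (p₃ : Star Link x t) →
              Simple (p₁ ◅◅ (p₂ ◅◅ p₃)) → s ∼ t → z ∼ x
  ordered-∼ {s} {z} {x} {t} p₁ p₂ p₃ sp st w z≢w x≢w with meets? w p₂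
  ... | inj₂ free = avoiding p₂ free
  ... | inj₁ (y , y∈ , refl) =
    conn-sym (avoiding p₁ a₁) ◅◅ (st w (a₁ (start∈ p₁)) (a₃ (end∈ p₃)) ◅◅ conn-sym (avoiding p₃ a₃))
    where
    s₁ = ◅◅-simple⁻ p₁ (p₂ ◅◅ p₃) sp
    s₂ = ◅◅-simple⁻ p₂ p₃ (proj₁ (proj₂ s₁))
    a₁ : ∀ {v} → v ∈ verts p₁ → toℕ v ≢ toℕ y
    a₁ m e with toℕ-injective e | ∈-verts⁻ p₁ m
    ... | refl | inj₁ k    = proj₂ (proj₂ s₁) k (∈-◅◅⁺ˡ p₂ p₃ y∈)
    ... | refl | inj₂ refl = z≢w refl
    a₃ : ∀ {v} → v ∈ verts p₃ → toℕ v ≢ toℕ y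
    a₃ m e with toℕ-injective e | ∈-verts⁻ p₂ y∈
    ... | refl | inj₁ k    = proj₂ (proj₂ s₂) k m
    ... | refl | inj₂ refl = x≢w refl

  link-path-∼ : (p : Star Link s t) → Simple p → s ∼ t → z ∈ verts p → x ∈ verts p → z ∼ x
  link-path-∼ p sp st zp xp with split p zp
  ... | p₁ , p₂ , refl with ∈-◅◅⁻ p₁ p₂ xp
  ...   | inj₂ x₂ with split p₂ x₂
  ...     | q₁ , q₂ , refl = ordered-∼ p₁ q₁ q₂ sp st
  link-path-∼ p sp st zp xp | p₁ , p₂ , refl | inj₁ x₁ with split p₁ (sources⊆verts p₁ x₁)
  ... | q₁ , q₂ , refl = ∼-sym (ordered-∼ q₁ q₂ p₂ (subst Unique (cong verts (◅◅-assoc q₁ q₂ p₂)) sp) st)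
    where
    open import Data.List.Relation.Unary.Unique.Propositional using (Unique)
    open import Relation.Binary.Construct.Closure.ReflexiveTransitive.Properties using (◅◅-assoc)

  edge-reach : (p : Star Arc s t) → (u , v) ∈ edges p → Star Arc s u × Star Arc v t
  edge-reach (a ◅ p) (here refl) = ε , p
  edge-reach (a ◅ p) (there m) with edge-reach p m
  ... | q , r = a ◅ q , r

  -- Each arc of `p` is closed to a directed walk by the rest of `p`, the return from `t` to `s` and
  -- the beginning of `p`. So the path never leaves its strong component.
  link-path : (p : Star Arc s t) → Mutual s t → Σ (Star Link s t) λ q → verts q ≡ verts p
  link-path p (_ , back) with relabel p (λ m → inj₁ (edge-rel p m) ,
      edge-rel p m ◅ ε , proj₂ (edge-reach p m) ◅◅ (back ◅◅ proj₁ (edge-reach p m)))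
  ... | q , e , _ = q , e

  path-∼ : (p : Star Arc s t) → Simple p → s ∼ t → z ∈ verts p → x ∈ verts p → z ∼ x
  path-∼ p sp st zp xp with link-path p (∼⇒mutual st)
  ... | q , e = link-path-∼ q (subst Unique (sym e) sp) st (subst (_ ∈_) (sym e) zp) (subst (_ ∈_) (sym e) xp)
    where open import Data.List.Relation.Unary.Unique.Propositional using (Unique)

  arc-∼ : Arc u v → Star Arc v u → u ∼ v
  arc-∼ uv q = link⇒∼ (inj₁ uv , uv ◅ ε , q)

  separator-on-path : (p : Star Arc s t) → Mutual s t → ¬ Conn w s t → Σ (Fin n) λ x → x ∈ verts p × toℕ x ≡ w
  separator-on-path {w = w} p m ¬c with meets? w p | link-path p m
  ... | inj₁ r    | _     = r
  ... | inj₂ free | q , e = ⊥-elim (¬c (avoiding q (λ k → free (subst (_ ∈_) e k))))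

  private
    apart : (p : Star Link s x) (q : Star Link x t) → Simple p → Simple q → ¬ Conn (toℕ x) s t →
            z ∈ verts p → z ∈ verts q → z ≡ x
    apart {x = x} {z = z} p q sp sq ¬c zp zq with z ≟ꟳ x
    ... | yes e = e
    ... | no z≢x with split p zp | split q zq
    ...   | p₁ , p₂ , refl | q₁ , q₂ , refl = ⊥-elim (¬c (avoiding p₁ a₁ ◅◅ avoiding q₂ a₂))
      where
      a₁ : ∀ {v} → v ∈ verts p₁ → toℕ v ≢ toℕ x
      a₁ m e with toℕ-injective e | ∈-verts⁻ p₁ m
      ... | refl | inj₁ k    = proj₂ (proj₂ (◅◅-simple⁻ p₁ p₂ sp)) k (end∈ p₂)
      ... | refl | inj₂ refl = z≢x refl
      a₂ : ∀ {v} → v ∈ verts q₂ → toℕ v ≢ toℕ x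
      a₂ m e with toℕ-injective e | ∈-verts⁻ q₁ (start∈ q₁)
      ... | refl | inj₁ k    = proj₂ (proj₂ (◅◅-simple⁻ q₁ q₂ sq)) k m
      ... | refl | inj₂ refl = z≢x refl

  -- Another common vertex of the two paths would allow going from `s` to `t` without passing `x`.
  -- No loop erasure is needed at separators for this reason.
  join-at-separator : (p : Star Arc s x) (q : Star Arc x t) → Mutual s t → Mutual s x → Simple p → Simple q →
                      ¬ Conn (toℕ x) s t → Simple (p ◅◅ q)
  join-at-separator p q st sx sp sq ¬c with link-path p sx | link-path q (mutual-trans (mutual-sym sx) st)
  ... | p′ , e | q′ , e′ = ◅◅-simple p q sp sq λ m k → end∉sources p sp (subst (_∈ sources p)
      (apart p′ q′ (subst Unique (sym e) sp) (subst Unique (sym e′) sq) ¬c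
        (subst (_ ∈_) (sym e) (sources⊆verts p m)) (subst (_ ∈_) (sym e′) k)) m)
    where open import Data.List.Relation.Unary.Unique.Propositional using (Unique)

-- Counting the negative trees of a block

count : (ℕ → Bool) → ℕ → ℕ
count f zero    = 0
count f (suc m) = if f m then suc (count f m) else count f m

count-cong : ∀ {f g : ℕ → Bool} m → (∀ {l} → l ℕ.< m → f l ≡ g l) → count f m ≡ count g m
count-cong zero    h = refl
count-cong {f} {g} (suc m) h rewrite h ℕₚ.≤-refl | count-cong {f} {g} m (λ l → h (ℕₚ.m≤n⇒m≤1+n l)) = refl

count-mono : ∀ {f g : ℕ → Bool} m → (∀ {l} → f l ≡ true → g l ≡ true) → count f m ℕ.≤ count g m
count-mono zero h = z≤n
count-mono {f} {g} (suc m) h with f m in fm | g m in gm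
... | false | false = count-mono m h
... | false | true  = ℕₚ.m≤n⇒m≤1+n (count-mono m h)
... | true  | true  = s≤s (count-mono m h)
... | true  | false with trans (sym gm) (h fm)
...   | ()

count-strict : ∀ {f g : ℕ → Bool} m {l} → (∀ {l} → f l ≡ true → g l ≡ true) → l ℕ.< m →
               f l ≡ false → g l ≡ true → count f m ℕ.< count g m
count-strict {f} {g} (suc m) {l} h (s≤s l≤m) fl gl with l ℕ.≟ m
... | yes refl rewrite fl | gl = s≤s (count-mono m h)
... | no l≢m with f m in fm | g m in gm
...   | false | false = count-strict m h (ℕₚ.≤∧≢⇒< l≤m l≢m) fl gl
...   | false | true  = ℕₚ.m≤n⇒m≤1+n (count-strict m h (ℕₚ.≤∧≢⇒< l≤m l≢m) fl gl)
...   | true  | true  = s≤s (count-strict m h (ℕₚ.≤∧≢⇒< l≤m l≢m) fl gl)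
...   | true  | false with trans (sym gm) (h fm)
...     | ()

counted : ∀ (f : ℕ → Bool) m → Σ (List ℕ) λ ls → Unique ls × length ls ≡ count f m ×
          All (λ l → l ℕ.< m × f l ≡ true) ls
counted f zero = [] , [] , refl , []
counted f (suc m) with f m in fm | counted f m
... | false | ls , u , e , al = ls , u , e , All.map (λ { (a , b) → ℕₚ.m≤n⇒m≤1+n a , b }) al
... | true  | ls , u , e , al = m ∷ ls , All.map (λ { (a , b) refl → ℕₚ.<-irrefl refl a }) al ∷ u , cong suc e ,
  (ℕₚ.≤-refl , fm) ∷ All.map (λ { (a , b) → ℕₚ.m≤n⇒m≤1+n a , b }) al

module _ {n : ℕ} {P : Fin n → Set} (P? : Decidable P) where

  comprehension : Subset n
  comprehension = tabulate (λ v → does (P? v))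

  ∈-comprehension⁺ : ∀ {v} → P v → v ∈ˢ comprehension
  ∈-comprehension⁺ {v} Pv = lookup⇒[]= v comprehension (trans (lookup∘tabulate _ v) (dec-true (P? v) Pv))

  ∈-comprehension⁻ : ∀ {v} → v ∈ˢ comprehension → P v
  ∈-comprehension⁻ {v} m with P? v | trans (sym (lookup∘tabulate (λ v → does (P? v)) v)) ([]=⇒lookup m)
  ... | yes Pv | _ = Pv
  ... | no _   | ()

∉-∖ : ∀ {n} (p : Subset n) x → ¬ x ∈ˢ p ∖ x
∉-∖ (_ ∷ p) Fin.zero    ()
∉-∖ (_ ∷ p) (Fin.suc x) (there m) = ∉-∖ p x m

∖-≢ : ∀ {n} {p : Subset n} {x y} → x ∈ˢ p ∖ y → x ≢ y
∖-≢ {p = p} {x} m refl = ∉-∖ p x m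

module Sharing {n : ℕ} (D : Digraph n) (tr : Fin n → ℕ) where
  open Separation D using (_∼_)

  -- Outside the tree of s, u lies on a negative tree of its block with s.

  Shared : Fin n → Fin n → Set
  Shared s u = s ∼ u × tr u ≢ tr s × ∃[ u′ ] u′ ≢ u × s ∼ u′ × tr u′ ≡ tr u

  -- Among vertices near `s` outside its tree, the condition `u′ ∼ u` selects the block of `u`; the
  -- labels only serve to put the trees of this block in some order.
  Earlier : Fin n → Fin n → ℕ → Set
  Earlier s u l = l ℕ.< tr u × ∃[ u′ ] Shared s u′ × tr u′ ≡ l × u′ ∼ u

module Counting (ℝ : RealNumbers) {n : ℕ} (D : Digraph n) (c : Weight ℝ D)
                {E : Rel (Fin n) 0ℓ} {tr : Fin n → ℕ} {P : Fin n → Fin n → RealNumbers.Carrier ℝ}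
                (forest : Theory.Forest ℝ D c E tr P) (E? : Decidable₂ E)
                (E-full : ∀ {u v} → Weighted.NegativeEdge ℝ D c u v → E u v)
                (tr<n : ∀ u → tr u ℕ.< n)
                (_∼?_ : Decidable₂ (Separation._∼_ D)) (mutual? : Decidable₂ (Separation.Mutual D)) where

  open Digraph D using (Arc; Adjacent; IsStrongComponent)
  open Weighted ℝ D c
  open Theory ℝ D c
  open Forest forest
  open Separation D
  open Spanning ℝ D c forest E? E-full using (Numbering)
  open Sharing D tr

  private variable
    u v x y z : Fin n
    l l′ : ℕ

  forest-path-∼ : tr x ≡ tr y → x ∼ y →
                  Σ (Star Arc x y) λ p → AllEdges E p × (∀ {z} → z ∈ verts p → z ∼ x × z ∼ y × tr z ≡ tr x)
  forest-path-∼ xy x∼y with path xy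
  ... | p , sp , ap , _ = p , ap , λ m →
    path-∼ p sp x∼y m (start∈ p) , path-∼ p sp x∼y m (end∈ p) , label-along p ap m

  -- The tree path between two vertices outside the tree of s avoids s.

  same-tree-∼ : ∀ {s} → s ∼ x → s ∼ y → tr x ≢ tr s → tr x ≡ tr y → x ∼ y
  same-tree-∼ {x} {y} {s} sx sy x≁s xy w x≢w y≢w with toℕ s ℕ.≟ w
  ... | no s≢w = conn-sym (sx w s≢w x≢w) ◅◅ sy w s≢w y≢w
  ... | yes refl with path xy
  ...   | p , _ , ap , _ with relabel {R′ = Link} p link
    where
    link : ∀ {u v} → (u , v) ∈ edges p → Link u v
    link m with E-negative (ap m)
    ... | _ , uv , vu , _ = inj₁ uv , (uv ◅ ε) , (vu ◅ ε)
  ...     | q , e , _ = avoiding q λ m i → x≁s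
    (trans (sym (label-along p ap (subst (_ ∈_) e m))) (cong tr (toℕ-injective i)))

  -- Trees are numbered, from 1 on, separately for each block containing s.

  record TreeNumbers (s : Fin n) (ix : Fin n → ℕ) : Set where
    field
      earlier   : Fin n → ℕ → Bool
      earlier⁺  : ∀ {u l} → Earlier s u l → earlier u l ≡ true
      earlier⁻  : ∀ {u l} → l ℕ.< n → earlier u l ≡ true → Earlier s u l
      ix-shared : ∀ {u} → Shared s u → ix u ≡ suc (count (earlier u) n)
      ix-other  : ∀ {u} → ix u ≢ 0 → Shared s u

  module _ {s : Fin n} {ix : Fin n → ℕ} (numbers : TreeNumbers s ix) where
    open TreeNumbers numbers

    private
      shared-sibling : s ∼ u → s ∼ v → tr u ≢ tr s → tr u ≡ tr v → u ≢ v → Shared s u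
      shared-sibling su sv u≁s uv u≢v = su , u≁s , _ , u≢v ∘ sym , sv , sym uv

      bool-ext : ∀ {a b : Bool} → (a ≡ true → b ≡ true) → (b ≡ true → a ≡ true) → a ≡ b
      bool-ext {false} {false} f g = refl
      bool-ext {false} {true}  f g = g refl
      bool-ext {true}  {false} f g = sym (f refl)
      bool-ext {true}  {true}  f g = refl

      -- Two vertices of one tree outside the tree of `s` see the same block, by `∼-detour` through
      -- `s`; hence all vertices of the tree receive the same number.
      earlier-transport : Shared s u → Shared s v → tr u ≡ tr v → u ∼ v → ∀ {l} → l ℕ.< n →
        earlier u l ≡ true → earlier v l ≡ true
      earlier-transport {u} {v} (su , u≁s , _) (sv , _) uv u∼v l<n e with earlier⁻ l<n e
      ... | l< , u′ , sh@(su′ , _) , tl , u′∼u = earlier⁺ (subst (_ ℕ.<_) uv l< , u′ , sh , tl ,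
        ∼-detour u′∼u u∼v (∼-sym su′) sv (λ { refl → u≁s refl }))

      -- Whatever precedes the tree of `u` also precedes that of `v`, and the tree of `u` itself
      -- comes in addition. The conjunction with `l < n` restricts the comparison to labels at which
      -- `earlier⁻` is available.
      smaller : Shared s u → Shared s v → u ∼ v → tr u ℕ.< tr v → ix u ≢ ix v
      smaller {u} {v} shu@(su , u≁s , _) shv@(sv , _) u∼v lt e = ℕₚ.<-irrefl refl (ℕₚ.<-≤-trans
        (count-strict {f = λ l → earlier u l Data.Bool.∧ does (l ℕ.<? n)} {g = earlier v} n
          {tr u} up (tr<n u) at-u
          (earlier⁺ (lt , u , shu , refl , u∼v)))
        (ℕₚ.≤-reflexive (trans (ℕₚ.suc-injective (trans (sym (ix-shared shv)) (trans (sym e) (ix-shared shu))))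
          (count-cong n λ {l} l<n → sym (trim l l<n)))))
        where
        import Data.Bool
        open import Data.Bool.Properties using (∧-identityʳ)
        trim : ∀ l → l ℕ.< n → earlier u l Data.Bool.∧ does (l ℕ.<? n) ≡ earlier u l
        trim l l<n = trans (cong (earlier u l Data.Bool.∧_) (dec-true (l ℕ.<? n) l<n)) (∧-identityʳ _)
        split∧ : ∀ {a b} → a Data.Bool.∧ b ≡ true → a ≡ true × b ≡ true
        split∧ {true} {true} _ = refl , refl
        toLt : ∀ {l} → does (l ℕ.<? n) ≡ true → l ℕ.< n
        toLt {l} d = ℕₚ.<ᵇ⇒< l n (subst Data.Bool.T (sym d) tt)
        up : ∀ {l} → earlier u l Data.Bool.∧ does (l ℕ.<? n) ≡ true → earlier v l ≡ true
        up {l} eq with split∧ {earlier u l} eq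
        ... | eu , d with earlier⁻ (toLt d) eu
        ...   | l< , u′ , sh@(su′ , _) , tl , u′∼u = earlier⁺ (ℕₚ.<-trans l< lt , u′ , sh , tl ,
          ∼-detour u′∼u u∼v (∼-sym su′) sv (λ { refl → u≁s refl }))
        at-u : earlier u (tr u) Data.Bool.∧ does (tr u ℕ.<? n) ≡ false
        at-u with earlier u (tr u) in eq
        ... | false = refl
        ... | true  = ⊥-elim (ℕₚ.<-irrefl refl (proj₁ (earlier⁻ (tr<n u) eq)))

    numbering : Numbering _∼_ s ix
    numbering = record { same-tree = same ; single = single ; distinct = distinct }
      where
      same : s ∼ u → s ∼ v → tr u ≢ tr s → tr u ≡ tr v → ix u ≡ ix v
      same {u} {v} su sv u≁s uv with u ≟ꟳ v
      ... | yes refl = refl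
      ... | no u≢v = trans (ix-shared shu) (trans (cong suc (count-cong n λ l<n →
          bool-ext (earlier-transport shu shv uv u∼v l<n) (earlier-transport shv shu (sym uv) (∼-sym u∼v) l<n)))
          (sym (ix-shared shv)))
        where
        shu = shared-sibling su sv u≁s uv u≢v
        shv = shared-sibling sv su (λ e → u≁s (trans uv e)) (sym uv) (u≢v ∘ sym)
        u∼v = same-tree-∼ su sv u≁s uv
      single : s ∼ u → s ∼ v → tr u ≢ tr s → tr u ≡ tr v → ix u ≡ 0 → u ≡ v
      single {u} {v} su sv u≁s uv i0 with u ≟ꟳ v
      ... | yes e = e
      ... | no u≢v with trans (sym i0) (ix-shared (shared-sibling su sv u≁s uv u≢v))
      ...   | ()
      distinct : s ∼ u → s ∼ v → u ∼ v → tr u ≢ tr s → tr v ≢ tr s → ix u ≡ ix v → ix u ≢ 0 → tr u ≡ tr v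
      distinct {u} {v} su sv u∼v _ _ e i≢0 with ℕₚ.<-cmp (tr u) (tr v)
      ... | tri≈ _ eq _ = eq
      ... | tri< lt _ _ = ⊥-elim (smaller (ix-other i≢0) (ix-other (i≢0 ∘ trans e)) u∼v lt e)
      ... | tri> _ _ gt = ⊥-elim (smaller (ix-other (i≢0 ∘ trans e)) (ix-other i≢0) (∼-sym u∼v) gt (sym e))

    module _ {v : Fin n} (shv : Shared s v) where
      private
        sv : s ∼ v
        sv = proj₁ shv

        s≢v : s ≢ v
        s≢v refl = proj₁ (proj₂ shv) refl

        -- Two distinct vertices determine their common block: it consists of the vertices that
        -- share a block with each of them.
        inB? : Decidable (λ z → s ∼ z × v ∼ z)
        inB? z = (s ∼? z) ×-dec (v ∼? z)

        B S : Subset n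
        B = comprehension inB?
        S = comprehension (mutual? s)

        B⁻ : z ∈ˢ B → s ∼ z × v ∼ z
        B⁻ = ∈-comprehension⁻ inB?

        B⁺ : s ∼ z → v ∼ z → z ∈ˢ B
        B⁺ a b = ∈-comprehension⁺ inB? (a , b)

        clique : x ∈ˢ B → y ∈ˢ B → x ∼ y
        clique x∈ y∈ with B⁻ x∈ | B⁻ y∈
        ... | sx , vx | sy , vy = ∼-detour (∼-sym sx) sy (∼-sym vx) vy (s≢v ∘ sym)

        closed : x ≢ y → x ∈ˢ B → y ∈ˢ B → z ∼ x → z ∼ y → z ∈ˢ B
        closed x≢y x∈ y∈ zx zy =
          B⁺ (∼-sym (∼-detour zx (∼-sym (proj₁ (B⁻ x∈))) zy (∼-sym (proj₁ (B⁻ y∈))) (x≢y ∘ sym)))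
             (∼-sym (∼-detour zx (∼-sym (proj₂ (B⁻ x∈))) zy (∼-sym (proj₂ (B⁻ y∈))) (x≢y ∘ sym)))

        Inside : ℕ → Rel (Fin n) 0ℓ
        Inside w x y = (x ∈ˢ B × toℕ x ≢ w) × (y ∈ˢ B × toℕ y ≢ w) × Adjacent x y

        -- The connection provided by `_∼_` may wander out of `B`. Once it is made simple, each of
        -- its vertices shares a block with both ends, and two distinct ends in `B` force it into
        -- `B`.
        connected-inside : ∀ w → x ∈ˢ B → y ∈ˢ B → toℕ x ≢ w → toℕ y ≢ w → Star (Inside w) x y
        connected-inside {x} {y} w x∈ y∈ x≢w y≢w with x ≟ꟳ y
        ... | yes refl = ε
        ... | no x≢y with erase _≟ꟳ_ (clique x∈ y∈ w x≢w y≢w)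
        ...   | p , sp , _ with relabel {R′ = Link} p (λ m → proj₂ (proj₂ (edge-rel p m)))
        ...     | q , e , _ = proj₁ (relabel p λ m →
          (on (sources⊆verts p (edge-source p m)) , proj₁ (edge-rel p m)) ,
          (on (edge-target p m) , proj₁ (proj₂ (edge-rel p m))) , proj₁ (proj₂ (proj₂ (edge-rel p m))))
          where
          on : ∀ {z} → z ∈ verts p → z ∈ˢ B
          on m = closed x≢y x∈ y∈ (z∼ (start∈ q)) (z∼ (end∈ q))
            where
            z∼ : ∀ {x} → x ∈ verts q → _ ∼ x
            z∼ = link-path-∼ q (subst Unique (sym e) sp) (clique x∈ y∈) (subst (_ ∈_) (sym e) m)

        nonseparable : Nonseparable Adjacent B
        nonseparable = (s , B⁺ ∼-refl (∼-sym sv)) ,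
          (λ x∈ y∈ → map (λ { ((a , _) , (b , _) , adj) → a , b , adj })
            (connected-inside n x∈ y∈ (ℕₚ.<⇒≢ (toℕ<n _)) (ℕₚ.<⇒≢ (toℕ<n _)))) ,
          λ {w} _ x∈ y∈ → map (λ { ((a , a≢) , (b , b≢) , adj) →
              x∈p∧x≢y⇒x∈p-y a (a≢ ∘ cong toℕ) , x∈p∧x≢y⇒x∈p-y b (b≢ ∘ cong toℕ) , adj })
            (connected-inside (toℕ w) (p─q⊆p B _ x∈) (p─q⊆p B _ y∈) (∖-≢ x∈ ∘ toℕ-injective)
              (∖-≢ y∈ ∘ toℕ-injective))

        isBlock : IsBlock Adjacent S B
        isBlock = (λ x∈ → ∈-comprehension⁺ (mutual? s) (∼⇒mutual (proj₁ (B⁻ x∈)))) , nonseparable , maximal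
          where
          -- In a larger nonseparable set every vertex stays connected to `s` and to `v` after any
          -- removal, inside or outside the set, and thus already belongs to `B`.
          maximal : ∀ {B′} → B ⊆ B′ → B′ ⊆ S → Nonseparable Adjacent B′ → B′ ⊆ B
          maximal {B′} B⊆B′ B′⊆S (_ , conn , conn∖) {x} x∈ = B⁺ (to sB) (to vB)
            where
            sB : s ∈ˢ B′
            sB = B⊆B′ (B⁺ ∼-refl (∼-sym sv))
            vB : v ∈ˢ B′
            vB = B⊆B′ (B⁺ sv ∼-refl)
            link : ∀ {x y} → x ∈ˢ B′ → y ∈ˢ B′ → Adjacent x y → Link x y
            link a b adj = adj , mutual-trans (mutual-sym (∈-comprehension⁻ (mutual? s) (B′⊆S a)))
                                              (∈-comprehension⁻ (mutual? s) (B′⊆S b))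
            to : ∀ {y} → y ∈ˢ B′ → y ∼ x
            to {y} y∈ w y≢w x≢w with anyꟳ? (λ z → (z ∈ˢ? B′) ×-dec (toℕ z ℕ.≟ w))
            ... | no ∄ = map (λ { (a , b , adj) → (λ e → ∄ (_ , a , e)) , (λ e → ∄ (_ , b , e)) ,
              link a b adj }) (conn y∈ x∈)
            ... | yes (z , z∈ , refl) = map (λ { (a , b , adj) → (∖-≢ a ∘ toℕ-injective) ,
              (∖-≢ b ∘ toℕ-injective) ,
                link (p─q⊆p B′ _ a) (p─q⊆p B′ _ b) adj })
              (conn∖ z∈ (x∈p∧x≢y⇒x∈p-y y∈ (y≢w ∘ cong toℕ)) (x∈p∧x≢y⇒x∈p-y x∈ (x≢w ∘ cong toℕ)))

        isStrongComponent : IsStrongComponent S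
        isStrongComponent = (s , ∈-comprehension⁺ (mutual? s) (ε , ε)) , λ u∈ v → mk⇔
          (λ v∈ → mutual-trans (mutual-sym (∈-comprehension⁻ (mutual? s) u∈)) (∈-comprehension⁻ (mutual? s) v∈))
          (λ m → ∈-comprehension⁺ (mutual? s) (mutual-trans (∈-comprehension⁻ (mutual? s) u∈) m))

        inY? : ∀ l → Decidable (λ z → z ∈ˢ B × tr z ≡ l)
        inY? l z = (z ∈ˢ? B) ×-dec (tr z ℕ.≟ l)

        Y : ℕ → Subset n
        Y l = comprehension (inY? l)

        Active : ℕ → Set
        Active l = ∃[ u ] Shared s u × tr u ≡ l × u ∼ v

        active∈ : ((u , _) : Active l) → u ∈ˢ Y l
        active∈ {l} (u , sh , ul , uv) = ∈-comprehension⁺ (inY? l) (B⁺ (proj₁ sh) (∼-sym uv) , ul)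

        -- A tree path between two vertices of a block stays in the block. So a tree of the whole
        -- digraph meets `B` in one connected set, and labels can be counted in place of the
        -- negative trees of `B`.
        walk-inside : x ∈ˢ Y l → y ∈ˢ Y l → Star (NegativeEdge ∣ B) x y
        walk-inside {x} {l} {y} x∈ y∈ with ∈-comprehension⁻ (inY? l) x∈ | ∈-comprehension⁻ (inY? l) y∈ | x ≟ꟳ y
        ... | _ | _ | yes refl = ε
        ... | xB , xl | yB , yl | no x≢y with forest-path-∼ (trans xl (sym yl)) (clique xB yB)
        ...   | p , ap , near = proj₁ (relabel p λ m →
          on (sources⊆verts p (edge-source p m)) , on (edge-target p m) , E-negative (ap m))
          where
          on : ∀ {z} → z ∈ verts p → z ∈ˢ B
          on m with near m
          ... | zx , zy , _ = closed x≢y xB yB zx zy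

        walk-label : Star (NegativeEdge ∣ B) x y → x ∈ˢ Y l → y ∈ˢ Y l
        walk-label ε x∈ = x∈
        walk-label {l = l} ((_ , b , e) ◅ p) x∈ = walk-label p (∈-comprehension⁺ (inY? l)
          (b , trans (sym (E-label (E-full e))) (proj₂ (∈-comprehension⁻ (inY? l) x∈))))

        -- The second vertex `u′` recorded in `Shared` supplies the edge that a negative tree must
        -- have; it lies in the same block as `u`.
        isNegativeTree : Active l → IsNegativeTree B (Y l)
        isNegativeTree {l} act@(u , sh@(su , u≁s , u′ , u′≢u , su′ , u′u) , ul , uv) =
          ((u , active∈ act) , (λ z∈ → proj₁ (∈-comprehension⁻ (inY? l) z∈)) ,
            λ x∈ y → mk⇔ (walk-inside x∈) (λ p → walk-label p x∈)) ,
          first (walk-inside (active∈ act) u′∈) (u′≢u ∘ sym) (active∈ act)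
          where
          u′∈ : u′ ∈ˢ Y l
          u′∈ = ∈-comprehension⁺ (inY? l) (B⁺ su′ (∼-sym (∼-detour
            (same-tree-∼ su′ su (λ e → u≁s (trans (sym u′u) e)) u′u) uv (∼-sym su′) sv
              (λ { refl → u≁s refl }))) , trans u′u ul)
          first : ∀ {x y} → Star (NegativeEdge ∣ B) x y → x ≢ y → x ∈ˢ Y l →
            ∃[ a ] ∃[ b ] (NegativeEdge ∣ Y l) a b
          first ε x≢y x∈ = ⊥-elim (x≢y refl)
          first (e@(_ , _ , ne) ◅ _) x≢y x∈ = _ , _ , x∈ , walk-label (e ◅ ε) x∈ , ne

        Y-injective : Active l → Y l ≡ Y l′ → l ≡ l′
        Y-injective {l} {l′} act@(_ , _ , ul , _) e =
          trans (sym ul) (proj₂ (∈-comprehension⁻ (inY? l′) (subst (_ ∈ˢ_) e (active∈ act))))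

        trees-unique : ∀ ls → All Active ls → Unique ls → Unique (List.map Y ls)
        trees-unique [] [] [] = []
        trees-unique (l ∷ ls) (a ∷ al) (l∉ ∷ u) =
          Allₚ.map⁺ (All.map (λ l≢ e → l≢ (Y-injective a e)) l∉) ∷ trees-unique ls al u

      -- The labels counted in `ix v`, together with the label of `v`, yield that many different
      -- negative trees of the block through `s` and `v`, which is a block of a strong component as
      -- the hypothesis requires.
      number-bound : ∀ {k} → BlocksHaveAtMost k NegativeTrees → ix v ℕ.≤ k
      number-bound {k} bounded with counted (earlier v) n
      ... | ls , u , eq , al = subst (ℕ._≤ k)
        (trans (length-map Y (tr v ∷ ls)) (trans (cong suc eq) (sym (ix-shared shv))))
        (bounded S isStrongComponent B isBlock (List.map Y (tr v ∷ ls))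
          (trees-unique (tr v ∷ ls) active (All.map
            (λ { (l< , e) refl → ℕₚ.<-irrefl refl (proj₁ (earlier⁻ l< e)) }) al ∷ u))
          (Allₚ.map⁺ (All.map isNegativeTree active)))
        where
        active : All Active (tr v ∷ ls)
        active = (v , shv , refl , ∼-refl) ∷ All.map (λ { (l< , e) → proj₂ (earlier⁻ l< e) }) al

-- Total correctness and running time of programs

module Programs where
  open import Data.Bool using (Bool; true; false; T; not; _∧_; _∨_; if_then_else_)
  open import Data.Empty using (⊥-elim)
  open import Data.Fin using (Fin; toℕ; fromℕ<)
  open import Data.Fin.Properties using (toℕ<n; toℕ-fromℕ<; toℕ-injective)
  open import Data.List using (List; []; _∷_; _++_)
  open import Data.Nat using (ℕ; zero; suc; _+_; _*_; _^_; _≤_; _<_; s≤s; _≡ᵇ_; _<ᵇ_)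
  open import Data.Nat.Properties
  open import Data.Product using (_×_; _,_; proj₁; proj₂)
  open import Data.Sum using (_⊎_; inj₁; inj₂)
  open import Data.Unit using (tt)
  open import Relation.Binary.PropositionalEquality using (_≡_; _≢_; refl; sym; trans; cong; subst)
  open import Relation.Nullary using (¬_; yes; no)

  scalar : ℕ → NExp
  scalar x = x [ litᴺ 0 , litᴺ 0 ]ᴺ

  FOR : ℕ → ℕ → Program → Program
  FOR x b p = (x [ litᴺ 0 , litᴺ 0 ]≔ᴺ litᴺ 0) ⨾
              (while (scalar x <ᴺ scalar b) loop (p ⨾ (x [ litᴺ 0 , litᴺ 0 ]≔ᴺ scalar x +ᴺ litᴺ 1)))

  WHEN : BExp → Program → Program
  WHEN b p = ifᴾ b then p else skip

  -- The cost of a program when every loop body is executed at most once.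

  κ : Program → ℕ
  κ skip                    = 1
  κ (a [ i , j ]≔ᴺ e)       = suc (costᴺ i + costᴺ j + costᴺ e)
  κ (a [ i , j ]≔ᵂ e)       = suc (costᴺ i + costᴺ j + costᵂ e)
  κ (p ⨾ q)                 = κ p + κ q
  κ (ifᴾ b then p else q)   = suc (costᴮ b + (κ p + κ q))
  κ (while b loop p)        = suc (costᴮ b) + κ p

  elem : ℕ → List ℕ → Bool
  elem a []       = false
  elem a (x ∷ xs) = (x ≡ᵇ a) ∨ elem a xs

  writesᴺ writesᵂ : Program → List ℕ
  writesᴺ skip                  = []
  writesᴺ (a [ _ , _ ]≔ᴺ _)     = a ∷ []
  writesᴺ (a [ _ , _ ]≔ᵂ _)     = []
  writesᴺ (p ⨾ q)               = writesᴺ p ++ writesᴺ q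
  writesᴺ (ifᴾ _ then p else q) = writesᴺ p ++ writesᴺ q
  writesᴺ (while _ loop p)      = writesᴺ p
  writesᵂ skip                  = []
  writesᵂ (a [ _ , _ ]≔ᴺ _)     = []
  writesᵂ (a [ _ , _ ]≔ᵂ _)     = a ∷ []
  writesᵂ (p ⨾ q)               = writesᵂ p ++ writesᵂ q
  writesᵂ (ifᴾ _ then p else q) = writesᵂ p ++ writesᵂ q
  writesᵂ (while _ loop p)      = writesᵂ p

  -- A Boolean equation, which `refl` proves by evaluation for a concrete array and program.
  _∉ᵇ_ : ℕ → List ℕ → Set
  a ∉ᵇ xs = elem a xs ≡ false

  ∨-false : ∀ {a b} → a ∨ b ≡ false → a ≡ false × b ≡ false
  ∨-false {false} {false} _ = refl , refl

  false-∨ : ∀ {a b} → a ≡ false → b ≡ false → a ∨ b ≡ false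
  false-∨ refl refl = refl

  ∉ᵇ-++ : ∀ {a} xs {ys} → a ∉ᵇ (xs ++ ys) → a ∉ᵇ xs × a ∉ᵇ ys
  ∉ᵇ-++ []           h = refl , h
  ∉ᵇ-++ {a} (x ∷ xs) h with ∨-false {x ≡ᵇ a} h
  ... | h₁ , h₂ with ∉ᵇ-++ {a} xs h₂
  ...   | h₃ , h₄ = false-∨ h₁ h₃ , h₄

  ∉ᵇ-++⁺ : ∀ {a} xs {ys} → a ∉ᵇ xs → a ∉ᵇ ys → a ∉ᵇ (xs ++ ys)
  ∉ᵇ-++⁺ []           h h′ = h′
  ∉ᵇ-++⁺ {a} (x ∷ xs) h h′ with ∨-false {x ≡ᵇ a} h
  ... | h₁ , h₂ = false-∨ h₁ (∉ᵇ-++⁺ {a} xs h₂ h′)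

  avoids : List ℕ → List ℕ → Bool
  avoids []       ys = true
  avoids (x ∷ xs) ys = not (elem x ys) ∧ avoids xs ys

  avoids⇒∉ᵇ : ∀ xs {ys a} → avoids xs ys ≡ true → elem a xs ≡ true → a ∉ᵇ ys
  avoids⇒∉ᵇ (x ∷ xs) {ys} {a} h e with elem x ys in ex | x ≡ᵇ a in xa
  ... | false | true  = subst (_∉ᵇ ys) (≡ᵇ⇒≡ x a (subst T (sym xa) tt)) ex
  ... | false | false = avoids⇒∉ᵇ xs h e

  ≡ᵇ-refl : ∀ m → (m ≡ᵇ m) ≡ true
  ≡ᵇ-refl zero    = refl
  ≡ᵇ-refl (suc m) = ≡ᵇ-refl m

  ≡ᵇ-false : ∀ {m k} → m ≢ k → (m ≡ᵇ k) ≡ false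
  ≡ᵇ-false {m} {k} m≢k with m ≡ᵇ k in e
  ... | false = refl
  ... | true  = ⊥-elim (m≢k (≡ᵇ⇒≡ m k (subst T (sym e) tt)))

  write-hit : ∀ {X : Set} (m : Memory X) a i j (x : X) → write m a i j x a i j ≡ x
  write-hit m a i j x rewrite ≡ᵇ-refl a | ≡ᵇ-refl i | ≡ᵇ-refl j = refl

  write-cases : ∀ {X : Set} (m : Memory X) a i j (x : X) i′ j′ →
                (i′ ≡ i × j′ ≡ j × write m a i j x a i′ j′ ≡ x) ⊎
                (¬ (i′ ≡ i × j′ ≡ j) × write m a i j x a i′ j′ ≡ m a i′ j′)
  write-cases m a i j x i′ j′ with i ≟ i′ | j ≟ j′
  ... | yes refl | yes refl = inj₁ (refl , refl , write-hit m a i j x)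
  ... | no i≢    | _        rewrite ≡ᵇ-refl a | ≡ᵇ-false i≢ = inj₂ ((λ { (e , _) → i≢ (sym e) }) , refl)
  ... | yes refl | no j≢    rewrite ≡ᵇ-refl a | ≡ᵇ-refl i | ≡ᵇ-false j≢ =
    inj₂ ((λ { (_ , e) → j≢ (sym e) }) , refl)

  write-other : ∀ {X : Set} (m : Memory X) a i j (x : X) a′ → (a ≡ᵇ a′) ≡ false → write m a i j x a′ ≡ m a′
  write-other m a i j x a′ h =
    cong (λ b i′ j′ → if b ∧ (i ≡ᵇ i′) ∧ (j ≡ᵇ j′) then x else m a′ i′ j′) h

  -- Bounds of the form (2^(k+1))^i (n+2)^j; the slack absorbs the extra
  -- evaluation of the condition of each loop.

  Exponents : Set
  Exponents = ℕ × ℕ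

  infix 4 _⊑ᵉ_
  _⊑ᵉ_ : Exponents → Exponents → Set
  (i , j) ⊑ᵉ (i′ , j′) = T ((i <ᵇ suc i′) ∧ (j <ᵇ suc j′))

  module Execution (ℝ : RealNumbers) (n : ℕ) (Good : ℕ → Set) where

    open State public using (nat; wt)

    private
      St = State ℝ

    bound : Exponents → ℕ → ℕ
    bound (i , j) k = (2 ^ suc k) ^ i * (2 + n) ^ j

    bound≥1 : ∀ e k → 1 ≤ bound e k
    bound≥1 (i , j) k = *-mono-≤ {1} {_} {1} (m^n>0 (2 ^ suc k) {{m^n≢0 2 (suc k)}} i) (m^n>0 (2 + n) j)

    bound-mono : ∀ e e′ → e ⊑ᵉ e′ → ∀ k → bound e k ≤ bound e′ k
    bound-mono (i , j) (i′ , j′) h k with i <ᵇ suc i′ in ei | j <ᵇ suc j′ in ej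
    ... | true | true = *-mono-≤
      (^-monoʳ-≤ (2 ^ suc k) {{m^n≢0 2 (suc k)}} (≤-pred (<ᵇ⇒< i (suc i′) (subst T (sym ei) tt))))
      (^-monoʳ-≤ (2 + n) (≤-pred (<ᵇ⇒< j (suc j′) (subst T (sym ej) tt))))

    record Frame (p : Program) (σ σ′ : St) : Set where
      constructor frame
      field
        keepᴺ : ∀ a → a ∉ᵇ writesᴺ p → nat σ′ a ≡ nat σ a
        keepᵂ : ∀ a → a ∉ᵇ writesᵂ p → wt σ′ a ≡ wt σ a
    open Frame public

    frame-refl : ∀ {p σ} → Frame p σ σ
    frame-refl = frame (λ _ _ → refl) (λ _ _ → refl)

    frame-trans : ∀ {p σ σ′ σ″} → Frame p σ σ′ → Frame p σ′ σ″ → Frame p σ σ″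
    frame-trans f g = frame (λ a h → trans (keepᴺ g a h) (keepᴺ f a h))
      (λ a h → trans (keepᵂ g a h) (keepᵂ f a h))

    frame-weaken : ∀ {p q σ σ′} → (∀ {a} → a ∉ᵇ writesᴺ q → a ∉ᵇ writesᴺ p) →
                   (∀ {a} → a ∉ᵇ writesᵂ q → a ∉ᵇ writesᵂ p) → Frame p σ σ′ → Frame q σ σ′
    frame-weaken f g fr = frame (λ a h → keepᴺ fr a (f h)) (λ a h → keepᵂ fr a (g h))

    frame-left : ∀ {p q σ σ′} → Frame p σ σ′ → Frame (p ⨾ q) σ σ′
    frame-left {p} {q} = frame-weaken (λ h → proj₁ (∉ᵇ-++ (writesᴺ p) h)) (λ h → proj₁ (∉ᵇ-++ (writesᵂ p) h))

    frame-right : ∀ {p q σ σ′} → Frame q σ σ′ → Frame (p ⨾ q) σ σ′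
    frame-right {p} {q} = frame-weaken (λ h → proj₂ (∉ᵇ-++ (writesᴺ p) h)) (λ h → proj₂ (∉ᵇ-++ (writesᵂ p) h))

    -- What a program leaves alone is read off its text, so specifications need to mention only what
    -- it changes.
    run-frame : ∀ {p σ σ′ t} → Run ℝ p σ σ′ t → Frame p σ σ′
    run-frame run-skip = frame-refl
    run-frame (run-nat {σ} {a} {i} {j} {x}) =
      frame (λ a′ h → write-other (nat σ) a (evalᴺ ℝ σ i) (evalᴺ ℝ σ j) (evalᴺ ℝ σ x) a′
        (proj₁ (∨-false h))) (λ _ _ → refl)
    run-frame (run-wt {σ} {a} {i} {j} {x}) = frame (λ _ _ → refl)
      (λ a′ h → write-other (wt σ) a (evalᴺ ℝ σ i) (evalᴺ ℝ σ j) (evalᵂ ℝ σ x) a′ (proj₁ (∨-false h)))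
    run-frame (run-seq {p} {q} r s) = frame-trans (frame-left {p} {q} (run-frame r))
      (frame-right {p} {q} (run-frame s))
    run-frame (run-then {b} {p} {q} _ r) = frame-weaken (λ h → proj₁ (∉ᵇ-++ (writesᴺ p) h))
      (λ h → proj₁ (∉ᵇ-++ (writesᵂ p) h)) (run-frame r)
    run-frame (run-else {b} {p} {q} _ r) = frame-weaken (λ h → proj₂ (∉ᵇ-++ (writesᴺ p) h))
      (λ h → proj₂ (∉ᵇ-++ (writesᵂ p) h)) (run-frame r)
    run-frame (run-exit _) = frame-refl
    run-frame (run-loop {b} {p} _ r s) = frame-trans
      (frame-weaken {p} (λ h → h) (λ h → h) (run-frame r)) (run-frame s)

    -- The run comes before the quantifier over `k`: one execution is bounded by every good `k` at
    -- once. `Good` is later the hypothesis on the blocks, which the program itself cannot consult.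
    record Exec (p : Program) (σ : St) (e : Exponents) (Q : St → Set) : Set where
      constructor exec
      field
        {final} : St
        {time}  : ℕ
        run     : Run ℝ p σ final time
        timely  : ∀ k → Good k → time ≤ κ p * bound e k
        post    : Q final
    open Exec public

    private variable
      σ : St
      p q : Program
      e e′ : Exponents
      Q R : St → Set

    consequence : (∀ {σ′} → Frame p σ σ′ → Q σ′ → R σ′) → Exec p σ e Q → Exec p σ e R
    consequence f (exec r t q) = exec r t (f (run-frame r) q)

    slower : e ⊑ᵉ e′ → Exec p σ e Q → Exec p σ e′ Q
    slower {e} {e′} {p} le (exec r t q) =
      exec r (λ k g → ≤-trans (t k g) (*-monoʳ-≤ (κ p) (bound-mono e e′ le k))) q

    private
      within : ∀ c e k → c ≤ c * bound e k
      within c e k = ≤-trans (≤-reflexive (sym (*-identityʳ c))) (*-monoʳ-≤ c (bound≥1 e k))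

    exec-skip : Q σ → Exec skip σ e Q
    exec-skip {e = e} q = exec run-skip (λ k _ → within 1 e k) q

    exec-nat : ∀ {a i j x} → Q ⟨ write (nat σ) a (evalᴺ ℝ σ i) (evalᴺ ℝ σ j) (evalᴺ ℝ σ x) , wt σ ⟩ →
               Exec (a [ i , j ]≔ᴺ x) σ e Q
    exec-nat {e = e} {a} {i} {j} {x} q = exec run-nat (λ k _ → within (κ (a [ i , j ]≔ᴺ x)) e k) q

    exec-wt : ∀ {a i j x} → Q ⟨ nat σ , write (wt σ) a (evalᴺ ℝ σ i) (evalᴺ ℝ σ j) (evalᵂ ℝ σ x) ⟩ →
              Exec (a [ i , j ]≔ᵂ x) σ e Q
    exec-wt {e = e} {a} {i} {j} {x} q = exec run-wt (λ k _ → within (κ (a [ i , j ]≔ᵂ x)) e k) q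

    infixr 1 _then-do_
    _then-do_ : Exec p σ e Q → (∀ {σ′} → Frame p σ σ′ → Q σ′ → Exec q σ′ e R) → Exec (p ⨾ q) σ e R
    _then-do_ {p = p} {e = e} {q = q} (exec r t pq) f with f (run-frame r) pq
    ... | exec r′ t′ qq = exec (run-seq r r′)
      (λ k g → ≤-trans (+-mono-≤ (t k g) (t′ k g)) (≤-reflexive (sym (*-distribʳ-+ (bound e k) (κ p) (κ q))))) qq

    ⟦_⟧ : BExp → St → Set
    ⟦ x <ᴺ y ⟧ σ  = evalᴺ ℝ σ x < evalᴺ ℝ σ y
    ⟦ x ≡ᴺ y ⟧ σ  = evalᴺ ℝ σ x ≡ evalᴺ ℝ σ y
    ⟦ x <ᵂ y ⟧ σ  = RealNumbers._<_ ℝ (evalᵂ ℝ σ x) (evalᵂ ℝ σ y)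
    ⟦ neg b ⟧ σ   = ¬ ⟦ b ⟧ σ
    ⟦ b and d ⟧ σ = ⟦ b ⟧ σ × ⟦ d ⟧ σ

    holds : ∀ b σ → evalᴮ ℝ σ b ≡ true → ⟦ b ⟧ σ
    fails : ∀ b σ → evalᴮ ℝ σ b ≡ false → ¬ ⟦ b ⟧ σ
    holds (x <ᴺ y) σ h = <ᵇ⇒< _ _ (subst T (sym h) tt)
    holds (x ≡ᴺ y) σ h = ≡ᵇ⇒≡ _ _ (subst T (sym h) tt)
    holds (x <ᵂ y) σ h with RealNumbers._≤?_ ℝ (evalᵂ ℝ σ y) (evalᵂ ℝ σ x)
    ... | no ¬le = ¬le
    holds (neg b) σ h with evalᴮ ℝ σ b in eq
    ... | false = fails b σ eq
    holds (b and d) σ h with evalᴮ ℝ σ b in eq | evalᴮ ℝ σ d in eq′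
    ... | true | true = holds b σ eq , holds d σ eq′
    fails (x <ᴺ y) σ h lt = subst T h (<⇒<ᵇ lt)
    fails (x ≡ᴺ y) σ h e = subst T h (≡⇒≡ᵇ _ _ e)
    fails (x <ᵂ y) σ h lt with RealNumbers._≤?_ ℝ (evalᵂ ℝ σ y) (evalᵂ ℝ σ x)
    ... | yes le = lt le
    fails (neg b) σ h nb with evalᴮ ℝ σ b in eq
    ... | true = nb (holds b σ eq)
    fails (b and d) σ h (x , y) with evalᴮ ℝ σ b in eq | evalᴮ ℝ σ d in eq′
    ... | false | _     = fails b σ eq x
    ... | true  | false = fails d σ eq′ y

    branch : ∀ {b} → (⟦ b ⟧ σ → Exec p σ e Q) → (¬ ⟦ b ⟧ σ → Exec q σ e Q) → Exec (ifᴾ b then p else q) σ e Q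
    branch {σ = σ} {p = p} {e = e} {q = q} {b = b} f g with evalᴮ ℝ σ b in eq
    ... | true with f (holds b σ eq)
    ...   | exec r t qq = exec (run-then eq r) (λ k gd → ≤-trans
          (s≤s (+-mono-≤ (within (costᴮ b) e k) (t k gd))) (≤-trans
          (+-mono-≤ (bound≥1 e k) (+-monoʳ-≤ (costᴮ b * bound e k) (*-monoˡ-≤ (bound e k) (m≤m+n (κ p) (κ q)))))
          (≤-reflexive (cong (bound e k +_) (sym (*-distribʳ-+ (bound e k) (costᴮ b) _)))))) qq
    branch {σ = σ} {p = p} {e = e} {q = q} {b = b} f g | false with g (fails b σ eq)
    ... | exec r t qq = exec (run-else eq r) (λ k gd → ≤-trans
          (s≤s (+-mono-≤ (within (costᴮ b) e k) (t k gd))) (≤-trans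
          (+-mono-≤ (bound≥1 e k) (+-monoʳ-≤ (costᴮ b * bound e k) (*-monoˡ-≤ (bound e k) (m≤n+m (κ q) (κ p)))))
          (≤-reflexive (cong (bound e k +_) (sym (*-distribʳ-+ (bound e k) (costᴮ b) _)))))) qq

    when : ∀ {b} → (⟦ b ⟧ σ → Exec p σ e Q) → (¬ ⟦ b ⟧ σ → Q σ) → Exec (WHEN b p) σ e Q
    when f g = branch f (λ h → exec-skip (g h))

    set : St → ℕ → ℕ → St
    set σ x v = ⟨ write (nat σ) x 0 0 v , wt σ ⟩

    data Fits (N : ℕ) : Exponents → Exponents → Set where
      polynomial  : ∀ {i j} → N ≤ suc n → Fits N (i , j) (i , suc j)
      exponential : ∀ {i j} → (∀ k → Good k → N ≤ 2 ^ k) → Fits N (i , j) (suc i , j)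

    private
      fits : ∀ {N e e′} → Fits N e e′ → ∀ k → Good k → suc N * bound e k ≤ bound e′ k
      fits {N} (polynomial {i} {j} le) k g = ≤-trans (*-monoˡ-≤ (bound (i , j) k) (s≤s le))
        (≤-reflexive (trans (sym (*-assoc (2 + n) (A ^ i) _))
          (trans (cong (_* (2 + n) ^ j) (*-comm (2 + n) (A ^ i))) (*-assoc (A ^ i) (2 + n) _))))
        where A = 2 ^ suc k
      fits {N} (exponential {i} {j} le) k g = ≤-trans (*-monoˡ-≤ (bound (i , j) k) suc≤)
        (≤-reflexive (sym (*-assoc (2 ^ suc k) _ _)))
        where
        suc≤ : suc N ≤ 2 ^ suc k
        suc≤ = ≤-trans (+-mono-≤ (m^n>0 2 k) (le k g)) (≤-reflexive (cong (2 ^ k +_) (sym (+-identityʳ _))))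

    -- For concrete programs all fields evaluate to the unit type, and `record {}` fills them in.
    record Loop (x b : ℕ) (p : Program) : Set where
      field
        {x-free} : T (not (elem x (writesᴺ p)))
        {b-free} : T (not (elem b (writesᴺ p)))
        {apart}  : T (not (x ≡ᵇ b))

    private
      not-true : ∀ {c} → T (not c) → c ≡ false
      not-true {false} _ = refl

    frame-FOR : ∀ {x b p σ σ′} → Frame p σ σ′ → Frame (FOR x b p) σ σ′
    frame-FOR {x} {b} {p} = frame-weaken
      (λ h → proj₁ (∉ᵇ-++ (writesᴺ p) (proj₂ (∨-false h)))) (λ h → proj₁ (∉ᵇ-++ (writesᵂ p) h))

    frame-set : ∀ {x b p σ v} → Frame (FOR x b p) σ (set σ x v)
    frame-set {x} {σ = σ} {v} = frame (λ a h → write-other (nat σ) x 0 0 v a (proj₁ (∨-false h))) (λ _ _ → refl)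

    bound-kept : ∀ {x b p σ σ′} → Loop x b p → Frame (FOR x b p) σ σ′ → nat σ′ b 0 0 ≡ nat σ b 0 0
    bound-kept {x} {b} {p} ok fr = cong (λ f → f 0 0) (keepᴺ fr b (false-∨ x≢b
      (∉ᵇ-++⁺ (writesᴺ p) (not-true (Loop.b-free ok)) (false-∨ x≢b refl))))
      where x≢b = not-true (Loop.apart ok)

    -- The counter is a memory cell like any other, hence the condition that `I` survives its being
    -- set.
    for-loop : ∀ {x b p σ N e e′} (I : ℕ → St → Set) → Loop x b p → Fits N e e′ → nat σ b 0 0 ≡ N →
               (∀ {i σ v} → I i σ → I i (set σ x v)) → I 0 σ →
               (∀ {i σ′} → i < N → Frame (FOR x b p) σ σ′ → nat σ′ x 0 0 ≡ i → I i σ′ → Exec p σ′ e (I (suc i))) →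
               Exec (FOR x b p) σ e′ (λ σ′ → I N σ′)
    for-loop {x} {b} {p} {σ₀} {N} {e} {e′} I ok fit bN stable base body =
      exec-nat {Q = _≡ set σ₀ x 0} {e = e′} {x} {litᴺ 0} {litᴺ 0} {litᴺ 0} refl then-do λ { {_} _ refl →
        finish (go N 0 (+-identityʳ N) (stable {0} base) (write-hit (nat σ₀) x 0 0 0) frame-set) }
      where
      cond : BExp
      cond = scalar x <ᴺ scalar b
      inner : Program
      inner = p ⨾ (x [ litᴺ 0 , litᴺ 0 ]≔ᴺ scalar x +ᴺ litᴺ 1)
      x∉ = not-true (Loop.x-free ok)

      record Iterate (σ : St) (m : ℕ) : Set where
        field
          {stop} : St
          {t}    : ℕ
          runs   : Run ℝ (while cond loop inner) σ stop t
          -- The final failing test is charged like a whole round; this explains the factor `suc N`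
          -- that `fits` accounts for.
          time≤  : ∀ k → Good k → t ≤ suc m * (κ (while cond loop inner) * bound e k)
          inv    : I N stop

      go : ∀ m i {σ} → m + i ≡ N → I i σ → nat σ x 0 0 ≡ i → Frame (FOR x b p) σ₀ σ → Iterate σ m
      go zero i {σ} refl Ii xi fr = record
        { runs = run-exit ff
        ; time≤ = λ k _ → ≤-trans (within (suc (costᴮ cond)) e k)
            (≤-trans (*-monoˡ-≤ (bound e k) (m≤m+n (suc (costᴮ cond)) (κ inner)))
              (≤-reflexive (sym (+-identityʳ _))))
        ; inv = Ii }
        where
        bσ : nat σ b 0 0 ≡ i
        bσ = trans (bound-kept ok fr) bN
        ff : evalᴮ ℝ σ cond ≡ false
        ff rewrite xi | bσ = not-< i
          where
          not-< : ∀ i → (i <ᵇ i) ≡ false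
          not-< zero    = refl
          not-< (suc i) = not-< i
      go (suc m) i {σ} refl Ii xi fr with body {i} {σ} (s≤s (m≤n+m i m)) fr xi Ii
      ... | exec {final = σ₁} r t≤ Ii′ = record
        { runs = run-loop tt′ (run-seq r run-nat) (Iterate.runs rest)
        ; time≤ = λ k g → arith k (t≤ k g) (Iterate.time≤ rest k g)
        ; inv = Iterate.inv rest }
        where
        fr₁ = run-frame r
        xσ₁ : nat σ₁ x 0 0 ≡ i
        xσ₁ = trans (cong (λ f → f 0 0) (keepᴺ fr₁ x x∉)) xi
        σ₂ = set σ₁ x (nat σ₁ x 0 0 + 1)
        rest : Iterate σ₂ m
        rest = go m (suc i) (+-suc m i) (stable Ii′)
          (trans (write-hit (nat σ₁) x 0 0 _) (trans (cong (_+ 1) xσ₁) (+-comm i 1)))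
          (frame-trans (frame-trans fr (frame-FOR {x} {b} {p} fr₁)) frame-set)
        bσ : nat σ b 0 0 ≡ N
        bσ = trans (bound-kept ok fr) bN
        tt′ : evalᴮ ℝ σ cond ≡ true
        tt′ rewrite xi | bσ = T⇒≡ (<⇒<ᵇ {i} {suc m + i} (s≤s (m≤n+m i m)))
          where
          T⇒≡ : ∀ {b} → T b → b ≡ true
          T⇒≡ {true} _ = refl
        arith : ∀ k {t t′} → t ≤ κ p * bound e k → t′ ≤ suc m * (κ (while cond loop inner) * bound e k) →
                suc (costᴮ cond + (t + κ (x [ litᴺ 0 , litᴺ 0 ]≔ᴺ scalar x +ᴺ litᴺ 1)) + t′) ≤
                suc (suc m) * (κ (while cond loop inner) * bound e k)
        arith k {t} {t′} h h′ = +-mono-≤ {suc (costᴮ cond + (t + _))} (≤-trans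
          (+-mono-≤ (within (suc (costᴮ cond)) e k)
            (≤-trans (+-mono-≤ h (within _ e k)) (≤-reflexive (sym (*-distribʳ-+ (bound e k) (κ p) _)))))
          (≤-reflexive (sym (*-distribʳ-+ (bound e k) (suc (costᴮ cond)) (κ inner))))) h′

      finish : ∀ {σ} → Iterate σ N → Exec (while cond loop inner) σ e′ (I N)
      finish it = exec (Iterate.runs it) (λ k g → ≤-trans (Iterate.time≤ it k g) (≤-trans
        (≤-reflexive (trans (sym (*-assoc (suc N) w (bound e k)))
          (trans (cong (_* bound e k) (*-comm (suc N) w)) (*-assoc w (suc N) (bound e k)))))
        (*-monoʳ-≤ w (fits fit k g)))) (Iterate.inv it)
        where w = κ (while cond loop inner)

    -- Describes what later iterations may do to the results of earlier ones. A preorder suffices,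
    -- since the facts about one iteration only have to persist along it.
    record Evolution : Set₁ where
      infix 4 _≼_
      field
        _≼_     : St → St → Set
        ≼-refl  : ∀ {σ} → σ ≼ σ
        ≼-trans : ∀ {σ σ′ σ″} → σ ≼ σ′ → σ′ ≼ σ″ → σ ≼ σ″

    module Each (evolution : Evolution) where
      open Evolution evolution

      for-each : ∀ {x b p σ N e e′} (Q : ℕ → St → Set) → Loop x b p → Fits N e e′ → nat σ b 0 0 ≡ N →
                 (∀ {σ v} → σ ≼ set σ x v) → (∀ {i σ σ′} → σ ≼ σ′ → Q i σ → Q i σ′) →
                 (∀ {i σ′} → i < N → Frame (FOR x b p) σ σ′ → nat σ′ x 0 0 ≡ i → σ ≼ σ′ →
                   Exec p σ′ e (λ σ″ → σ′ ≼ σ″ × Q i σ″)) →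
                 Exec (FOR x b p) σ e′ (λ σ′ → σ ≼ σ′ × ∀ {i} → i < N → Q i σ′)
      for-each {x} {b} {p} {σ} Q ok fit bN ≼-set persist body =
        for-loop (λ i σ′ → σ ≼ σ′ × ∀ {j} → j < i → Q j σ′) ok fit bN
          (λ { (le , h) → ≼-trans le ≼-set , λ j<i → persist ≼-set (h j<i) })
          (≼-refl , λ ())
          (λ i<N fr xi (le , h) → consequence (λ { _ (le′ , qi) → ≼-trans le le′ , step le′ h qi })
            (body i<N fr xi le))
        where
        step : ∀ {i σ′ σ″} → σ′ ≼ σ″ → (∀ {j} → j < i → Q j σ′) → Q i σ″ → ∀ {j} → j < suc i → Q j σ″
        step le h qi (s≤s j≤i) with m≤n⇒m<n∨m≡n j≤i
        ... | inj₁ j<i  = persist le (h j<i)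
        ... | inj₂ refl = qi

      for-fin : ∀ {x p σ i j} (Q : Fin n → St → Set) → Loop x 0 p → nat σ 0 0 0 ≡ n →
                (∀ {σ v} → σ ≼ set σ x v) → (∀ {u σ σ′} → σ ≼ σ′ → Q u σ → Q u σ′) →
                (∀ u {σ′} → Frame (FOR x 0 p) σ σ′ → nat σ′ x 0 0 ≡ toℕ u → σ ≼ σ′ →
                  Exec p σ′ (i , j) (λ σ″ → σ′ ≼ σ″ × Q u σ″)) →
                Exec (FOR x 0 p) σ (i , suc j) (λ σ′ → σ ≼ σ′ × ∀ u → Q u σ′)
      for-fin {x} {p} {σ} Q ok bN ≼-set persist body =
        consequence (λ { _ (le , h) → le , λ u → h (toℕ<n u) u refl })
        (for-each (λ i σ′ → ∀ u → toℕ u ≡ i → Q u σ′) ok (polynomial (n≤1+n n)) bN ≼-set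
          (λ le h u e → persist le (h u e))
          (λ {i} i<n fr xi le → consequence
            (λ { _ (le′ , q) → le′ , λ u e → subst (λ u → Q u _)
              (toℕ-injective (trans (toℕ-fromℕ< i<n) (sym e))) q })
            (body (fromℕ< i<n) fr (trans xi (sym (toℕ-fromℕ< i<n))) le)))

      for-fin₂ : ∀ {x y p σ i j} (Q : Fin n → Fin n → St → Set) → Loop x 0 (FOR y 0 p) → Loop y 0 p →
        nat σ 0 0 0 ≡ n →
                 (∀ {σ v} → σ ≼ set σ x v) → (∀ {σ v} → σ ≼ set σ y v) →
                 (∀ {u v σ σ′} → σ ≼ σ′ → Q u v σ → Q u v σ′) →
                 (∀ u v {σ′} → Frame (FOR x 0 (FOR y 0 p)) σ σ′ → nat σ′ x 0 0 ≡ toℕ u →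
                   nat σ′ y 0 0 ≡ toℕ v → σ ≼ σ′ →
                   Exec p σ′ (i , j) (λ σ″ → σ′ ≼ σ″ × Q u v σ″)) →
                 Exec (FOR x 0 (FOR y 0 p)) σ (i , suc (suc j)) (λ σ′ → σ ≼ σ′ × ∀ u v → Q u v σ′)
      for-fin₂ {x} {y} {p} Q okx oky bN ≼x ≼y persist body =
        for-fin (λ u σ → ∀ v → Q u v σ) okx bN ≼x (λ le h v → persist le (h v)) λ u fr xu le →
          for-fin (Q u) oky (trans (bound-kept okx fr) bN) ≼y persist λ v fr′ yv le′ →
            body u v (frame-trans fr (frame-FOR {x} {0} {FOR y 0 p} fr′))
              (trans (cong (λ f → f 0 0) (keepᴺ fr′ x (not-true (Loop.x-free okx)))) xu) yv (≼-trans le le′)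

    write-at : ∀ {X : Set} {m : Memory X} {a} {x : X} {i j : ℕ} {u v : Fin n} → i ≡ toℕ u → j ≡ toℕ v → ∀ u′ v′ →
               (u′ ≡ u × v′ ≡ v × write m a i j x a (toℕ u′) (toℕ v′) ≡ x) ⊎
               (¬ (u′ ≡ u × v′ ≡ v) × write m a i j x a (toℕ u′) (toℕ v′) ≡ m a (toℕ u′) (toℕ v′))
    write-at {m = m} {a} {x} {u = u} {v} refl refl u′ v′ with write-cases m a (toℕ u) (toℕ v) x (toℕ u′) (toℕ v′)
    ... | inj₁ (e , e′ , h) = inj₁ (toℕ-injective e , toℕ-injective e′ , h)
    ... | inj₂ (ne , h)     = inj₂ ((λ { (refl , refl) → ne (refl , refl) }) , h)

open Programs

-- Relaxation of partial matrices

STORE RELAX : ℕ → ℕ → NExp → NExp → WExp → Program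
STORE fin val i j e = (val [ i , j ]≔ᵂ e) ⨾ (fin [ i , j ]≔ᴺ litᴺ 1)
RELAX fin val i j e =
  ifᴾ (fin [ i , j ]ᴺ ≡ᴺ litᴺ 0) then STORE fin val i j e
  else WHEN (e <ᵂ val [ i , j ]ᵂ) (STORE fin val i j e)

module Relaxation (ℝ : RealNumbers) (n : ℕ) (Good : ℕ → Set) where
  open Execution ℝ n Good
  open OrderedField ℝ

  -- A pair of arrays holds a partial matrix of weights: an entry is present
  -- when its flag is nonzero.

  Entry : ℕ → ℕ → State ℝ → ℕ → ℕ → Carrier → Set
  Entry fin val σ i j x = nat σ fin i j ≢ 0 × wt σ val i j ≤ x

  Sound : ℕ → ℕ → (ℕ → ℕ → Carrier → Set) → State ℝ → Set
  Sound fin val P σ = ∀ {i j} → nat σ fin i j ≢ 0 → P i j (wt σ val i j)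

  -- Entries may appear and decrease but never vanish or grow, and soundness is inherited instead of
  -- asserted. In this form relaxations of the same table compose without regard to their order.
  record Improves (fin val : ℕ) (P : ℕ → ℕ → Carrier → Set) (σ σ′ : State ℝ) : Set where
    constructor improves
    field
      entries : ∀ {i j x} → Entry fin val σ i j x → Entry fin val σ′ i j x
      sound   : Sound fin val P σ → Sound fin val P σ′
  open Improves public

  improvement : ℕ → ℕ → (ℕ → ℕ → Carrier → Set) → Evolution
  improvement fin val P = record
    { _≼_ = Improves fin val P
    ; ≼-refl = improves (λ h → h) (λ h → h)
    ; ≼-trans = λ f g → improves (λ h → entries g (entries f h)) (λ h → sound g (sound f h))
    }

  improves-set : ∀ x {fin val P σ v} → (x ℕ.≡ᵇ fin) ≡ false → Improves fin val P σ (set σ x v)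
  improves-set x {fin} {val} {P} {σ} {v} h = improves
    (λ { (f , le) → subst (λ m → m _ _ ≢ 0) (sym same) f , le })
    (λ snd f → snd (subst (λ m → m _ _ ≢ 0) same f))
    where
    same : nat (set σ x v) fin ≡ nat σ fin
    same = write-other (nat σ) x 0 0 v fin h

  kept-table : ∀ fin val P {p σ σ′} → fin ∉ᵇ writesᴺ p → val ∉ᵇ writesᵂ p → Frame p σ σ′ → Improves fin val P σ σ′
  kept-table fin val P h h′ fr = improves
    (λ { {i} {j} (f , le) → subst (λ m → m i j ≢ 0) (sym (keepᴺ fr _ h)) f ,
                            subst (λ m → m i j ≤ _) (sym (keepᵂ fr _ h′)) le })
    (λ snd {i} {j} f → subst (λ m → P i j (m i j)) (sym (keepᵂ fr _ h′))
      (snd (subst (λ m → m i j ≢ 0) (keepᴺ fr _ h) f)))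

  -- `STORE` writes the weight before the flag. Index expressions read natural number arrays only,
  -- so the flag still goes to the same cell.
  evalᴺ-wt : ∀ {m w w′} e → evalᴺ ℝ ⟨ m , w ⟩ e ≡ evalᴺ ℝ ⟨ m , w′ ⟩ e
  evalᴺ-wt (litᴺ _) = refl
  evalᴺ-wt {m} {w} {w′} (a [ i , j ]ᴺ) = cong₂ (m a) (evalᴺ-wt {m} {w} {w′} i) (evalᴺ-wt {m} {w} {w′} j)
  evalᴺ-wt {m} {w} {w′} (e +ᴺ f) = cong₂ ℕ._+_ (evalᴺ-wt {m} {w} {w′} e) (evalᴺ-wt {m} {w} {w′} f)
  evalᴺ-wt {m} {w} {w′} (e ∸ᴺ f) = cong₂ ℕ._∸_ (evalᴺ-wt {m} {w} {w′} e) (evalᴺ-wt {m} {w} {w′} f)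

  module _ {fin val : ℕ} {P : ℕ → ℕ → Carrier → Set} where

    private
      store : ∀ {σ e i j x} → (nat σ fin (evalᴺ ℝ σ i) (evalᴺ ℝ σ j) ≢ 0 →
                evalᵂ ℝ σ x ≤ wt σ val (evalᴺ ℝ σ i) (evalᴺ ℝ σ j)) →
              (Sound fin val P σ → P (evalᴺ ℝ σ i) (evalᴺ ℝ σ j) (evalᵂ ℝ σ x)) →
              Exec (STORE fin val i j x) σ e
                (λ σ′ → Improves fin val P σ σ′ × Entry fin val σ′ (evalᴺ ℝ σ i) (evalᴺ ℝ σ j) (evalᵂ ℝ σ x))
      store {σ} {e} {i} {j} {x} smaller ok =
        exec-wt {Q = λ σ′ → σ′ ≡ σ₁} {e = e} {val} {i} {j} {x} refl then-do λ { _ refl →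
        exec-nat {σ = σ₁} {e = e} {fin} {i} {j} {litᴺ 1}
          (subst₂ (λ I′ J′ → Goal I′ J′) (evalᴺ-wt {nat σ} {wt σ} {wt σ₁} i) (evalᴺ-wt {nat σ} {wt σ} {wt σ₁} j)
            (improves keep snd , (λ e → one≢0 (trans (sym (write-hit (nat σ) fin I J 1)) e)) ,
             ≡⇒≤ ((write-hit (wt σ) val I J v)))) }
        where
        I J : ℕ
        I = evalᴺ ℝ σ i
        J = evalᴺ ℝ σ j
        v : Carrier
        v = evalᵂ ℝ σ x
        σ₁ : State ℝ
        σ₁ = ⟨ nat σ , write (wt σ) val I J v ⟩
        one≢0 : 1 ≢ 0
        one≢0 ()
        Goal : ℕ → ℕ → Set
        Goal I′ J′ = Improves fin val P σ σ′ × Entry fin val σ′ I J v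
          where σ′ = ⟨ write (nat σ) fin I′ J′ 1 , write (wt σ) val I J v ⟩
        keep : ∀ {i j x} → Entry fin val σ i j x →
          Entry fin val ⟨ write (nat σ) fin I J 1 , write (wt σ) val I J v ⟩ i j x
        keep {i} {j} (f , le) with write-cases (nat σ) fin I J 1 i j | write-cases (wt σ) val I J v i j
        ... | inj₁ (refl , refl , h) | inj₁ (_ , _ , h′) =
          (λ e → one≢0 (trans (sym h) e)) , ≤-trans (≡⇒≤ (h′)) (≤-trans (smaller f) le)
        ... | inj₁ (refl , refl , h) | inj₂ (ne , _) = ⊥-elim (ne (refl , refl))
        ... | inj₂ (ne , _) | inj₁ (refl , refl , _) = ⊥-elim (ne (refl , refl))
        ... | inj₂ (_ , h) | inj₂ (_ , h′) = (λ e → f (trans (sym h) e)) , ≤-trans (≡⇒≤ (h′)) le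
        snd : Sound fin val P σ → Sound fin val P ⟨ write (nat σ) fin I J 1 , write (wt σ) val I J v ⟩
        snd s {i} {j} f with write-cases (nat σ) fin I J 1 i j | write-cases (wt σ) val I J v i j
        ... | inj₁ (refl , refl , h) | inj₁ (_ , _ , h′) = subst (P I J) (sym h′) (ok s)
        ... | inj₁ (refl , refl , h) | inj₂ (ne , _) = ⊥-elim (ne (refl , refl))
        ... | inj₂ (ne , _) | inj₁ (refl , refl , _) = ⊥-elim (ne (refl , refl))
        ... | inj₂ (_ , h) | inj₂ (_ , h′) = subst (P i j) (sym h′) (s (λ e → f (trans h e)))

    relax : ∀ {σ e i j x} → (Sound fin val P σ → P (evalᴺ ℝ σ i) (evalᴺ ℝ σ j) (evalᵂ ℝ σ x)) →
            Exec (RELAX fin val i j x) σ e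
              (λ σ′ → Improves fin val P σ σ′ × Entry fin val σ′ (evalᴺ ℝ σ i) (evalᴺ ℝ σ j) (evalᵂ ℝ σ x))
    relax {σ} ok = branch
      (λ f≡0 → store (λ f≢0 → ⊥-elim (f≢0 f≡0)) ok)
      (λ f≢0 → when (λ lt → store (λ _ → <⇒≤ lt) ok) (λ ≮ → improves (λ h → h) (λ h → h) , f≢0 , ≮⇒≥ ≮))

    relax-when : ∀ {σ e b i j x} → (⟦ b ⟧ σ → Sound fin val P σ → P (evalᴺ ℝ σ i) (evalᴺ ℝ σ j) (evalᵂ ℝ σ x)) →
                 Exec (WHEN b (RELAX fin val i j x)) σ e
                   (λ σ′ → Improves fin val P σ σ′ ×
                           (⟦ b ⟧ σ → Entry fin val σ′ (evalᴺ ℝ σ i) (evalᴺ ℝ σ j) (evalᵂ ℝ σ x)))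
    relax-when ok = when (λ b → consequence (λ { _ (im , en) → im , λ _ → en }) (relax (ok b)))
                         (λ ¬b → improves (λ h → h) (λ h → h) , λ b → ⊥-elim (¬b b))

-- The algorithm

-- The arrays 0 to 3, and the weight arrays 0 and 1, have the positions fixed by the conventions for
-- input and output. The others are work space and start at zero.
sizeᴬ adjᴬ answerᴬ distFᴬ treeᴬ reachᴬ connᴬ sepᴬ bitᴬ powerᴬ indexᴬ stateFᴬ entryFᴬ crossFᴬ edgeᴬ sharedᴬ : ℕ
sizeᴬ   = 0
adjᴬ    = 1
answerᴬ = 2
distFᴬ  = 3
treeᴬ   = 4
reachᴬ  = 5
connᴬ   = 6
sepᴬ    = 7
bitᴬ    = 8
powerᴬ  = 9
indexᴬ  = 10
stateFᴬ = 11
entryFᴬ = 12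
crossFᴬ = 13
edgeᴬ   = 14
sharedᴬ = 15

arcᵂ distᵂ pathᵂ stateᵂ entryᵂ crossᵂ : ℕ
arcᵂ   = 0
distᵂ  = 1
pathᵂ  = 2
stateᵂ = 3
entryᵂ = 4
crossᵂ = 5

uᵛ vᵛ xᵛ yᵛ kᵛ iᵛ jᵛ wᵛ sᵛ rᵛ mᵛ aᵛ bᵛ tᵛ lᵛ flagᵛ bitsᵛ masksᵛ size⁺ᵛ badᵛ label₁ᵛ label₂ᵛ pᵛ qᵛ : ℕ
uᵛ      = 20
vᵛ      = 21
xᵛ      = 22
yᵛ      = 23
kᵛ      = 24
iᵛ      = 25
jᵛ      = 26
wᵛ      = 27
sᵛ      = 28
rᵛ      = 29
mᵛ      = 30
aᵛ      = 31
bᵛ      = 32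
tᵛ      = 33
lᵛ      = 34
flagᵛ   = 35
bitsᵛ   = 36
masksᵛ  = 37
size⁺ᵛ  = 38
badᵛ    = 39
label₁ᵛ = 40
label₂ᵛ = 41
pᵛ      = 42
qᵛ      = 43

infix 5 _≢ᴺ_
infixr 3 _or_

_≢ᴺ_ : NExp → NExp → BExp
e ≢ᴺ f = neg (e ≡ᴺ f)

_or_ : BExp → BExp → BExp
b or d = neg (neg b and neg d)

_⟪_⟫₁ : ℕ → ℕ → NExp
a ⟪ x ⟫₁ = a [ scalar x , litᴺ 0 ]ᴺ

_⟪_,_⟫ : ℕ → ℕ → ℕ → NExp
a ⟪ x , y ⟫ = a [ scalar x , scalar y ]ᴺ

_⟪_,_⟫ᵂ : ℕ → ℕ → ℕ → WExp
a ⟪ x , y ⟫ᵂ = a [ scalar x , scalar y ]ᵂ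

infix 3 _≔_
_≔_ : ℕ → NExp → Program
x ≔ e = x [ litᴺ 0 , litᴺ 0 ]≔ᴺ e

EACH : ℕ → Program → Program
EACH x p = FOR x sizeᴬ p

EACH₂ : ℕ → ℕ → Program → Program
EACH₂ x y p = EACH x (EACH y p)

-- Negative edges are added one at a time, as in Kruskal's algorithm; treeᴬ
-- labels the components and pathᵂ holds the weights of the tree paths.

JOIN-PATHS RELABEL MERGE LINK KRUSKAL : Program
JOIN-PATHS = EACH₂ xᵛ yᵛ
  (ifᴾ (treeᴬ ⟪ xᵛ ⟫₁ ≡ᴺ scalar label₁ᵛ and treeᴬ ⟪ yᵛ ⟫₁ ≡ᴺ scalar label₂ᵛ)
   then (pathᵂ [ scalar xᵛ , scalar yᵛ ]≔ᵂ pathᵂ ⟪ xᵛ , uᵛ ⟫ᵂ +ᵂ arcᵂ ⟪ uᵛ , vᵛ ⟫ᵂ +ᵂ pathᵂ ⟪ vᵛ , yᵛ ⟫ᵂ)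
   else WHEN (treeᴬ ⟪ xᵛ ⟫₁ ≡ᴺ scalar label₂ᵛ and treeᴬ ⟪ yᵛ ⟫₁ ≡ᴺ scalar label₁ᵛ)
          (pathᵂ [ scalar xᵛ , scalar yᵛ ]≔ᵂ pathᵂ ⟪ xᵛ , vᵛ ⟫ᵂ +ᵂ arcᵂ ⟪ vᵛ , uᵛ ⟫ᵂ +ᵂ pathᵂ ⟪ uᵛ , yᵛ ⟫ᵂ))
RELABEL = EACH xᵛ (WHEN (treeᴬ ⟪ xᵛ ⟫₁ ≡ᴺ scalar label₂ᵛ) (treeᴬ [ scalar xᵛ , litᴺ 0 ]≔ᴺ scalar label₁ᵛ))
MERGE = (label₁ᵛ ≔ treeᴬ ⟪ uᵛ ⟫₁) ⨾ (label₂ᵛ ≔ treeᴬ ⟪ vᵛ ⟫₁) ⨾ JOIN-PATHS ⨾ RELABEL ⨾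
        (edgeᴬ [ scalar uᵛ , scalar vᵛ ]≔ᴺ litᴺ 1) ⨾ (edgeᴬ [ scalar vᵛ , scalar uᵛ ]≔ᴺ litᴺ 1)
-- Every edge is met in both orders; the test of `edgeᴬ` keeps the second encounter from being taken
-- for a cycle.
LINK = WHEN (adjᴬ ⟪ uᵛ , vᵛ ⟫ ≡ᴺ litᴺ 1 and adjᴬ ⟪ vᵛ , uᵛ ⟫ ≡ᴺ litᴺ 1 and
             arcᵂ ⟪ uᵛ , vᵛ ⟫ᵂ +ᵂ arcᵂ ⟪ vᵛ , uᵛ ⟫ᵂ <ᵂ 0ᵂ and edgeᴬ ⟪ uᵛ , vᵛ ⟫ ≢ᴺ litᴺ 1)
         (ifᴾ (treeᴬ ⟪ uᵛ ⟫₁ ≡ᴺ treeᴬ ⟪ vᵛ ⟫₁) then (badᵛ ≔ litᴺ 1) else MERGE)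
KRUSKAL = EACH xᵛ (treeᴬ [ scalar xᵛ , litᴺ 0 ]≔ᴺ scalar xᵛ) ⨾ EACH₂ uᵛ vᵛ LINK

STAGE WARSHALL : Program
STAGE = EACH₂ iᵛ jᵛ (WHEN (connᴬ ⟪ iᵛ , kᵛ ⟫ ≡ᴺ litᴺ 1 and connᴬ ⟪ kᵛ , jᵛ ⟫ ≡ᴺ litᴺ 1)
                       (connᴬ [ scalar iᵛ , scalar jᵛ ]≔ᴺ litᴺ 1))
WARSHALL = EACH kᵛ STAGE

FILL : BExp → Program
FILL b = EACH₂ iᵛ jᵛ (ifᴾ b then (connᴬ [ scalar iᵛ , scalar jᵛ ]≔ᴺ litᴺ 1)
                           else (connᴬ [ scalar iᵛ , scalar jᵛ ]≔ᴺ litᴺ 0))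

arc? link? : BExp
arc? = scalar iᵛ ≡ᴺ scalar jᵛ or adjᴬ ⟪ iᵛ , jᵛ ⟫ ≡ᴺ litᴺ 1
link? = scalar iᵛ ≡ᴺ scalar jᵛ or
        (scalar iᵛ ≢ᴺ scalar wᵛ and scalar jᵛ ≢ᴺ scalar wᵛ and
         (adjᴬ ⟪ iᵛ , jᵛ ⟫ ≡ᴺ litᴺ 1 or adjᴬ ⟪ jᵛ , iᵛ ⟫ ≡ᴺ litᴺ 1) and
         reachᴬ ⟪ iᵛ , jᵛ ⟫ ≡ᴺ litᴺ 1 and reachᴬ ⟪ jᵛ , iᵛ ⟫ ≡ᴺ litᴺ 1)

-- sepᴬ is 0 at pairs in a common block, w + 1 at pairs separated by w in their
-- strong component, and n + 1 at pairs in different strong components.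

REACH COPY SEPARATE SEPARATORS : Program
COPY = EACH₂ iᵛ jᵛ (reachᴬ [ scalar iᵛ , scalar jᵛ ]≔ᴺ connᴬ ⟪ iᵛ , jᵛ ⟫)
REACH = FILL arc? ⨾ WARSHALL ⨾ COPY
SEPARATE = EACH₂ iᵛ jᵛ
  (WHEN (scalar iᵛ ≢ᴺ scalar wᵛ and scalar jᵛ ≢ᴺ scalar wᵛ and connᴬ ⟪ iᵛ , jᵛ ⟫ ≢ᴺ litᴺ 1)
     (sepᴬ [ scalar iᵛ , scalar jᵛ ]≔ᴺ scalar wᵛ +ᴺ litᴺ 1))
-- The loop includes `w = n`, which removes no vertex. As it comes last, it leaves `n + 1` at the
-- pairs in different strong components, whatever earlier rounds have written.
SEPARATORS = FOR wᵛ size⁺ᵛ (FILL link? ⨾ WARSHALL ⨾ SEPARATE)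

-- The trees sharing a block with s are numbered separately for each block.

local : ℕ → BExp
local x = sepᴬ ⟪ sᵛ , x ⟫ ≡ᴺ litᴺ 0 and treeᴬ ⟪ x ⟫₁ ≢ᴺ treeᴬ ⟪ sᵛ ⟫₁

EXISTS : ℕ → BExp → Program
EXISTS x b = (flagᵛ ≔ litᴺ 0) ⨾ EACH x (WHEN b (flagᵛ ≔ litᴺ 1))

SHARED COUNT INDEX MAXIMUM NUMBER : Program
SHARED = EACH vᵛ (EXISTS uᵛ (local vᵛ and local uᵛ and scalar uᵛ ≢ᴺ scalar vᵛ and
                             treeᴬ ⟪ uᵛ ⟫₁ ≡ᴺ treeᴬ ⟪ vᵛ ⟫₁) ⨾
                  (sharedᴬ [ scalar vᵛ , litᴺ 0 ]≔ᴺ scalar flagᵛ))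
COUNT = EACH lᵛ (EXISTS uᵛ (sharedᴬ ⟪ uᵛ ⟫₁ ≡ᴺ litᴺ 1 and treeᴬ ⟪ uᵛ ⟫₁ ≡ᴺ scalar lᵛ and
                            sepᴬ ⟪ uᵛ , vᵛ ⟫ ≡ᴺ litᴺ 0) ⨾
                 WHEN (scalar flagᵛ ≡ᴺ litᴺ 1 and scalar lᵛ <ᴺ treeᴬ ⟪ vᵛ ⟫₁)
                   (indexᴬ [ scalar vᵛ , litᴺ 0 ]≔ᴺ indexᴬ ⟪ vᵛ ⟫₁ +ᴺ litᴺ 1))
INDEX = EACH vᵛ ((indexᴬ [ scalar vᵛ , litᴺ 0 ]≔ᴺ litᴺ 0) ⨾
                 WHEN (sharedᴬ ⟪ vᵛ ⟫₁ ≡ᴺ litᴺ 1)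
                   ((indexᴬ [ scalar vᵛ , litᴺ 0 ]≔ᴺ litᴺ 1) ⨾ COUNT))
-- The number of digits is determined at run time for every source, in place of the unknown `k₂`.
MAXIMUM = (bitsᵛ ≔ litᴺ 0) ⨾ EACH vᵛ (WHEN (scalar bitsᵛ <ᴺ indexᴬ ⟪ vᵛ ⟫₁) (bitsᵛ ≔ indexᴬ ⟪ vᵛ ⟫₁))
NUMBER = SHARED ⨾ INDEX ⨾ MAXIMUM

-- Column i + 1 of bitᴬ holds the binary digits of weight 2^i, and column 0
-- holds 0; entry i + 1 of powerᴬ is 2^i, and entry 0 is 0.

BITS : Program
BITS = (powerᴬ [ litᴺ 0 , litᴺ 0 ]≔ᴺ litᴺ 0) ⨾ (masksᵛ ≔ litᴺ 1) ⨾
  FOR iᵛ size⁺ᵛ (bitᴬ [ litᴺ 0 , scalar iᵛ ]≔ᴺ litᴺ 0) ⨾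
  -- Every round doubles the table: row `m + masks` is a copy of row `m` with one more digit set.
  -- Neither multiplication nor division of natural numbers is required.
  FOR jᵛ bitsᵛ
    (FOR mᵛ masksᵛ
       (FOR iᵛ size⁺ᵛ (bitᴬ [ scalar mᵛ +ᴺ scalar masksᵛ , scalar iᵛ ]≔ᴺ bitᴬ ⟪ mᵛ , iᵛ ⟫) ⨾
        (bitᴬ [ scalar mᵛ +ᴺ scalar masksᵛ , scalar jᵛ +ᴺ litᴺ 1 ]≔ᴺ litᴺ 1)) ⨾
     (powerᴬ [ scalar jᵛ +ᴺ litᴺ 1 , litᴺ 0 ]≔ᴺ scalar masksᵛ) ⨾
     (masksᵛ ≔ scalar masksᵛ +ᴺ scalar masksᵛ))

-- Paths from s within its blocks, by the set m of numbered trees visited.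

CLEAR BEGIN ENTER CROSS-TREE SEARCH FROM : Program
CLEAR = FOR mᵛ masksᵛ (EACH vᵛ
  ((stateFᴬ [ scalar mᵛ , scalar vᵛ ]≔ᴺ litᴺ 0) ⨾ (entryFᴬ [ scalar mᵛ , scalar vᵛ ]≔ᴺ litᴺ 0)))
BEGIN = EACH bᵛ (WHEN (treeᴬ ⟪ bᵛ ⟫₁ ≡ᴺ treeᴬ ⟪ sᵛ ⟫₁ and sepᴬ ⟪ sᵛ , bᵛ ⟫ ≡ᴺ litᴺ 0)
  (RELAX stateFᴬ stateᵂ (litᴺ 0) (scalar bᵛ) (pathᵂ ⟪ sᵛ , bᵛ ⟫ᵂ)))
-- A hop from `v` through `a` to `b` is cut at `a`: for each set, `ENTER` and `CROSS-TREE` treat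
-- pairs of vertices where a single step would treat triples.
ENTER = FOR mᵛ masksᵛ (EACH₂ vᵛ aᵛ
  (WHEN (stateFᴬ ⟪ mᵛ , vᵛ ⟫ ≢ᴺ litᴺ 0 and adjᴬ ⟪ vᵛ , aᵛ ⟫ ≡ᴺ litᴺ 1 and local aᵛ and
         treeᴬ ⟪ aᵛ ⟫₁ ≢ᴺ treeᴬ ⟪ vᵛ ⟫₁ and bitᴬ [ scalar mᵛ , indexᴬ ⟪ aᵛ ⟫₁ ]ᴺ ≡ᴺ litᴺ 0)
     (RELAX entryFᴬ entryᵂ (scalar mᵛ) (scalar aᵛ) (stateᵂ ⟪ mᵛ , vᵛ ⟫ᵂ +ᵂ arcᵂ ⟪ vᵛ , aᵛ ⟫ᵂ))))
CROSS-TREE = FOR mᵛ masksᵛ (EACH₂ aᵛ bᵛ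
  (WHEN (entryFᴬ ⟪ mᵛ , aᵛ ⟫ ≢ᴺ litᴺ 0 and treeᴬ ⟪ aᵛ ⟫₁ ≡ᴺ treeᴬ ⟪ bᵛ ⟫₁ and sepᴬ ⟪ sᵛ , bᵛ ⟫ ≡ᴺ litᴺ 0)
     (RELAX stateFᴬ stateᵂ (scalar mᵛ +ᴺ powerᴬ [ indexᴬ ⟪ aᵛ ⟫₁ , litᴺ 0 ]ᴺ) (scalar bᵛ)
            (entryᵂ ⟪ mᵛ , aᵛ ⟫ᵂ +ᵂ pathᵂ ⟪ aᵛ , bᵛ ⟫ᵂ))))
-- Every hop uses up an arc of a path, so `n` rounds are enough.
SEARCH = CLEAR ⨾ BEGIN ⨾ EACH rᵛ (ENTER ⨾ CROSS-TREE) ⨾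
  FOR mᵛ masksᵛ (EACH tᵛ (WHEN (stateFᴬ ⟪ mᵛ , tᵛ ⟫ ≢ᴺ litᴺ 0)
    (RELAX distFᴬ distᵂ (scalar sᵛ) (scalar tᵛ) (stateᵂ ⟪ mᵛ , tᵛ ⟫ᵂ))))
FROM = NUMBER ⨾ BITS ⨾ SEARCH

THROUGH-SEPARATORS CROSSINGS THROUGH-CROSSINGS : Program
THROUGH-SEPARATORS = EACH rᵛ (EACH₂ sᵛ tᵛ
  -- `sepᴬ` stores the separating vertex plus one, so 1 is subtracted. The bounds in the guard
  -- discard 0 (a common block) and `n + 1` (different strong components).
  ((qᵛ ≔ sepᴬ ⟪ sᵛ , tᵛ ⟫) ⨾ (pᵛ ≔ scalar qᵛ ∸ᴺ litᴺ 1) ⨾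
   WHEN (litᴺ 0 <ᴺ scalar qᵛ and scalar qᵛ <ᴺ scalar size⁺ᵛ and
         distFᴬ ⟪ sᵛ , pᵛ ⟫ ≢ᴺ litᴺ 0 and distFᴬ ⟪ pᵛ , tᵛ ⟫ ≢ᴺ litᴺ 0)
     (RELAX distFᴬ distᵂ (scalar sᵛ) (scalar tᵛ) (distᵂ ⟪ sᵛ , pᵛ ⟫ᵂ +ᵂ distᵂ ⟪ pᵛ , tᵛ ⟫ᵂ))))
-- Minimising over the last vertex `a` of the component in advance leaves triples for each round of
-- `THROUGH-CROSSINGS`, hence `n ^ 4` steps in all.
CROSSINGS = EACH sᵛ (EACH₂ aᵛ bᵛ
  (WHEN (distFᴬ ⟪ sᵛ , aᵛ ⟫ ≢ᴺ litᴺ 0 and sepᴬ ⟪ sᵛ , aᵛ ⟫ ≢ᴺ scalar size⁺ᵛ and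
         adjᴬ ⟪ aᵛ , bᵛ ⟫ ≡ᴺ litᴺ 1 and sepᴬ ⟪ aᵛ , bᵛ ⟫ ≡ᴺ scalar size⁺ᵛ)
     (RELAX crossFᴬ crossᵂ (scalar sᵛ) (scalar bᵛ) (distᵂ ⟪ sᵛ , aᵛ ⟫ᵂ +ᵂ arcᵂ ⟪ aᵛ , bᵛ ⟫ᵂ))))
THROUGH-CROSSINGS = EACH rᵛ (EACH sᵛ (EACH₂ bᵛ tᵛ
  (WHEN (crossFᴬ ⟪ sᵛ , bᵛ ⟫ ≢ᴺ litᴺ 0 and distFᴬ ⟪ bᵛ , tᵛ ⟫ ≢ᴺ litᴺ 0)
     (RELAX distFᴬ distᵂ (scalar sᵛ) (scalar tᵛ) (crossᵂ ⟪ sᵛ , bᵛ ⟫ᵂ +ᵂ distᵂ ⟪ bᵛ , tᵛ ⟫ᵂ)))))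

CHECK : Program
CHECK = EACH₂ sᵛ tᵛ
  -- Negative edges are exempt: the two arcs of such an edge form a negative cycle that is
  -- permitted.
  (WHEN (adjᴬ ⟪ tᵛ , sᵛ ⟫ ≡ᴺ litᴺ 1 and edgeᴬ ⟪ tᵛ , sᵛ ⟫ ≢ᴺ litᴺ 1 and
         distFᴬ ⟪ sᵛ , tᵛ ⟫ ≢ᴺ litᴺ 0 and distᵂ ⟪ sᵛ , tᵛ ⟫ᵂ +ᵂ arcᵂ ⟪ tᵛ , sᵛ ⟫ᵂ <ᵂ 0ᵂ)
     (badᵛ ≔ litᴺ 1))

DISTANCES APSP : Program
DISTANCES = REACH ⨾ SEPARATORS ⨾ EACH sᵛ FROM ⨾ THROUGH-SEPARATORS ⨾ CROSSINGS ⨾ THROUGH-CROSSINGS ⨾ CHECK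
APSP = (size⁺ᵛ ≔ scalar sizeᴬ +ᴺ litᴺ 1) ⨾ KRUSKAL ⨾ WHEN (scalar badᵛ ≢ᴺ litᴺ 1) DISTANCES ⨾
       WHEN (scalar badᵛ ≢ᴺ litᴺ 1) (answerᴬ [ litᴺ 0 , litᴺ 0 ]≔ᴺ litᴺ 1)

-- Building the negative trees

read : ∀ {X : Set} {m m′ : ℕ → ℕ → X} {i i′ j j′} → m ≡ m′ → i ≡ i′ → j ≡ j′ → m i j ≡ m′ i′ j′
read refl refl refl = refl

row : ∀ {X : Set} {m m′ : ℕ → ℕ → X} {i i′ j} → m ≡ m′ → i ≡ i′ → m i j ≡ m′ i′ j
row refl refl = refl

table-at : ∀ (ℝ : RealNumbers) {X : Set} (d : X) {n} (f : Fin n → Fin n → X) u v →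
  table ℝ d f (toℕ u) (toℕ v) ≡ f u v
table-at ℝ d {n} f u v with toℕ u ℕ.<? n | toℕ v ℕ.<? n
... | yes p | yes q = cong₂ f (fromℕ<-toℕ u p) (fromℕ<-toℕ v q)
... | no ¬p | _     = ⊥-elim (¬p (toℕ<n u))
... | yes _ | no ¬q = ⊥-elim (¬q (toℕ<n v))

module Reading (ℝ : RealNumbers) {n : ℕ} (D : Digraph n) (c : Weight ℝ D) (Good : ℕ → Set) where
  open Execution ℝ n Good
  open OrderedField ℝ
  open Digraph D using (Arc; arc)
  open Weighted ℝ D c

  record Input (σ : State ℝ) : Set where
    constructor mkInput
    field
      size-kept : nat σ sizeᴬ ≡ nat (input ℝ D c) sizeᴬ
      adj-kept  : nat σ adjᴬ ≡ nat (input ℝ D c) adjᴬ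
      arc-kept  : wt σ arcᵂ ≡ wt (input ℝ D c) arcᵂ

    size-n : nat σ sizeᴬ 0 0 ≡ n
    size-n = cong (λ m → m 0 0) size-kept

    private
      entry : ∀ u v → nat σ adjᴬ (toℕ u) (toℕ v) ≡ (if arc u v then 1 else 0)
      entry u v = trans (cong (λ m → m (toℕ u) (toℕ v)) adj-kept) (table-at ℝ 0 _ u v)

    adj⇒arc : ∀ {u v} → nat σ adjᴬ (toℕ u) (toℕ v) ≡ 1 → Arc u v
    adj⇒arc {u} {v} h with arc u v | trans (sym h) (entry u v)
    ... | true  | _ = tt
    ... | false | ()

    arc⇒adj : ∀ {u v} → Arc u v → nat σ adjᴬ (toℕ u) (toℕ v) ≡ 1
    arc⇒adj {u} {v} a with arc u v | entry u v
    ... | true | e = e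

    arc-weight : ∀ {u v} (uv : Arc u v) → wt σ arcᵂ (toℕ u) (toℕ v) ≡ c u v uv
    arc-weight {u} {v} uv = trans (cong (λ m → m (toℕ u) (toℕ v)) arc-kept)
      (trans (table-at ℝ 0# (weightEntry ℝ D c) u v) entry-weight)
      where
      open import Data.Bool.Properties using (T?)
      entry-weight : weightEntry ℝ D c u v ≡ c u v uv
      entry-weight with T? (arc u v)
      ... | yes _ = refl
      ... | no ¬a = ⊥-elim (¬a uv)

  input-kept : ∀ {p σ σ′} → sizeᴬ ∉ᵇ writesᴺ p → adjᴬ ∉ᵇ writesᴺ p → arcᵂ ∉ᵇ writesᵂ p →
               Frame p σ σ′ → Input σ → Input σ′
  input-kept a b d fr (mkInput x y z) = mkInput (trans (keepᴺ fr _ a) x) (trans (keepᴺ fr _ b) y)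
    (trans (keepᵂ fr _ d) z)

module KruskalProof (ℝ : RealNumbers) {n : ℕ} (D : Digraph n) (c : Weight ℝ D) (Good : ℕ → Set) where
  open Execution ℝ n Good
  open OrderedField ℝ
  open Digraph D using (Arc)
  open Weighted ℝ D c
  open Theory ℝ D c
  open Reading ℝ D c Good

  tree : State ℝ → Fin n → ℕ
  tree σ u = nat σ treeᴬ (toℕ u) 0

  path-weight : State ℝ → Fin n → Fin n → Carrier
  path-weight σ u v = wt σ pathᵂ (toℕ u) (toℕ v)

  Edge : State ℝ → Rel (Fin n) 0ℓ
  Edge σ u v = nat σ edgeᴬ (toℕ u) (toℕ v) ≡ 1

  via : State ℝ → (a b x y : Fin n) → Carrier
  via σ a b x y = (path-weight σ x a + wt σ arcᵂ (toℕ a) (toℕ b)) + path-weight σ b y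

  Across : State ℝ → (a b x y : Fin n) → Set
  Across σ a b x y = tree σ x ≡ tree σ a × tree σ y ≡ tree σ b

  record Joined (u v : Fin n) (σ σ′ : State ℝ) : Set where
    field
      forward   : ∀ {x y} → Across σ u v x y → path-weight σ′ x y ≡ via σ u v x y
      backward  : ∀ {x y} → Across σ v u x y → path-weight σ′ x y ≡ via σ v u x y
      elsewhere : ∀ {x y} → ¬ Across σ u v x y → ¬ Across σ v u x y → path-weight σ′ x y ≡ path-weight σ x y

  -- Updating in place is safe. The entries that are read belong to pairs inside one of the two
  -- trees, the entries that are written to pairs across them.
  join-paths : ∀ {σ} u v → nat σ sizeᴬ 0 0 ≡ n → nat σ uᵛ 0 0 ≡ toℕ u → nat σ vᵛ 0 0 ≡ toℕ v →
               nat σ label₁ᵛ 0 0 ≡ tree σ u → nat σ label₂ᵛ 0 0 ≡ tree σ v → tree σ u ≢ tree σ v →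
               Exec JOIN-PATHS σ (0 , 2) (Joined u v σ)
  join-paths {σ} u v N xu xv l₁ l₂ u≁v = consequence
    (λ { {τ} _ ((ok , _) , done) → record
      { forward = λ {x} {y} → proj₁ (done x y)
      ; backward = λ {x} {y} → proj₂ (done x y)
      ; elsewhere = λ f b → case {σ′ = τ} (ok refl-ok _ _) f b } })
    (for-fin₂ Done (record {}) (record {}) N ((λ h → h) , λ h → h) ((λ h → h) , λ h → h) (λ le → proj₂ le)
      λ x y {σ′} fr xx yy le → step x y fr xx yy (proj₁ le refl-ok))
    where
    OK : State ℝ → Set
    OK σ′ = ∀ x y → (path-weight σ′ x y ≡ path-weight σ x y) ⊎ (Across σ u v x y ⊎ Across σ v u x y)
    Done : Fin n → Fin n → State ℝ → Set
    Done x y σ′ = (Across σ u v x y → path-weight σ′ x y ≡ via σ u v x y) ×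
                  (Across σ v u x y → path-weight σ′ x y ≡ via σ v u x y)
    refl-ok : OK σ
    refl-ok x y = inj₁ refl
    evolution : Evolution
    evolution = record
      { _≼_ = λ σ₁ σ₂ → (OK σ₁ → OK σ₂) × (∀ {x y} → Done x y σ₁ → Done x y σ₂)
      ; ≼-refl = (λ h → h) , λ h → h
      ; ≼-trans = λ { (f , g) (f′ , g′) → (λ h → f′ (f h)) , λ h → g′ (g h) } }
    open Each evolution
    case : ∀ {x y σ′} → (path-weight σ′ x y ≡ path-weight σ x y) ⊎ (Across σ u v x y ⊎ Across σ v u x y) →
           ¬ Across σ u v x y → ¬ Across σ v u x y → path-weight σ′ x y ≡ path-weight σ x y
    case (inj₁ e) _ _ = e
    case (inj₂ (inj₁ a)) f _ = ⊥-elim (f a)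
    case (inj₂ (inj₂ b)) _ g = ⊥-elim (g b)
    step : ∀ x y {σ′} → Frame JOIN-PATHS σ σ′ → nat σ′ xᵛ 0 0 ≡ toℕ x → nat σ′ yᵛ 0 0 ≡ toℕ y → OK σ′ →
           Exec _ σ′ (0 , 0) (λ σ″ → ((OK σ′ → OK σ″) × (∀ {x y} → Done x y σ′ → Done x y σ″)) × Done x y σ″)
    step x y {σ′} fr xx yy ok = branch
      (λ { (g₁ , g₂) → exec-wt (write-ok (inj₁ (fw g₁ g₂)) (via σ u v x y) (fw-value (fw g₁ g₂)) (λ _ → refl)
        (λ b → ⊥-elim (u≁v (trans (sym (proj₁ (fw g₁ g₂))) (proj₁ b))))) })
      (λ ¬f → when
        (λ { (g₁ , g₂) → exec-wt (write-ok (inj₂ (bw g₁ g₂)) (via σ v u x y) (bw-value (bw g₁ g₂))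
          (λ f → ⊥-elim (u≁v (trans (sym (proj₁ f)) (proj₁ (bw g₁ g₂))))) (λ _ → refl)) })
        (λ ¬b → ((λ h → h) , λ h → h) , (λ f → ⊥-elim (¬f (wf f))) , λ b → ⊥-elim (¬b (wb b))))
      where
      tx : ∀ {a} → nat σ′ a 0 0 ≡ toℕ x → nat σ′ treeᴬ (nat σ′ a 0 0) 0 ≡ tree σ x
      tx e = row (keepᴺ fr treeᴬ refl) e
      ty : nat σ′ treeᴬ (nat σ′ yᵛ 0 0) 0 ≡ tree σ y
      ty = row (keepᴺ fr treeᴬ refl) yy
      xu′ : nat σ′ uᵛ 0 0 ≡ toℕ u
      xu′ = trans (cong (λ m → m 0 0) (keepᴺ fr uᵛ refl)) xu
      xv′ : nat σ′ vᵛ 0 0 ≡ toℕ v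
      xv′ = trans (cong (λ m → m 0 0) (keepᴺ fr vᵛ refl)) xv
      l₁′ : nat σ′ label₁ᵛ 0 0 ≡ tree σ u
      l₁′ = trans (cong (λ m → m 0 0) (keepᴺ fr label₁ᵛ refl)) l₁
      l₂′ : nat σ′ label₂ᵛ 0 0 ≡ tree σ v
      l₂′ = trans (cong (λ m → m 0 0) (keepᴺ fr label₂ᵛ refl)) l₂
      fw : nat σ′ treeᴬ (nat σ′ xᵛ 0 0) 0 ≡ nat σ′ label₁ᵛ 0 0 →
        nat σ′ treeᴬ (nat σ′ yᵛ 0 0) 0 ≡ nat σ′ label₂ᵛ 0 0 → Across σ u v x y
      fw g₁ g₂ = trans (sym (tx {xᵛ} xx)) (trans g₁ l₁′) , trans (sym ty) (trans g₂ l₂′)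
      bw : nat σ′ treeᴬ (nat σ′ xᵛ 0 0) 0 ≡ nat σ′ label₂ᵛ 0 0 →
        nat σ′ treeᴬ (nat σ′ yᵛ 0 0) 0 ≡ nat σ′ label₁ᵛ 0 0 → Across σ v u x y
      bw g₁ g₂ = trans (sym (tx {xᵛ} xx)) (trans g₁ l₂′) , trans (sym ty) (trans g₂ l₁′)
      wf : Across σ u v x y → _ × _
      wf (a , b) = trans (tx {xᵛ} xx) (trans a (sym l₁′)) , trans ty (trans b (sym l₂′))
      wb : Across σ v u x y → _ × _
      wb (a , b) = trans (tx {xᵛ} xx) (trans a (sym l₂′)) , trans ty (trans b (sym l₁′))
      within : ∀ {x y} → ¬ Across σ u v x y → ¬ Across σ v u x y → path-weight σ′ x y ≡ path-weight σ x y
      within {x} {y} = case {σ′ = σ′} (ok x y)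
      fw-value : Across σ u v x y → _ ≡ via σ u v x y
      fw-value a = cong₂ _+_ (cong₂ _+_
        (trans (cong₂ (wt σ′ pathᵂ) xx xu′) (within (λ { (_ , b) → u≁v b })
          (λ { (b , _) → u≁v (trans (sym (proj₁ a)) b) })))
        (read (keepᵂ fr _ refl) xu′ xv′))
        (trans (cong₂ (wt σ′ pathᵂ) xv′ yy) (within (λ { (b , _) → u≁v (sym b) })
          (λ { (_ , b) → u≁v (trans (sym b) (proj₂ a)) })))
      bw-value : Across σ v u x y → _ ≡ via σ v u x y
      bw-value a = cong₂ _+_ (cong₂ _+_
        (trans (cong₂ (wt σ′ pathᵂ) xx xv′) (within (λ { (b , _) → u≁v (trans (sym b) (proj₁ a)) })
          (λ { (_ , b) → u≁v (sym b) })))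
        (read (keepᵂ fr _ refl) xv′ xu′))
        (trans (cong₂ (wt σ′ pathᵂ) xu′ yy) (within (λ { (_ , b) → u≁v (trans (sym (proj₂ a)) b) })
          (λ { (b , _) → u≁v b })))
      write-ok : Across σ u v x y ⊎ Across σ v u x y → ∀ new {val} → val ≡ new →
                 (Across σ u v x y → new ≡ via σ u v x y) → (Across σ v u x y → new ≡ via σ v u x y) →
                 let σ″ = ⟨ nat σ′ , write (wt σ′) pathᵂ (nat σ′ xᵛ 0 0) (nat σ′ yᵛ 0 0) val ⟩ in
                 ((OK σ′ → OK σ″) × (∀ {x y} → Done x y σ′ → Done x y σ″)) × Done x y σ″
      write-ok across new {val} refl isF isB = ((λ ok → ok′ ok) , done′) , here′
        where
        σ″ : State ℝ
        σ″ = ⟨ nat σ′ , write (wt σ′) pathᵂ (nat σ′ xᵛ 0 0) (nat σ′ yᵛ 0 0) val ⟩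
        at : ∀ x′ y′ → (x′ ≡ x × y′ ≡ y × path-weight σ″ x′ y′ ≡ val) ⊎
                       (¬ (x′ ≡ x × y′ ≡ y) × path-weight σ″ x′ y′ ≡ path-weight σ′ x′ y′)
        at = write-at {m = wt σ′} xx yy
        ok′ : OK σ′ → OK σ″
        ok′ h x′ y′ with at x′ y′
        ... | inj₁ (refl , refl , _) = inj₂ across
        ... | inj₂ (_ , e) with h x′ y′
        ...   | inj₁ e′ = inj₁ (trans e e′)
        ...   | inj₂ a  = inj₂ a
        here′ : Done x y σ″
        here′ with at x y
        ... | inj₁ (_ , _ , e) = (λ a → trans e (isF a)) , λ b → trans e (isB b)
        ... | inj₂ (ne , _) = ⊥-elim (ne (refl , refl))
        done′ : ∀ {x y} → Done x y σ′ → Done x y σ″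
        done′ {x′} {y′} (f , b) with at x′ y′
        ... | inj₁ (refl , refl , e) = (λ a → trans e (isF a)) , λ b → trans e (isB b)
        ... | inj₂ (_ , e) = (λ a → trans e (f a)) , λ a → trans e (b a)

  record Relabelled (ℓ₁ ℓ₂ : ℕ) (σ σ′ : State ℝ) : Set where
    field
      changed : ∀ {x} → tree σ x ≡ ℓ₂ → tree σ′ x ≡ ℓ₁
      kept    : ∀ {x} → tree σ x ≢ ℓ₂ → tree σ′ x ≡ tree σ x

  relabel-tree : ∀ {σ ℓ₁ ℓ₂} → nat σ sizeᴬ 0 0 ≡ n → nat σ label₁ᵛ 0 0 ≡ ℓ₁ → nat σ label₂ᵛ 0 0 ≡ ℓ₂ →
                 Exec RELABEL σ (0 , 1) (Relabelled ℓ₁ ℓ₂ σ)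
  relabel-tree {σ} {ℓ₁} {ℓ₂} N l₁ l₂ = consequence
    (λ { {τ} _ ((ok , _) , done) → record { changed = λ {x} → done x ; kept = λ {x} ne →
      old {τ} ne (ok (λ x → inj₁ refl) x) } })
    (for-fin Done (record {}) N ((λ h → h) , λ h → h) (λ le → proj₂ le)
      λ x {σ′} fr xx le → step x fr xx (proj₁ le (λ x → inj₁ refl)))
    where
    OK : State ℝ → Set
    OK σ′ = ∀ x → (tree σ′ x ≡ tree σ x) ⊎ (tree σ x ≡ ℓ₂ × tree σ′ x ≡ ℓ₁)
    Done : Fin n → State ℝ → Set
    Done x σ′ = tree σ x ≡ ℓ₂ → tree σ′ x ≡ ℓ₁
    old : ∀ {τ x} → tree σ x ≢ ℓ₂ → (tree τ x ≡ tree σ x) ⊎ (tree σ x ≡ ℓ₂ × tree τ x ≡ ℓ₁) → tree τ x ≡ tree σ x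
    old ne (inj₁ e) = e
    old ne (inj₂ (e , _)) = ⊥-elim (ne e)
    evolution : Evolution
    evolution = record
      { _≼_ = λ σ₁ σ₂ → (OK σ₁ → OK σ₂) × (∀ {x} → Done x σ₁ → Done x σ₂)
      ; ≼-refl = (λ h → h) , λ h → h
      ; ≼-trans = λ { (f , g) (f′ , g′) → (λ h → f′ (f h)) , λ h → g′ (g h) } }
    open Each evolution
    step : ∀ x {σ′} → Frame RELABEL σ σ′ → nat σ′ xᵛ 0 0 ≡ toℕ x → OK σ′ →
           Exec _ σ′ (0 , 0) (λ σ″ → ((OK σ′ → OK σ″) × (∀ {x} → Done x σ′ → Done x σ″)) × Done x σ″)
    step x {σ′} fr xx ok = when
      (λ g → exec-nat (written (was (trans (sym (cong (λ i → nat σ′ treeᴬ i 0) xx)) (trans g l₂′)))))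
      (λ ¬g → ((λ h → h) , λ h → h) , λ e → fallback ¬g e (ok x))
      where
      l₁′ : nat σ′ label₁ᵛ 0 0 ≡ ℓ₁
      l₁′ = trans (cong (λ m → m 0 0) (keepᴺ fr label₁ᵛ refl)) l₁
      l₂′ : nat σ′ label₂ᵛ 0 0 ≡ ℓ₂
      l₂′ = trans (cong (λ m → m 0 0) (keepᴺ fr label₂ᵛ refl)) l₂
      was : tree σ′ x ≡ ℓ₂ → tree σ x ≡ ℓ₂
      was e with ok x
      ... | inj₁ e′ = trans (sym e′) e
      ... | inj₂ (e′ , _) = e′
      fallback : ¬ nat σ′ treeᴬ (nat σ′ xᵛ 0 0) 0 ≡ nat σ′ label₂ᵛ 0 0 → tree σ x ≡ ℓ₂ →
                 (tree σ′ x ≡ tree σ x) ⊎ (tree σ x ≡ ℓ₂ × tree σ′ x ≡ ℓ₁) → tree σ′ x ≡ ℓ₁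
      fallback ¬g e (inj₁ e′) = ⊥-elim (¬g (trans (cong (λ i → nat σ′ treeᴬ i 0) xx)
        (trans e′ (trans e (sym l₂′)))))
      fallback ¬g e (inj₂ (_ , e′)) = e′
      written : tree σ x ≡ ℓ₂ →
        let σ″ = ⟨ write (nat σ′) treeᴬ (nat σ′ xᵛ 0 0) 0 (nat σ′ label₁ᵛ 0 0) , wt σ′ ⟩ in
        ((OK σ′ → OK σ″) × (∀ {x} → Done x σ′ → Done x σ″)) × Done x σ″
      written xℓ = (ok′ , (λ {y} → done′ {y})) , here′
        where
        σ″ : State ℝ
        σ″ = ⟨ write (nat σ′) treeᴬ (nat σ′ xᵛ 0 0) 0 (nat σ′ label₁ᵛ 0 0) , wt σ′ ⟩
        at : ∀ y → (y ≡ x × tree σ″ y ≡ ℓ₁) ⊎ (tree σ″ y ≡ tree σ′ y)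
        at y with write-cases (nat σ′) treeᴬ (nat σ′ xᵛ 0 0) 0 (nat σ′ label₁ᵛ 0 0) (toℕ y) 0
        ... | inj₁ (e , _ , h) = inj₁ (toℕ-injective (trans e xx) , trans h l₁′)
        ... | inj₂ (_ , h) = inj₂ h
        ok′ : OK σ′ → OK σ″
        ok′ h y with at y
        ... | inj₁ (refl , e) = inj₂ (xℓ , e)
        ... | inj₂ e with h y
        ...   | inj₁ e′ = inj₁ (trans e e′)
        ...   | inj₂ (a , e′) = inj₂ (a , trans e e′)
        done′ : ∀ {y} → Done y σ′ → Done y σ″
        done′ {y} d a with at y
        ... | inj₁ (_ , e) = e
        ... | inj₂ e = trans e (d a)
        here′ : Done x σ″
        here′ a with write-cases (nat σ′) treeᴬ (nat σ′ xᵛ 0 0) 0 (nat σ′ label₁ᵛ 0 0) (toℕ x) 0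
        ... | inj₁ (_ , _ , h) = trans h l₁′
        ... | inj₂ (ne , _) = ⊥-elim (ne (sym xx , refl))

  record Merged (u v : Fin n) (σ σ′ : State ℝ) : Set where
    field
      joined     : ∀ {x y} → (Across σ u v x y → path-weight σ′ x y ≡ via σ u v x y) ×
                             (Across σ v u x y → path-weight σ′ x y ≡ via σ v u x y) ×
                             (¬ Across σ u v x y → ¬ Across σ v u x y → path-weight σ′ x y ≡ path-weight σ x y)
      relabelled : Relabelled (tree σ u) (tree σ v) σ σ′
      old-edge   : ∀ {x y} → Edge σ x y → Edge σ′ x y
      new-edge   : Edge σ′ u v × Edge σ′ v u
      edge-cases : ∀ {x y} → Edge σ′ x y → Edge σ x y ⊎ ((x ≡ u × y ≡ v) ⊎ (x ≡ v × y ≡ u))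

  merge : ∀ {σ} u v → nat σ sizeᴬ 0 0 ≡ n → nat σ uᵛ 0 0 ≡ toℕ u → nat σ vᵛ 0 0 ≡ toℕ v →
          tree σ u ≢ tree σ v → Exec MERGE σ (0 , 2) (Merged u v σ)
  merge {σ} u v N xu xv u≁v =
    exec-nat {Q = _≡ σ₁} refl then-do λ { _ refl →
    exec-nat {Q = _≡ σ₂} refl then-do λ { _ refl →
    join-paths {σ₂} u v N xu xv (cong (λ i → nat σ treeᴬ i 0) xu) (cong (λ i → nat σ treeᴬ i 0) xv) u≁v
      then-do λ {σ₃} fr₃ J →
    slower tt (relabel-tree {σ₃} (trans (cong (λ m → m 0 0) (keepᴺ fr₃ sizeᴬ refl)) N)
      (trans (cong (λ m → m 0 0) (keepᴺ fr₃ label₁ᵛ refl)) (cong (λ i → nat σ treeᴬ i 0) xu))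
      (trans (cong (λ m → m 0 0) (keepᴺ fr₃ label₂ᵛ refl)) (cong (λ i → nat σ treeᴬ i 0) xv)))
        then-do λ {σ₄} fr₄ R →
    exec-nat {Q = _≡ σ₅ σ₄} refl then-do λ { _ refl → exec-nat (finish fr₃ J fr₄ R) } } }
    where
    σ₁ σ₂ : State ℝ
    σ₁ = set σ label₁ᵛ (nat σ treeᴬ (nat σ uᵛ 0 0) 0)
    σ₂ = set σ₁ label₂ᵛ (nat σ treeᴬ (nat σ vᵛ 0 0) 0)
    σ₅ σ₆ : State ℝ → State ℝ
    σ₅ σ₄ = ⟨ write (nat σ₄) edgeᴬ (nat σ₄ uᵛ 0 0) (nat σ₄ vᵛ 0 0) 1 , wt σ₄ ⟩
    σ₆ σ₄ = ⟨ write (nat (σ₅ σ₄)) edgeᴬ (nat σ₄ vᵛ 0 0) (nat σ₄ uᵛ 0 0) 1 , wt σ₄ ⟩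
    finish : ∀ {σ₃ σ₄} → Frame JOIN-PATHS σ₂ σ₃ → Joined u v σ₂ σ₃ → Frame RELABEL σ₃ σ₄ →
             Relabelled (tree σ u) (tree σ v) σ₃ σ₄ → Merged u v σ (σ₆ σ₄)
    finish {σ₃} {σ₄} fr₃ J fr₄ R = record
      { joined = λ {x} {y} → (λ a → trans (P₄ x y) (Joined.forward J a)) ,
        (λ a → trans (P₄ x y) (Joined.backward J a)) ,
                             λ a b → trans (P₄ x y) (Joined.elsewhere J a b)
      ; relabelled = record { changed = λ {x} e → Relabelled.changed R (trans (T₃ x) e)
                            ; kept = λ {x} ne → trans (Relabelled.kept R
                              (λ e → ne (trans (sym (T₃ x)) e))) (T₃ x) }
      ; old-edge = λ {x} {y} e → old x y e
      ; new-edge = first , second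
      ; edge-cases = λ {x} {y} → cases x y }
      where
      P₄ : ∀ x y → path-weight σ₄ x y ≡ path-weight σ₃ x y
      P₄ x y = cong (λ m → m (toℕ x) (toℕ y)) (keepᵂ fr₄ pathᵂ refl)
      T₃ : ∀ x → tree σ₃ x ≡ tree σ x
      T₃ x = cong (λ m → m (toℕ x) 0) (keepᴺ fr₃ treeᴬ refl)
      E₄ : ∀ x y → nat σ₄ edgeᴬ (toℕ x) (toℕ y) ≡ nat σ edgeᴬ (toℕ x) (toℕ y)
      E₄ x y = cong (λ m → m (toℕ x) (toℕ y)) (trans (keepᴺ fr₄ edgeᴬ refl) (keepᴺ fr₃ edgeᴬ refl))
      u₄ : nat σ₄ uᵛ 0 0 ≡ toℕ u
      u₄ = trans (cong (λ m → m 0 0) (trans (keepᴺ fr₄ uᵛ refl) (keepᴺ fr₃ uᵛ refl))) xu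
      v₄ : nat σ₄ vᵛ 0 0 ≡ toℕ v
      v₄ = trans (cong (λ m → m 0 0) (trans (keepᴺ fr₄ vᵛ refl) (keepᴺ fr₃ vᵛ refl))) xv
      at₅ : ∀ x y → (x ≡ u × y ≡ v × Edge (σ₅ σ₄) x y) ⊎
                    (¬ (x ≡ u × y ≡ v) × nat (σ₅ σ₄) edgeᴬ (toℕ x) (toℕ y) ≡ nat σ₄ edgeᴬ (toℕ x) (toℕ y))
      at₅ = write-at {m = nat σ₄} u₄ v₄
      at₆ : ∀ x y → (x ≡ v × y ≡ u × Edge (σ₆ σ₄) x y) ⊎
                    (¬ (x ≡ v × y ≡ u) × nat (σ₆ σ₄) edgeᴬ (toℕ x) (toℕ y) ≡ nat (σ₅ σ₄) edgeᴬ (toℕ x) (toℕ y))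
      at₆ = write-at {m = nat (σ₅ σ₄)} v₄ u₄
      old : ∀ x y → Edge σ x y → Edge (σ₆ σ₄) x y
      old x y e with at₆ x y | at₅ x y
      ... | inj₁ (_ , _ , h) | _ = h
      ... | inj₂ (_ , h) | inj₁ (_ , _ , h′) = trans h h′
      ... | inj₂ (_ , h) | inj₂ (_ , h′) = trans h (trans h′ (trans (E₄ x y) e))
      first : Edge (σ₆ σ₄) u v
      first with at₆ u v | at₅ u v
      ... | inj₁ (_ , _ , h) | _ = h
      ... | inj₂ (_ , h) | inj₁ (_ , _ , h′) = trans h h′
      ... | inj₂ _ | inj₂ (ne , _) = ⊥-elim (ne (refl , refl))
      second : Edge (σ₆ σ₄) v u
      second with at₆ v u
      ... | inj₁ (_ , _ , h) = h
      ... | inj₂ (ne , _) = ⊥-elim (ne (refl , refl))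
      cases : ∀ x y → Edge (σ₆ σ₄) x y → Edge σ x y ⊎ ((x ≡ u × y ≡ v) ⊎ (x ≡ v × y ≡ u))
      cases x y e with at₆ x y | at₅ x y
      ... | inj₁ (a , b , _) | _ = inj₂ (inj₂ (a , b))
      ... | inj₂ _ | inj₁ (a , b , _) = inj₂ (inj₁ (a , b))
      ... | inj₂ (_ , h) | inj₂ (_ , h′) = inj₁ (trans (sym (E₄ x y)) (trans (sym h′) (trans (sym h) e)))

  bad : State ℝ → ℕ
  bad σ = nat σ badᵛ 0 0

  -- After a cycle has been found the loops run on; from then on only the verdict is maintained, and
  -- nothing is claimed about the forest.
  KruskalInvariant : State ℝ → Set
  KruskalInvariant σ =
    (bad σ ≡ 0 × Forest (Edge σ) (tree σ) (path-weight σ) × (∀ u → tree σ u ℕ.< n)) ⊎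
    (bad σ ≡ 1 × ¬ NearlyConservative)

  Treated : Fin n → Fin n → State ℝ → Set
  Treated u v σ = bad σ ≡ 1 ⊎ (NegativeEdge u v → Edge σ u v)

  record Grows (σ σ′ : State ℝ) : Set where
    constructor grows
    field
      invariant : KruskalInvariant σ → KruskalInvariant σ′
      bad-stays : bad σ ≡ 1 → bad σ′ ≡ 1
      edge-stays : ∀ {u v} → Edge σ u v → Edge σ′ u v
  open Grows

  growth : Evolution
  growth = record
    { _≼_ = Grows
    ; ≼-refl = grows (λ h → h) (λ h → h) (λ h → h)
    ; ≼-trans = λ f g → grows (λ h → invariant g (invariant f h)) (λ h → bad-stays g (bad-stays f h))
      (λ h → edge-stays g (edge-stays f h)) }
  open Each growth

  treated-stays : ∀ {u v σ σ′} → Grows σ σ′ → Treated u v σ → Treated u v σ′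
  treated-stays g (inj₁ b) = inj₁ (bad-stays g b)
  treated-stays g (inj₂ f) = inj₂ (λ e → edge-stays g (f e))

  link : ∀ {σ} u v → Input σ → nat σ uᵛ 0 0 ≡ toℕ u → nat σ vᵛ 0 0 ≡ toℕ v →
         Exec LINK σ (0 , 2) (λ σ′ → Grows σ σ′ × Treated u v σ′)
  link {σ} u v inp xu xv = when
    (λ { (uv , vu , lt , new) →
      let e = negative uv vu lt in
      branch (λ same → exec-nat (cyclic e (trans (sym T-u) (trans same T-v)) new))
             (λ differ → consequence (λ fr M → merged fr M e (λ s → differ (trans T-u (trans s (sym T-v)))))
               (merge u v size-n xu xv (λ s → differ (trans T-u (trans s (sym T-v)))))) })
    (λ ¬g → grows (λ h → h) (λ h → h) (λ h → h) , inj₂ (λ e → done ¬g e))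
    where
    open Input inp
    A-uv = cong₂ (nat σ adjᴬ) xu xv
    A-vu = cong₂ (nat σ adjᴬ) xv xu
    W-uv = cong₂ (wt σ arcᵂ) xu xv
    W-vu = cong₂ (wt σ arcᵂ) xv xu
    E-uv = cong₂ (nat σ edgeᴬ) xu xv
    T-u  = cong (λ i → nat σ treeᴬ i 0) xu
    T-v  = cong (λ i → nat σ treeᴬ i 0) xv
    negative : nat σ adjᴬ (nat σ uᵛ 0 0) (nat σ vᵛ 0 0) ≡ 1 → nat σ adjᴬ (nat σ vᵛ 0 0) (nat σ uᵛ 0 0) ≡ 1 →
               wt σ arcᵂ (nat σ uᵛ 0 0) (nat σ vᵛ 0 0) + wt σ arcᵂ (nat σ vᵛ 0 0) (nat σ uᵛ 0 0) <
                 0# → NegativeEdge u v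
    negative h₁ h₂ lt = (λ { refl → no-loop uv }) , uv , vu ,
      λ le → lt (≤-trans le (≡⇒≤ ((sym (cong₂ _+_ (trans W-uv (arc-weight uv)) (trans W-vu (arc-weight vu)))))))
      where
      uv = adj⇒arc (trans (sym A-uv) h₁)
      vu = adj⇒arc (trans (sym A-vu) h₂)
    done : ¬ _ → NegativeEdge u v → Edge σ u v
    done ¬g (_ , uv , vu , lt) with nat σ edgeᴬ (toℕ u) (toℕ v) ℕ.≟ 1
    ... | yes e = e
    ... | no ne = ⊥-elim (¬g (trans A-uv (arc⇒adj uv) , trans A-vu (arc⇒adj vu) ,
      (λ le → lt (≤-trans le (≡⇒≤ ((cong₂ _+_ (trans W-uv (arc-weight uv)) (trans W-vu (arc-weight vu))))))) ,
      λ e → ne (trans (sym E-uv) e)))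
    cyclic : NegativeEdge u v → tree σ u ≡ tree σ v → ¬ nat σ edgeᴬ (nat σ uᵛ 0 0) (nat σ vᵛ 0 0) ≡ 1 →
             Grows σ (set σ badᵛ 1) × Treated u v (set σ badᵛ 1)
    cyclic e same new = grows inv (λ _ → refl) (λ h → h) , inj₁ refl
      where
      inv : KruskalInvariant σ → KruskalInvariant (set σ badᵛ 1)
      inv (inj₂ (_ , ¬nc)) = inj₂ (refl , ¬nc)
      inv (inj₁ (_ , forest , _)) =
        inj₂ (refl , negative-edge-cycle forest e same (λ E → new (trans E-uv E)))
    merged : ∀ {σ′} → Frame MERGE σ σ′ → Merged u v σ σ′ → NegativeEdge u v → tree σ u ≢ tree σ v →
             Grows σ σ′ × Treated u v σ′
    merged {σ′} fr M e@(_ , uv , vu , _) u≁v = grows inv (λ h → trans bad-kept h) old-edge ,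
      inj₂ (λ _ → proj₁ new-edge)
      where
      open Merged M
      open Relabelled relabelled
      bad-kept : bad σ′ ≡ bad σ
      bad-kept = cong (λ m → m 0 0) (keepᴺ fr badᵛ refl)
      small : (∀ x → tree σ x ℕ.< n) → ∀ x → tree σ′ x ℕ.< n
      small h x with tree σ x ℕ.≟ tree σ v
      ... | yes s = subst (ℕ._< n) (sym (changed s)) (h u)
      ... | no ns = subst (ℕ._< n) (sym (kept ns)) (h x)
      inv : KruskalInvariant σ → KruskalInvariant σ′
      inv (inj₂ (b , ¬nc)) = inj₂ (trans bad-kept b , ¬nc)
      inv (inj₁ (b , forest , h)) = inj₁ (trans bad-kept b ,
        Merge.merged forest e u≁v old-edge (proj₁ new-edge) (proj₂ new-edge)
        edge-cases changed kept
        (λ {x} {y} same → ≡⇒≈ (proj₂ (proj₂ (joined {x} {y}))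
          (λ { (a , b) → u≁v (trans (sym a) (trans same b)) })
            (λ { (a , b) → u≁v (trans (sym b) (trans (sym same) a)) })))
        (λ {x} {y} a b → ≡⇒≈ (trans (proj₁ (joined {x} {y}) (a , b))
          (cong (λ w → (path-weight σ x u + w) + path-weight σ v y) (arc-weight uv))))
        (λ {x} {y} a b → ≡⇒≈ (trans (proj₁ (proj₂ (joined {x} {y})) (a , b))
          (cong (λ w → (path-weight σ x v + w) + path-weight σ u y) (arc-weight vu)))) ,
        small h)

  kruskal : ∀ {σ} → Input σ → (∀ u v → nat σ edgeᴬ (toℕ u) (toℕ v) ≡ 0) →
    (∀ u → path-weight σ u u ≡ 0#) → bad σ ≡ 0 →
            Exec KRUSKAL σ (0 , 4) (λ σ′ → KruskalInvariant σ′ × ∀ u v → Treated u v σ′)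
  kruskal {σ} inp no-edges no-paths good =
    slower tt (Each.for-fin labels (λ u σ′ → tree σ′ u ≡ toℕ u) (record {}) (Input.size-n inp) (λ _ h → h)
      (λ le h → le _ h)
      λ u {σ′} fr xu le → exec-nat {e = 0 , 0} (written u {σ′} xu)) then-do λ {σ₁} fr₁ (_ , labelled) →
    let inp₁ = input-kept refl refl refl fr₁ inp in
    consequence (λ { _ (g , t) → invariant g (start fr₁ labelled) , t })
      (for-fin₂ Treated (record {}) (record {}) (Input.size-n inp₁)
        (grows (λ h → h) (λ h → h) (λ h → h)) (grows (λ h → h) (λ h → h) (λ h → h)) treated-stays
        λ u v fr xu xv _ → link u v (input-kept refl refl refl fr inp₁) xu xv)
    where
    labels : Evolution
    labels = record { _≼_ = λ σ σ′ → ∀ u → tree σ u ≡ toℕ u → tree σ′ u ≡ toℕ u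
                    ; ≼-refl = λ _ h → h ; ≼-trans = λ f g u h → g u (f u h) }
    written : ∀ u {σ′} → nat σ′ xᵛ 0 0 ≡ toℕ u →
      let σ″ = ⟨ write (nat σ′) treeᴬ (nat σ′ xᵛ 0 0) 0 (nat σ′ xᵛ 0 0) , wt σ′ ⟩ in
      (∀ u → tree σ′ u ≡ toℕ u → tree σ″ u ≡ toℕ u) × tree σ″ u ≡ toℕ u
    written u {σ′} xu = others , mine
      where
      others : ∀ v → tree σ′ v ≡ toℕ v → _
      others v h with write-cases (nat σ′) treeᴬ (nat σ′ xᵛ 0 0) 0 (nat σ′ xᵛ 0 0) (toℕ v) 0
      ... | inj₁ (e , _ , h′) = trans h′ (sym e)
      ... | inj₂ (_ , h′) = trans h′ h
      mine : write (nat σ′) treeᴬ (nat σ′ xᵛ 0 0) 0 (nat σ′ xᵛ 0 0) treeᴬ (toℕ u) 0 ≡ toℕ u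
      mine with write-cases (nat σ′) treeᴬ (nat σ′ xᵛ 0 0) 0 (nat σ′ xᵛ 0 0) (toℕ u) 0
      ... | inj₁ (e , _ , h′) = trans h′ (sym e)
      ... | inj₂ (ne , _) = ⊥-elim (ne (sym xu , refl))
    start : ∀ {σ₁} → Frame _ σ σ₁ → (∀ u → tree σ₁ u ≡ toℕ u) → KruskalInvariant σ₁
    start {σ₁} fr labelled = inj₁
      ( trans (cong (λ m → m 0 0) (keepᴺ fr badᵛ refl)) good
      -- The zero-initialised memory already holds the right tree distances: initially every tree is
      -- a single vertex, and only the diagonal matters.
      , empty-forest
          (λ {u} {v} e → zero≢one (trans (sym (trans (cong (λ m → m (toℕ u) (toℕ v)) (keepᴺ fr edgeᴬ refl))
            (no-edges u v))) e))
          (λ {x} {y} e → toℕ-injective (trans (sym (labelled x)) (trans e (labelled y))))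
          (λ x → ≡⇒≈ (trans (cong (λ m → m (toℕ x) (toℕ x)) (keepᵂ fr pathᵂ refl)) (no-paths x)))
      , λ u → subst (ℕ._< n) (sym (labelled u)) (toℕ<n u))
      where
      zero≢one : ¬ 0 ≡ 1
      zero≢one ()

-- Separating vertices of all pairs

module ConnectivityProof (ℝ : RealNumbers) {n : ℕ} (D : Digraph n) (c : Weight ℝ D) (Good : ℕ → Set) where
  open Execution ℝ n Good
  open Digraph D using (Arc)
  open Reading ℝ D c Good
  open Separation D

  On : State ℝ → Rel (Fin n) 0ℓ
  On σ u v = nat σ connᴬ (toℕ u) (toℕ v) ≡ 1

  on? : ∀ σ u v → Dec (On σ u v)
  on? σ u v = nat σ connᴬ (toℕ u) (toℕ v) ℕ.≟ 1

  Agrees : Rel (Fin n) 0ℓ → State ℝ → Set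
  Agrees G σ = ∀ u v → (On σ u v → G u v) × (G u v → On σ u v)

  scalar-kept : ∀ {p σ σ′ a x} → a ∉ᵇ writesᴺ p → Frame p σ σ′ → nat σ a 0 0 ≡ x → nat σ′ a 0 0 ≡ x
  scalar-kept h fr e = trans (cong (λ m → m 0 0) (keepᴺ fr _ h)) e

  fill : ∀ {b σ} (G : Rel (Fin n) 0ℓ) → nat σ sizeᴬ 0 0 ≡ n →
         (∀ u v {σ′} → Frame (FILL b) σ σ′ → nat σ′ iᵛ 0 0 ≡ toℕ u → nat σ′ jᵛ 0 0 ≡ toℕ v →
           (⟦ b ⟧ σ′ → G u v) × (G u v → ⟦ b ⟧ σ′)) →
         Exec (FILL b) σ (0 , 2) (Agrees G)
  fill {b} {σ} G N meaning = consequence (λ _ → proj₂)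
    (for-fin₂ Done (record {}) (record {}) N (λ _ _ h → h) (λ _ _ h → h) (λ {u} {v} le → le u v)
      λ u v {σ′} fr xi xj _ → branch
        (λ g → exec-nat {e = 0 , 0} (written u v {σ′} xi xj 1
          (λ _ → proj₁ (meaning u v fr xi xj) g) (λ _ → refl)))
        (λ ¬g → exec-nat {e = 0 , 0} (written u v {σ′} xi xj 0 (λ ())
          (λ g → ⊥-elim (¬g (proj₂ (meaning u v fr xi xj) g))))))
    where
    Done : Fin n → Fin n → State ℝ → Set
    Done u v σ = (On σ u v → G u v) × (G u v → On σ u v)
    evolution : Evolution
    evolution = record { _≼_ = λ σ σ′ → ∀ u v → Done u v σ → Done u v σ′
                      ; ≼-refl = λ _ _ h → h ; ≼-trans = λ f g u v h → g u v (f u v h) }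
    open Each evolution
    written : ∀ u v {σ′} → nat σ′ iᵛ 0 0 ≡ toℕ u → nat σ′ jᵛ 0 0 ≡ toℕ v → ∀ x → (x ≡ 1 → G u v) →
      (G u v → x ≡ 1) →
      let σ″ = ⟨ write (nat σ′) connᴬ (nat σ′ iᵛ 0 0) (nat σ′ jᵛ 0 0) x , wt σ′ ⟩ in
      (∀ u v → Done u v σ′ → Done u v σ″) × Done u v σ″
    written u v {σ′} xi xj x f g = others , mine
      where
      σ″ : State ℝ
      σ″ = ⟨ write (nat σ′) connᴬ (nat σ′ iᵛ 0 0) (nat σ′ jᵛ 0 0) x , wt σ′ ⟩
      at = write-at {m = nat σ′} {connᴬ} {x} xi xj
      others : ∀ u′ v′ → Done u′ v′ σ′ → Done u′ v′ σ″
      others u′ v′ (a , b) with at u′ v′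
      ... | inj₁ (refl , refl , e) = (λ o → f (trans (sym e) o)) , λ h → trans e (g h)
      ... | inj₂ (_ , e)           = (λ o → a (trans (sym e) o)) , λ h → trans e (b h)
      mine : Done u v σ″
      mine with at u v
      ... | inj₁ (_ , _ , e) = (λ o → f (trans (sym e) o)) , λ h → trans e (g h)
      ... | inj₂ (ne , _)    = ⊥-elim (ne (refl , refl))

  -- The invariant of Warshall's algorithm: after stage m the relation is
  -- transitive through each of the first m vertices.

  warshall : ∀ {σ} → nat σ sizeᴬ 0 0 ≡ n → (∀ u → On σ u u) →
             Exec WARSHALL σ (0 , 3) (λ σ′ → ∀ u v → (On σ′ u v → Star (On σ) u v) ×
               (Star (On σ) u v → On σ′ u v))
  warshall {σ} N reflexive = consequence
    (λ { {τ} _ (sound , ext , tr) u v → sound u v , closure {τ} ext tr })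
    (for-loop Inv (record {}) (polynomial (ℕₚ.n≤1+n n)) N (λ h → h)
      ((λ u v o → o ◅ ε) , (λ u v o → o) , λ k u v ()) stage)
    where
    Inv : ℕ → State ℝ → Set
    Inv m τ = (∀ u v → On τ u v → Star (On σ) u v) × (∀ u v → On σ u v → On τ u v) ×
              (∀ k u v → toℕ k ℕ.< m → On τ u k → On τ k v → On τ u v)
    closure : ∀ {τ} → (∀ u v → On σ u v → On τ u v) → (∀ k u v → toℕ k ℕ.< n → On τ u k → On τ k v → On τ u v) →
              ∀ {u v} → Star (On σ) u v → On τ u v
    closure ext tr {u} ε = ext u u (reflexive u)
    closure {τ} ext tr (_◅_ {j = k} o p) = tr k _ _ (toℕ<n k) (ext _ _ o) (closure {τ} ext tr p)
    stage : ∀ {m σ₁} → m ℕ.< n → Frame WARSHALL σ σ₁ → nat σ₁ kᵛ 0 0 ≡ m → Inv m σ₁ →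
      Exec _ σ₁ (0 , 2) (Inv (suc m))
    stage {m} {σ₁} m<n fr xk (sound , ext , tr) = consequence
      (λ { {τ} _ ((mono , upper) , done) → after {τ} mono (upper (λ u v o → inj₁ o)) done })
      (Each.for-fin₂ evolution Done (record {}) (record {}) (scalar-kept refl fr N)
        ((λ _ _ h → h) , λ h → h) ((λ _ _ h → h) , λ h → h) (λ {u} {v} le d a b → proj₁ le u v (d a b))
        λ u v {σ₂} fr₂ xi xj le → when
          (λ { (g₁ , g₂) → exec-nat {e = 0 , 0} (written u v {σ₂} xi xj (proj₁ (as u v fr₂ xi xj) g₁)
            (proj₂ (as u v fr₂ xi xj) g₂)) })
          (λ ¬g → ((λ _ _ h → h) , λ h → h) , λ a b → ⊥-elim (¬g
            ( trans (cong₂ (nat σ₂ connᴬ) xi (k₂ fr₂)) (proj₁ le u k a)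
            , trans (cong₂ (nat σ₂ connᴬ) (k₂ fr₂) xj) (proj₁ le k v b)))))
      where
      k : Fin n
      k = fromℕ< m<n
      xk′ : nat σ₁ kᵛ 0 0 ≡ toℕ k
      xk′ = trans xk (sym (toℕ-fromℕ< m<n))
      Done : Fin n → Fin n → State ℝ → Set
      Done u v τ = On σ₁ u k → On σ₁ k v → On τ u v
      -- Stage `k` works in place. It does not change row and column `k`, because a new entry there
      -- presupposes the very entry it would set; hence all pairs are judged by the relation before
      -- the stage.
      Upper : State ℝ → Set
      Upper τ = ∀ u v → On τ u v → On σ₁ u v ⊎ (On σ₁ u k × On σ₁ k v)
      evolution : Evolution
      evolution = record { _≼_ = λ τ τ′ → (∀ u v → On τ u v → On τ′ u v) × (Upper τ → Upper τ′)
                         ; ≼-refl = (λ _ _ h → h) , λ h → h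
                         ; ≼-trans = λ { (f , g) (f′ , g′) → (λ u v h → f′ u v (f u v h)) , λ h → g′ (g h) } }
      k₂ : ∀ {σ₂} → Frame STAGE σ₁ σ₂ → nat σ₂ kᵛ 0 0 ≡ toℕ k
      k₂ fr₂ = scalar-kept refl fr₂ xk′
      as : ∀ u v {σ₂} → Frame STAGE σ₁ σ₂ → nat σ₂ iᵛ 0 0 ≡ toℕ u → nat σ₂ jᵛ 0 0 ≡ toℕ v →
           (nat σ₂ connᴬ (nat σ₂ iᵛ 0 0) (nat σ₂ kᵛ 0 0) ≡ 1 → On σ₂ u k) ×
           (nat σ₂ connᴬ (nat σ₂ kᵛ 0 0) (nat σ₂ jᵛ 0 0) ≡ 1 → On σ₂ k v)
      as u v {σ₂} fr₂ xi xj = (λ g → trans (sym (cong₂ (nat σ₂ connᴬ) xi (k₂ fr₂))) g) ,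
                              (λ g → trans (sym (cong₂ (nat σ₂ connᴬ) (k₂ fr₂) xj)) g)
      written : ∀ u v {σ₂} → nat σ₂ iᵛ 0 0 ≡ toℕ u → nat σ₂ jᵛ 0 0 ≡ toℕ v → On σ₂ u k → On σ₂ k v →
        let σ₃ = ⟨ write (nat σ₂) connᴬ (nat σ₂ iᵛ 0 0) (nat σ₂ jᵛ 0 0) 1 , wt σ₂ ⟩ in
        ((∀ u v → On σ₂ u v → On σ₃ u v) × (Upper σ₂ → Upper σ₃)) × Done u v σ₃
      written u v {σ₂} xi xj uk kv = (mono , upper) , λ _ _ → mine
        where
        σ₃ : State ℝ
        σ₃ = ⟨ write (nat σ₂) connᴬ (nat σ₂ iᵛ 0 0) (nat σ₂ jᵛ 0 0) 1 , wt σ₂ ⟩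
        at : ∀ u′ v′ → (u′ ≡ u × v′ ≡ v × On σ₃ u′ v′) ⊎ _
        at = write-at {m = nat σ₂} {connᴬ} {1} xi xj
        mono : ∀ u v → On σ₂ u v → On σ₃ u v
        mono u′ v′ o with at u′ v′
        ... | inj₁ (_ , _ , e) = e
        ... | inj₂ (_ , e) = trans e o
        left : On σ₁ u k ⊎ (On σ₁ u k × On σ₁ k k) → On σ₁ u k
        left (inj₁ a) = a
        left (inj₂ (a , _)) = a
        right : On σ₁ k v ⊎ (On σ₁ k k × On σ₁ k v) → On σ₁ k v
        right (inj₁ a) = a
        right (inj₂ (_ , a)) = a
        upper : Upper σ₂ → Upper σ₃
        upper h u′ v′ o with at u′ v′
        ... | inj₁ (refl , refl , _) = inj₂ (left (h u k uk) , right (h k v kv))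
        ... | inj₂ (_ , e) = h u′ v′ (trans (sym e) o)
        mine : On σ₃ u v
        mine with at u v
        ... | inj₁ (_ , _ , e) = e
        ... | inj₂ (ne , _) = ⊥-elim (ne (refl , refl))
      after : ∀ {τ} → (∀ u v → On σ₁ u v → On τ u v) → Upper τ → (∀ u v → Done u v τ) → Inv (suc m) τ
      after {τ} mono upper done = sound′ , (λ u v o → mono u v (ext u v o)) , tr′
        where
        sound′ : ∀ u v → On τ u v → Star (On σ) u v
        sound′ u v o with upper u v o
        ... | inj₁ a = sound u v a
        ... | inj₂ (a , b) = sound u k a ◅◅ sound k v b
        tr′ : ∀ l u v → toℕ l ℕ.< suc m → On τ u l → On τ l v → On τ u v
        tr′ l u v (s≤s l≤m) ul lv with upper u l ul | upper l v lv | ℕₚ.m≤n⇒m<n∨m≡n l≤m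
        ... | inj₁ a | inj₁ b | inj₁ l<m = mono u v (tr l u v l<m a b)
        ... | inj₁ a | inj₂ (b , d) | inj₁ l<m = done u v (tr l u k l<m a b) d
        ... | inj₂ (a , b) | inj₁ d | inj₁ l<m = done u v a (tr l k v l<m b d)
        ... | inj₂ (a , b) | inj₂ (_ , d) | inj₁ l<m = done u v a d
        ... | p | q | inj₂ l≡m with toℕ-injective (trans l≡m (sym (toℕ-fromℕ< m<n)))
        ...   | refl = done u v (first p) (second q)
          where
          first : On σ₁ u k ⊎ (On σ₁ u k × On σ₁ k k) → On σ₁ u k
          first (inj₁ a) = a
          first (inj₂ (a , _)) = a
          second : On σ₁ k v ⊎ (On σ₁ k k × On σ₁ k v) → On σ₁ k v
          second (inj₁ a) = a
          second (inj₂ (_ , a)) = a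

  Reach : State ℝ → Rel (Fin n) 0ℓ
  Reach σ u v = nat σ reachᴬ (toℕ u) (toℕ v) ≡ 1

  ReachCorrect : State ℝ → Set
  ReachCorrect σ = ∀ u v → (Reach σ u v → Star Arc u v) × (Star Arc u v → Reach σ u v)

  close : ∀ {σ} (G : Rel (Fin n) 0ℓ) → nat σ sizeᴬ 0 0 ≡ n → Agrees (λ u v → u ≡ v ⊎ G u v) σ →
          Exec WARSHALL σ (0 , 3) (Agrees (Star G))
  close {σ} G N agrees = consequence (λ _ h u v → (λ o → down (proj₁ (h u v) o)) , λ p → proj₂ (h u v) (up p))
    (warshall {σ} N (λ u → proj₂ (agrees u u) (inj₁ refl)))
    where
    down : ∀ {u v} → Star (On σ) u v → Star G u v
    down ε = ε
    down (o ◅ p) with proj₁ (agrees _ _) o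
    ... | inj₁ refl = down p
    ... | inj₂ g    = g ◅ down p
    up : ∀ {u v} → Star G u v → Star (On σ) u v
    up ε = ε
    up (g ◅ p) = proj₂ (agrees _ _) (inj₂ g) ◅ up p

  -- `_or_` is built from negation and conjunction, so its meaning is only a double negation, which
  -- decidability resolves.
  or-elim : ∀ {A B : Set} → Dec A → Dec B → ¬ (¬ A × ¬ B) → A ⊎ B
  or-elim (yes a) _ _ = inj₁ a
  or-elim (no ¬a) (yes b) _ = inj₂ b
  or-elim (no ¬a) (no ¬b) h = ⊥-elim (h (¬a , ¬b))

  or-intro : ∀ {A B : Set} → A ⊎ B → ¬ (¬ A × ¬ B)
  or-intro (inj₁ a) (¬a , _) = ¬a a
  or-intro (inj₂ b) (_ , ¬b) = ¬b b

  copy : ∀ {σ} → nat σ sizeᴬ 0 0 ≡ n →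
         Exec COPY σ (0 , 2) (λ σ′ → ∀ u v → nat σ′ reachᴬ (toℕ u) (toℕ v) ≡ nat σ connᴬ (toℕ u) (toℕ v))
  copy {σ} N = consequence (λ _ → proj₂)
    (for-fin₂ Done (record {}) (record {}) N (λ _ _ h → h) (λ _ _ h → h) (λ {u} {v} le → le u v)
      λ u v {σ′} fr xi xj _ → exec-nat {e = 0 , 0} (written u v {σ′} fr xi xj))
    where
    Done : Fin n → Fin n → State ℝ → Set
    Done u v σ′ = nat σ′ reachᴬ (toℕ u) (toℕ v) ≡ nat σ connᴬ (toℕ u) (toℕ v)
    evolution : Evolution
    evolution = record { _≼_ = λ σ σ′ → ∀ u v → Done u v σ → Done u v σ′
                      ; ≼-refl = λ _ _ h → h ; ≼-trans = λ f g u v h → g u v (f u v h) }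
    open Each evolution
    written : ∀ u v {σ′} → Frame COPY σ σ′ → nat σ′ iᵛ 0 0 ≡ toℕ u → nat σ′ jᵛ 0 0 ≡ toℕ v →
      let σ″ = ⟨ write (nat σ′) reachᴬ (nat σ′ iᵛ 0 0) (nat σ′ jᵛ 0 0) (nat σ′ connᴬ (nat σ′ iᵛ 0 0) (nat σ′ jᵛ 0 0)) , wt σ′ ⟩ in
      (∀ u v → Done u v σ′ → Done u v σ″) × Done u v σ″
    written u v {σ′} fr xi xj = others , mine
      where
      σ″ : State ℝ
      σ″ = ⟨ write (nat σ′) reachᴬ (nat σ′ iᵛ 0 0) (nat σ′ jᵛ 0 0)
        (nat σ′ connᴬ (nat σ′ iᵛ 0 0) (nat σ′ jᵛ 0 0)) , wt σ′ ⟩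
      at = write-at {m = nat σ′} {reachᴬ} {nat σ′ connᴬ (nat σ′ iᵛ 0 0) (nat σ′ jᵛ 0 0)} xi xj
      value : nat σ′ connᴬ (nat σ′ iᵛ 0 0) (nat σ′ jᵛ 0 0) ≡ nat σ connᴬ (toℕ u) (toℕ v)
      value = trans (cong₂ (nat σ′ connᴬ) xi xj) (cong (λ m → m (toℕ u) (toℕ v)) (keepᴺ fr connᴬ refl))
      others : ∀ u′ v′ → Done u′ v′ σ′ → Done u′ v′ σ″
      others u′ v′ d with at u′ v′
      ... | inj₁ (refl , refl , e) = trans e value
      ... | inj₂ (_ , e)           = trans e d
      mine : Done u v σ″
      mine with at u v
      ... | inj₁ (_ , _ , e) = trans e value
      ... | inj₂ (ne , _)    = ⊥-elim (ne (refl , refl))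

  reach : ∀ {σ} → Input σ → Exec REACH σ (0 , 3) ReachCorrect
  reach {σ} inp =
    slower tt (fill (λ u v → u ≡ v ⊎ Arc u v) (Input.size-n inp) meaning) then-do λ {σ₁} fr₁ agrees →
    close Arc (scalar-kept refl fr₁ (Input.size-n inp)) agrees then-do λ {σ₂} fr₂ closed →
    slower tt (consequence (λ { _ h u v → (λ r → proj₁ (closed u v) (trans (sym (h u v)) r)) ,
                                          λ p → trans (h u v) (proj₂ (closed u v) p) })
      (copy (scalar-kept refl fr₂ (scalar-kept refl fr₁ (Input.size-n inp)))))
    where
    meaning : ∀ u v {σ′} → Frame (FILL arc?) σ σ′ → nat σ′ iᵛ 0 0 ≡ toℕ u → nat σ′ jᵛ 0 0 ≡ toℕ v →
              (⟦ arc? ⟧ σ′ → u ≡ v ⊎ Arc u v) × (u ≡ v ⊎ Arc u v → ⟦ arc? ⟧ σ′)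
    meaning u v {σ′} fr xi xj = to , from
      where
      inp′ = input-kept refl refl refl fr inp
      to : ⟦ arc? ⟧ σ′ → u ≡ v ⊎ Arc u v
      to h with or-elim (_ ℕ.≟ _) (_ ℕ.≟ _) h
      ... | inj₁ e = inj₁ (toℕ-injective (trans (sym xi) (trans e xj)))
      ... | inj₂ a = inj₂ (Input.adj⇒arc inp′ (trans (sym (cong₂ (nat σ′ adjᴬ) xi xj)) a))
      from : u ≡ v ⊎ Arc u v → ⟦ arc? ⟧ σ′
      from (inj₁ refl) = or-intro (inj₁ (trans xi (sym xj)))
      from (inj₂ a) = or-intro (inj₂ (trans (cong₂ (nat σ′ adjᴬ) xi xj) (Input.arc⇒adj inp′ a)))

  sep : State ℝ → Fin n → Fin n → ℕ
  sep σ u v = nat σ sepᴬ (toℕ u) (toℕ v)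

  -- z is one more than the last w < m separating u and v, or 0.

  LastSeparator : ℕ → Fin n → Fin n → ℕ → Set
  LastSeparator m u v z = (∀ w → w ℕ.< m → z ℕ.≤ w → toℕ u ≢ w → toℕ v ≢ w → Conn w u v) ×
                          (∀ w → z ≡ suc w → w ℕ.< m × toℕ u ≢ w × toℕ v ≢ w × ¬ Conn w u v)

  separate : ∀ {σ} w → nat σ sizeᴬ 0 0 ≡ n → nat σ wᵛ 0 0 ≡ w → Agrees (Conn w) σ →
             (∀ u v → LastSeparator w u v (sep σ u v)) →
             Exec SEPARATE σ (0 , 2) (λ σ′ → ∀ u v → LastSeparator (suc w) u v (sep σ′ u v))
  separate {σ} w N xw agrees before = consequence (λ _ → proj₂)
    (for-fin₂ Done (record {}) (record {}) N (λ _ _ → (λ h → h) , λ h → h) (λ _ _ → (λ h → h) , λ h → h)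
      (λ {u} {v} le → proj₂ (le u v))
      λ u v {σ′} fr xi xj le → when
        (λ { (g₁ , g₂ , g₃) → exec-nat {e = 0 , 0} (written u v {σ′} xi xj
          (new u v {σ′} fr xi xj g₁ g₂ g₃)) })
        (λ ¬g → (λ _ _ → (λ h → h) , λ h → h) , keep u v {σ′} fr xi xj ¬g (proj₁ (le u v) (inj₁ (before u v)))))
    where
    Done : Fin n → Fin n → State ℝ → Set
    Done u v τ = LastSeparator (suc w) u v (sep τ u v)
    -- A pair that the loop has not visited still satisfies the condition for `w`, a visited one
    -- that for `suc w`; no record of the visited pairs is kept.
    Open : Fin n → Fin n → State ℝ → Set
    Open u v τ = LastSeparator w u v (sep τ u v) ⊎ Done u v τ
    evolution : Evolution
    evolution = record { _≼_ = λ τ τ′ → ∀ u v → (Open u v τ → Open u v τ′) × (Done u v τ → Done u v τ′)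
                      ; ≼-refl = λ _ _ → (λ h → h) , λ h → h
                      ; ≼-trans = λ f g u v → (λ h → proj₁ (g u v) (proj₁ (f u v) h)) , λ h →
                        proj₂ (g u v) (proj₂ (f u v) h) }
    open Each evolution
    w-kept : ∀ {σ′} → Frame SEPARATE σ σ′ → nat σ′ wᵛ 0 0 ≡ w
    w-kept fr = scalar-kept refl fr xw
    on-kept : ∀ u v {σ′} → Frame SEPARATE σ σ′ → nat σ′ iᵛ 0 0 ≡ toℕ u → nat σ′ jᵛ 0 0 ≡ toℕ v →
              nat σ′ connᴬ (nat σ′ iᵛ 0 0) (nat σ′ jᵛ 0 0) ≡ nat σ connᴬ (toℕ u) (toℕ v)
    on-kept u v {σ′} fr xi xj = trans (cong₂ (nat σ′ connᴬ) xi xj)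
      (cong (λ m → m (toℕ u) (toℕ v)) (keepᴺ fr connᴬ refl))
    new : ∀ u v {σ′} → Frame SEPARATE σ σ′ → nat σ′ iᵛ 0 0 ≡ toℕ u → nat σ′ jᵛ 0 0 ≡ toℕ v →
          nat σ′ iᵛ 0 0 ≢ nat σ′ wᵛ 0 0 → nat σ′ jᵛ 0 0 ≢ nat σ′ wᵛ 0 0 →
          ¬ nat σ′ connᴬ (nat σ′ iᵛ 0 0) (nat σ′ jᵛ 0 0) ≡ 1 → LastSeparator (suc w) u v (nat σ′ wᵛ 0 0 ℕ.+ 1)
    new u v {σ′} fr xi xj g₁ g₂ g₃ = subst (LastSeparator (suc w) u v)
      (sym (trans (cong (ℕ._+ 1) (w-kept fr)) (ℕₚ.+-comm w 1)))
      ((λ w′ w′≤ w< → ⊥-elim (ℕₚ.<-irrefl refl (ℕₚ.≤-trans w′≤ w<))) ,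
       λ { _ refl → ℕₚ.≤-refl , (λ e → g₁ (trans xi (trans e (sym (w-kept fr))))) ,
                    (λ e → g₂ (trans xj (trans e (sym (w-kept fr))))) ,
                    λ p → g₃ (trans (on-kept u v fr xi xj) (proj₂ (agrees u v) p)) })
    keep : ∀ u v {σ′} → Frame SEPARATE σ σ′ → nat σ′ iᵛ 0 0 ≡ toℕ u → nat σ′ jᵛ 0 0 ≡ toℕ v →
           ¬ _ → Open u v σ′ → Done u v σ′
    keep u v fr xi xj ¬g (inj₂ d) = d
    keep u v {σ′} fr xi xj ¬g (inj₁ (f , h)) = f′ , λ w′ e → let a , b = h w′ e in ℕₚ.m≤n⇒m≤1+n a , b
      where
      f′ : ∀ w′ → w′ ℕ.< suc w → sep σ′ u v ℕ.≤ w′ → toℕ u ≢ w′ → toℕ v ≢ w′ → Conn w′ u v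
      f′ w′ (s≤s w′≤w) z≤ u≢ v≢ with ℕₚ.m≤n⇒m<n∨m≡n w′≤w
      ... | inj₁ w′<w = f w′ w′<w z≤ u≢ v≢
      ... | inj₂ refl with on? σ u v
      ...   | yes o = proj₁ (agrees u v) o
      ...   | no ¬o = ⊥-elim (¬g ((λ e → u≢ (trans (sym xi) (trans e (w-kept fr)))) ,
                                  (λ e → v≢ (trans (sym xj) (trans e (w-kept fr)))) ,
                                  λ e → ¬o (trans (sym (on-kept u v fr xi xj)) e)))
    written : ∀ u v {σ′ z} → nat σ′ iᵛ 0 0 ≡ toℕ u → nat σ′ jᵛ 0 0 ≡ toℕ v → LastSeparator (suc w) u v z →
      let σ″ = ⟨ write (nat σ′) sepᴬ (nat σ′ iᵛ 0 0) (nat σ′ jᵛ 0 0) z , wt σ′ ⟩ in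
      (∀ u v → (Open u v σ′ → Open u v σ″) × (Done u v σ′ → Done u v σ″)) × Done u v σ″
    written u v {σ′} {z} xi xj ls = others , mine
      where
      σ″ : State ℝ
      σ″ = ⟨ write (nat σ′) sepᴬ (nat σ′ iᵛ 0 0) (nat σ′ jᵛ 0 0) z , wt σ′ ⟩
      at = write-at {m = nat σ′} {sepᴬ} {z} xi xj
      others : ∀ u′ v′ → (Open u′ v′ σ′ → Open u′ v′ σ″) × (Done u′ v′ σ′ → Done u′ v′ σ″)
      others u′ v′ with at u′ v′
      ... | inj₁ (refl , refl , e) = (λ _ → inj₂ (subst (LastSeparator (suc w) u v) (sym e) ls)) ,
                                     λ _ → subst (LastSeparator (suc w) u v) (sym e) ls
      ... | inj₂ (_ , e) = (λ { (inj₁ h) → inj₁ (subst (LastSeparator w u′ v′) (sym e) h)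
                              ; (inj₂ h) → inj₂ (subst (LastSeparator (suc w) u′ v′) (sym e) h) }) ,
                           subst (LastSeparator (suc w) u′ v′) (sym e)
      mine : Done u v σ″
      mine with at u v
      ... | inj₁ (_ , _ , e) = subst (LastSeparator (suc w) u v) (sym e) ls
      ... | inj₂ (ne , _)    = ⊥-elim (ne (refl , refl))

  separators : ∀ {σ} → Input σ → nat σ size⁺ᵛ 0 0 ≡ suc n → ReachCorrect σ → (∀ u v → sep σ u v ≡ 0) →
               Exec SEPARATORS σ (0 , 4) (λ σ′ → ∀ u v → LastSeparator (suc n) u v (sep σ′ u v))
  separators {σ} inp N⁺ correct zeros = for-loop (λ w τ → ∀ u v → LastSeparator w u v (sep τ u v)) (record {})
    (polynomial ℕₚ.≤-refl) N⁺ (λ h → h)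
    (λ u v → (λ w ()) , λ w e → ⊥-elim (zero≢suc (trans (sym (zeros u v)) e)))
    λ {w} {σ₁} w< fr xw before →
      let inp₁ = input-kept refl refl refl fr inp in
      slower tt (fill (λ u v → u ≡ v ⊎ Avoid w u v) (Input.size-n inp₁) (meaning w {σ₁} fr xw)) then-do
        λ {σ₂} fr₂ agrees →
      close (Avoid w) (scalar-kept refl fr₂ (Input.size-n inp₁)) agrees then-do λ {σ₃} fr₃ closed →
      slower tt (separate w (scalar-kept refl fr₃ (scalar-kept refl fr₂ (Input.size-n inp₁)))
        (scalar-kept refl fr₃ (scalar-kept refl fr₂ xw)) closed
        (λ u v → subst (LastSeparator w u v)
          (sym (cong (λ m → m (toℕ u) (toℕ v)) (trans (keepᴺ fr₃ sepᴬ refl)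
            (keepᴺ fr₂ sepᴬ refl)))) (before u v)))
    where
    zero≢suc : ∀ {w} → ¬ 0 ≡ suc w
    zero≢suc ()
    meaning : ∀ w {σ₁} → Frame SEPARATORS σ σ₁ → nat σ₁ wᵛ 0 0 ≡ w →
              ∀ u v {σ′} → Frame (FILL link?) σ₁ σ′ → nat σ′ iᵛ 0 0 ≡ toℕ u → nat σ′ jᵛ 0 0 ≡ toℕ v →
              (⟦ link? ⟧ σ′ → u ≡ v ⊎ Avoid w u v) × (u ≡ v ⊎ Avoid w u v → ⟦ link? ⟧ σ′)
    meaning w {σ₁} fr xw u v {σ′} fr′ xi xj = to , from
      where
      inp′ = input-kept refl refl refl fr′ (input-kept refl refl refl fr inp)
      w′ : nat σ′ wᵛ 0 0 ≡ w
      w′ = scalar-kept refl fr′ xw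
      R : ∀ {x y} {i j} → nat σ′ i 0 0 ≡ toℕ x → nat σ′ j 0 0 ≡ toℕ y →
          nat σ′ reachᴬ (nat σ′ i 0 0) (nat σ′ j 0 0) ≡ nat σ reachᴬ (toℕ x) (toℕ y)
      R {x} {y} xi xj = trans (cong₂ (nat σ′ reachᴬ) xi xj)
        (cong (λ m → m (toℕ x) (toℕ y)) (trans (keepᴺ fr′ reachᴬ refl) (keepᴺ fr reachᴬ refl)))
      A-uv = cong₂ (nat σ′ adjᴬ) xi xj
      A-vu = cong₂ (nat σ′ adjᴬ) xj xi
      R-uv = R {u} {v} {iᵛ} {jᵛ} xi xj
      R-vu = R {v} {u} {jᵛ} {iᵛ} xj xi
      to : ⟦ link? ⟧ σ′ → u ≡ v ⊎ Avoid w u v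
      to h with (nat σ′ iᵛ 0 0) ℕ.≟ (nat σ′ jᵛ 0 0)
      ... | yes e = inj₁ (toℕ-injective (trans (sym xi) (trans e xj)))
      ... | no ne = inj₂ (decide (adj?) )
        where
        Body = nat σ′ iᵛ 0 0 ≢ nat σ′ wᵛ 0 0 × nat σ′ jᵛ 0 0 ≢ nat σ′ wᵛ 0 0 ×
               ¬ (¬ nat σ′ adjᴬ (nat σ′ iᵛ 0 0) (nat σ′ jᵛ 0 0) ≡ 1 ×
                 ¬ nat σ′ adjᴬ (nat σ′ jᵛ 0 0) (nat σ′ iᵛ 0 0) ≡ 1) ×
               nat σ′ reachᴬ (nat σ′ iᵛ 0 0) (nat σ′ jᵛ 0 0) ≡ 1 ×
                 nat σ′ reachᴬ (nat σ′ jᵛ 0 0) (nat σ′ iᵛ 0 0) ≡ 1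
        open import Relation.Nullary.Decidable using (_×-dec_; ¬?)
        adj? : Dec Body
        adj? = ¬? (_ ℕ.≟ _) ×-dec ¬? (_ ℕ.≟ _) ×-dec ¬? (¬? (_ ℕ.≟ _) ×-dec ¬? (_ ℕ.≟ _)) ×-dec
          (_ ℕ.≟ _) ×-dec (_ ℕ.≟ _)
        decide : Dec Body → Avoid w u v
        decide (no ¬b) = ⊥-elim (h (ne , ¬b))
        decide (yes (u≢ , v≢ , a , r , r′)) = (λ e → u≢ (trans xi (trans e (sym w′)))) ,
          (λ e → v≢ (trans xj (trans e (sym w′)))) ,
          adjacent (or-elim (_ ℕ.≟ _) (_ ℕ.≟ _) a) , proj₁ (correct u v) (trans (sym R-uv) r) ,
            proj₁ (correct v u) (trans (sym R-vu) r′)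
          where
          adjacent : _ ⊎ _ → Digraph.Adjacent D u v
          adjacent (inj₁ a) = inj₁ (Input.adj⇒arc inp′ (trans (sym A-uv) a))
          adjacent (inj₂ a) = inj₂ (Input.adj⇒arc inp′ (trans (sym A-vu) a))
      from : u ≡ v ⊎ Avoid w u v → ⟦ link? ⟧ σ′
      from (inj₁ refl) = or-intro (inj₁ (trans xi (sym xj)))
      from (inj₂ (u≢ , v≢ , adj , r , r′)) = or-intro (inj₂ ((λ e → u≢ (trans (sym xi) (trans e w′))) ,
        (λ e → v≢ (trans (sym xj) (trans e w′))) , or-intro (adjacent adj) ,
        trans R-uv (proj₂ (correct u v) r) , trans R-vu (proj₂ (correct v u) r′)))
        where
        adjacent : Digraph.Adjacent D u v → _ ⊎ _
        adjacent (inj₁ a) = inj₁ (trans A-uv (Input.arc⇒adj inp′ a))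
        adjacent (inj₂ a) = inj₂ (trans A-vu (Input.arc⇒adj inp′ a))

-- Numbering the trees around a source

module NumberingProof (ℝ : RealNumbers) {n : ℕ} (D : Digraph n) (c : Weight ℝ D) (Good : ℕ → Set)
                      (tr : Fin n → ℕ) (tr<n : ∀ u → tr u ℕ.< n) (_∼?_ : Decidable₂ (Separation._∼_ D)) where
  open Execution ℝ n Good
  open Separation D using (_∼_)
  open ConnectivityProof ℝ D c Good using (scalar-kept; sep)
  open KruskalProof ℝ D c Good using (tree)
  open Sharing D tr

  shared? : ∀ s u → Dec (Shared s u)
  shared? s u = (s ∼? u) ×-dec (¬? (tr u ℕ.≟ tr s) ×-dec
    anyꟳ? (λ u′ → ¬? (u′ ≟ꟳ u) ×-dec ((s ∼? u′) ×-dec (tr u′ ℕ.≟ tr u))))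

  earlier? : ∀ s u l → Dec (Earlier s u l)
  earlier? s u l = (l ℕ.<? tr u) ×-dec anyꟳ? (λ u′ → shared? s u′ ×-dec ((tr u′ ℕ.≟ l) ×-dec (u′ ∼? u)))

  number : Fin n → Fin n → ℕ
  number s u = if does (shared? s u) then suc (count (λ l → does (earlier? s u l)) n) else 0

  number-shared : ∀ s v → Shared s v → number s v ≡ suc (count (λ l → does (earlier? s v l)) n)
  number-shared s v h rewrite dec-true (shared? s v) h = refl

  number-other : ∀ s v → ¬ Shared s v → number s v ≡ 0
  number-other s v h rewrite dec-false (shared? s v) h = refl

  count≤ : ∀ (f : ℕ → Bool) m → count f m ℕ.≤ m
  count≤ f zero = z≤n
  count≤ f (suc m) with f m
  ... | true  = s≤s (count≤ f m)
  ... | false = ℕₚ.m≤n⇒m≤1+n (count≤ f m)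

  -- The label of `u` is never counted, which makes up for the leading `suc`. Columns 0 to `n` of
  -- the digit table therefore suffice.
  number≤n : ∀ s u → number s u ℕ.≤ n
  number≤n s u with does (shared? s u)
  ... | false = z≤n
  ... | true  = ℕₚ.<-≤-trans (count-strict {g = λ _ → true} n (λ _ → refl) (tr<n u)
    (dec-false (earlier? s u (tr u)) (λ e → ℕₚ.<-irrefl refl (proj₁ e))) refl) (count≤ _ n)

  record Landscape (s : Fin n) (σ : State ℝ) : Set where
    field
      size-is : nat σ sizeᴬ 0 0 ≡ n
      size⁺-is : nat σ size⁺ᵛ 0 0 ≡ suc n
      s-is    : nat σ sᵛ 0 0 ≡ toℕ s
      tree-is : ∀ u → tree σ u ≡ tr u
      sep-is  : ∀ u v → (sep σ u v ≡ 0 → u ∼ v) × (u ∼ v → sep σ u v ≡ 0)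

    module _ {x : ℕ} {u : Fin n} (xu : nat σ x 0 0 ≡ toℕ u) where

      tree-at : nat σ treeᴬ (nat σ x 0 0) 0 ≡ tr u
      tree-at = trans (cong (λ i → nat σ treeᴬ i 0) xu) (tree-is u)

      tree-s : nat σ treeᴬ (nat σ sᵛ 0 0) 0 ≡ tr s
      tree-s = trans (cong (λ i → nat σ treeᴬ i 0) s-is) (tree-is s)

      near⁻ : nat σ sepᴬ (nat σ sᵛ 0 0) (nat σ x 0 0) ≡ 0 → s ∼ u
      near⁻ h = proj₁ (sep-is s u) (trans (sym (cong₂ (nat σ sepᴬ) s-is xu)) h)

      near⁺ : s ∼ u → nat σ sepᴬ (nat σ sᵛ 0 0) (nat σ x 0 0) ≡ 0
      near⁺ h = trans (cong₂ (nat σ sepᴬ) s-is xu) (proj₂ (sep-is s u) h)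

      local⁻ : ⟦ local x ⟧ σ → s ∼ u × tr u ≢ tr s
      local⁻ (a , b) = near⁻ a , λ e → b (trans tree-at (trans e (sym tree-s)))

      local⁺ : s ∼ u × tr u ≢ tr s → ⟦ local x ⟧ σ
      local⁺ (a , b) = near⁺ a , λ e → b (trans (sym tree-at) (trans e tree-s))

  landscape-kept : ∀ {p σ σ′ s} → sizeᴬ ∉ᵇ writesᴺ p → size⁺ᵛ ∉ᵇ writesᴺ p → sᵛ ∉ᵇ writesᴺ p →
    treeᴬ ∉ᵇ writesᴺ p →
                   sepᴬ ∉ᵇ writesᴺ p → Frame p σ σ′ → Landscape s σ → Landscape s σ′
  landscape-kept a a⁺ b d e fr L = record
    { size-is = scalar-kept a fr size-is
    ; size⁺-is = scalar-kept a⁺ fr size⁺-is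
    ; s-is = scalar-kept b fr s-is
    ; tree-is = λ u → trans (cong (λ m → m (toℕ u) 0) (keepᴺ fr treeᴬ d)) (tree-is u)
    ; sep-is = λ u v → let h = cong (λ m → m (toℕ u) (toℕ v)) (keepᴺ fr sepᴬ e) in
        (λ z → proj₁ (sep-is u v) (trans (sym h) z)) , λ z → trans h (proj₂ (sep-is u v) z) }
    where open Landscape L

  private
    one≢zero : ¬ 1 ≡ 0
    one≢zero ()

  exists : ∀ {b σ} (G : Fin n → Set) → nat σ sizeᴬ 0 0 ≡ n →
           (∀ u {σ′} → Frame (EXISTS uᵛ b) σ σ′ → nat σ′ uᵛ 0 0 ≡ toℕ u → (⟦ b ⟧ σ′ → G u) × (G u → ⟦ b ⟧ σ′)) →
           Exec (EXISTS uᵛ b) σ (0 , 1) (λ σ′ → (nat σ′ flagᵛ 0 0 ≡ 1 × ∃ G) ⊎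
             (nat σ′ flagᵛ 0 0 ≡ 0 × ∀ u → ¬ G u))
  exists {b} {σ} G N meaning =
    exec-nat {Q = _≡ set σ flagᵛ 0} refl then-do λ { fr₀ refl →
    consequence (λ { {τ} _ ((ok , _) , q) → conclude {τ} (ok (inj₁ refl)) q })
      (for-fin Q (record {}) N ((λ h → h) , λ h → h)
        (λ { (_ , m) → λ { (inj₁ e) → inj₁ (m e) ; (inj₂ h) → inj₂ h } })
        λ u fr xu _ → when
          (λ g → exec-nat {e = 0 , 0} (((λ _ → inj₂ (refl , u , proj₁ (meaning u (whole fr₀ fr) xu) g)) ,
            λ _ → refl) , inj₁ refl))
          (λ ¬g → ((λ h → h) , λ h → h) , inj₂ (λ g → ¬g (proj₂ (meaning u (whole fr₀ fr) xu) g)))) }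
    where
    Ok : State ℝ → Set
    Ok τ = nat τ flagᵛ 0 0 ≡ 0 ⊎ (nat τ flagᵛ 0 0 ≡ 1 × ∃ G)
    Q : Fin n → State ℝ → Set
    Q u τ = nat τ flagᵛ 0 0 ≡ 1 ⊎ ¬ G u
    evolution : Evolution
    evolution = record
      { _≼_ = λ τ τ′ → (Ok τ → Ok τ′) × (nat τ flagᵛ 0 0 ≡ 1 → nat τ′ flagᵛ 0 0 ≡ 1)
      ; ≼-refl = (λ h → h) , λ h → h
      ; ≼-trans = λ { (f , g) (f′ , g′) → (λ h → f′ (f h)) , λ h → g′ (g h) } }
    open Each evolution
    whole : ∀ {σ′} → Frame (flagᵛ ≔ litᴺ 0) σ (set σ flagᵛ 0) →
      Frame (EACH uᵛ (WHEN b (flagᵛ ≔ litᴺ 1))) (set σ flagᵛ 0) σ′ →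
            Frame (EXISTS uᵛ b) σ σ′
    whole fr fr′ = frame-trans (frame-left {flagᵛ ≔ litᴺ 0} {EACH uᵛ (WHEN b (flagᵛ ≔ litᴺ 1))} fr)
                               (frame-right {flagᵛ ≔ litᴺ 0} {EACH uᵛ (WHEN b (flagᵛ ≔ litᴺ 1))} fr′)
    conclude : ∀ {τ} → Ok τ → (∀ u → Q u τ) → (nat τ flagᵛ 0 0 ≡ 1 × ∃ G) ⊎ (nat τ flagᵛ 0 0 ≡ 0 × ∀ u → ¬ G u)
    conclude (inj₂ h) q = inj₁ h
    conclude {τ} (inj₁ z) q = inj₂ (z , none)
      where
      none : ∀ u → ¬ G u
      none u g with q u
      ... | inj₁ e = one≢zero (trans (sym e) z)
      ... | inj₂ ¬g = ¬g g

  column : ℕ → State ℝ → Fin n → ℕ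
  column a σ u = nat σ a (toℕ u) 0

  write-column : ∀ {m : Memory ℕ} {a i x} {u : Fin n} → i ≡ toℕ u → ∀ v →
                 (v ≡ u × write m a i 0 x a (toℕ v) 0 ≡ x) ⊎ (v ≢ u × write m a i 0 x a (toℕ v) 0 ≡ m a (toℕ v) 0)
  write-column {m} {a} {x = x} {u} refl v with write-cases m a (toℕ u) 0 x (toℕ v) 0
  ... | inj₁ (e , _ , h) = inj₁ (toℕ-injective e , h)
  ... | inj₂ (ne , h)    = inj₂ ((λ { refl → ne (refl , refl) }) , h)

  module _ (s : Fin n) where

    IsShared : Fin n → State ℝ → Set
    IsShared v τ = (column sharedᴬ τ v ≡ 1 → Shared s v) × (Shared s v → column sharedᴬ τ v ≡ 1)

    shared : ∀ {σ} → Landscape s σ → Exec SHARED σ (0 , 2) (λ σ′ → ∀ v → IsShared v σ′)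
    shared {σ} L = consequence (λ _ → proj₂)
      (Each.for-fin evolution IsShared (record {}) (Landscape.size-is L) (λ _ h → h) (λ {v} le → le v)
        λ v {σ₁} fr xv _ →
          let L₁ = landscape-kept refl refl refl refl refl fr L in
          exists (G v) (Landscape.size-is L₁) (λ u {σ′} fr′ xu →
            meaning v u (landscape-kept refl refl refl refl refl fr′ L₁) (scalar-kept refl fr′ xv) xu)
              then-do λ {σ₂} fr₂ flag →
          exec-nat (written v {σ₁} {σ₂} fr₂ (scalar-kept refl fr₂ xv) flag))
      where
      evolution : Evolution
      evolution = record { _≼_ = λ τ τ′ → ∀ v → IsShared v τ → IsShared v τ′ ; ≼-refl = λ _ h →
        h ; ≼-trans = λ f g v h → g v (f v h) }
      G : Fin n → Fin n → Set
      G v u = (s ∼ v × tr v ≢ tr s) × (s ∼ u × tr u ≢ tr s) × u ≢ v × tr u ≡ tr v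
      meaning : ∀ v u {σ′} → Landscape s σ′ → nat σ′ vᵛ 0 0 ≡ toℕ v → nat σ′ uᵛ 0 0 ≡ toℕ u →
                (⟦ local vᵛ and local uᵛ and scalar uᵛ ≢ᴺ scalar vᵛ and treeᴬ ⟪ uᵛ ⟫₁ ≡ᴺ treeᴬ
                  ⟪ vᵛ ⟫₁ ⟧ σ′ → G v u) ×
                (G v u → ⟦ local vᵛ and local uᵛ and scalar uᵛ ≢ᴺ scalar vᵛ and treeᴬ ⟪ uᵛ ⟫₁ ≡ᴺ
                  treeᴬ ⟪ vᵛ ⟫₁ ⟧ σ′)
      meaning v u {σ′} L′ xv xu =
        (λ { (a , b , d , e) → local⁻ {vᵛ} xv a , local⁻ {uᵛ} xu b , (λ { refl → d (trans xu (sym xv)) }) ,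
                               trans (sym (tree-at {uᵛ} xu)) (trans e (tree-at {vᵛ} xv)) }) ,
        (λ { (a , b , d , e) → local⁺ {vᵛ} xv a , local⁺ {uᵛ} xu b ,
          (λ e′ → d (toℕ-injective (trans (sym xu) (trans e′ xv)))) ,
                               trans (tree-at {uᵛ} xu) (trans e (sym (tree-at {vᵛ} xv))) })
        where open Landscape L′
      written : ∀ v {σ₁ σ₂} → Frame (EXISTS uᵛ _) σ₁ σ₂ → nat σ₂ vᵛ 0 0 ≡ toℕ v →
        (nat σ₂ flagᵛ 0 0 ≡ 1 × ∃ (G v)) ⊎ (nat σ₂ flagᵛ 0 0 ≡ 0 × ∀ u → ¬ G v u) →
        let σ₃ = ⟨ write (nat σ₂) sharedᴬ (nat σ₂ vᵛ 0 0) 0 (nat σ₂ flagᵛ 0 0) , wt σ₂ ⟩ in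
        (∀ u → IsShared u σ₁ → IsShared u σ₃) × IsShared v σ₃
      written v {σ₁} {σ₂} fr xv flag = others , mine
        where
        σ₃ : State ℝ
        σ₃ = ⟨ write (nat σ₂) sharedᴬ (nat σ₂ vᵛ 0 0) 0 (nat σ₂ flagᵛ 0 0) , wt σ₂ ⟩
        at : ∀ u → (u ≡ v × column sharedᴬ σ₃ u ≡ nat σ₂ flagᵛ 0 0) ⊎
          (u ≢ v × column sharedᴬ σ₃ u ≡ column sharedᴬ σ₂ u)
        at = write-column {nat σ₂} {sharedᴬ} xv
        here′ : (nat σ₂ flagᵛ 0 0 ≡ 1 × ∃ (G v)) ⊎ (nat σ₂ flagᵛ 0 0 ≡ 0 × ∀ u → ¬ G v u) →
                column sharedᴬ σ₃ v ≡ nat σ₂ flagᵛ 0 0 → IsShared v σ₃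
        here′ (inj₁ (f , u , (sv , v≁s) , (su , _) , u≢v , uv)) e =
          (λ _ → sv , v≁s , u , u≢v , su , uv) , λ _ → trans e f
        here′ (inj₂ (f , none)) e = (λ o → ⊥-elim (one≢zero (trans (sym o) (trans e f)))) ,
          λ { (sv , v≁s , u , u≢v , su , uv) → ⊥-elim
            (none u ((sv , v≁s) , (su , (λ e → v≁s (trans (sym uv) e))) , u≢v , uv)) }
        mine : IsShared v σ₃
        mine with at v
        ... | inj₁ (_ , e) = here′ flag e
        ... | inj₂ (ne , _) = ⊥-elim (ne refl)
        others : ∀ u → IsShared u σ₁ → IsShared u σ₃
        others u (a , b) with at u
        ... | inj₁ (refl , e) = here′ flag e
        ... | inj₂ (_ , e) = (λ o → a (trans (sym (trans e same)) o)) , λ h → trans (trans e same) (b h)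
          where same = cong (λ m → m (toℕ u) 0) (keepᴺ fr sharedᴬ refl)

    IndexIs : Fin n → State ℝ → Set
    IndexIs v τ = column indexᴬ τ v ≡ number s v

    count-trees : ∀ v {σ} → Landscape s σ → (∀ u → IsShared u σ) → nat σ vᵛ 0 0 ≡ toℕ v → column indexᴬ σ v ≡ 1 →
                  Exec COUNT σ (0 , 2) (λ σ′ → column indexᴬ σ′ v ≡ suc (count (λ l → does (earlier? s v l)) n) ×
                                               (∀ u → u ≢ v → column indexᴬ σ′ u ≡ column indexᴬ σ u))
    count-trees v {σ} L sh xv one = for-loop Inv (record {}) (polynomial (ℕₚ.n≤1+n n))
      (Landscape.size-is L) (λ h → h)
      (one , λ _ _ → refl) λ {l} {σ₁} l<n fr xl inv →
        let L₁ = landscape-kept refl refl refl refl refl fr L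
            sh₁ = sh-kept {σ} {σ₁} fr sh in
        exists (G l) (Landscape.size-is L₁) (λ u {σ′} fr′ xu →
          meaning l u (landscape-kept refl refl refl refl refl fr′ L₁) (sh-kept′ {σ₁} {σ′} fr′ sh₁)
            (scalar-kept refl fr′ xl) (scalar-kept refl fr′ (scalar-kept refl fr xv)) xu) then-do
              λ {σ₂} fr₂ flag →
        let L₂ = landscape-kept refl refl refl refl refl fr₂ L₁
            xv₂ = scalar-kept refl fr₂ (scalar-kept refl fr xv)
            xl₂ = scalar-kept refl fr₂ xl in
        when (λ { (f , lt) → exec-nat {e = 0 , 1} (bump {l} {σ₁} {σ₂} fr₂ inv xv₂
                (dec-true (earlier? s v l) (subst₂ ℕ._<_ xl₂ (Landscape.tree-at L₂ {vᵛ} xv₂) lt ,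
                  witness {τ = σ₂} flag f))) })
             (λ ¬g → stay {l} {σ₁} {σ₂} fr₂ inv (dec-false (earlier? s v l)
                (λ { (lt , u , shu , ul , uv) → ¬g (present {τ = σ₂} flag (u , shu , ul , uv) ,
                  subst₂ ℕ._<_ (sym xl₂) (sym (Landscape.tree-at L₂ {vᵛ} xv₂)) lt) })))
      where
      Inv : ℕ → State ℝ → Set
      Inv l τ = column indexᴬ τ v ≡ suc (count (λ l → does (earlier? s v l)) l) ×
                (∀ u → u ≢ v → column indexᴬ τ u ≡ column indexᴬ σ u)
      G : ℕ → Fin n → Set
      G l u = Shared s u × tr u ≡ l × u ∼ v
      witness : ∀ {l τ} → (nat τ flagᵛ 0 0 ≡ 1 × ∃ (G l)) ⊎ (nat τ flagᵛ 0 0 ≡ 0 × ∀ u → ¬ G l u) →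
        nat τ flagᵛ 0 0 ≡ 1 → ∃ (G l)
      witness (inj₁ (_ , g)) f = g
      witness (inj₂ (z , _)) f = ⊥-elim (one≢zero (trans (sym f) z))
      present : ∀ {l τ} → (nat τ flagᵛ 0 0 ≡ 1 × ∃ (G l)) ⊎ (nat τ flagᵛ 0 0 ≡ 0 × ∀ u → ¬ G l u) →
        ∃ (G l) → nat τ flagᵛ 0 0 ≡ 1
      present (inj₁ (f , _)) g = f
      present (inj₂ (_ , none)) (u , g) = ⊥-elim (none u g)
      sh-kept : ∀ {σ₀ τ} → Frame COUNT σ₀ τ → (∀ u → IsShared u σ₀) → ∀ u → IsShared u τ
      sh-kept fr h u = (λ o → proj₁ (h u) (trans (sym e) o)) , λ x → trans e (proj₂ (h u) x)
        where e = cong (λ m → m (toℕ u) 0) (keepᴺ fr sharedᴬ refl)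
      sh-kept′ : ∀ {σ₀ τ b} → Frame (EXISTS uᵛ b) σ₀ τ → (∀ u → IsShared u σ₀) → ∀ u → IsShared u τ
      sh-kept′ fr h u = (λ o → proj₁ (h u) (trans (sym e) o)) , λ x → trans e (proj₂ (h u) x)
        where e = cong (λ m → m (toℕ u) 0) (keepᴺ fr sharedᴬ refl)
      meaning : ∀ l u {σ′} → Landscape s σ′ → (∀ u → IsShared u σ′) → nat σ′ lᵛ 0 0 ≡ l →
        nat σ′ vᵛ 0 0 ≡ toℕ v → nat σ′ uᵛ 0 0 ≡ toℕ u →
                (⟦ sharedᴬ ⟪ uᵛ ⟫₁ ≡ᴺ litᴺ 1 and treeᴬ ⟪ uᵛ ⟫₁ ≡ᴺ scalar lᵛ and
                  (sepᴬ [ scalar uᵛ , scalar vᵛ ]ᴺ) ≡ᴺ litᴺ 0 ⟧ σ′ → G l u) ×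
                (G l u → ⟦ sharedᴬ ⟪ uᵛ ⟫₁ ≡ᴺ litᴺ 1 and treeᴬ ⟪ uᵛ ⟫₁ ≡ᴺ scalar lᵛ and
                  (sepᴬ [ scalar uᵛ , scalar vᵛ ]ᴺ) ≡ᴺ litᴺ 0 ⟧ σ′)
      meaning l u {σ′} L′ sh′ xl xv xu =
        (λ { (a , b , d) → proj₁ (sh′ u) (trans (sym shared-at) a) , trans (sym (tree-at {uᵛ} xu)) (trans b xl) ,
                           proj₁ (sep-is u v) (trans (sym (cong₂ (nat σ′ sepᴬ) xu xv)) d) }) ,
        (λ { (a , b , d) → trans shared-at (proj₂ (sh′ u) a) , trans (tree-at {uᵛ} xu) (trans b (sym xl)) ,
                           trans (cong₂ (nat σ′ sepᴬ) xu xv) (proj₂ (sep-is u v) d) })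
        where
        open Landscape L′
        shared-at : nat σ′ sharedᴬ (nat σ′ uᵛ 0 0) 0 ≡ column sharedᴬ σ′ u
        shared-at = cong (λ i → nat σ′ sharedᴬ i 0) xu
      index-kept : ∀ {σ₁ σ₂ b} → Frame (EXISTS uᵛ b) σ₁ σ₂ → ∀ u → column indexᴬ σ₂ u ≡ column indexᴬ σ₁ u
      index-kept fr u = cong (λ m → m (toℕ u) 0) (keepᴺ fr indexᴬ refl)
      count-true : ∀ l → does (earlier? s v l) ≡ true →
        suc (count (λ l → does (earlier? s v l)) l) ≡ count (λ l → does (earlier? s v l)) (suc l)
      count-true l e rewrite e = refl
      count-false : ∀ l → does (earlier? s v l) ≡ false →
        count (λ l → does (earlier? s v l)) l ≡ count (λ l → does (earlier? s v l)) (suc l)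
      count-false l e rewrite e = refl
      stay : ∀ {l σ₁ σ₂ b} → Frame (EXISTS uᵛ b) σ₁ σ₂ → Inv l σ₁ → does (earlier? s v l) ≡ false → Inv (suc l) σ₂
      stay {l} fr (a , b) e = trans (index-kept fr v) (trans a (cong suc (count-false l e))) , λ u ne →
        trans (index-kept fr u) (b u ne)
      bump : ∀ {l σ₁ σ₂ b} → Frame (EXISTS uᵛ b) σ₁ σ₂ → Inv l σ₁ → nat σ₂ vᵛ 0 0 ≡ toℕ v →
        does (earlier? s v l) ≡ true →
        Inv (suc l) ⟨ write (nat σ₂) indexᴬ (nat σ₂ vᵛ 0 0) 0 (nat σ₂ indexᴬ (nat σ₂ vᵛ 0 0) 0 ℕ.+ 1) , wt σ₂ ⟩
      bump {l} {σ₁} {σ₂} fr (a , b) xv e = mine , others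
        where
        σ₃ : State ℝ
        σ₃ = ⟨ write (nat σ₂) indexᴬ (nat σ₂ vᵛ 0 0) 0 (nat σ₂ indexᴬ (nat σ₂ vᵛ 0 0) 0 ℕ.+ 1) , wt σ₂ ⟩
        at = write-column {nat σ₂} {indexᴬ} {x = nat σ₂ indexᴬ (nat σ₂ vᵛ 0 0) 0 ℕ.+ 1} xv
        mine : column indexᴬ σ₃ v ≡ suc (count (λ l → does (earlier? s v l)) (suc l))
        mine with at v
        ... | inj₂ (ne , _) = ⊥-elim (ne refl)
        ... | inj₁ (_ , h) = trans h (trans (ℕₚ.+-comm _ 1) (cong suc (trans (cong (λ i → nat σ₂ indexᴬ i 0) xv)
          (trans (index-kept fr v) (trans a (count-true l e))))))
        others : ∀ u → u ≢ v → column indexᴬ σ₃ u ≡ column indexᴬ σ u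
        others u ne with at u
        ... | inj₁ (e , _) = ⊥-elim (ne e)
        ... | inj₂ (_ , h) = trans h (trans (index-kept fr u) (b u ne))

    index : ∀ {σ} → Landscape s σ → (∀ u → IsShared u σ) → Exec INDEX σ (0 , 3) (λ σ′ → ∀ v → IndexIs v σ′)
    index {σ} L sh = consequence (λ _ → proj₂)
      (Each.for-fin evolution IndexIs (record {}) (Landscape.size-is L) (λ _ h → h) (λ {v} le → le v)
        λ v {σ₁} fr xv _ →
          let L₁ = landscape-kept refl refl refl refl refl fr L
              sh₁ = sh-kept {INDEX} {σ} {σ₁} refl fr sh in
          exec-nat {Q = _≡ cleared σ₁} refl then-do λ { fr₀ refl →
          when
            (λ g → exec-nat {Q = _≡ started σ₁} refl then-do λ { fr₁ refl →
              consequence (λ { {τ} fr₂ (e , h) → others₁ v {σ₁} {τ} xv h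
                (trans e (sym (number-shared s v (proj₁ (sh₁ v) (trans (sym (at-v {σ₁} xv)) g))))) ,
                                                 trans e (sym (number-shared s v (proj₁ (sh₁ v)
                                                   (trans (sym (at-v {σ₁} xv)) g)))) })
                (count-trees v {started σ₁} (landscape-kept refl refl refl refl refl
                  (frame-trans {INDEX} (frame₀ {σ₁} fr₀) (frame₁ {σ₁} fr₁)) L₁)
                  (sh-kept {INDEX} {σ₁} {started σ₁} refl (frame-trans {INDEX} (frame₀ {σ₁} fr₀)
                    (frame₁ {σ₁} fr₁)) sh₁) xv (one {σ₁} xv)) })
            (λ ¬g → others₀ v {σ₁} xv (number-other s v (λ h → ¬g (trans (at-v {σ₁} xv) (proj₂ (sh₁ v) h)))) ,
                    trans (zeroed v {σ₁} xv) (sym (number-other s v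
                      (λ h → ¬g (trans (at-v {σ₁} xv) (proj₂ (sh₁ v) h)))))) })
      where
      evolution : Evolution
      evolution = record { _≼_ = λ τ τ′ → ∀ v → IndexIs v τ → IndexIs v τ′ ; ≼-refl = λ _ h → h ; ≼-trans =
        λ f g v h → g v (f v h) }
      cleared started : State ℝ → State ℝ
      cleared τ = ⟨ write (nat τ) indexᴬ (nat τ vᵛ 0 0) 0 0 , wt τ ⟩
      started τ = ⟨ write (nat (cleared τ)) indexᴬ (nat τ vᵛ 0 0) 0 1 , wt τ ⟩
      frame₀ : ∀ {τ} → Frame (indexᴬ [ scalar vᵛ , litᴺ 0 ]≔ᴺ litᴺ 0) τ (cleared τ) → Frame INDEX τ (cleared τ)
      frame₀ = frame-weaken (λ {a} h → false-∨ (proj₁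
        (∨-false {indexᴬ ℕ.≡ᵇ a} (proj₂ (∨-false {vᵛ ℕ.≡ᵇ a} h)))) refl) (λ h → h)
      frame₁ : ∀ {τ} → Frame (indexᴬ [ scalar vᵛ , litᴺ 0 ]≔ᴺ litᴺ 1) (cleared τ) (started τ) →
        Frame INDEX (cleared τ) (started τ)
      frame₁ = frame-weaken (λ {a} h → false-∨ (proj₁
        (∨-false {indexᴬ ℕ.≡ᵇ a} (proj₂ (∨-false {vᵛ ℕ.≡ᵇ a} h)))) refl) (λ h → h)
      sh-kept : ∀ {p σ₀ τ} → sharedᴬ ∉ᵇ writesᴺ p → Frame p σ₀ τ → (∀ u → IsShared u σ₀) → ∀ u → IsShared u τ
      sh-kept k fr h u = (λ o → proj₁ (h u) (trans (sym e) o)) , λ x → trans e (proj₂ (h u) x)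
        where e = cong (λ m → m (toℕ u) 0) (keepᴺ fr sharedᴬ k)
      at-v : ∀ {τ v} → nat τ vᵛ 0 0 ≡ toℕ v → nat τ sharedᴬ (nat τ vᵛ 0 0) 0 ≡ column sharedᴬ τ v
      at-v {τ} xv = cong (λ i → nat τ sharedᴬ i 0) xv
      zeroed : ∀ v {τ} → nat τ vᵛ 0 0 ≡ toℕ v → column indexᴬ (cleared τ) v ≡ 0
      zeroed v {τ} xv with write-column {nat τ} {indexᴬ} {x = 0} xv v
      ... | inj₁ (_ , h) = h
      ... | inj₂ (ne , _) = ⊥-elim (ne refl)
      one : ∀ {τ v} → nat τ vᵛ 0 0 ≡ toℕ v → column indexᴬ (started τ) v ≡ 1
      one {τ} {v} xv with write-column {nat (cleared τ)} {indexᴬ} {x = 1} xv v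
      ... | inj₁ (_ , h) = h
      ... | inj₂ (ne , _) = ⊥-elim (ne refl)
      others₀ : ∀ v {τ} → nat τ vᵛ 0 0 ≡ toℕ v → number s v ≡ 0 → ∀ u → IndexIs u τ → IndexIs u (cleared τ)
      others₀ v {τ} xv z u h with write-column {nat τ} {indexᴬ} {x = 0} xv u
      ... | inj₁ (refl , e) = trans e (sym z)
      ... | inj₂ (_ , e) = trans e h
      others₁ : ∀ v {τ τ′} → nat τ vᵛ 0 0 ≡ toℕ v →
        (∀ u → u ≢ v → column indexᴬ τ′ u ≡ column indexᴬ (started τ) u) →
                IndexIs v τ′ → ∀ u → IndexIs u τ → IndexIs u τ′
      others₁ v {τ} xv h hv u iu with u ≟ꟳ v
      ... | yes refl = hv
      ... | no u≢v with write-column {nat (cleared τ)} {indexᴬ} {x = 1} xv u | write-column {nat τ}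
        {indexᴬ} {x = 0} xv u
      ...   | inj₁ (e , _) | _ = ⊥-elim (u≢v e)
      ...   | inj₂ _ | inj₁ (e , _) = ⊥-elim (u≢v e)
      ...   | inj₂ (_ , e) | inj₂ (_ , e′) = trans (h u u≢v) (trans e (trans e′ iu))

    -- That the result is 0 or one of the numbers transfers any common bound on the numbers to the
    -- number of digits.
    maximum : ∀ {σ} → nat σ sizeᴬ 0 0 ≡ n → (∀ v → IndexIs v σ) →
              Exec MAXIMUM σ (0 , 1) (λ σ′ → (∀ v → number s v ℕ.≤ nat σ′ bitsᵛ 0 0) ×
                                             (nat σ′ bitsᵛ 0 0 ≡ 0 ⊎ ∃[ v ] nat σ′ bitsᵛ 0 0 ≡ number s v))
    maximum {σ} N ix =
      exec-nat {Q = _≡ set σ bitsᵛ 0} refl then-do λ { _ refl →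
      consequence (λ { _ ((ok , _) , q) → q , ok (inj₁ refl) })
        (for-fin (λ v τ → number s v ℕ.≤ nat τ bitsᵛ 0 0) (record {}) N ((λ h → h) , ℕₚ.≤-refl)
          (λ { (_ , le) q → ℕₚ.≤-trans q le })
          λ v {σ′} fr xv _ → when
            (λ lt → exec-nat {e = 0 , 0} (((λ _ → inj₂ (v , value v {σ′} fr xv)) , ℕₚ.<⇒≤ lt) ,
              ℕₚ.≤-reflexive (sym (value v {σ′} fr xv))))
            (λ ≮ → ((λ h → h) , ℕₚ.≤-refl) , ℕₚ.≤-trans (ℕₚ.≤-reflexive (sym (value v {σ′} fr xv))) (ℕₚ.≮⇒≥ ≮))) }
      where
      Ok : State ℝ → Set
      Ok τ = nat τ bitsᵛ 0 0 ≡ 0 ⊎ ∃[ v ] nat τ bitsᵛ 0 0 ≡ number s v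
      evolution : Evolution
      evolution = record
        { _≼_ = λ τ τ′ → (Ok τ → Ok τ′) × nat τ bitsᵛ 0 0 ℕ.≤ nat τ′ bitsᵛ 0 0
        ; ≼-refl = (λ h → h) , ℕₚ.≤-refl
        ; ≼-trans = λ { (f , a) (g , b) → (λ h → g (f h)) , ℕₚ.≤-trans a b } }
      open Each evolution
      value : ∀ v {σ′} → Frame _ (set σ bitsᵛ 0) σ′ → nat σ′ vᵛ 0 0 ≡ toℕ v →
        nat σ′ indexᴬ (nat σ′ vᵛ 0 0) 0 ≡ number s v
      value v {σ′} fr xv = trans (cong (λ i → nat σ′ indexᴬ i 0) xv)
        (trans (cong (λ m → m (toℕ v) 0) (keepᴺ fr indexᴬ refl)) (ix v))

    number-trees : ∀ {σ} → Landscape s σ →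
                   Exec NUMBER σ (0 , 3) (λ σ′ → (∀ v → IndexIs v σ′) × (∀ v → number s v ℕ.≤ nat σ′ bitsᵛ 0 0) ×
                                                 (nat σ′ bitsᵛ 0 0 ≡ 0 ⊎ ∃[ v ] nat σ′ bitsᵛ 0 0 ≡ number s v))
    number-trees L =
      slower tt (shared L) then-do λ {σ₁} fr₁ sh →
      let L₁ = landscape-kept refl refl refl refl refl fr₁ L in
      index L₁ sh then-do λ {σ₂} fr₂ ix →
      let L₂ = landscape-kept refl refl refl refl refl fr₂ L₁ in
      slower tt (consequence (λ { {τ} fr₃ (a , b) →
          (λ v → trans (cong (λ m → m (toℕ v) 0) (keepᴺ fr₃ indexᴬ refl)) (ix v)) , a , b })
        (maximum {σ₂} (Landscape.size-is L₂) ix))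

-- Tabulating sets of trees

digit : Bool → ℕ
digit b = if b then 1 else 0

digit-zero : ∀ {b} → digit b ≡ 0 → b ≡ false
digit-zero {false} _ = refl

module BitTable (ℝ : RealNumbers) (n : ℕ) (Good : ℕ → Set) where
  open Execution ℝ n Good

  Rows : ℕ → State ℝ → Set
  Rows M τ = ∀ m i → m ℕ.< M → i ℕ.≤ n → nat τ bitᴬ m i ≡ digit (bit m i)

  record BitTables (K : ℕ) (τ : State ℝ) : Set where
    field
      masks-is : nat τ masksᵛ 0 0 ≡ 2 ℕ.^ K
      bits-are : Rows (2 ℕ.^ K) τ
      powers-are : ∀ i → i ℕ.≤ K → nat τ powerᴬ i 0 ≡ pw i

  private
    kept : ∀ {p σ σ′ a x} → a ∉ᵇ writesᴺ p → Frame p σ σ′ → nat σ a 0 0 ≡ x → nat σ′ a 0 0 ≡ x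
    kept h fr e = trans (cong (λ m → m 0 0) (keepᴺ fr _ h)) e

    after-write : ∀ (m : Memory ℕ) i j x {i′ j′} → ¬ (i′ ≡ i × j′ ≡ j) →
      write m bitᴬ i j x bitᴬ i′ j′ ≡ m bitᴬ i′ j′
    after-write m i j x {i′} {j′} ne with write-cases m bitᴬ i j x i′ j′
    ... | inj₁ (e , e′ , _) = ⊥-elim (ne (e , e′))
    ... | inj₂ (_ , h) = h

  row-copied : ∀ {σ M m} → nat σ size⁺ᵛ 0 0 ≡ suc n → nat σ masksᵛ 0 0 ≡ M → nat σ mᵛ 0 0 ≡ m → m ℕ.< M →
             Exec (FOR iᵛ size⁺ᵛ (bitᴬ [ scalar mᵛ +ᴺ scalar masksᵛ , scalar iᵛ ]≔ᴺ bitᴬ ⟪ mᵛ , iᵛ ⟫)) σ (0 , 1)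
               (λ τ → (∀ i → i ℕ.≤ n → nat τ bitᴬ (m ℕ.+ M) i ≡ nat σ bitᴬ m i) ×
                      (∀ m′ i → m′ ≢ m ℕ.+ M → nat τ bitᴬ m′ i ≡ nat σ bitᴬ m′ i))
  row-copied {σ} {M} {m} N⁺ xM xm m<M = consequence (λ { _ (a , b) → (λ i i≤n → a i (s≤s i≤n)) , b })
    (for-loop Inv (record {}) (polynomial ℕₚ.≤-refl) N⁺ (λ h → h) ((λ i ()) , λ _ _ _ → refl)
      λ {i} {τ} i< fr xi inv → exec-nat {e = 0 , 0} (step {i} {τ} xi (kept refl fr xm) (kept refl fr xM) inv))
    where
    Inv : ℕ → State ℝ → Set
    Inv i τ = (∀ i′ → i′ ℕ.< i → nat τ bitᴬ (m ℕ.+ M) i′ ≡ nat σ bitᴬ m i′) ×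
              (∀ m′ i → m′ ≢ m ℕ.+ M → nat τ bitᴬ m′ i ≡ nat σ bitᴬ m′ i)
    m≢ : m ≢ m ℕ.+ M
    m≢ e = ℕₚ.<-irrefl e (ℕₚ.m<m+n m (ℕₚ.≤-trans (s≤s z≤n) m<M))
    step : ∀ {i τ} → nat τ iᵛ 0 0 ≡ i → nat τ mᵛ 0 0 ≡ m → nat τ masksᵛ 0 0 ≡ M → Inv i τ →
           Inv (suc i) ⟨ write (nat τ) bitᴬ (nat τ mᵛ 0 0 ℕ.+ nat τ masksᵛ 0 0) (nat τ iᵛ 0 0)
             (nat τ bitᴬ (nat τ mᵛ 0 0) (nat τ iᵛ 0 0)) , wt τ ⟩
    step {i} {τ} xi xm xM (a , b) rewrite xi | xm | xM = a′ , λ m′ i′ ne →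
      trans (after-write (nat τ) (m ℕ.+ M) i (nat τ bitᴬ m i) (ne ∘ proj₁)) (b m′ i′ ne)
      where
      a′ : ∀ i′ → i′ ℕ.< suc i → write (nat τ) bitᴬ (m ℕ.+ M) i (nat τ bitᴬ m i) bitᴬ (m ℕ.+ M)
        i′ ≡ nat σ bitᴬ m i′
      a′ i′ (s≤s i′≤i) with i′ ℕ.≟ i
      ... | yes refl = trans (write-hit (nat τ) bitᴬ (m ℕ.+ M) i _) (b m i m≢)
      ... | no ne = trans (after-write (nat τ) (m ℕ.+ M) i (nat τ bitᴬ m i) (ne ∘ proj₂))
        (a i′ (ℕₚ.≤∧≢⇒< i′≤i ne))

  bits : ∀ {σ K} → nat σ size⁺ᵛ 0 0 ≡ suc n → nat σ bitsᵛ 0 0 ≡ K → K ℕ.≤ n → (∀ k → Good k → K ℕ.≤ k) →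
         Exec BITS σ (1 , 2) (BitTables K)
  bits {σ} {K} N⁺ xK K≤n K≤k =
    exec-nat {Q = _≡ σ₁} refl then-do λ { _ refl →
    exec-nat {Q = _≡ σ₂} refl then-do λ { _ refl →
    slower tt first-row then-do λ {σ₃} fr₃ r₀ →
    consequence (λ { _ (a , b , d) → record { masks-is = a ; bits-are = b ; powers-are = d } })
      (for-loop Inv (record {}) (polynomial (ℕₚ.m≤n⇒m≤1+n K≤n)) (kept refl fr₃ xK) (λ h → h)
        ( kept refl fr₃ refl , (λ { zero i _ i≤n → trans (r₀ i i≤n) (cong digit (sym (bit-zero i))) ;
          (suc m) i (s≤s ()) _ })
        , λ { zero _ → cong (λ m → m 0 0) (keepᴺ fr₃ powerᴬ refl) })
        λ {j} {τ} j<K fr xj inv → stage {j} {τ} j<K (kept refl fr (kept refl fr₃ N⁺)) xj inv) } }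
    where
    σ₁ σ₂ : State ℝ
    σ₁ = ⟨ write (nat σ) powerᴬ 0 0 0 , wt σ ⟩
    σ₂ = set σ₁ masksᵛ 1
    first-row : Exec (FOR iᵛ size⁺ᵛ (bitᴬ [ litᴺ 0 , scalar iᵛ ]≔ᴺ litᴺ 0)) σ₂ (0 , 1)
      (λ τ → ∀ i → i ℕ.≤ n → nat τ bitᴬ 0 i ≡ 0)
    first-row = consequence (λ _ h i i≤n → h i (s≤s i≤n))
      (for-loop (λ i τ → ∀ i′ → i′ ℕ.< i → nat τ bitᴬ 0 i′ ≡ 0) (record {}) (polynomial ℕₚ.≤-refl) N⁺
        (λ h → h) (λ i ())
        λ {i} {τ} i< fr xi inv → exec-nat {e = 0 , 0} (step {i} {τ} xi inv))
      where
      step : ∀ {i τ} → nat τ iᵛ 0 0 ≡ i → (∀ i′ → i′ ℕ.< i → nat τ bitᴬ 0 i′ ≡ 0) →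
             ∀ i′ → i′ ℕ.< suc i → write (nat τ) bitᴬ 0 (nat τ iᵛ 0 0) 0 bitᴬ 0 i′ ≡ 0
      step {i} {τ} xi inv i′ (s≤s i′≤i) with write-cases (nat τ) bitᴬ 0 (nat τ iᵛ 0 0) 0 0 i′
      ... | inj₁ (_ , _ , h) = h
      ... | inj₂ (ne , h) = trans h (inv i′ (ℕₚ.≤∧≢⇒< i′≤i (λ e → ne (refl , trans e (sym xi)))))
    Inv : ℕ → State ℝ → Set
    Inv j τ = nat τ masksᵛ 0 0 ≡ 2 ℕ.^ j × Rows (2 ℕ.^ j) τ × (∀ i → i ℕ.≤ j → nat τ powerᴬ i 0 ≡ pw i)
    stage : ∀ {j τ} → j ℕ.< K → nat τ size⁺ᵛ 0 0 ≡ suc n → nat τ jᵛ 0 0 ≡ j → Inv j τ →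
      Exec _ τ (1 , 1) (Inv (suc j))
    stage {j} {τ} j<K N⁺ xj (xM , rows , powers) =
      -- The rounds grow geometrically, yet each is charged the full `2 ^ k`; with at most `n`
      -- rounds over rows of length `n + 1` this stays far below the cost of the search.
      for-loop Half (record {}) (exponential (λ k g →
        ℕₚ.^-monoʳ-≤ 2 (ℕₚ.≤-trans (ℕₚ.<⇒≤ j<K) (K≤k k g)))) xM (λ h → h)
        ((λ m i m< i≤ → rows m i m< i≤) , λ m i ())
        (λ {m} {τ₁} m<M fr xm half →
          row-copied {τ₁} (kept refl fr N⁺) (kept refl fr xM) xm m<M then-do λ {τ₂} fr₂ (copied , same) →
          exec-nat {e = 0 , 1} (half-step {m} {τ₁} {τ₂} m<M (kept refl fr₂ xm) (kept refl fr₂ (kept refl fr xM))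
            (kept refl fr₂ (kept refl fr xj)) copied same half))
      then-do λ {τ₃} fr₃ half →
      exec-nat {Q = _≡ powered τ₃} refl then-do λ { _ refl →
      exec-nat {e = 1 , 1} (finish {τ₃} fr₃ half) }
      where
      M = 2 ℕ.^ j
      Half : ℕ → State ℝ → Set
      Half m τ′ = Rows M τ′ × (∀ m′ i → m′ ℕ.< m → i ℕ.≤ n → nat τ′ bitᴬ (m′ ℕ.+ M) i ≡ digit (bit (m′ ℕ.+ M) i))
      powered : State ℝ → State ℝ
      powered τ₃ = ⟨ write (nat τ₃) powerᴬ (nat τ₃ jᵛ 0 0 ℕ.+ 1) 0 (nat τ₃ masksᵛ 0 0) , wt τ₃ ⟩
      half-step : ∀ {m τ₁ τ₂} → m ℕ.< M → nat τ₂ mᵛ 0 0 ≡ m → nat τ₂ masksᵛ 0 0 ≡ M → nat τ₂ jᵛ 0 0 ≡ j →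
        (∀ i → i ℕ.≤ n → nat τ₂ bitᴬ (m ℕ.+ M) i ≡ nat τ₁ bitᴬ m i) →
        (∀ m′ i → m′ ≢ m ℕ.+ M → nat τ₂ bitᴬ m′ i ≡ nat τ₁ bitᴬ m′ i) → Half m τ₁ →
        Half (suc m) ⟨ write (nat τ₂) bitᴬ (nat τ₂ mᵛ 0 0 ℕ.+ nat τ₂ masksᵛ 0 0) (nat τ₂ jᵛ 0 0 ℕ.+ 1) 1 , wt τ₂ ⟩
      half-step {m} {τ₁} {τ₂} m<M xm xM xj copied same (low , high) rewrite xm | xM | xj | ℕₚ.+-comm
        j 1 = low′ , high′
        where
        other : ∀ m′ i → m′ ≢ m ℕ.+ M → write (nat τ₂) bitᴬ (m ℕ.+ M) (suc j) 1 bitᴬ m′ i ≡ nat τ₁ bitᴬ m′ i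
        other m′ i ne = trans (after-write (nat τ₂) (m ℕ.+ M) (suc j) 1 (ne ∘ proj₁)) (same m′ i ne)
        low′ : Rows M ⟨ write (nat τ₂) bitᴬ (m ℕ.+ M) (suc j) 1 , wt τ₂ ⟩
        low′ m′ i m′< i≤ = trans (other m′ i (λ e →
          ℕₚ.<⇒≱ m′< (ℕₚ.≤-trans (ℕₚ.m≤n+m M m) (ℕₚ.≤-reflexive (sym e))))) (low m′ i m′< i≤)
        unset : bit m (suc j) ≡ false
        unset = testbit-high j m<M
        high′ : ∀ m′ i → m′ ℕ.< suc m → i ℕ.≤ n →
                write (nat τ₂) bitᴬ (m ℕ.+ M) (suc j) 1 bitᴬ (m′ ℕ.+ M) i ≡ digit (bit (m′ ℕ.+ M) i)
        high′ m′ i (s≤s m′≤m) i≤ with m′ ℕ.≟ m | i ℕ.≟ suc j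
        ... | no ne | _ = trans (other (m′ ℕ.+ M) i (λ e → ne (ℕₚ.+-cancelʳ-≡ M m′ m e)))
          (high m′ i (ℕₚ.≤∧≢⇒< m′≤m ne) i≤)
        ... | yes refl | yes refl = trans (write-hit (nat τ₂) bitᴬ (m ℕ.+ M) (suc j) 1)
          (cong digit (sym (bit-set (suc j) (λ ()) unset)))
        ... | yes refl | no ne = trans (after-write (nat τ₂) (m ℕ.+ M) (suc j) 1 (ne ∘ proj₂))
          (trans (copied i i≤)
          (trans (low m i m<M i≤) (cong digit (sym (bit-other (suc j) i unset ne)))))
      finish : ∀ {τ₃} → Frame _ τ τ₃ → Half M τ₃ →
        Inv (suc j) (set (powered τ₃) masksᵛ (nat τ₃ masksᵛ 0 0 ℕ.+ nat τ₃ masksᵛ 0 0))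
      finish {τ₃} fr (low , high) = trans (cong₂ ℕ._+_ M₃ M₃) (sym (2^suc j)) , rows′ , powers′
        where
        M₃ : nat τ₃ masksᵛ 0 0 ≡ M
        M₃ = kept refl fr xM
        j₃ : nat τ₃ jᵛ 0 0 ≡ j
        j₃ = kept refl fr xj
        rows′ : Rows (2 ℕ.^ suc j) τ₃
        rows′ m i m< i≤ with m ℕ.<? M
        ... | yes m<M = low m i m<M i≤
        ... | no m≮M = subst (λ m → nat τ₃ bitᴬ m i ≡ digit (bit m i)) (ℕₚ.m∸n+n≡m (ℕₚ.≮⇒≥ m≮M))
          (high (m ℕ.∸ M) i (ℕₚ.+-cancelʳ-< M (m ℕ.∸ M) M
            (subst (ℕ._< M ℕ.+ M) (sym (ℕₚ.m∸n+n≡m (ℕₚ.≮⇒≥ m≮M))) (subst (m ℕ.<_) (2^suc j) m<))) i≤)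
        powers′ : ∀ i → i ℕ.≤ suc j → nat (powered τ₃) powerᴬ i 0 ≡ pw i
        powers′ i i≤ with write-cases (nat τ₃) powerᴬ (nat τ₃ jᵛ 0 0 ℕ.+ 1) 0 (nat τ₃ masksᵛ 0 0) i 0
        ... | inj₁ (e , _ , h) = trans h (trans M₃
          (cong pw (sym (trans e (trans (cong (ℕ._+ 1) j₃) (ℕₚ.+-comm j 1))))))
        ... | inj₂ (ne , h) = trans h (trans (cong (λ m → m i 0) (keepᴺ fr powerᴬ refl))
          (powers i (ℕₚ.≤-pred (ℕₚ.≤∧≢⇒< i≤
            (λ e → ne (trans e (trans (ℕₚ.+-comm 1 j) (cong (ℕ._+ 1) (sym j₃))) , refl))))))

-- Search from a source

module SearchingProof (ℝ : RealNumbers) {n : ℕ} (D : Digraph n) (c : Weight ℝ D) (Good : ℕ → Set)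
                      {E : Rel (Fin n) 0ℓ} {tr : Fin n → ℕ} {P : Fin n → Fin n → RealNumbers.Carrier ℝ}
                      (forest : Theory.Forest ℝ D c E tr P) (E? : Decidable₂ E)
                      (E-full : ∀ {u v} → Weighted.NegativeEdge ℝ D c u v → E u v)
                      (tr<n : ∀ u → tr u ℕ.< n) (_∼?_ : Decidable₂ (Separation._∼_ D)) where
  open Execution ℝ n Good
  open Relaxation ℝ n Good
  open OrderedField ℝ
  open Digraph D using (Arc)
  open Reading ℝ D c Good
  open Separation D using (_∼_)
  open ConnectivityProof ℝ D c Good using (scalar-kept)
  open NumberingProof ℝ D c Good tr tr<n _∼?_
  open BitTable ℝ n Good
  open Spanning ℝ D c forest E? E-full using (Hops; start; hop)

  record Terrain (s : Fin n) (K : ℕ) (σ : State ℝ) : Set where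
    field
      landscape : Landscape s σ
      inp       : Input σ
      index-is  : ∀ v → IndexIs s v σ
      tables    : BitTables K σ
      paths-are : ∀ u v → wt σ pathᵂ (toℕ u) (toℕ v) ≡ P u v
    open Landscape landscape public
    open Input inp public using (adj⇒arc; arc⇒adj; arc-weight)
    open BitTables tables public

  statics : List ℕ
  statics = sizeᴬ ∷ adjᴬ ∷ treeᴬ ∷ sepᴬ ∷ bitᴬ ∷ powerᴬ ∷ indexᴬ ∷ sᵛ ∷ size⁺ᵛ ∷ masksᵛ ∷ []

  terrain-kept : ∀ {p σ σ′ s K} →
    avoids statics (writesᴺ p) ≡ true →
    arcᵂ ∉ᵇ writesᵂ p → pathᵂ ∉ᵇ writesᵂ p → Frame p σ σ′ → Terrain s K σ → Terrain s K σ′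
  terrain-kept {p} av kc kp fr T = record
    { landscape = landscape-kept (k refl) (k refl) (k refl) (k refl) (k refl) fr (Terrain.landscape T)
    ; inp = input-kept (k refl) (k refl) kc fr (Terrain.inp T)
    ; index-is = λ v → trans (cong (λ m → m (toℕ v) 0) (keepᴺ fr indexᴬ (k refl))) (Terrain.index-is T v)
    ; tables = record
      { masks-is = scalar-kept (k refl) fr (Terrain.masks-is T)
      ; bits-are = λ m i m< i≤ → trans (cong (λ f → f m i) (keepᴺ fr bitᴬ (k refl)))
        (Terrain.bits-are T m i m< i≤)
      ; powers-are = λ i i≤ → trans (cong (λ f → f i 0) (keepᴺ fr powerᴬ (k refl))) (Terrain.powers-are T i i≤) }
    ; paths-are = λ u v → trans (cong (λ m → m (toℕ u) (toℕ v)) (keepᵂ fr pathᵂ kp)) (Terrain.paths-are T u v) }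
    where
    k : ∀ {a} → elem a statics ≡ true → a ∉ᵇ writesᴺ p
    k {a} = avoids⇒∉ᵇ statics {writesᴺ p} {a} av

  -- `K` is the number of digits found at run time. `K≤k` serves the running time, and `number≤K`
  -- keeps all sets that occur below `2 ^ K`.
  module _ (s : Fin n) (K : ℕ) (K≤k : ∀ k → Good k → K ℕ.≤ k) (number≤K : ∀ v → number s v ℕ.≤ K) where

    ix : Fin n → ℕ
    ix = number s

    HopsFrom : ℕ → ℕ → Fin n → Carrier → Set
    HopsFrom = Hops _∼_ s ix

    masks-fit : ∀ {i j} → Fits (2 ℕ.^ K) (i , j) (suc i , j)
    masks-fit = exponential λ k g → ℕₚ.^-monoʳ-≤ 2 (K≤k k g)

    hops-mask : ∀ {r S y x} → HopsFrom r S y x → S ℕ.< 2 ℕ.^ K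
    hops-mask (start _ _) = ℕₚ.m^n>0 2 K
    hops-mask (hop {a = a} h _ _ _ _ free _ _) = bit-bound K (ix a) (number≤K a) (hops-mask h) free

    Reaches : ℕ → Fin n → Carrier → Set
    Reaches m y x = ∃[ r ] ∃[ x′ ] HopsFrom r m y x′ × x′ ≤ x

    record Enters (m : ℕ) (a : Fin n) (x : Carrier) : Set where
      constructor enters
      field
        {r}  : ℕ
        {y}  : Fin n
        {x₀} : Carrier
        hops : HopsFrom r m y x₀
        ya   : Arc y a
        near : s ∼ a
        away : tr a ≢ tr s
        new  : tr a ≢ tr y
        free : bit m (ix a) ≡ false
        cost : x₀ + c y a ya ≤ x

    -- The arrays are shared by all sources, and `CLEAR` resets only the rows of the current sets.
    -- The premise `m < 2 ^ K` excludes rows that an earlier source may have left behind.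
    StateOK EntryOK : ℕ → ℕ → Carrier → Set
    StateOK m v x = m ℕ.< 2 ℕ.^ K → ∀ y → toℕ y ≡ v → Reaches m y x
    EntryOK m v x = m ℕ.< 2 ℕ.^ K → ∀ a → toℕ a ≡ v → Enters m a x

    module States = Each (improvement stateFᴬ stateᵂ StateOK)
    module Entries = Each (improvement entryFᴬ entryᵂ EntryOK)

    states-kept : ∀ {p σ σ′} → stateFᴬ ∉ᵇ writesᴺ p → stateᵂ ∉ᵇ writesᵂ p → Frame p σ σ′ →
      Improves stateFᴬ stateᵂ StateOK σ σ′
    states-kept = kept-table stateFᴬ stateᵂ StateOK

    entries-kept : ∀ {p σ σ′} → entryFᴬ ∉ᵇ writesᴺ p → entryᵂ ∉ᵇ writesᵂ p → Frame p σ σ′ →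
      Improves entryFᴬ entryᵂ EntryOK σ σ′
    entries-kept = kept-table entryFᴬ entryᵂ EntryOK

    StateEntry EntryEntry : State ℝ → ℕ → Fin n → Carrier → Set
    StateEntry σ m v x = Entry stateFᴬ stateᵂ σ m (toℕ v) x
    EntryEntry σ m v x = Entry entryFᴬ entryᵂ σ m (toℕ v) x

    private
      entry-at : ∀ fin val σ {i i′ j j′ x x′} → i ≡ i′ → j ≡ j′ → x ≤ x′ → Entry fin val σ i j x →
        Entry fin val σ i′ j′ x′
      entry-at _ _ _ refl refl le (f , h) = f , ≤-trans h le

    enter : ∀ {σ} → Terrain s K σ → Sound stateFᴬ stateᵂ StateOK σ →
            Exec ENTER σ (1 , 2) (λ σ′ → Improves entryFᴬ entryᵂ EntryOK σ σ′ ×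
              (∀ {m y a x} → m ℕ.< 2 ℕ.^ K → StateEntry σ m y x → (ya : Arc y a) → s ∼ a →
                tr a ≢ tr s → tr a ≢ tr y →
                bit m (ix a) ≡ false → EntryEntry σ′ m a (x + c y a ya)))
    enter {σ} T snd = consequence (λ { _ (im , q) → im , λ {m} {y} {a} m< → q m< y a m< })
      (Entries.for-each (λ m τ → ∀ y a → Q m y a τ) (record {}) masks-fit (Terrain.masks-is T)
        (improves-set mᵛ refl)
        (λ le h y a m< e ya sa a≁s a≁y fr → entries le (h y a m< e ya sa a≁s a≁y fr))
        λ {m} {σ₁} m<M fr xm _ →
          Entries.for-fin₂ (Q m) (record {}) (record {}) (scalar-kept refl fr (Terrain.size-is T))
            (improves-set vᵛ refl) (improves-set aᵛ refl)
            (λ le h m< e ya sa a≁s a≁y fr → entries le (h m< e ya sa a≁s a≁y fr))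
            λ v a {σ₂} fr₂ xv xa _ →
              let fr′ = frame-trans fr (frame-FOR {mᵛ} {masksᵛ} fr₂)
                  T₂ = terrain-kept {ENTER} refl refl refl fr′ T
                  snd₂ = sound-kept {σ₂} fr′ in
              consequence (λ { {τ} _ (im , en) → im , λ m< e ya sa a≁s a≁y free →
                  entry-at entryFᴬ entryᵂ τ (scalar-kept refl fr₂ xm) xa
                    (+-mono (stored {σ₂} fr′ (scalar-kept refl fr₂ xm) xv e) (≡⇒≤ (arc-at {σ₂} T₂ xv xa ya)))
                    (en (guard⁺ {m} {v} {a} {σ₂} fr′ T₂ m< (scalar-kept refl fr₂ xm) xv xa e ya sa
                      a≁s a≁y free)) })
                (relax-when {b = guard} (λ g _ m<′ a′ a′≡ →
                  subst (λ a → Enters _ a _) (toℕ-injective (trans (sym xa) (sym a′≡)))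
                  (guard⁻ {m} {v} {a} {σ₂} T₂ snd₂ m<M (scalar-kept refl fr₂ xm) xv xa g))))
      where
      Q : ℕ → Fin n → Fin n → State ℝ → Set
      Q m y a τ = m ℕ.< 2 ℕ.^ K → ∀ {x} → StateEntry σ m y x → (ya : Arc y a) → s ∼ a →
        tr a ≢ tr s → tr a ≢ tr y →
                  bit m (ix a) ≡ false → EntryEntry τ m a (x + c y a ya)
      guard : BExp
      guard = stateFᴬ ⟪ mᵛ , vᵛ ⟫ ≢ᴺ litᴺ 0 and adjᴬ ⟪ vᵛ , aᵛ ⟫ ≡ᴺ litᴺ 1 and local aᵛ and
              treeᴬ ⟪ aᵛ ⟫₁ ≢ᴺ treeᴬ ⟪ vᵛ ⟫₁ and bitᴬ [ scalar mᵛ , indexᴬ ⟪ aᵛ ⟫₁ ]ᴺ ≡ᴺ litᴺ 0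
      sound-kept : ∀ {τ} → Frame ENTER σ τ → Sound stateFᴬ stateᵂ StateOK τ
      sound-kept fr = sound (states-kept {ENTER} refl refl fr) snd
      stored : ∀ {τ m v x} → Frame ENTER σ τ → nat τ mᵛ 0 0 ≡ m → nat τ vᵛ 0 0 ≡ toℕ v → StateEntry σ m v x →
               wt τ stateᵂ (nat τ mᵛ 0 0) (nat τ vᵛ 0 0) ≤ x
      stored {τ} {m} {v} fr xm xv (_ , le) = ≤-trans
        (≡⇒≤ (trans (cong₂ (wt τ stateᵂ) xm xv) (cong (λ f → f m (toℕ v)) (keepᵂ fr stateᵂ refl)))) le
      arc-at : ∀ {τ v a} → Terrain s K τ → nat τ vᵛ 0 0 ≡ toℕ v → nat τ aᵛ 0 0 ≡ toℕ a → (va : Arc v a) →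
               wt τ arcᵂ (nat τ vᵛ 0 0) (nat τ aᵛ 0 0) ≡ c v a va
      arc-at {τ} T xv xa va = trans (cong₂ (wt τ arcᵂ) xv xa) (Terrain.arc-weight T va)
      bit-at : ∀ {τ m a} → Terrain s K τ → m ℕ.< 2 ℕ.^ K → nat τ mᵛ 0 0 ≡ m → nat τ aᵛ 0 0 ≡ toℕ a →
               nat τ bitᴬ (nat τ mᵛ 0 0) (nat τ indexᴬ (nat τ aᵛ 0 0) 0) ≡ digit (bit m (ix a))
      bit-at {τ} {m} {a} T m< xm xa = trans (cong₂ (nat τ bitᴬ) xm
        (trans (cong (λ i → nat τ indexᴬ i 0) xa) (Terrain.index-is T a)))
        (Terrain.bits-are T m (ix a) m< (number≤n s a))
      guard⁺ : ∀ {m v a τ x} → Frame ENTER σ τ → Terrain s K τ → m ℕ.< 2 ℕ.^ K → nat τ mᵛ 0 0 ≡ m →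
        nat τ vᵛ 0 0 ≡ toℕ v → nat τ aᵛ 0 0 ≡ toℕ a →
               StateEntry σ m v x → Arc v a → s ∼ a → tr a ≢ tr s → tr a ≢ tr v →
                 bit m (ix a) ≡ false → ⟦ guard ⟧ τ
      guard⁺ {m} {v} {a} {τ} fr T m< xm xv xa (f , _) va sa a≁s a≁v free =
        (λ z → f (trans (sym (trans (cong₂ (nat τ stateFᴬ) xm xv)
          (cong (λ g → g m (toℕ v)) (keepᴺ fr stateFᴬ refl)))) z)) ,
        trans (cong₂ (nat τ adjᴬ) xv xa) (Terrain.arc⇒adj T va) ,
        Terrain.local⁺ T {aᵛ} xa (sa , a≁s) ,
        (λ e → a≁v (trans (sym (Terrain.tree-at T {aᵛ} xa)) (trans e (Terrain.tree-at T {vᵛ} xv)))) ,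
        trans (bit-at {τ} {m} {a} T m< xm xa) (cong digit free)
      guard⁻ : ∀ {m v a τ} → Terrain s K τ → Sound stateFᴬ stateᵂ StateOK τ → m ℕ.< 2 ℕ.^ K →
               nat τ mᵛ 0 0 ≡ m → nat τ vᵛ 0 0 ≡ toℕ v → nat τ aᵛ 0 0 ≡ toℕ a → ⟦ guard ⟧ τ →
               Enters (nat τ mᵛ 0 0) a (wt τ stateᵂ (nat τ mᵛ 0 0) (nat τ vᵛ 0 0) + wt τ arcᵂ
                 (nat τ vᵛ 0 0) (nat τ aᵛ 0 0))
      guard⁻ {m} {v} {a} {τ} T snd m< xm xv xa (f , va , loc , a≁v , free)
        with snd f (subst (ℕ._< 2 ℕ.^ K) (sym xm) m<) v (sym xv) | Terrain.local⁻ T {aᵛ} xa loc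
      ... | r , x′ , h , x′≤ | sa , a≁s = enters h arc sa a≁s
        (λ e → a≁v (trans (Terrain.tree-at T {aᵛ} xa) (trans e (sym (Terrain.tree-at T {vᵛ} xv)))))
        (subst (λ m → bit m (ix a) ≡ false) (sym xm)
          (digit-zero (trans (sym (bit-at {τ} {m} {a} T m< xm xa)) free)))
        (+-mono x′≤ (≡⇒≤ (sym (arc-at {τ} T xv xa arc))))
        where arc = Terrain.adj⇒arc T (trans (sym (cong₂ (nat τ adjᴬ) xv xa)) va)

    cross-tree : ∀ {σ} → Terrain s K σ → Sound entryFᴬ entryᵂ EntryOK σ →
                 Exec CROSS-TREE σ (1 , 2) (λ σ′ → Improves stateFᴬ stateᵂ StateOK σ σ′ ×
                   (∀ {m a b x} → m ℕ.< 2 ℕ.^ K → EntryEntry σ m a x → tr a ≡ tr b → s ∼ b →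
                     StateEntry σ′ (m ℕ.+ pw (ix a)) b (x + P a b)))
    cross-tree {σ} T snd = consequence (λ { _ (im , q) → im , λ {m} {a} {b} m< → q m< a b })
      (States.for-each (λ m τ → ∀ a b → Q m a b τ) (record {}) masks-fit (Terrain.masks-is T)
        (improves-set mᵛ refl)
        (λ le h a b e ab sb → entries le (h a b e ab sb))
        λ {m} {σ₁} m<M fr xm _ →
          States.for-fin₂ (Q m) (record {}) (record {}) (scalar-kept refl fr (Terrain.size-is T))
            (improves-set aᵛ refl) (improves-set bᵛ refl)
            (λ le h e ab sb → entries le (h e ab sb))
            λ a b {σ₂} fr₂ xa xb _ →
              let fr′ = frame-trans fr (frame-FOR {mᵛ} {masksᵛ} fr₂)
                  T₂ = terrain-kept {CROSS-TREE} refl refl refl fr′ T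
                  snd₂ = sound-kept {σ₂} fr′
                  xm₂ = scalar-kept refl fr₂ xm in
              consequence (λ { {τ} _ (im , en) → im , λ e ab sb →
                  entry-at stateFᴬ stateᵂ τ (target {σ₂} T₂ xm₂ xa) xb
                    (+-mono (stored {σ₂} fr′ xm₂ xa e) (≡⇒≤ (path-at {σ₂} T₂ xa xb)))
                    (en (guard⁺ {m} {a} {b} {σ₂} fr′ T₂ xm₂ xa xb e ab sb)) })
                (relax-when {b = guard} (λ g _ _ b′ b′≡ →
                  subst (λ b → Reaches _ b _) (toℕ-injective (trans (sym xb) (sym b′≡)))
                  (guard⁻ {m} {a} {b} {σ₂} T₂ snd₂ m<M xm₂ xa xb g))))
      where
      Q : ℕ → Fin n → Fin n → State ℝ → Set
      Q m a b τ = ∀ {x} → EntryEntry σ m a x → tr a ≡ tr b → s ∼ b → StateEntry τ (m ℕ.+ pw (ix a)) b (x + P a b)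
      guard : BExp
      guard = entryFᴬ ⟪ mᵛ , aᵛ ⟫ ≢ᴺ litᴺ 0 and treeᴬ ⟪ aᵛ ⟫₁ ≡ᴺ treeᴬ ⟪ bᵛ ⟫₁ and sepᴬ ⟪ sᵛ , bᵛ ⟫ ≡ᴺ litᴺ 0
      sound-kept : ∀ {τ} → Frame CROSS-TREE σ τ → Sound entryFᴬ entryᵂ EntryOK τ
      sound-kept fr = sound (entries-kept {CROSS-TREE} refl refl fr) snd
      stored : ∀ {τ m v x} → Frame CROSS-TREE σ τ → nat τ mᵛ 0 0 ≡ m → nat τ aᵛ 0 0 ≡ toℕ v → EntryEntry σ m v x →
               wt τ entryᵂ (nat τ mᵛ 0 0) (nat τ aᵛ 0 0) ≤ x
      stored {τ} {m} {v} fr xm xv (_ , le) = ≤-trans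
        (≡⇒≤ (trans (cong₂ (wt τ entryᵂ) xm xv) (cong (λ f → f m (toℕ v)) (keepᵂ fr entryᵂ refl)))) le
      path-at : ∀ {τ a b} → Terrain s K τ → nat τ aᵛ 0 0 ≡ toℕ a → nat τ bᵛ 0 0 ≡ toℕ b →
                wt τ pathᵂ (nat τ aᵛ 0 0) (nat τ bᵛ 0 0) ≡ P a b
      path-at {τ} {a} {b} T xa xb = trans (cong₂ (wt τ pathᵂ) xa xb) (Terrain.paths-are T a b)
      target : ∀ {τ m a} → Terrain s K τ → nat τ mᵛ 0 0 ≡ m → nat τ aᵛ 0 0 ≡ toℕ a →
               nat τ mᵛ 0 0 ℕ.+ nat τ powerᴬ (nat τ indexᴬ (nat τ aᵛ 0 0) 0) 0 ≡ m ℕ.+ pw (ix a)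
      target {τ} {m} {a} T xm xa = cong₂ ℕ._+_ xm
        (trans (cong (λ i → nat τ powerᴬ i 0) (trans (cong (λ i → nat τ indexᴬ i 0) xa) (Terrain.index-is T a)))
        (Terrain.powers-are T (ix a) (number≤K a)))
      guard⁺ : ∀ {m a b τ x} → Frame CROSS-TREE σ τ → Terrain s K τ → nat τ mᵛ 0 0 ≡ m →
        nat τ aᵛ 0 0 ≡ toℕ a → nat τ bᵛ 0 0 ≡ toℕ b →
               EntryEntry σ m a x → tr a ≡ tr b → s ∼ b → ⟦ guard ⟧ τ
      guard⁺ {m} {a} {b} {τ} fr T xm xa xb (f , _) ab sb =
        (λ z → f (trans (sym (trans (cong₂ (nat τ entryFᴬ) xm xa)
          (cong (λ g → g m (toℕ a)) (keepᴺ fr entryFᴬ refl)))) z)) ,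
        trans (Terrain.tree-at T {aᵛ} xa) (trans ab (sym (Terrain.tree-at T {bᵛ} xb))) ,
          Terrain.near⁺ T {bᵛ} xb sb
      guard⁻ : ∀ {m a b τ} → Terrain s K τ → Sound entryFᴬ entryᵂ EntryOK τ → m ℕ.< 2 ℕ.^ K →
               nat τ mᵛ 0 0 ≡ m → nat τ aᵛ 0 0 ≡ toℕ a → nat τ bᵛ 0 0 ≡ toℕ b → ⟦ guard ⟧ τ →
               Reaches (nat τ mᵛ 0 0 ℕ.+ nat τ powerᴬ (nat τ indexᴬ (nat τ aᵛ 0 0) 0) 0) b
                 (wt τ entryᵂ (nat τ mᵛ 0 0) (nat τ aᵛ 0 0) + wt τ pathᵂ (nat τ aᵛ 0 0) (nat τ bᵛ 0 0))
      guard⁻ {m} {a} {b} {τ} T snd m< xm xa xb (f , ab , sb)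
        with snd f (subst (ℕ._< 2 ℕ.^ K) (sym xm) m<) a (sym xa)
      ... | enters {r} {y} {x₀} h ya sa a≁s a≁y free cost = suc r , (x₀ + c y a ya) + P a b ,
        subst (λ k → HopsFrom (suc r) k b ((x₀ + c y a ya) + P a b))
          (trans (cong (ℕ._+ pw (ix a)) xm) (sym (target {τ} T xm xa)))
          (hop h ya sa a≁s a≁y free (trans (sym (Terrain.tree-at T {aᵛ} xa))
            (trans ab (Terrain.tree-at T {bᵛ} xb))) (Terrain.near⁻ T {bᵛ} xb sb)) ,
        +-mono cost (≡⇒≤ (sym (path-at {τ} T xa xb)))

    clear : ∀ {σ} → Terrain s K σ →
            Exec CLEAR σ (1 , 1) (λ σ′ → ∀ {m} → m ℕ.< 2 ℕ.^ K → ∀ v → nat σ′ stateFᴬ m (toℕ v) ≡ 0 ×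
              nat σ′ entryFᴬ m (toℕ v) ≡ 0)
    clear {σ} T = consequence (λ { _ (_ , q) → q })
      (for-each (λ m τ → ∀ v → Q m v τ) (record {}) masks-fit (Terrain.masks-is T) (λ _ _ → (λ h → h) , λ h → h)
        (λ {m} {τ} {τ′} le h v → persist {m} {v} {τ} {τ′} le (h v))
        λ {m} {σ₁} m<M fr xm _ →
          for-fin (Q m) (record {}) (scalar-kept refl fr (Terrain.size-is T)) (λ _ _ → (λ h → h) , λ h → h)
            (λ {v} {τ} {τ′} le → persist {m} {v} {τ} {τ′} le)
            λ v {σ₂} fr₂ xv _ →
              exec-nat {Q = _≡ once σ₂} refl then-do λ { _ refl →
                exec-nat {e = 0 , 0} (done {σ₂} (scalar-kept refl fr₂ xm) xv) })
      where
      Q : ℕ → Fin n → State ℝ → Set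
      Q m v τ = nat τ stateFᴬ m (toℕ v) ≡ 0 × nat τ entryFᴬ m (toℕ v) ≡ 0
      evolution : Evolution
      evolution = record
        { _≼_ = λ τ τ′ → ∀ i j → (nat τ stateFᴬ i j ≡ 0 → nat τ′ stateFᴬ i j ≡ 0) ×
          (nat τ entryFᴬ i j ≡ 0 → nat τ′ entryFᴬ i j ≡ 0)
        ; ≼-refl = λ _ _ → (λ h → h) , λ h → h
        ; ≼-trans = λ f g i j → (λ h → proj₁ (g i j) (proj₁ (f i j) h)) , λ h → proj₂ (g i j) (proj₂ (f i j) h) }
      open Each evolution
      persist : ∀ {m v τ τ′} → (∀ i j → (nat τ stateFᴬ i j ≡ 0 → nat τ′ stateFᴬ i j ≡ 0) ×
        (nat τ entryFᴬ i j ≡ 0 → nat τ′ entryFᴬ i j ≡ 0)) →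
                Q m v τ → Q m v τ′
      persist {m} {v} le (a , b) = proj₁ (le m (toℕ v)) a , proj₂ (le m (toℕ v)) b
      once : State ℝ → State ℝ
      once τ = ⟨ write (nat τ) stateFᴬ (nat τ mᵛ 0 0) (nat τ vᵛ 0 0) 0 , wt τ ⟩
      zero-write : ∀ (m : Memory ℕ) a i j i′ j′ → m a i′ j′ ≡ 0 → write m a i j 0 a i′ j′ ≡ 0
      zero-write m a i j i′ j′ h with write-cases m a i j 0 i′ j′
      ... | inj₁ (_ , _ , e) = e
      ... | inj₂ (_ , e) = trans e h
      done : ∀ {τ m v} → nat τ mᵛ 0 0 ≡ m → nat τ vᵛ 0 0 ≡ toℕ v →
        let τ′ = ⟨ write (nat (once τ)) entryFᴬ (nat τ mᵛ 0 0) (nat τ vᵛ 0 0) 0 , wt τ ⟩ in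
        (∀ i j → (nat τ stateFᴬ i j ≡ 0 → nat τ′ stateFᴬ i j ≡ 0) ×
          (nat τ entryFᴬ i j ≡ 0 → nat τ′ entryFᴬ i j ≡ 0)) × Q m v τ′
      done {τ} {m} {v} xm xv =
        (λ i j → zero-write (nat τ) stateFᴬ (nat τ mᵛ 0 0) (nat τ vᵛ 0 0) i j ,
          zero-write (nat (once τ)) entryFᴬ (nat τ mᵛ 0 0) (nat τ vᵛ 0 0) i j) ,
        subst₂ (λ i j → write (nat τ) stateFᴬ (nat τ mᵛ 0 0) (nat τ vᵛ 0 0) 0 stateFᴬ i j ≡ 0) xm xv
          (write-hit (nat τ) stateFᴬ (nat τ mᵛ 0 0) (nat τ vᵛ 0 0) 0) ,
        subst₂ (λ i j → write (nat (once τ)) entryFᴬ (nat τ mᵛ 0 0) (nat τ vᵛ 0 0) 0 entryFᴬ i j ≡ 0) xm xv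
          (write-hit (nat (once τ)) entryFᴬ (nat τ mᵛ 0 0) (nat τ vᵛ 0 0) 0)

    begin : ∀ {σ} → Terrain s K σ →
            Exec BEGIN σ (0 , 1) (λ σ′ → Improves stateFᴬ stateᵂ StateOK σ σ′ ×
              (∀ b → tr b ≡ tr s → s ∼ b → StateEntry σ′ 0 b (P s b)))
    begin {σ} T = States.for-fin (λ b τ → tr b ≡ tr s → s ∼ b → StateEntry τ 0 b (P s b)) (record {})
      (Terrain.size-is T) (improves-set bᵛ refl)
      (λ le h bs sb → entries le (h bs sb))
      λ b {σ₁} fr xb _ →
        let T₁ = terrain-kept {BEGIN} refl refl refl fr T
            value = trans (cong₂ (wt σ₁ pathᵂ) (Terrain.s-is T₁) xb) (Terrain.paths-are T₁ s b) in
        consequence (λ { {τ} _ (im , en) → im , λ bs sb → entry-at stateFᴬ stateᵂ τ refl xb (≡⇒≤ value)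
            (en (trans (Terrain.tree-at T₁ {bᵛ} xb) (trans bs (sym (Terrain.tree-s T₁ {bᵛ} xb))) ,
              Terrain.near⁺ T₁ {bᵛ} xb sb)) })
          (relax-when {b = treeᴬ ⟪ bᵛ ⟫₁ ≡ᴺ treeᴬ ⟪ sᵛ ⟫₁ and sepᴬ ⟪ sᵛ , bᵛ ⟫ ≡ᴺ litᴺ 0}
            λ { (bs , sb) _ _ b′ b′≡ → subst (λ b → Reaches _ b _) (toℕ-injective (trans (sym xb) (sym b′≡)))
              (0 , _ , start (trans (sym (Terrain.tree-at T₁ {bᵛ} xb))
                (trans bs (Terrain.tree-s T₁ {bᵛ} xb))) (Terrain.near⁻ T₁ {bᵛ} xb sb) ,
                ≡⇒≤ (sym value)) })

    -- What a walk guarantees about the distance table is left open here. The instance will be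
    -- `Realised`, since turning a walk into a path takes near conservativeness.
    module _ (Guarantee : Fin n → Fin n → Carrier → Set)
             (guaranteed : ∀ {r S t x y} → HopsFrom r S t x → x ≤ y → Guarantee s t y) where

      DistanceOK : ℕ → ℕ → Carrier → Set
      DistanceOK i j x = ∀ u v → toℕ u ≡ i → toℕ v ≡ j → Guarantee u v x

      private
        module Distances = Each (improvement distFᴬ distᵂ DistanceOK)

        dists-kept : ∀ {p σ σ′} → distFᴬ ∉ᵇ writesᴺ p → distᵂ ∉ᵇ writesᵂ p → Frame p σ σ′ →
          Improves distFᴬ distᵂ DistanceOK σ σ′
        dists-kept = kept-table distFᴬ distᵂ DistanceOK

        Complete : ℕ → State ℝ → Set
        Complete r τ = ∀ {r′ S y x} → r′ ℕ.≤ r → HopsFrom r′ S y x → StateEntry τ S y x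

      extract : ∀ {σ} → Terrain s K σ → Sound stateFᴬ stateᵂ StateOK σ →
                Exec (FOR mᵛ masksᵛ (EACH tᵛ (WHEN (stateFᴬ ⟪ mᵛ , tᵛ ⟫ ≢ᴺ litᴺ 0)
                  (RELAX distFᴬ distᵂ (scalar sᵛ) (scalar tᵛ) (stateᵂ ⟪ mᵛ , tᵛ ⟫ᵂ))))) σ (1 , 1)
                  (λ σ′ → Improves distFᴬ distᵂ DistanceOK σ σ′ ×
                    (∀ {m t x} → m ℕ.< 2 ℕ.^ K → StateEntry σ m t x → Entry distFᴬ distᵂ σ′ (toℕ s) (toℕ t) x))
      extract {σ} T snd = consequence (λ { _ (im , q) → im , λ {m} {t} m< e → q m< t e })
        (Distances.for-each (λ m τ → ∀ t → Q m t τ) (record {}) masks-fit (Terrain.masks-is T)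
          (improves-set mᵛ refl)
          (λ le h t e → entries le (h t e))
          λ {m} {σ₁} m<M fr xm _ →
            Distances.for-fin (Q m) (record {}) (scalar-kept refl fr (Terrain.size-is T)) (improves-set tᵛ refl)
              (λ le h e → entries le (h e))
              λ t {σ₂} fr₂ xt _ →
                let fr′ = frame-trans fr (frame-FOR {mᵛ} {masksᵛ} fr₂)
                    T₂ = terrain-kept {_} refl refl refl fr′ T
                    xm₂ = scalar-kept refl fr₂ xm
                    xs₂ = Terrain.s-is T₂
                    flag : nat σ₂ stateFᴬ (nat σ₂ mᵛ 0 0) (nat σ₂ tᵛ 0 0) ≡ nat σ stateFᴬ m (toℕ t)
                    flag = trans (cong₂ (nat σ₂ stateFᴬ) xm₂ xt)
                      (cong (λ f → f m (toℕ t)) (keepᴺ fr′ stateFᴬ refl))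
                    value : wt σ₂ stateᵂ (nat σ₂ mᵛ 0 0) (nat σ₂ tᵛ 0 0) ≡ wt σ stateᵂ m (toℕ t)
                    value = trans (cong₂ (wt σ₂ stateᵂ) xm₂ xt)
                      (cong (λ f → f m (toℕ t)) (keepᵂ fr′ stateᵂ refl)) in
                consequence (λ { {τ} _ (im , en) → im , λ { (f , le) →
                    entry-at distFᴬ distᵂ τ xs₂ xt (≤-trans (≡⇒≤ value) le)
                      (en (λ z → f (trans (sym flag) z))) } })
                  (relax-when {b = stateFᴬ ⟪ mᵛ , tᵛ ⟫ ≢ᴺ litᴺ 0} λ f _ u v ui vj →
                    claim {m} {t} m<M (snd (λ z → f (trans flag z))) (trans ui xs₂) (trans vj xt) value))
        where
        Q : ℕ → Fin n → State ℝ → Set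
        Q m t τ = ∀ {x} → StateEntry σ m t x → Entry distFᴬ distᵂ τ (toℕ s) (toℕ t) x
        claim : ∀ {m t u v y} → m ℕ.< 2 ℕ.^ K → StateOK m (toℕ t) (wt σ stateᵂ m (toℕ t)) →
                toℕ u ≡ toℕ s → toℕ v ≡ toℕ t → y ≡ wt σ stateᵂ m (toℕ t) → Guarantee u v y
        claim {m} {t} m< ok us vt refl with toℕ-injective us | toℕ-injective vt | ok m< t refl
        ... | refl | refl | _ , _ , h , le = guaranteed h le

      rounds : ∀ {σ} → Terrain s K σ → Sound stateFᴬ stateᵂ StateOK σ →
        Sound entryFᴬ entryᵂ EntryOK σ → Complete 0 σ →
               Exec (EACH rᵛ (ENTER ⨾ CROSS-TREE)) σ (1 , 3)
                 (λ σ′ → Sound stateFᴬ stateᵂ StateOK σ′ × Sound entryFᴬ entryᵂ EntryOK σ′ × Complete n σ′)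
      rounds {σ} T sndˢ sndᵉ complete = for-loop Inv (record {}) (polynomial (ℕₚ.n≤1+n n))
        (Terrain.size-is T) (λ h → h) (sndˢ , sndᵉ , complete)
        λ {r} {σ₁} r<n fr xr (ss , se , comp) →
          let T₁ = terrain-kept {EACH rᵛ (ENTER ⨾ CROSS-TREE)} refl refl refl fr T in
          enter {σ₁} T₁ ss then-do λ {σ₂} fr₂ (im , en) →
          let T₂ = terrain-kept {ENTER} refl refl refl fr₂ T₁ in
          consequence (λ { {σ₃} fr₃ (im′ , en′) →
              sound im′ (sound (states-kept {ENTER} refl refl fr₂) ss) ,
                sound (entries-kept {CROSS-TREE} refl refl fr₃) (sound im se) ,
              step {r} {σ₁} {σ₂} {σ₃} comp fr₂ en im′ en′ })
            (cross-tree {σ₂} T₂ (sound im se))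
        where
        Inv : ℕ → State ℝ → Set
        Inv r τ = Sound stateFᴬ stateᵂ StateOK τ × Sound entryFᴬ entryᵂ EntryOK τ × Complete r τ
        -- The last hop of a walk is replayed in two halves, entry and tree path; the walk before it
        -- has one hop less and is in the table since the previous round.
        step : ∀ {r σ₁ σ₂ σ₃} → Complete r σ₁ → Frame ENTER σ₁ σ₂ →
          (∀ {m y a x} → m ℕ.< 2 ℕ.^ K → StateEntry σ₁ m y x → (ya : Arc y a) → s ∼ a →
            tr a ≢ tr s → tr a ≢ tr y →
            bit m (ix a) ≡ false → EntryEntry σ₂ m a (x + c y a ya)) →
          Improves stateFᴬ stateᵂ StateOK σ₂ σ₃ →
          (∀ {m a b x} → m ℕ.< 2 ℕ.^ K → EntryEntry σ₂ m a x → tr a ≡ tr b → s ∼ b →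
            StateEntry σ₃ (m ℕ.+ pw (ix a)) b (x + P a b)) →
          Complete (suc r) σ₃
        step comp fr en im en′ _ h@(start _ _) = entries im
          (entries (states-kept {ENTER} refl refl fr) (comp z≤n h))
        step comp fr en im en′ (s≤s r′≤) (hop h ya sa a≁s a≁y free ab sb) =
          en′ (hops-mask h) (en (hops-mask h) (comp r′≤ h) ya sa a≁s a≁y free) ab sb

      search : ∀ {σ} → Terrain s K σ →
               Exec SEARCH σ (1 , 3) (λ σ′ → Improves distFᴬ distᵂ DistanceOK σ σ′ ×
                 (∀ {r S t x} → r ℕ.≤ n → HopsFrom r S t x → Entry distFᴬ distᵂ σ′ (toℕ s) (toℕ t) x))
      search {σ} T =
        slower tt (clear {σ} T) then-do λ {σ₁} fr₁ zeros →
        let T₁ = terrain-kept {CLEAR} refl refl refl fr₁ T in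
        slower tt (begin {σ₁} T₁) then-do λ {σ₂} fr₂ (im , st) →
        let T₂ = terrain-kept {BEGIN} refl refl refl fr₂ T₁
            ss : Sound stateFᴬ stateᵂ StateOK σ₂
            ss = sound im (λ {i} {j} f m< y yj → ⊥-elim
              (f (subst (λ j → nat σ₁ stateFᴬ i j ≡ 0) yj (proj₁ (zeros m< y)))))
            se : Sound entryFᴬ entryᵂ EntryOK σ₂
            se = λ {i} {j} f m< y yj → ⊥-elim (f (trans (cong (λ m → m i j) (keepᴺ fr₂ entryFᴬ refl))
                   (subst (λ j → nat σ₁ entryFᴬ i j ≡ 0) yj (proj₂ (zeros m< y))))) in
        rounds {σ₂} T₂ (λ {i} {j} → ss {i} {j}) (λ {i} {j} → se {i} {j})
          (λ { z≤n (start ys sy) → st _ ys sy }) then-do λ {σ₃} fr₃ (ss₃ , se₃ , comp) →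
        let T₃ = terrain-kept {EACH rᵛ (ENTER ⨾ CROSS-TREE)} refl refl refl fr₃ T₂ in
        slower tt (consequence (λ { {τ} fr₄ (im′ , out) →
            ≼-trans (dists-kept {CLEAR} refl refl fr₁) (≼-trans (dists-kept {BEGIN} refl refl fr₂)
              (≼-trans (dists-kept {EACH rᵛ (ENTER ⨾ CROSS-TREE)} refl refl fr₃) im′)) ,
            λ r≤n h → out (hops-mask h) (comp r≤n h) })
          (extract {σ₃} T₃ ss₃))
        where open Evolution (improvement distFᴬ distᵂ DistanceOK) using (≼-trans)

-- Combining blocks and components

module CombiningProof (ℝ : RealNumbers) {n : ℕ} (D : Digraph n) (c : Weight ℝ D) (Good : ℕ → Set) where
  open Execution ℝ n Good
  open Relaxation ℝ n Good
  open OrderedField ℝ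
  open Digraph D using (Arc)
  open Weighted ℝ D c
  open Theory ℝ D c
  open Reading ℝ D c Good
  open Separation D
  open ConnectivityProof ℝ D c Good using (scalar-kept; sep; LastSeparator)
  open KruskalProof ℝ D c Good using (Edge; bad)

  private variable
    s t u v a b : Fin n

  -- Finite distances have to be realised by paths only when c is nearly
  -- conservative.

  Realised : Fin n → Fin n → Carrier → Set
  Realised u v x = NearlyConservative → Σ (Star Arc u v) λ p → Simple p × weight p ≤ x

  DistanceOK : ℕ → ℕ → Carrier → Set
  DistanceOK i j x = ∀ u v → toℕ u ≡ i → toℕ v ≡ j → Realised u v x

  DistEntry CrossEntry : State ℝ → Fin n → Fin n → Carrier → Set
  DistEntry σ u v x = Entry distFᴬ distᵂ σ (toℕ u) (toℕ v) x
  CrossEntry σ u v x = Entry crossFᴬ crossᵂ σ (toℕ u) (toℕ v) x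

  DistSound : State ℝ → Set
  DistSound = Sound distFᴬ distᵂ DistanceOK

  DistImproves : State ℝ → State ℝ → Set
  DistImproves = Improves distFᴬ distᵂ DistanceOK

  dists-kept : ∀ {p σ σ′} → distFᴬ ∉ᵇ writesᴺ p → distᵂ ∉ᵇ writesᵂ p → Frame p σ σ′ → DistImproves σ σ′
  dists-kept = kept-table distFᴬ distᵂ DistanceOK

  entry-at : ∀ fin val σ {i i′ j j′ x x′} → i ≡ i′ → j ≡ j′ → x ≤ x′ → Entry fin val σ i j x →
    Entry fin val σ i′ j′ x′
  entry-at _ _ _ refl refl le (f , h) = f , ≤-trans h le

  realised-at : ∀ {σ u v i j} → DistSound σ → i ≡ toℕ u → j ≡ toℕ v → nat σ distFᴬ i j ≢ 0 →
    Realised u v (wt σ distᵂ i j)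
  realised-at snd xi xj f = snd f _ _ (sym xi) (sym xj)

  SeparatorsKnown : State ℝ → Set
  SeparatorsKnown σ = ∀ u v → LastSeparator (suc n) u v (sep σ u v)

  separators-kept : ∀ {p σ σ′} → sepᴬ ∉ᵇ writesᴺ p → Frame p σ σ′ → SeparatorsKnown σ → SeparatorsKnown σ′
  separators-kept h fr k u v = subst (LastSeparator (suc n) u v)
    (sym (cong (λ m → m (toℕ u) (toℕ v)) (keepᴺ fr sepᴬ h))) (k u v)

  mutual⇒conn : Mutual u v → Conn n u v
  mutual⇒conn m@(p , _) with link-path p m
  ... | q , _ = avoiding q (λ {z} _ → ℕₚ.<⇒≢ (toℕ<n z))

  different-component : ∀ {z} → LastSeparator (suc n) u v z → z ≡ suc n → ¬ Mutual u v
  different-component (_ , f) refl m = proj₂ (proj₂ (proj₂ (f n refl))) (mutual⇒conn m)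

  same-component : ∀ {z} → LastSeparator (suc n) u v z → z ≢ suc n → Mutual u v
  same-component {z = z} (f , g) z≢ = conn⇒mutual (f n ℕₚ.≤-refl z≤n′ (ℕₚ.<⇒≢ (toℕ<n _)) (ℕₚ.<⇒≢ (toℕ<n _)))
    where
    bounded : ∀ z → (∀ w → z ≡ suc w → w ℕ.< suc n × _) → z ℕ.≤ suc n
    bounded zero    h = z≤n
    bounded (suc w) h = proj₁ (h w refl)
    z≤n′ : z ℕ.≤ n
    z≤n′ = ℕₚ.≤-pred (ℕₚ.≤∧≢⇒< (bounded z g) z≢)

  zero⇒∼ : LastSeparator (suc n) u v 0 → u ∼ v
  zero⇒∼ {u} {v} (f , _) w u≢ v≢ with w ℕ.<? suc n
  ... | yes w< = f w w< z≤n u≢ v≢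
  ... | no w≮ = map (λ { (_ , _ , l) → big _ , big _ , l })
    (f n ℕₚ.≤-refl z≤n (ℕₚ.<⇒≢ (toℕ<n u)) (ℕₚ.<⇒≢ (toℕ<n v)))
    where
    open import Relation.Binary.Construct.Closure.ReflexiveTransitive using (map)
    big : ∀ (z : Fin n) → toℕ z ≢ w
    big z refl = w≮ (ℕₚ.<-trans (toℕ<n z) ℕₚ.≤-refl)

  ∼⇒zero : ∀ {z} → LastSeparator (suc n) u v z → u ∼ v → z ≡ 0
  ∼⇒zero {z = zero} _ _ = refl
  ∼⇒zero {z = suc w} (_ , g) uv with g w refl
  ... | _ , u≢ , v≢ , ¬c = ⊥-elim (¬c (uv w u≢ v≢))

  mutual? : ∀ {σ} → SeparatorsKnown σ → Decidable₂ Mutual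
  mutual? {σ} k u v with sep σ u v ℕ.≟ suc n
  ... | yes e = no (different-component (k u v) e)
  ... | no ne = yes (same-component (k u v) ne)

  ∼-dec : ∀ {σ} → SeparatorsKnown σ → Decidable₂ _∼_
  ∼-dec {σ} k u v with sep σ u v in e
  ... | zero  = yes (zero⇒∼ (subst (LastSeparator (suc n) u v) e (k u v)))
  ... | suc w = no λ uv → absurd (trans (sym e) (∼⇒zero (k u v) uv))
    where
    absurd : ¬ suc w ≡ 0
    absurd ()

  nonempty : (p : Star Arc s t) → s ≢ t → 1 ℕ.≤ len p
  nonempty ε       s≢t = ⊥-elim (s≢t refl)
  nonempty (_ ◅ _) s≢t = s≤s z≤n

  module Dist = Each (improvement distFᴬ distᵂ DistanceOK)

  module _ (σ₀ : State ℝ) (N : nat σ₀ sizeᴬ 0 0 ≡ n) (N⁺ : nat σ₀ size⁺ᵛ 0 0 ≡ suc n)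
           (known : SeparatorsKnown σ₀) (snd₀ : DistSound σ₀) where

    private
      -- Appears as a premise inside the loop invariant: completeness within blocks depends on the
      -- verdict of `CHECK`, which falls after this loop has run.
      BlockComplete : Set
      BlockComplete = ∀ {u v} (p : Star Arc u v) → Simple p → u ∼ v → DistEntry σ₀ u v (weight p)

      Inv : ℕ → State ℝ → Set
      Inv r τ = DistImproves σ₀ τ ×
        (BlockComplete → ∀ {u v} (p : Star Arc u v) → Simple p → Mutual u v → len p ℕ.≤ r →
          DistEntry τ u v (weight p))

    through-separators : Exec THROUGH-SEPARATORS σ₀ (0 , 3) (λ τ → DistImproves σ₀ τ ×
      (BlockComplete → ∀ {u v} (p : Star Arc u v) → Simple p → Mutual u v → DistEntry τ u v (weight p)))
    through-separators = consequence
      (λ { _ (im , h) → im , λ bc p sp m → h bc p sp m (ℕₚ.≤-trans (ℕₚ.n≤1+n _) (simple-short p sp)) })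
      (for-loop Inv (record {}) (polynomial (ℕₚ.n≤1+n n)) N
        (λ { (im , h) → improves (entries im) (sound im) , h })
        (improves (λ h → h) (λ h → h) , base) stage)
      where
      base : BlockComplete → ∀ {u v} (p : Star Arc u v) → Simple p → Mutual u v → len p ℕ.≤ 0 →
        DistEntry σ₀ u v (weight p)
      base bc ε sp _ _ = bc ε sp ∼-refl
      stage : ∀ {r σ₁} → r ℕ.< n → Frame THROUGH-SEPARATORS σ₀ σ₁ → nat σ₁ rᵛ 0 0 ≡ r → Inv r σ₁ →
        Exec _ σ₁ (0 , 2) (Inv (suc r))
      stage {r} {σ₁} r<n fr xr (im₀ , comp) = consequence
        (λ { {τ} _ (im , q) → improves (λ h → entries im (entries im₀ h)) (λ h → sound im (sound im₀ h)) ,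
          λ bc p sp m le → step {τ} im q bc p sp m le })
        (Dist.for-fin₂ Q (record {}) (record {}) (scalar-kept refl fr N) (improves-set sᵛ refl)
          (improves-set tᵛ refl)
          (λ le h e a b → entries le (h e a b))
          λ s t {σ₂} fr₂ xs xt im →
            exec-nat {Q = _≡ σ₃ σ₂} refl then-do λ { _ refl →
            exec-nat {Q = _≡ σ₄ σ₂} refl then-do λ { _ refl →
            consequence (λ { {τ} _ (im′ , en) →
                (improves (λ h → entries im′ h) (λ h → sound im′ h)) , λ {x} e d₁ d₂ →
                  let d₁′ = entries im d₁
                      d₂′ = entries im d₂ in
                  entry-at distFᴬ distᵂ τ xs xt (+-mono (≤-trans
                    (≡⇒≤ (cong₂ (wt σ₂ distᵂ) xs (p-is {s} {t} {σ₂} fr₂ xs xt e))) (proj₂ d₁′))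
                                                       (≤-trans (≡⇒≤ (cong₂ (wt σ₂ distᵂ) (p-is {s} {t} {σ₂}
                                                         fr₂ xs xt e) xt)) (proj₂ d₂′)))
                    (en (guard⁺ {s} {t} {σ₂} fr₂ xs xt {x} e (proj₁ d₁′) (proj₁ d₂′))) })
              (relax-when {fin = distFᴬ} {val = distᵂ} {P = DistanceOK} {σ = σ₄ σ₂} {b = guard} λ g snd u v
                ui vj → claim {s} {t} {σ₂} fr₂ xs xt g (λ {i} {j} → snd {i} {j})
                  (toℕ-injective (trans ui xs)) (toℕ-injective (trans vj xt))) } })
        where
        guard : BExp
        guard = litᴺ 0 <ᴺ scalar qᵛ and scalar qᵛ <ᴺ scalar size⁺ᵛ and
                distFᴬ ⟪ sᵛ , pᵛ ⟫ ≢ᴺ litᴺ 0 and distFᴬ ⟪ pᵛ , tᵛ ⟫ ≢ᴺ litᴺ 0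
        Q : Fin n → Fin n → State ℝ → Set
        Q s t τ = ∀ {x y₁ y₂} → sep σ₀ s t ≡ suc (toℕ x) → DistEntry σ₁ s x y₁ → DistEntry σ₁ x t y₂ →
          DistEntry τ s t (y₁ + y₂)
        Inner = EACH₂ sᵛ tᵛ ((qᵛ ≔ sepᴬ ⟪ sᵛ , tᵛ ⟫) ⨾ (pᵛ ≔ scalar qᵛ ∸ᴺ litᴺ 1) ⨾
                  WHEN guard (RELAX distFᴬ distᵂ (scalar sᵛ) (scalar tᵛ)
                    (distᵂ ⟪ sᵛ , pᵛ ⟫ᵂ +ᵂ distᵂ ⟪ pᵛ , tᵛ ⟫ᵂ)))
        z-of : State ℝ → ℕ
        z-of τ = nat τ sepᴬ (nat τ sᵛ 0 0) (nat τ tᵛ 0 0)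
        σ₃ σ₄ : State ℝ → State ℝ
        σ₃ τ = set τ qᵛ (z-of τ)
        σ₄ τ = set (σ₃ τ) pᵛ (z-of τ ℕ.∸ 1)
        z-is : ∀ {s t σ₂} → Frame Inner σ₁ σ₂ → nat σ₂ sᵛ 0 0 ≡ toℕ s → nat σ₂ tᵛ 0 0 ≡ toℕ t →
          z-of σ₂ ≡ sep σ₀ s t
        z-is {s} {t} {σ₂} fr₂ xs xt = trans (cong₂ (nat σ₂ sepᴬ) xs xt)
          (cong (λ m → m (toℕ s) (toℕ t)) (trans (keepᴺ fr₂ sepᴬ refl) (keepᴺ fr sepᴬ refl)))
        p-is : ∀ {s t σ₂ x} → Frame Inner σ₁ σ₂ → nat σ₂ sᵛ 0 0 ≡ toℕ s → nat σ₂ tᵛ 0 0 ≡ toℕ t →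
          sep σ₀ s t ≡ suc x → z-of σ₂ ℕ.∸ 1 ≡ x
        p-is {s} {t} {σ₂} fr₂ xs xt e = cong (ℕ._∸ 1) (trans (z-is {s} {t} {σ₂} fr₂ xs xt) e)
        size⁺₂ : ∀ {σ₂} → Frame Inner σ₁ σ₂ → nat σ₂ size⁺ᵛ 0 0 ≡ suc n
        size⁺₂ fr₂ = scalar-kept refl fr₂ (scalar-kept refl fr N⁺)
        guard⁺ : ∀ {s t σ₂} → Frame Inner σ₁ σ₂ → nat σ₂ sᵛ 0 0 ≡ toℕ s → nat σ₂ tᵛ 0 0 ≡ toℕ t →
          ∀ {x : Fin n} → sep σ₀ s t ≡ suc (toℕ x) →
                 nat σ₂ distFᴬ (toℕ s) (toℕ x) ≢ 0 → nat σ₂ distFᴬ (toℕ x) (toℕ t) ≢ 0 → ⟦ guard ⟧ (σ₄ σ₂)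
        guard⁺ {s} {t} {σ₂} fr₂ xs xt {x} e f₁ f₂ =
          subst (0 ℕ.<_) (sym (trans (z-is {s} {t} {σ₂} fr₂ xs xt) e)) (s≤s z≤n) ,
          subst₂ ℕ._<_ (sym (trans (z-is {s} {t} {σ₂} fr₂ xs xt) e)) (sym (size⁺₂ {σ₂} fr₂)) (s≤s (toℕ<n x)) ,
          (λ z → f₁ (trans (sym (cong₂ (nat σ₂ distFᴬ) xs (p-is {s} {t} {σ₂} fr₂ xs xt e))) z)) ,
          (λ z → f₂ (trans (sym (cong₂ (nat σ₂ distFᴬ) (p-is {s} {t} {σ₂} fr₂ xs xt e) xt)) z))
        claim : ∀ {s t σ₂ u v} → Frame Inner σ₁ σ₂ → nat σ₂ sᵛ 0 0 ≡ toℕ s → nat σ₂ tᵛ 0 0 ≡ toℕ t →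
          ⟦ guard ⟧ (σ₄ σ₂) → DistSound (σ₄ σ₂) →
                u ≡ s → v ≡ t → Realised u v (wt σ₂ distᵂ (nat σ₂ sᵛ 0 0) (z-of σ₂ ℕ.∸ 1) + wt σ₂ distᵂ
                  (z-of σ₂ ℕ.∸ 1) (nat σ₂ tᵛ 0 0))
        claim {s} {t} {σ₂} fr₂ xs xt (0<z , z<n , f₁ , f₂) snd refl refl nc = result (known s t)
          where
          z = z-of σ₂
          z≡ : z ≡ sep σ₀ s t
          z≡ = z-is {s} {t} {σ₂} fr₂ xs xt
          z-suc : suc (z ℕ.∸ 1) ≡ z
          z-suc = ℕₚ.m+[n∸m]≡n 0<z
          w<n : z ℕ.∸ 1 ℕ.< n
          w<n = ℕₚ.≤-pred (subst₂ ℕ._<_ (sym z-suc) (size⁺₂ {σ₂} fr₂) z<n)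
          x : Fin n
          x = fromℕ< w<n
          xz : z ℕ.∸ 1 ≡ toℕ x
          xz = sym (toℕ-fromℕ< w<n)
          result : LastSeparator (suc n) s t (sep σ₀ s t) → _
          result ls@(_ , g) with realised-at {σ₄ σ₂} {s} {x} snd xs xz f₁ nc | realised-at {σ₄ σ₂} {x}
            {t} snd xz xt f₂ nc
          ... | p , sp , p≤ | q , sq , q≤ = p ◅◅ q , join-at-separator p q st (p , q ◅◅ proj₂ st) sp sq
                (subst (λ w → ¬ Conn w s t) xz (proj₂ (proj₂
                  (proj₂ (g (z ℕ.∸ 1) (trans (sym z≡) (sym z-suc))))))) ,
                ≤-trans (≈⇒≤ (weight-◅◅ p q)) (+-mono p≤ q≤)
            where
            st : Mutual s t
            st = same-component ls (λ e → ℕₚ.<⇒≢ (subst₂ ℕ._<_ z≡ (size⁺₂ {σ₂} fr₂) z<n) e)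
        -- A path between separated vertices contains the separator, which differs from both ends.
        -- Both parts are shorter and were complete one round earlier.
        step : ∀ {τ} → DistImproves σ₁ τ → (∀ u v → Q u v τ) → BlockComplete →
               ∀ {u v} (p : Star Arc u v) → Simple p → Mutual u v → len p ℕ.≤ suc r → DistEntry τ u v (weight p)
        step {τ} im q bc {u} {v} p sp m le with sep σ₀ u v in e
        ... | zero = entries im (entries im₀ (bc p sp (zero⇒∼ (subst (LastSeparator (suc n) u v) e (known u v)))))
        ... | suc w with proj₂ (known u v) w e
        ...   | _ , u≢ , v≢ , ¬c with separator-on-path p m ¬c
        ...     | x , x∈ , refl with split p x∈
        ...       | p₁ , p₂ , refl = entry-at distFᴬ distᵂ τ refl refl (≈⇒≥ (weight-◅◅ p₁ p₂))
          (q u v {x} e (comp bc p₁ (proj₁ sps) (p₁ , p₂ ◅◅ proj₂ m) l₁)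
            (comp bc p₂ (proj₁ (proj₂ sps)) (p₂ , proj₂ m ◅◅ p₁) l₂))
          where
          sps = ◅◅-simple⁻ p₁ p₂ sp
          le′ : len p₁ ℕ.+ len p₂ ℕ.≤ suc r
          le′ = subst (ℕ._≤ suc r) (len-◅◅ p₁ p₂) le
          l₁ : len p₁ ℕ.≤ r
          l₁ = ℕₚ.≤-pred (ℕₚ.≤-trans (ℕₚ.≤-reflexive (ℕₚ.+-comm 1 _))
                 (ℕₚ.≤-trans (ℕₚ.+-monoʳ-≤ (len p₁) (nonempty p₂ (λ { refl → v≢ refl }))) le′))
          l₂ : len p₂ ℕ.≤ r
          l₂ = ℕₚ.≤-pred (ℕₚ.≤-trans (ℕₚ.+-monoˡ-≤ (len p₂) (nonempty p₁ (λ { refl → u≢ refl }))) le′)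

  Crossing : Fin n → Fin n → Carrier → Set
  Crossing s b x = NearlyConservative → Σ (Fin n) λ a → Σ (Arc a b) λ ab → Σ (Star Arc s a) λ p →
    Mutual s a × ¬ Mutual a b × Simple p × weight p + c a b ab ≤ x

  CrossOK : ℕ → ℕ → Carrier → Set
  CrossOK i j x = ∀ s b → toℕ s ≡ i → toℕ b ≡ j → Crossing s b x

  CrossSound : State ℝ → Set
  CrossSound = Sound crossFᴬ crossᵂ CrossOK

  module Cross = Each (improvement crossFᴬ crossᵂ CrossOK)

  crossings : ∀ {σ₀} → Input σ₀ → nat σ₀ size⁺ᵛ 0 0 ≡ suc n → SeparatorsKnown σ₀ → DistSound σ₀ →
              Exec CROSSINGS σ₀ (0 , 3) (λ τ → Improves crossFᴬ crossᵂ CrossOK σ₀ τ ×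
                (∀ s a b {x} → (ab : Arc a b) → Mutual s a → ¬ Mutual a b → DistEntry σ₀ s a x →
                  CrossEntry τ s b (x + c a b ab)))
  crossings {σ₀} inp N⁺ known snd₀ = consequence (λ { _ (im , q) → im , λ s a b → q s a b })
    (Cross.for-fin (λ s τ → ∀ a b → Q s a b τ) (record {}) (Input.size-n inp) (improves-set sᵛ refl)
      (λ le h a b ab m ¬m e → entries le (h a b ab m ¬m e))
      λ s {σ₁} fr xs _ → Cross.for-fin₂ (Q s) (record {}) (record {})
        (scalar-kept refl fr (Input.size-n inp)) (improves-set aᵛ refl) (improves-set bᵛ refl)
        (λ le h ab m ¬m e → entries le (h ab m ¬m e))
        λ a b {σ₂} fr₂ xa xb _ →
          let fr′ = frame-trans fr (frame-FOR {sᵛ} {sizeᴬ} fr₂)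
              xs₂ = scalar-kept refl fr₂ xs in
          consequence (λ { {τ} _ (im , en) → im , λ ab m ¬m e →
              entry-at crossFᴬ crossᵂ τ xs₂ xb (+-mono (stored {s} {a} {σ₂} fr′ xs₂ xa e)
                (≡⇒≤ (arc-at {a} {b} {σ₂} fr′ xa xb ab)))
                (en (guard⁺ {s} {a} {b} {σ₂} fr′ xs₂ xa xb ab m ¬m e)) })
            (relax-when {fin = crossFᴬ} {val = crossᵂ} {P = CrossOK} {σ = σ₂} {b = guard}
              λ g _ u v ui vj → claim {s} {a} {b} {σ₂} fr′ xs₂ xa xb g (toℕ-injective (trans ui xs₂))
                (toℕ-injective (trans vj xb))))
    where
    guard : BExp
    guard = distFᴬ ⟪ sᵛ , aᵛ ⟫ ≢ᴺ litᴺ 0 and sepᴬ ⟪ sᵛ , aᵛ ⟫ ≢ᴺ scalar size⁺ᵛ and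
            adjᴬ ⟪ aᵛ , bᵛ ⟫ ≡ᴺ litᴺ 1 and sepᴬ ⟪ aᵛ , bᵛ ⟫ ≡ᴺ scalar size⁺ᵛ
    Q : Fin n → Fin n → Fin n → State ℝ → Set
    Q s a b τ = ∀ {x} → (ab : Arc a b) → Mutual s a → ¬ Mutual a b → DistEntry σ₀ s a x →
      CrossEntry τ s b (x + c a b ab)
    inp₂ : ∀ {σ₂} → Frame CROSSINGS σ₀ σ₂ → Input σ₂
    inp₂ fr = input-kept refl refl refl fr inp
    stored : ∀ {s a σ₂ x} → Frame CROSSINGS σ₀ σ₂ → nat σ₂ sᵛ 0 0 ≡ toℕ s → nat σ₂ aᵛ 0 0 ≡ toℕ a →
      DistEntry σ₀ s a x →
             wt σ₂ distᵂ (nat σ₂ sᵛ 0 0) (nat σ₂ aᵛ 0 0) ≤ x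
    stored {s} {a} {σ₂} fr xs xa (_ , le) = ≤-trans
      (≡⇒≤ (trans (cong₂ (wt σ₂ distᵂ) xs xa) (cong (λ m → m (toℕ s) (toℕ a)) (keepᵂ fr distᵂ refl)))) le
    arc-at : ∀ {a b σ₂} → Frame CROSSINGS σ₀ σ₂ → nat σ₂ aᵛ 0 0 ≡ toℕ a → nat σ₂ bᵛ 0 0 ≡ toℕ b → (ab : Arc a b) →
             wt σ₂ arcᵂ (nat σ₂ aᵛ 0 0) (nat σ₂ bᵛ 0 0) ≡ c a b ab
    arc-at {σ₂ = σ₂} fr xa xb ab = trans (cong₂ (wt σ₂ arcᵂ) xa xb) (Input.arc-weight (inp₂ fr) ab)
    sep-at : ∀ {u v σ₂ i j} → Frame CROSSINGS σ₀ σ₂ → i ≡ toℕ u → j ≡ toℕ v → nat σ₂ sepᴬ i j ≡ sep σ₀ u v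
    sep-at {u} {v} {σ₂} fr xu xv = trans (cong₂ (nat σ₂ sepᴬ) xu xv)
      (cong (λ m → m (toℕ u) (toℕ v)) (keepᴺ fr sepᴬ refl))
    size⁺₂ : ∀ {σ₂} → Frame CROSSINGS σ₀ σ₂ → nat σ₂ size⁺ᵛ 0 0 ≡ suc n
    size⁺₂ fr = scalar-kept refl fr N⁺
    guard⁺ : ∀ {s a b σ₂ x} → Frame CROSSINGS σ₀ σ₂ → nat σ₂ sᵛ 0 0 ≡ toℕ s → nat σ₂ aᵛ 0 0 ≡ toℕ a →
      nat σ₂ bᵛ 0 0 ≡ toℕ b →
             Arc a b → Mutual s a → ¬ Mutual a b → DistEntry σ₀ s a x → ⟦ guard ⟧ σ₂
    guard⁺ {s} {a} {b} {σ₂} fr xs xa xb ab m ¬m (f , _) =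
      (λ z → f (trans (sym (trans (cong₂ (nat σ₂ distFᴬ) xs xa)
        (cong (λ m → m (toℕ s) (toℕ a)) (keepᴺ fr distFᴬ refl)))) z)) ,
      (λ e → different-component (known s a) (trans (sym (sep-at {σ₂ = σ₂} fr xs xa))
        (trans e (size⁺₂ {σ₂} fr))) m) ,
      trans (cong₂ (nat σ₂ adjᴬ) xa xb) (Input.arc⇒adj (inp₂ fr) ab) ,
      crossing
      where
      crossing : nat σ₂ sepᴬ (nat σ₂ aᵛ 0 0) (nat σ₂ bᵛ 0 0) ≡ nat σ₂ size⁺ᵛ 0 0
      crossing with sep σ₀ a b ℕ.≟ suc n
      ... | yes e = trans (sep-at {σ₂ = σ₂} fr xa xb) (trans e (sym (size⁺₂ {σ₂} fr)))
      ... | no ne = ⊥-elim (¬m (same-component (known a b) ne))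
    claim : ∀ {s a b σ₂ u v} → Frame CROSSINGS σ₀ σ₂ → nat σ₂ sᵛ 0 0 ≡ toℕ s → nat σ₂ aᵛ 0 0 ≡ toℕ a →
      nat σ₂ bᵛ 0 0 ≡ toℕ b →
            ⟦ guard ⟧ σ₂ → u ≡ s → v ≡ b → Crossing u v
              (wt σ₂ distᵂ (nat σ₂ sᵛ 0 0) (nat σ₂ aᵛ 0 0) + wt σ₂ arcᵂ (nat σ₂ aᵛ 0 0) (nat σ₂ bᵛ 0 0))
    claim {s} {a} {b} {σ₂} fr xs xa xb (f , same , adj , diff) refl refl nc
      with realised-at {σ₂} {s} {a} (λ {i} {j} → sound (dists-kept {CROSSINGS} refl refl fr)
        (λ {i} {j} → snd₀ {i} {j}) {i} {j}) xs xa f nc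
    ... | p , sp , p≤ = a , ab , p ,
      same-component (known s a) (λ e → same (trans (sep-at {σ₂ = σ₂} fr xs xa)
        (trans e (sym (size⁺₂ {σ₂} fr))))) ,
      different-component (known a b) (trans (sym (sep-at {σ₂ = σ₂} fr xa xb)) (trans diff (size⁺₂ {σ₂} fr))) ,
      sp , +-mono p≤ (≡⇒≤ (sym (arc-at {a} {b} {σ₂} fr xa xb ab)))
      where ab = Input.adj⇒arc (inp₂ fr) (trans (sym (cong₂ (nat σ₂ adjᴬ) xa xb)) adj)

  reach-end : ∀ {z} (p : Star Arc s t) → z ∈ verts p → Star Arc z t
  reach-end p m with split p m
  ... | _ , q , _ = q

  reach-start : ∀ {z} (p : Star Arc s t) → z ∈ verts p → Star Arc s z
  reach-start p m with split p m
  ... | q , _ , _ = q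

  -- A vertex common to both parts would lead from `b` back to `a`, contrary to `¬ Mutual a b`.
  join-crossing : (p : Star Arc s a) (ab : Arc a b) (q : Star Arc b t) → Simple p → Simple q → ¬ Mutual a b →
                  Simple (p ◅◅ (ab ◅ q))
  join-crossing {a = a} p ab q sp sq ¬m = ◅◅-simple p (ab ◅ q) sp
    (Unique-∷ (λ m → ¬m (ab ◅ ε , reach-start q m)) sq) dis
    where
    dis : ∀ {z} → z ∈ sources p → z ∉ a ∷ verts q
    dis m (here refl) = end∉sources p sp m
    dis m (there k)   = ¬m (ab ◅ ε , reach-start q k ◅◅ reach-end p (sources⊆verts p m))

  module _ (σ₀ : State ℝ) (N : nat σ₀ sizeᴬ 0 0 ≡ n) (known : SeparatorsKnown σ₀) (sndᶜ : CrossSound σ₀) where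

    private
      ComponentComplete : Set
      ComponentComplete =
        (∀ {u v} (p : Star Arc u v) → Simple p → Mutual u v → DistEntry σ₀ u v (weight p)) ×
        (∀ {s a b} (p : Star Arc s a) (ab : Arc a b) → Simple p → Mutual s a → ¬ Mutual a b →
          CrossEntry σ₀ s b (weight p + c a b ab))

      Inv : ℕ → State ℝ → Set
      Inv r τ = DistImproves σ₀ τ ×
        (ComponentComplete → ∀ {u v} (p : Star Arc u v) → Simple p → len p ℕ.≤ r → DistEntry τ u v (weight p))

    through-crossings : Exec THROUGH-CROSSINGS σ₀ (0 , 4) (λ τ → DistImproves σ₀ τ ×
      (ComponentComplete → ∀ {u v} (p : Star Arc u v) → Simple p → DistEntry τ u v (weight p)))
    through-crossings = consequence
      (λ { _ (im , h) → im , λ cc p sp → h cc p sp (ℕₚ.≤-trans (ℕₚ.n≤1+n _) (simple-short p sp)) })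
      (for-loop Inv (record {}) (polynomial (ℕₚ.n≤1+n n)) N
        (λ { (im , h) → improves (entries im) (sound im) , h })
        (improves (λ h → h) (λ h → h) , base) stage)
      where
      base : ComponentComplete → ∀ {u v} (p : Star Arc u v) → Simple p → len p ℕ.≤ 0 → DistEntry σ₀ u v (weight p)
      base cc ε sp _ = proj₁ cc ε sp (ε , ε)
      stage : ∀ {r σ₁} → r ℕ.< n → Frame THROUGH-CROSSINGS σ₀ σ₁ → nat σ₁ rᵛ 0 0 ≡ r → Inv r σ₁ →
        Exec _ σ₁ (0 , 3) (Inv (suc r))
      stage {r} {σ₁} r<n fr xr (im₀ , comp) = consequence
        (λ { {τ} _ (im , q) → improves (λ h → entries im (entries im₀ h)) (λ h → sound im (sound im₀ h)) ,
          λ cc p sp le → step {τ} im q cc p sp le })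
        (Dist.for-fin (λ s τ → ∀ b t → Q s b t τ) (record {}) (scalar-kept refl fr N) (improves-set sᵛ refl)
          (λ le h b t x d → entries le (h b t x d))
          λ s {σ₂} fr₂ xs im₁ → Dist.for-fin₂ (Q s) (record {}) (record {})
            (scalar-kept refl fr₂ (scalar-kept refl fr N))
            (improves-set bᵛ refl) (improves-set tᵛ refl) (λ le h x d → entries le (h x d))
            λ b t {σ₃} fr₃ xb xt im₂ →
              let fr′ = frame-trans fr₂ (frame-FOR {sᵛ} {sizeᴬ} fr₃)
                  xs₃ = scalar-kept refl fr₃ xs in
              consequence (λ { {τ} _ (im′ , en) → im′ , λ x d →
                  let d′ = entries im₂ (entries im₁ d) in
                  entry-at distFᴬ distᵂ τ xs₃ xt (+-mono (stored {s} {b} {σ₃} fr′ xs₃ xb x)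
                    (≤-trans (≡⇒≤ (cong₂ (wt σ₃ distᵂ) xb xt)) (proj₂ d′)))
                    (en ((λ z → proj₁ x (trans (sym (flag {s} {b} {σ₃} fr′ xs₃ xb)) z)) ,
                         λ z → proj₁ d′ (trans (sym (cong₂ (nat σ₃ distFᴬ) xb xt)) z))) })
                (relax-when {fin = distFᴬ} {val = distᵂ} {P = DistanceOK} {σ = σ₃} {b = guard} λ g snd u v ui vj →
                  claim {s} {b} {t} {σ₃} fr′ xs₃ xb xt g (λ {i} {j} → snd {i} {j})
                    (toℕ-injective (trans ui xs₃)) (toℕ-injective (trans vj xt))))
        where
        guard : BExp
        guard = crossFᴬ ⟪ sᵛ , bᵛ ⟫ ≢ᴺ litᴺ 0 and distFᴬ ⟪ bᵛ , tᵛ ⟫ ≢ᴺ litᴺ 0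
        Inner = EACH sᵛ (EACH₂ bᵛ tᵛ (WHEN guard (RELAX distFᴬ distᵂ (scalar sᵛ) (scalar tᵛ)
          (crossᵂ ⟪ sᵛ , bᵛ ⟫ᵂ +ᵂ distᵂ ⟪ bᵛ , tᵛ ⟫ᵂ))))
        Q : Fin n → Fin n → Fin n → State ℝ → Set
        Q s b t τ = ∀ {x y} → CrossEntry σ₀ s b x → DistEntry σ₁ b t y → DistEntry τ s t (x + y)
        flag : ∀ {s b σ₃} → Frame Inner σ₁ σ₃ → nat σ₃ sᵛ 0 0 ≡ toℕ s → nat σ₃ bᵛ 0 0 ≡ toℕ b →
               nat σ₃ crossFᴬ (nat σ₃ sᵛ 0 0) (nat σ₃ bᵛ 0 0) ≡ nat σ₀ crossFᴬ (toℕ s) (toℕ b)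
        flag {s} {b} {σ₃} fr′ xs xb = trans (cong₂ (nat σ₃ crossFᴬ) xs xb)
          (cong (λ m → m (toℕ s) (toℕ b)) (trans (keepᴺ fr′ crossFᴬ refl) (keepᴺ fr crossFᴬ refl)))
        value : ∀ {s b σ₃} → Frame Inner σ₁ σ₃ → nat σ₃ sᵛ 0 0 ≡ toℕ s → nat σ₃ bᵛ 0 0 ≡ toℕ b →
                wt σ₃ crossᵂ (nat σ₃ sᵛ 0 0) (nat σ₃ bᵛ 0 0) ≡ wt σ₀ crossᵂ (toℕ s) (toℕ b)
        value {s} {b} {σ₃} fr′ xs xb = trans (cong₂ (wt σ₃ crossᵂ) xs xb)
          (cong (λ m → m (toℕ s) (toℕ b)) (trans (keepᵂ fr′ crossᵂ refl) (keepᵂ fr crossᵂ refl)))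
        stored : ∀ {s b σ₃ x} → Frame Inner σ₁ σ₃ → nat σ₃ sᵛ 0 0 ≡ toℕ s → nat σ₃ bᵛ 0 0 ≡ toℕ b →
          CrossEntry σ₀ s b x →
                 wt σ₃ crossᵂ (nat σ₃ sᵛ 0 0) (nat σ₃ bᵛ 0 0) ≤ x
        stored {s} {b} {σ₃} fr′ xs xb (_ , le) = ≤-trans (≡⇒≤ (value {s} {b} {σ₃} fr′ xs xb)) le
        claim : ∀ {s b t σ₃ u v} → Frame Inner σ₁ σ₃ → nat σ₃ sᵛ 0 0 ≡ toℕ s → nat σ₃ bᵛ 0 0 ≡ toℕ b →
          nat σ₃ tᵛ 0 0 ≡ toℕ t →
                ⟦ guard ⟧ σ₃ → DistSound σ₃ → u ≡ s → v ≡ t →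
                Realised u v (wt σ₃ crossᵂ (nat σ₃ sᵛ 0 0) (nat σ₃ bᵛ 0 0) + wt σ₃ distᵂ
                  (nat σ₃ bᵛ 0 0) (nat σ₃ tᵛ 0 0))
        claim {s} {b} {t} {σ₃} fr′ xs xb xt (f₁ , f₂) snd refl refl nc
          with sndᶜ (λ z → f₁ (trans (flag {s} {b} {σ₃} fr′ xs xb) z)) s b refl refl nc | realised-at {σ₃}
            {b} {t} snd xb xt f₂ nc
        ... | a , ab , p , _ , ¬m , sp , p≤ | q , sq , q≤ = p ◅◅ (ab ◅ q) , join-crossing p ab q sp sq ¬m ,
          ≤-trans (≈⇒≤ (≈-trans (weight-◅◅ p (ab ◅ q)) (≈-sym (+-assoc _ _ _))))
            (+-mono (≤-trans p≤ (≡⇒≤ (sym (value {s} {b} {σ₃} fr′ xs xb)))) q≤)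
        step : ∀ {τ} → DistImproves σ₁ τ → (∀ s b t → Q s b t τ) → ComponentComplete →
               ∀ {u v} (p : Star Arc u v) → Simple p → len p ℕ.≤ suc r → DistEntry τ u v (weight p)
        -- The path is cut at its last vertex in the strong component of `u`. The first part stays
        -- inside the component, the next arc is a crossing, and the remainder is shorter.
        step {τ} im q cc {u} {v} p sp le with last (mutual? {σ₀} known u) p
        ... | never none = ⊥-elim (none (start∈ p) (ε , ε))
        ... | at-end m = entries im (entries im₀ (proj₁ cc p sp m))
        ... | leave {a = b} p₁ e p₂ m none = entry-at distFᴬ distᵂ τ refl refl
          (≤-trans (≈⇒≤ (+-assoc _ _ _)) (≈⇒≥ (weight-◅◅ p₁ (e ◅ p₂))))
          (q u b v (proj₂ cc p₁ e (proj₁ sps) m (λ m′ → none (start∈ p₂) (mutual-trans m m′)))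
                   (comp cc p₂ (Unique-tail (proj₁ (proj₂ sps))) shorter))
          where
          sps = ◅◅-simple⁻ p₁ (e ◅ p₂) sp
          shorter : len p₂ ℕ.≤ r
          shorter = ℕₚ.≤-pred (ℕₚ.≤-trans (ℕₚ.m≤n+m _ (len p₁)) (subst (ℕ._≤ suc r) (len-◅◅ p₁ (e ◅ p₂)) le))

  Passed : State ℝ → Fin n → Fin n → Set
  Passed σ s t = ∀ {x} → (ts : Arc t s) → ¬ Edge σ t s → DistEntry σ s t x → 0# ≤ x + c t s ts

  check : ∀ {σ₀} → Input σ₀ → DistSound σ₀ → (∀ {u v} → NegativeEdge u v → Edge σ₀ u v) → bad σ₀ ≢ 1 →
          Exec CHECK σ₀ (0 , 2) (λ τ → (bad τ ≡ 1 × ¬ NearlyConservative) ⊎ (bad τ ≢ 1 × ∀ s t → Passed σ₀ s t))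
  check {σ₀} inp snd₀ full good = consequence (λ { {τ} _ ((ok , _) , q) → conclude {τ} (ok (inj₁ good)) q })
    (for-fin₂ Q (record {}) (record {}) (Input.size-n inp) ((λ h → h) , λ h → h) ((λ h → h) , λ h → h)
      (λ { (_ , m) → λ { (inj₁ e) → inj₁ (m e) ; (inj₂ h) → inj₂ h } })
      λ s t {σ₁} fr xs xt _ → when
        (λ g → exec-nat {e = 0 , 0} (((λ _ → inj₂ (refl , violated {s} {t} {σ₁} fr xs xt g)) , λ _ →
          refl) , inj₁ refl))
        (λ ¬g → ((λ h → h) , λ h → h) , inj₂ (λ {x} → passed {s} {t} {σ₁} fr xs xt ¬g {x})))
    where
    guard : BExp
    guard = adjᴬ ⟪ tᵛ , sᵛ ⟫ ≡ᴺ litᴺ 1 and edgeᴬ ⟪ tᵛ , sᵛ ⟫ ≢ᴺ litᴺ 1 and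
            distFᴬ ⟪ sᵛ , tᵛ ⟫ ≢ᴺ litᴺ 0 and distᵂ ⟪ sᵛ , tᵛ ⟫ᵂ +ᵂ arcᵂ ⟪ tᵛ , sᵛ ⟫ᵂ <ᵂ 0ᵂ
    Ok : State ℝ → Set
    Ok τ = bad τ ≢ 1 ⊎ (bad τ ≡ 1 × ¬ NearlyConservative)
    Q : Fin n → Fin n → State ℝ → Set
    Q s t τ = bad τ ≡ 1 ⊎ Passed σ₀ s t
    evolution : Evolution
    evolution = record
      { _≼_ = λ τ τ′ → (Ok τ → Ok τ′) × (bad τ ≡ 1 → bad τ′ ≡ 1)
      ; ≼-refl = (λ h → h) , λ h → h
      ; ≼-trans = λ { (f , g) (f′ , g′) → (λ h → f′ (f h)) , λ h → g′ (g h) } }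
    open Each evolution
    conclude : ∀ {τ} → Ok τ → (∀ s t → Q s t τ) → (bad τ ≡ 1 × ¬ NearlyConservative) ⊎
      (bad τ ≢ 1 × ∀ s t → Passed σ₀ s t)
    conclude (inj₂ h) q = inj₁ h
    conclude {τ} (inj₁ ok) q = inj₂ (ok , λ s t {x} → pass s t {x})
      where
      pass : ∀ s t → Passed σ₀ s t
      pass s t {x} with q s t
      ... | inj₁ e = ⊥-elim (ok e)
      ... | inj₂ h = h {x}
    inp₁ : ∀ {σ₁} → Frame CHECK σ₀ σ₁ → Input σ₁
    inp₁ fr = input-kept refl refl refl fr inp
    dist-at : ∀ {s t σ₁} → Frame CHECK σ₀ σ₁ → nat σ₁ sᵛ 0 0 ≡ toℕ s → nat σ₁ tᵛ 0 0 ≡ toℕ t →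
              wt σ₁ distᵂ (nat σ₁ sᵛ 0 0) (nat σ₁ tᵛ 0 0) ≡ wt σ₀ distᵂ (toℕ s) (toℕ t)
    dist-at {s} {t} {σ₁} fr xs xt = trans (cong₂ (wt σ₁ distᵂ) xs xt)
      (cong (λ m → m (toℕ s) (toℕ t)) (keepᵂ fr distᵂ refl))
    flag-at : ∀ {s t σ₁} → Frame CHECK σ₀ σ₁ → nat σ₁ sᵛ 0 0 ≡ toℕ s → nat σ₁ tᵛ 0 0 ≡ toℕ t →
              nat σ₁ distFᴬ (nat σ₁ sᵛ 0 0) (nat σ₁ tᵛ 0 0) ≡ nat σ₀ distFᴬ (toℕ s) (toℕ t)
    flag-at {s} {t} {σ₁} fr xs xt = trans (cong₂ (nat σ₁ distFᴬ) xs xt)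
      (cong (λ m → m (toℕ s) (toℕ t)) (keepᴺ fr distFᴬ refl))
    edge-at : ∀ {s t σ₁} → Frame CHECK σ₀ σ₁ → nat σ₁ sᵛ 0 0 ≡ toℕ s → nat σ₁ tᵛ 0 0 ≡ toℕ t →
              nat σ₁ edgeᴬ (nat σ₁ tᵛ 0 0) (nat σ₁ sᵛ 0 0) ≡ nat σ₀ edgeᴬ (toℕ t) (toℕ s)
    edge-at {s} {t} {σ₁} fr xs xt = trans (cong₂ (nat σ₁ edgeᴬ) xt xs)
      (cong (λ m → m (toℕ t) (toℕ s)) (keepᴺ fr edgeᴬ refl))
    arc-at : ∀ {s t σ₁} → Frame CHECK σ₀ σ₁ → nat σ₁ sᵛ 0 0 ≡ toℕ s → nat σ₁ tᵛ 0 0 ≡ toℕ t → (ts : Arc t s) →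
             wt σ₁ arcᵂ (nat σ₁ tᵛ 0 0) (nat σ₁ sᵛ 0 0) ≡ c t s ts
    arc-at {σ₁ = σ₁} fr xs xt ts = trans (cong₂ (wt σ₁ arcᵂ) xt xs) (Input.arc-weight (inp₁ fr) ts)
    violated : ∀ {s t σ₁} → Frame CHECK σ₀ σ₁ → nat σ₁ sᵛ 0 0 ≡ toℕ s → nat σ₁ tᵛ 0 0 ≡ toℕ t →
      ⟦ guard ⟧ σ₁ → ¬ NearlyConservative
    violated {s} {t} {σ₁} fr xs xt (adj , new , f , lt) nc
      with snd₀ (λ z → f (trans (flag-at {s} {t} {σ₁} fr xs xt) z)) s t refl refl nc
    ... | p , sp , p≤ = closes p sp (λ le → lt (≤-trans le (≤-trans (≈⇒≤ (+-comm _ _)) (+-mono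
          (≤-trans p≤ (≡⇒≤ (sym (dist-at {s} {t} {σ₁} fr xs xt))))
            (≡⇒≤ (sym (arc-at {s} {t} {σ₁} fr xs xt ts)))))))
      where
      ts : Arc t s
      ts = Input.adj⇒arc (inp₁ fr) (trans (sym (cong₂ (nat σ₁ adjᴬ) xt xs)) adj)
      -- A negative cycle of two arcs would make the chord a negative edge, and those are all in the
      -- forest; a longer one contradicts near conservativeness.
      closes : (p : Star Arc s t) → Simple p → c t s ts + weight p < 0# → ⊥
      closes ε sp lt = no-loop ts
      closes (st ◅ ε) sp lt = new (trans (edge-at {s} {t} {σ₁} fr xs xt) (full
        ((λ { refl → no-loop ts }) , ts , st , λ le → lt (≤-trans le (+-monoʳ _ (≈⇒≥ (+-identityʳ _)))))))
      closes p@(_ ◅ _ ◅ _) sp lt = lt (cycle-nonnegative nc ts p sp (s≤s (s≤s z≤n)))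
    passed : ∀ {s t σ₁} → Frame CHECK σ₀ σ₁ → nat σ₁ sᵛ 0 0 ≡ toℕ s → nat σ₁ tᵛ 0 0 ≡ toℕ t →
      ¬ ⟦ guard ⟧ σ₁ → Passed σ₀ s t
    passed {s} {t} {σ₁} fr xs xt ¬g {x} ts new (f , le) = ≤-trans (≮⇒≥ nonneg) (+-mono le ≤-refl)
      where
      nonneg : ¬ wt σ₀ distᵂ (toℕ s) (toℕ t) + c t s ts < 0#
      nonneg lt = ¬g (trans (cong₂ (nat σ₁ adjᴬ) xt xs) (Input.arc⇒adj (inp₁ fr) ts) ,
        (λ e → new (trans (sym (edge-at {s} {t} {σ₁} fr xs xt)) e)) ,
        (λ z → f (trans (sym (flag-at {s} {t} {σ₁} fr xs xt)) z)) ,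
        λ le → lt (≤-trans le (+-mono (≡⇒≤ (dist-at {s} {t} {σ₁} fr xs xt))
          (≡⇒≤ (arc-at {s} {t} {σ₁} fr xs xt ts)))))

-- Correctness of the algorithm

module Correctness (ℝ : RealNumbers) {n : ℕ} (D : Digraph n) (c : Weight ℝ D) where
  open OrderedField ℝ
  open Digraph D using (Arc)
  open Weighted ℝ D c

  Good : ℕ → Set
  Good k = BlocksHaveAtMost k NegativeTrees

  open Execution ℝ n Good
  open Relaxation ℝ n Good
  open Theory ℝ D c
  open Reading ℝ D c Good
  open Separation D
  open KruskalProof ℝ D c Good
  open ConnectivityProof ℝ D c Good
  open CombiningProof ℝ D c Good

  record Ready (σ : State ℝ) : Set where
    field
      inp    : Input σ
      size⁺  : nat σ size⁺ᵛ 0 0 ≡ suc n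
      forest : Forest (Edge σ) (tree σ) (path-weight σ)
      tree<n : ∀ u → tree σ u ℕ.< n
      full   : ∀ {u v} → NegativeEdge u v → Edge σ u v
      known  : SeparatorsKnown σ

  module Sources {σ₀ : State ℝ} (ready : Ready σ₀) where
    open Ready ready

    edge? : Decidable₂ (Edge σ₀)
    edge? u v = nat σ₀ edgeᴬ (toℕ u) (toℕ v) ℕ.≟ 1

    _∼?_ : Decidable₂ _∼_
    _∼?_ = ∼-dec {σ₀} known

    open Spanning ℝ D c forest edge? full
    open Counting ℝ D c forest edge? full tree<n _∼?_ (mutual? {σ₀} known) using (TreeNumbers; numbering; number-bound)
    open Sharing D (tree σ₀)
    open NumberingProof ℝ D c Good (tree σ₀) tree<n _∼?_
    open BitTable ℝ n Good using (bits)
    open SearchingProof ℝ D c Good forest edge? full tree<n _∼?_ using (Terrain; search)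

    tree-numbers : ∀ s → TreeNumbers s (number s)
    tree-numbers s = record
      { earlier = λ u l → does (earlier? s u l)
      ; earlier⁺ = λ {u} {l} e → dec-true (earlier? s u l) e
      ; earlier⁻ = λ {u} {l} _ e → witness (earlier? s u l) e
      ; ix-shared = λ {u} h → number-shared s u h
      ; ix-other = λ {u} ne → decide {u} (shared? s u) ne }
      where
      witness : ∀ {A : Set} (d : Dec A) → does d ≡ true → A
      witness (yes a) _ = a
      decide : ∀ {u} → Dec (Shared s u) → number s u ≢ 0 → Shared s u
      decide (yes h) _ = h
      decide {u} (no ¬h) ne = ⊥-elim (ne (number-other s u ¬h))

    number≤ : ∀ s v k → Good k → number s v ℕ.≤ k
    number≤ s v k good with number s v ℕ.≟ 0
    ... | yes e = subst (ℕ._≤ k) (sym e) z≤n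
    ... | no ne = number-bound (tree-numbers s) (TreeNumbers.ix-other (tree-numbers s) ne) {k} good

    HopsComplete : Fin n → State ℝ → Set
    HopsComplete s τ = ∀ {r S t x} → r ℕ.≤ n → Hops _∼_ s (number s) r S t x → DistEntry τ s t x

    from : ∀ s {σ} → Landscape s σ → Input σ → (∀ u v → path-weight σ u v ≡ path-weight σ₀ u v) →
           Exec FROM σ (1 , 3) (λ τ → DistImproves σ τ × HopsComplete s τ)
    from s {σ} L inp paths =
      slower tt (number-trees s L) then-do λ {σ₁} fr₁ (ix , ≤K , K≡) →
      let K = nat σ₁ bitsᵛ 0 0
          L₁ = landscape-kept refl refl refl refl refl fr₁ L
          K≤k = λ k good → small K≡ z≤n (λ v → number≤ s v k good)
          K≤n = small K≡ z≤n (λ v → number≤n s v) in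
      slower tt (bits {σ₁} {K} (Landscape.size⁺-is L₁) refl K≤n K≤k) then-do λ {σ₂} fr₂ tables →
      consequence (λ { {τ} _ (im , h) →
          ≼-trans (dists-kept {NUMBER} refl refl fr₁) (≼-trans (dists-kept {BITS} refl refl fr₂) im) , h })
        (search s K K≤k ≤K Realised (λ h x≤y nc → realise h x≤y nc) {σ₂} (record
          { landscape = landscape-kept refl refl refl refl refl fr₂ L₁
          ; inp = input-kept refl refl refl fr₂ (input-kept refl refl refl fr₁ inp)
          ; index-is = λ v → trans (cong (λ m → m (toℕ v) 0) (keepᴺ fr₂ indexᴬ refl)) (ix v)
          ; tables = tables
          ; paths-are = λ u v → trans (cong (λ m → m (toℕ u) (toℕ v))
            (trans (keepᵂ fr₂ pathᵂ refl) (keepᵂ fr₁ pathᵂ refl))) (paths u v) }))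
      where
      small : ∀ {K k} → K ≡ 0 ⊎ (∃[ v ] K ≡ number s v) → 0 ℕ.≤ k → (∀ v → number s v ℕ.≤ k) → K ℕ.≤ k
      small (inj₁ refl) z _ = z
      small (inj₂ (v , refl)) _ h = h v
      realise : ∀ {r S t x y} → Hops _∼_ s (number s) r S t x → x ≤ y → Realised s t y
      realise h x≤y nc with hops⇒path (numbering (tree-numbers s)) nc h
      ... | p , sp , p≤ = p , sp , ≤-trans p≤ x≤y
      open Evolution (improvement distFᴬ distᵂ DistanceOK) using (≼-trans)

    sources-searched : Exec (EACH sᵛ FROM) σ₀ (1 , 4) (λ τ → DistImproves σ₀ τ × ∀ s → HopsComplete s τ)
    sources-searched = Dist.for-fin HopsComplete (record {}) (Input.size-n inp) (improves-set sᵛ refl)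
      (λ le h r≤n hops → entries le (h r≤n hops))
      λ s {σ₁} fr xs _ → from s {σ₁}
        (record { size-is = scalar-kept refl fr (Input.size-n inp)
                ; size⁺-is = scalar-kept refl fr size⁺
                ; s-is = xs
                ; tree-is = λ u → cong (λ m → m (toℕ u) 0) (keepᴺ fr treeᴬ refl)
                ; sep-is = λ u v → let e = cong (λ m → m (toℕ u) (toℕ v)) (keepᴺ fr sepᴬ refl) in
                    (λ z → zero⇒∼ (subst (LastSeparator (suc n) u v) (trans (sym e) z) (known u v))) ,
                    λ uv → trans e (∼⇒zero (known u v) uv) })
        (input-kept refl refl refl fr inp)
        (λ u v → cong (λ m → m (toℕ u) (toℕ v)) (keepᵂ fr pathᵂ refl))

    module _ {τ : State ℝ} (hops-complete : ∀ s → HopsComplete s τ)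
             (passed : ∀ {s t x} (ts : Arc t s) → ¬ Edge σ₀ t s → DistEntry τ s t x → 0# ≤ x + c t s ts) where

      -- A simple path between vertices of a common block lies in that block, so its vertices are
      -- pairwise related as `path⇒hops` demands.
      block-path : ∀ {m u v} → ClosedBelow m → (p : Star Arc u v) → Simple p → chords p ℕ.≤ m → u ∼ v →
        DistEntry τ u v (weight p)
      block-path {m} {u} {v} closed p sp p≤m uv
        with path⇒hops (numbering (tree-numbers u)) closed p sp p≤m (λ a b → path-∼ p sp uv a b)
      ... | r , S , x , r≤ , x≤ , h =
        entry-at distFᴬ distᵂ τ refl refl x≤ (hops-complete u
          (ℕₚ.≤-trans r≤ (ℕₚ.≤-trans (ℕₚ.n≤1+n _) (simple-short p sp))) h)

      -- The joint induction on chords: at level `m` the stored distance is at most the weight of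
      -- `q`, and the passed check turns this into closedness at level `suc m`. A chord and the path
      -- that closes it lie in one block, so the block search alone supports the argument.
      all-closed : ∀ m → ClosedBelow m
      all-closed zero ab ¬e q sq ()
      all-closed (suc m) {a} {b} ab ¬e q sq (s≤s q≤m) = ≤-trans
        (passed ab ¬e (block-path (all-closed m) q sq q≤m (∼-sym (arc-∼ ab q)))) (≈⇒≤ (+-comm _ _))

      block-complete : ∀ {u v} (p : Star Arc u v) → Simple p → u ∼ v → DistEntry τ u v (weight p)
      block-complete p sp uv = block-path (all-closed (chords p)) p sp ℕₚ.≤-refl uv

      nearly-conservative : NearlyConservative
      nearly-conservative = closed⇒nearlyConservative all-closed

  record Solved (σ : State ℝ) : Set where
    field
      conservative : NearlyConservative
      complete     : ∀ {u v} (p : Star Arc u v) → Simple p → DistEntry σ u v (weight p)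
      realised     : DistSound σ

  Decided : State ℝ → Set
  Decided σ = (bad σ ≡ 1 × ¬ NearlyConservative) ⊎ (bad σ ≢ 1 × Solved σ)

  initial : State ℝ
  initial = input ℝ D c

  private
    ready-after : ∀ {σ₁ σ₂ σ₃} → Input σ₁ → nat σ₁ size⁺ᵛ 0 0 ≡ suc n →
      Forest (Edge σ₁) (tree σ₁) (path-weight σ₁) →
                  (∀ u → tree σ₁ u ℕ.< n) → (∀ {u v} → NegativeEdge u v → Edge σ₁ u v) →
                  Frame REACH σ₁ σ₂ → Frame SEPARATORS σ₂ σ₃ → SeparatorsKnown σ₃ → Ready σ₃
    ready-after {σ₁} {σ₂} {σ₃} inp size⁺ forest small full f g known = record
      { inp = input-kept refl refl refl g (input-kept refl refl refl f inp)
      ; size⁺ = scalar-kept refl g (scalar-kept refl f size⁺)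
      ; forest = subst₂ (λ E tr → Forest E tr (path-weight σ₃)) (sym edges≡) (sym trees≡)
          (subst (Forest (Edge σ₁) (tree σ₁)) (sym paths≡) forest)
      ; tree<n = subst (λ tr → ∀ u → tr u ℕ.< n) (sym trees≡) small
      ; full = λ {u} {v} e → subst (λ E → E u v) (sym edges≡) (full e)
      ; known = known }
      where
      edges≡ : Edge σ₃ ≡ Edge σ₁
      edges≡ = cong (λ m u v → m (toℕ u) (toℕ v) ≡ 1) (trans (keepᴺ g edgeᴬ refl) (keepᴺ f edgeᴬ refl))
      trees≡ : tree σ₃ ≡ tree σ₁
      trees≡ = cong (λ m u → m (toℕ u) 0) (trans (keepᴺ g treeᴬ refl) (keepᴺ f treeᴬ refl))
      paths≡ : path-weight σ₃ ≡ path-weight σ₁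
      paths≡ = cong (λ m u v → m (toℕ u) (toℕ v)) (trans (keepᵂ g pathᵂ refl) (keepᵂ f pathᵂ refl))

  distances : ∀ {σ₁} → Input σ₁ → nat σ₁ size⁺ᵛ 0 0 ≡ suc n → Forest (Edge σ₁) (tree σ₁) (path-weight σ₁) →
              (∀ u → tree σ₁ u ℕ.< n) → (∀ {u v} → NegativeEdge u v → Edge σ₁ u v) → bad σ₁ ≢ 1 →
              nat σ₁ sepᴬ ≡ nat initial sepᴬ → nat σ₁ distFᴬ ≡ nat initial distFᴬ →
                nat σ₁ crossFᴬ ≡ nat initial crossFᴬ →
              Exec DISTANCES σ₁ (1 , 4) Decided
  distances {σ₁} inp size⁺ forest small full good sep₀ dist₀ cross₀ =
    slower tt (reach inp) then-do λ {σ₂} fr₂ correct →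
    let inp₂ = input-kept refl refl refl fr₂ inp in
    slower tt (separators {σ₂} inp₂ (scalar-kept refl fr₂ size⁺) correct
      (λ u v → cong (λ m → m (toℕ u) (toℕ v)) (trans (keepᴺ fr₂ sepᴬ refl) sep₀))) then-do λ {σ₃} fr₃ known →
    let ready = ready-after {σ₁} {σ₂} {σ₃} inp size⁺ forest small full fr₂ fr₃ known
        inp₃ = Ready.inp ready
        size⁺₃ = Ready.size⁺ ready
        snd₃ : DistSound σ₃
        snd₃ = λ {i} {j} f → ⊥-elim (f (cong (λ m → m i j)
          (trans (keepᴺ fr₃ distFᴬ refl) (trans (keepᴺ fr₂ distFᴬ refl) dist₀)))) in
    Sources.sources-searched ready then-do λ {σ₄} fr₄ (im₄ , hops) →
    let inp₄ = input-kept refl refl refl fr₄ inp₃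
        known₄ = separators-kept {_} {σ₃} {σ₄} refl fr₄ known
        size⁺₄ = scalar-kept refl fr₄ size⁺₃
        snd₄ : DistSound σ₄
        snd₄ = λ {i} {j} → sound im₄ (λ {i} {j} → snd₃ {i} {j}) {i} {j} in
    slower tt (through-separators σ₄ (Input.size-n inp₄) size⁺₄ known₄ (λ {i} {j} → snd₄ {i} {j})) then-do
      λ {σ₅} fr₅ (im₅ , comp₅) →
    let inp₅ = input-kept refl refl refl fr₅ inp₄
        known₅ = separators-kept {_} {σ₄} {σ₅} refl fr₅ known₄
        snd₅ : DistSound σ₅
        snd₅ = λ {i} {j} → sound im₅ (λ {i} {j} → snd₄ {i} {j}) {i} {j} in
    slower tt (crossings {σ₅} inp₅ (scalar-kept refl fr₅ size⁺₄) known₅ (λ {i} {j} → snd₅ {i} {j})) then-do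
      λ {σ₆} fr₆ (im₆ , cross₆) →
    let inp₆ = input-kept refl refl refl fr₆ inp₅
        known₆ = separators-kept {_} {σ₅} {σ₆} refl fr₆ known₅
        snd₆ : DistSound σ₆
        snd₆ = λ {i} {j} → sound (dists-kept {CROSSINGS} refl refl fr₆) (λ {i} {j} → snd₅ {i} {j}) {i} {j}
        cross-snd₅ : CrossSound σ₅
        cross-snd₅ = λ {i} {j} f → ⊥-elim (f (cong (λ m → m i j)
          (trans (keepᴺ fr₅ crossFᴬ refl) (trans (keepᴺ fr₄ crossFᴬ refl)
          (trans (keepᴺ fr₃ crossFᴬ refl) (trans (keepᴺ fr₂ crossFᴬ refl) cross₀))))))
        cross-snd₆ : CrossSound σ₆
        cross-snd₆ = λ {i} {j} → sound im₆ (λ {i} {j} → cross-snd₅ {i} {j}) {i} {j} in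
    slower tt (through-crossings σ₆ (Input.size-n inp₆) known₆ (λ {i} {j} → cross-snd₆ {i} {j})) then-do
      λ {σ₇} fr₇ (im₇ , comp₇) →
    let inp₇ = input-kept refl refl refl fr₇ inp₆
        snd₇ : DistSound σ₇
        snd₇ = λ {i} {j} → sound im₇ (λ {i} {j} → snd₆ {i} {j}) {i} {j}
        edges₇ = λ u v → cong (λ m → m (toℕ u) (toℕ v))
          (trans (keepᴺ fr₇ edgeᴬ refl) (trans (keepᴺ fr₆ edgeᴬ refl)
          (trans (keepᴺ fr₅ edgeᴬ refl) (keepᴺ fr₄ edgeᴬ refl)))) in
    slower tt (consequence
      (λ { {τ} fr₈ (inj₁ failed) → inj₁ failed
         ; {τ} fr₈ (inj₂ (ok , passed)) → inj₂ (ok ,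
             let open Sources ready using (block-complete; nearly-conservative)
                 same₆ : DistImproves σ₅ σ₆
                 same₆ = dists-kept {CROSSINGS} refl refl fr₆
                 same₈ : DistImproves σ₇ τ
                 same₈ = dists-kept {CHECK} refl refl fr₈
                 up : ∀ {u v x} → DistEntry σ₅ u v x → DistEntry σ₇ u v x
                 up e = entries im₇ (entries same₆ e)
                 pass : ∀ {s t x} (ts : Arc t s) → ¬ Edge σ₃ t s → DistEntry σ₄ s t x → 0# ≤ x + c t s ts
                 -- `CHECK` judged the final table. Entries only decrease after the block search, so
                 -- its verdict applies to the earlier table as well.
                 pass = λ {s} {t} ts ¬e e → passed s t ts (λ e₇ → ¬e (trans (sym (edges₇ t s)) e₇))
                   (up (entries im₅ e))
                 within = comp₅ (λ p sp → block-complete {σ₄} hops pass p sp) in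
             record
             { conservative = nearly-conservative {σ₄} hops pass
             ; complete = λ p sp → entries same₈ (comp₇ ((λ p sp m → entries same₆ (within p sp m)) ,
                 λ p ab sp m ¬m → cross₆ _ _ _ ab m ¬m (within p sp m)) p sp)
             ; realised = λ {i} {j} → sound same₈ (λ {i} {j} → snd₇ {i} {j}) {i} {j} }) })
      (check {σ₇} inp₇ (λ {i} {j} → snd₇ {i} {j}) (λ {u} {v} e → trans (edges₇ u v) (Ready.full ready e))
        (λ e → good (trans (sym (trans (scalar-kept refl fr₇
          (scalar-kept refl fr₆ (scalar-kept refl fr₅ (scalar-kept refl fr₄
          (scalar-kept refl fr₃ (scalar-kept {_} {σ₁} {σ₂} {badᵛ} refl fr₂ refl)))))) refl)) e))))

  -- The realising path weighs at most the entry, and completeness bounds the entry by every path,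
  -- this one included; antisymmetry gives equality. A missing entry is incompatible with the
  -- existence of a path.
  solved⇒distance : ∀ {σ} → Solved σ → ∀ s t → IsDistance s t (distance ℝ D c σ s t)
  solved⇒distance {σ} S s t with nat σ distFᴬ (toℕ s) (toℕ t) in eq
  ... | zero  = λ { (p , sp) → proj₁ (Solved.complete S p (fromSimple p sp)) eq }
  ... | suc _ with Solved.realised S (λ z → absurd (trans (sym eq) z)) s t refl refl (Solved.conservative S)
    where
    absurd : ∀ {k} → ¬ suc k ≡ 0
    absurd ()
  ...   | p , sp , p≤ = (p , toSimple p sp , antisym p≤ (proj₂ (Solved.complete S p sp))) ,
    λ q sq → proj₂ (Solved.complete S q (fromSimple q sq))

  apsp : Exec APSP initial (1 , 4) (APSPSolution ℝ D c)
  apsp =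
    exec-nat {Q = _≡ σ₀} refl then-do λ { _ refl →
    slower tt (kruskal {σ₀} (mkInput refl refl refl) (λ _ _ → refl) (λ _ → refl) refl) then-do λ {σ₁} fr₁
      (inv , treated) →
    when (λ good → consequence (λ { {τ} fr d → d , zero-answer fr₁ fr })
            (main {σ₁} fr₁ inv treated good))
         (λ ¬good → inj₁ (stopped {σ₁} inv ¬good) , cong (λ m → m 0 0) (keepᴺ fr₁ answerᴬ refl)) then-do
           λ {σ₂} _ (decided , zero-answer) →
    -- The answer is 0 from the start and is written only here, so each of the two ways to fail
    -- leaves a correct negative answer.
    when (λ good → exec-nat {e = 1 , 4} (yes-answer {σ₂} decided good))
         (λ ¬good → no-answer {σ₂} decided zero-answer ¬good) }
    where
    σ₀ : State ℝ
    σ₀ = set initial size⁺ᵛ (n ℕ.+ 1)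
    zero-answer : ∀ {σ₁ σ₂} → Frame KRUSKAL σ₀ σ₁ → Frame DISTANCES σ₁ σ₂ → nat σ₂ answerᴬ 0 0 ≡ 0
    zero-answer f g = cong (λ m → m 0 0) (trans (keepᴺ g answerᴬ refl) (keepᴺ f answerᴬ refl))
    stopped : ∀ {σ₁} → KruskalInvariant σ₁ → ¬ bad σ₁ ≢ 1 → bad σ₁ ≡ 1 × ¬ NearlyConservative
    stopped (inj₁ (b , _)) ¬good = ⊥-elim (¬good (λ e → absurd (trans (sym b) e)))
      where
      absurd : ¬ 0 ≡ 1
      absurd ()
    stopped (inj₂ h) _ = h
    main : ∀ {σ₁} → Frame KRUSKAL σ₀ σ₁ → KruskalInvariant σ₁ → (∀ u v → Treated u v σ₁) → bad σ₁ ≢ 1 →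
      Exec DISTANCES σ₁ (1 , 4) Decided
    main fr (inj₂ (b , _)) treated good = ⊥-elim (good b)
    main {σ₁} fr (inj₁ (_ , forest , small)) treated good =
      distances {σ₁} (input-kept refl refl refl fr (mkInput refl refl refl))
      (scalar-kept refl fr (ℕₚ.+-comm n 1)) forest small full good
      (keepᴺ fr sepᴬ refl) (keepᴺ fr distFᴬ refl) (keepᴺ fr crossFᴬ refl)
      where
      full : ∀ {u v} → NegativeEdge u v → Edge σ₁ u v
      full {u} {v} e with treated u v
      ... | inj₁ b = ⊥-elim (good b)
      ... | inj₂ f = f e
    yes-answer : ∀ {σ₂} → Decided σ₂ → bad σ₂ ≢ 1 → APSPSolution ℝ D c ⟨ write (nat σ₂) answerᴬ 0 0 1 , wt σ₂ ⟩
    yes-answer (inj₁ (b , _)) good = ⊥-elim (good b)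
    yes-answer {σ₂} (inj₂ (_ , S)) good = inj₁ (refl , Solved.conservative S , λ s t _ →
      solved⇒distance {σ₃} S′ s t)
      where
      σ₃ : State ℝ
      σ₃ = ⟨ write (nat σ₂) answerᴬ 0 0 1 , wt σ₂ ⟩
      S′ : Solved σ₃
      S′ = record { conservative = Solved.conservative S ; complete = Solved.complete S ; realised =
        Solved.realised S }
    no-answer : ∀ {σ₂} → Decided σ₂ → nat σ₂ answerᴬ 0 0 ≡ 0 → ¬ bad σ₂ ≢ 1 → APSPSolution ℝ D c σ₂
    no-answer (inj₁ (_ , ¬nc)) z _ = inj₂ (z , ¬nc)
    no-answer (inj₂ (ok , _)) z ¬good = ⊥-elim (¬good ok)

  -- The constant is `162 = 2 * 3 ^ 4`: the slack in `2 ^ suc k` contributes the factor 2, and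
  -- `2 + n ≤ 3 * n` for positive `n` contributes the fourth power of 3.
  within-bound : ∀ k → 1 ℕ.≤ n → κ APSP ℕ.* bound (1 , 4) k ℕ.≤ (κ APSP ℕ.* 162) ℕ.* (2 ℕ.^ k ℕ.* n ℕ.^ 4)
  within-bound k 1≤n = ℕₚ.≤-trans (ℕₚ.*-monoʳ-≤ (κ APSP) le)
    (ℕₚ.≤-reflexive (sym (ℕₚ.*-assoc (κ APSP) 162 (2 ℕ.^ k ℕ.* n ℕ.^ 4))))
    where
    open import Data.Nat.Solver using (module +-*-Solver)
    open +-*-Solver using (solve; _:*_; _:=_; con; _:^_)
    2+n≤3n : 2 ℕ.+ n ℕ.≤ 3 ℕ.* n
    2+n≤3n = ℕₚ.≤-trans (ℕₚ.+-monoˡ-≤ n (ℕₚ.*-monoʳ-≤ 2 1≤n)) (ℕₚ.≤-reflexive (ℕₚ.+-comm (2 ℕ.* n) n))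
    le : bound (1 , 4) k ℕ.≤ 162 ℕ.* (2 ℕ.^ k ℕ.* n ℕ.^ 4)
    le = ℕₚ.≤-trans (ℕₚ.*-monoʳ-≤ ((2 ℕ.^ suc k) ℕ.^ 1) (ℕₚ.^-monoˡ-≤ 4 2+n≤3n))
      (ℕₚ.≤-reflexive (solve 2 (λ a n → ((con 2 :* a) :^ 1) :* ((con 3 :* n) :^ 4) := con 162 :*
        (a :* (n :^ 4))) refl (2 ℕ.^ k) n))

open import Data.Nat using (ℕ; _*_; _^_; _≤_)
open import Data.Product using (_×_; ∃-syntax)

corollary8 : ∃[ program ] ∃[ C ]
    ∀ (ℝ : RealNumbers) {n : ℕ} (D : Digraph n) (c : Weight ℝ D) →
    ∃[ σ ] ∃[ time ]
    Run ℝ program (input ℝ D c) σ time ×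
    APSPSolution ℝ D c σ ×
    (∀ k₂ → 1 ≤ n → Weighted.BlocksHaveAtMost_NegativeTrees ℝ D c k₂ →
    time ≤ C * (2 ^ k₂ * n ^ 4))
corollary8 = APSP , κ APSP * 162 , solution
  where
  solution : ∀ (ℝ : RealNumbers) {n : ℕ} (D : Digraph n) (c : Weight ℝ D) →
    ∃[ σ ] ∃[ time ]
    Run ℝ APSP (input ℝ D c) σ time ×
    APSPSolution ℝ D c σ ×
    (∀ k₂ → 1 ≤ n → Weighted.BlocksHaveAtMost_NegativeTrees ℝ D c k₂ →
    time ≤ κ APSP * 162 * (2 ^ k₂ * n ^ 4))
  solution ℝ {n} D c =
    Exec.final apsp , Exec.time apsp , Exec.run apsp , Exec.post apsp ,
    λ k₂ 1≤n good → ℕₚ.≤-trans (Exec.timely apsp k₂ good) (within-bound k₂ 1≤n)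
    where
    open Correctness ℝ D c
    open Execution ℝ n Good
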